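{- Let $\mathbf a=(a_n)_{n\ge 0}$ be a sequence of positive integers which is not ultimately periodic. Let $(n_k)_{k\ge 0}$ be a strictly increasing sequence of positive integers and let $(\lambda_k)_{k\ge 0}$ and $(r_k)_{k\ge 0}$ be sequences of positive integers such that, for every $k\ge 0$, $n_{k+1}\ge n_k+\lambda_k r_k$ and $$a_{m+r_k}=a_m \quad\text{for all } m \text{ with } n_k\le m\le n_k+(\lambda_k-1)r_k-1.$$ Let $\xi=[a_0;a_1,a_2,\ldots]$ and let $(p_n/q_n)_{n\ge1}$ be the sequence of its convergents. Assume that the sequence $(q_n^{1/n})_{n\ge 1}$ is bounded (which is in particular the case when $\mathbf a$ is bounded), and that $$\limsup_{k\to\infty}\frac{\lambda_k}{n_k}>0.$$ Then $\xi$ is transcendental.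
   Context: $[a_0;a_1,a_2,\ldots]$ denotes the simple continued fraction with partial quotients $a_0,a_1,\ldots$; its $n$-th convergent is $p_n/q_n=[a_0;a_1,\ldots,a_n]$ in lowest terms with $q_n>0$. -}

module Defs where

open import Data.Nat using (ℕ; zero; suc; _+_; _*_; _≤_; pred)
open import Data.Integer as ℤ using (ℤ; +_)
open import Data.Rational.Unnormalised as Q using (ℚᵘ; mkℚᵘ; ∣_∣)
open import Data.Product using (Σ; _×_; _,_; proj₁; proj₂; ∃; ∃-syntax)
open import Data.List using (List; []; _∷_)
open import Data.List.Relation.Unary.Any using (Any)
open import Relation.Binary.PropositionalEquality using (_≡_; _≢_)
open import Relation.Nullary using (¬_)

Seq : Set
Seq = ℕ → ℕ

UltimatelyPeriodic : Seq → Set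
UltimatelyPeriodic a =
  ∃[ N ] ∃[ T ] (1 ≤ T × (∀ m → N ≤ m → a (m + T) ≡ a m))

-- Continuants via the standard recurrence:
--   p_{-1} = 1, q_{-1} = 0, p_0 = a_0, q_0 = 1,
--   p_n = a_n p_{n-1} + p_{n-2},  q_n = a_n q_{n-1} + q_{n-2}.
-- pq a n = ((p_n , q_n) , (p_{n-1} , q_{n-1})).
pq : Seq → ℕ → (ℕ × ℕ) × (ℕ × ℕ)
pq a zero = ((a 0 , 1) , (1 , 0))
pq a (suc n) with pq a n
... | ((p , q) , (p' , q')) = ((a (suc n) * p + p' , a (suc n) * q + q') , (p , q))

p : Seq → ℕ → ℕ
p a n = proj₁ (proj₁ (pq a n))

q : Seq → ℕ → ℕ
q a n = proj₂ (proj₁ (pq a n))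

-- the n-th convergent p_n / q_n as an (unnormalised) rational
-- (mkℚᵘ x d denotes x / (d+1); q_n ≥ 1 when all a_n ≥ 1)
convergent : Seq → ℕ → ℚᵘ
convergent a n = mkℚᵘ (+ p a n) (pred (q a n))

evalPoly : List ℤ → ℚᵘ → ℚᵘ
evalPoly [] x = Q.0ℚᵘ
evalPoly (c ∷ cs) x = (c Q./ 1) Q.+ x Q.* evalPoly cs x

NonZeroPoly : List ℤ → Set
NonZeroPoly P = Any (λ c → c ≢ + 0) P

-- P(ξ) = 0 where ξ = [a_0; a_1, ...] = lim_n p_n/q_n, written out via the
-- convergents: P(p_n/q_n) → 0, i.e. ∀ M ∃ N ∀ n ≥ N, |P(p_n/q_n)| < 1/(M+1).
IsRootOfCF : List ℤ → Seq → Set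
IsRootOfCF P a =
  ∀ (M : ℕ) → ∃[ N ] (∀ n → N ≤ n → ∣ evalPoly P (convergent a n) ∣ Q.< mkℚᵘ (+ 1) M)

AlgebraicCF : Seq → Set
AlgebraicCF a = ∃[ P ] (NonZeroPoly P × IsRootOfCF P a)

TranscendentalCF : Seq → Set
TranscendentalCF a = ¬ AlgebraicCF a

{-# OPTIONS --safe #-}
-- Continuing a block periodically gives a quadratic number x / y very close to ξ. Suppose that ξ is a root of an integer polynomial f, of minimal length.
-- If the long blocks have unbounded periods, Liouville's argument suffices: the norm of the homogenised value f(x , y) is less than one, hence zero, so the minimal
-- polynomial of x / y divides a multiple of f, and the quotient is a shorter polynomial with the root ξ.
-- If the periods are bounded, the blocks are first extended to the left as far as possible, which makes the norm of y large. Since q_n grows at most exponentially, the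
-- matrices of the periods have bounded entries, so some matrix occurs infinitely often, and its approximations to ξ all lie in one real quadratic order ℤ[θ].
-- Roth's method applies there with its two real places: Siegel's lemma gives an integer polynomial vanishing to high index at (ξ , … , ξ), by Roth's lemma some derivative
-- of small index does not vanish at (x₁ : y₁ , … , x_m : y_m), and its norm would be less than one.
-- The real numbers are bounded sequences of rationals modulo null sequences, and polynomials are integer measures on exponents.

module Submission where

open import Algebra.Bundles using (CommutativeRing)
open import Level using (0ℓ)
open import Function using (id; _∘_)
open import Data.Empty using (⊥; ⊥-elim)
open import Data.Unit using (⊤; tt)
open import Data.Maybe using (Maybe; just; nothing)
open import Data.Product using (_×_; _,_; proj₁; proj₂; ∃; ∃-syntax; Σ)
open import Data.Sum using (_⊎_; inj₁; inj₂; [_,_]; [_,_]′)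
open import Data.Nat as ℕ using (ℕ; zero; suc; z≤n; s≤s; _≤_; _<_; _≤?_; _<?_; _∸_; _^_; _⊓_; _⊔_; _/_; _%_; pred)
import Data.Nat.DivMod as DM
open import Data.Nat.Divisibility using (divides)
import Data.Nat.Properties as ℕₚ
open ℕₚ using (*-cancelʳ-≤; *-cancelˡ-≤; *-mono-<; *-mono-≤; *-monoʳ-≤; *-monoˡ-≤; *-suc; +-cancelʳ-≤; +-cancelˡ-<; +-cancelˡ-≡; +-cancelˡ-≤; +-mono-<; +-mono-≤; +-monoʳ-<; +-monoʳ-≤; +-monoˡ-<; +-monoˡ-≤; +-suc; +-∸-assoc; +-∸-comm; <-cmp; <-trans; <-≤-trans; <⇒≢; <⇒≤; <⇒≱; ^-*-assoc; ^-distribˡ-+-*; ^-monoʳ-<; ^-monoʳ-≤; ^-monoˡ-<; ^-monoˡ-≤; m+[n∸m]≡n; m+n∸m≡n; m<m+n; m<n⇒0<n∸m; m<n⇒m<1+n; m^n>0; m∸n+n≡m; m∸n≡0⇒m≤n; m∸n≢0⇒n<m; m∸n≤m; m≤m*n; m≤m+n; m≤m⊔n; m≤n*m; m≤n+m; m≤n+m∸n; m≤n⇒m<n∨m≡n; m≤n⇒m≤1+n; m≤n⊔m; m⊓n≤m; m⊓n≤n; n∸n≡0; n≢0⇒n>0; n≤0⇒n≡0; n≤1+n; ∸-+-assoc; ∸-monoʳ-≤; ∸-monoˡ-≤; ≤-<-connex; ≤-<-trans; ≤-pred; ≤-refl; ≤-reflexive; ≤-trans; ≤∧≢⇒<; ≮⇒≥;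 ≰⇒>; ⊓-glb; ⊔-lub)
open import Data.Nat.Solver using (module +-*-Solver)
open import Data.Integer as ℤ using (ℤ; +_; 0ℤ; 1ℤ; ∣_∣)
import Data.Integer.Properties as ℤₚ
open import Algebra.Properties.AbelianGroup ℤₚ.+-0-abelianGroup using () renaming (∙-cancelʳ to ℤ-cancelʳ)
open ℤₚ using (abs-*; pos-*; ∣i∣≡0⇒i≡0; i*j≡0⇒i≡0∨j≡0; ∣i+j∣≤∣i∣+∣j∣; ∣-i∣≡∣i∣; ∣i-j∣≤∣i∣+∣j∣)
open import Data.Rational.Unnormalised as Q using (ℚᵘ; mkℚᵘ; ↥_; ↧ₙ_; _≃_; *≡*)
import Data.Rational.Unnormalised.Properties as Qₚ
open import Data.Fin as Fin using (Fin; toℕ)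
import Data.Fin.Properties as Finₚ
open import Data.List as List using (List; []; _∷_; _++_; map; length; _∷ʳ_; upTo; cartesianProduct; initLast; InitLast; _∷ʳ′_)
open import Data.List.Properties using (length-map)
open import Data.List.Membership.Propositional using (_∈_)
open import Data.List.Membership.Propositional.Properties using (∈-upTo⁺; ∈-cartesianProduct⁺)
open import Data.List.Relation.Unary.All as All using (All; []; _∷_)
import Data.List.Relation.Unary.All.Properties as Allₚ
open import Data.List.Relation.Unary.Any using (Any; here; there)
open import Data.Vec as Vec using (Vec; []; _∷_; lookup; zipWith; replicate)
open import Data.Vec.Properties using (zipWith-comm; zipWith-assoc; zipWith-identityˡ; zipWith-identityʳ)
open import Data.Vec.Relation.Unary.All as VecAll using ([]; _∷_)
open import Data.Vec.Relation.Binary.Pointwise.Inductive as Pointwise using (Pointwise; []; _∷_)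
open import Relation.Binary.Definitions using (tri<; tri≈; tri>)
open import Relation.Binary.PropositionalEquality as P using (_≡_; _≢_; cong; cong₂; subst; subst₂)
open import Relation.Nullary using (¬_; yes; no; Dec)
open import Relation.Nullary.Decidable using (decidable-stable)
open import Defs hiding (p; q)

skip : ℕ → ℕ → ℕ
skip zero k = suc k
skip (suc j) zero = zero
skip (suc j) (suc k) = suc (skip j k)

module Sum (A : CommutativeRing 0ℓ 0ℓ) where
  open CommutativeRing A
  open import Algebra.Properties.CommutativeSemigroup +-commutativeSemigroup using (interchange)
  open import Relation.Binary.Reasoning.Setoid setoid

  sum : ℕ → (ℕ → Carrier) → Carrier
  sum zero f = 0#
  sum (suc n) f = f 0 + sum n (λ i → f (suc i))

  sum-cong : ∀ n {f g : ℕ → Carrier} → (∀ i → i < n → f i ≈ g i) → sum n f ≈ sum n g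
  sum-cong zero h = refl
  sum-cong (suc n) h = +-cong (h 0 (s≤s z≤n)) (sum-cong n (λ i l → h (suc i) (s≤s l)))

  sum-0 : ∀ n {f : ℕ → Carrier} → (∀ i → i < n → f i ≈ 0#) → sum n f ≈ 0#
  sum-0 zero h = refl
  sum-0 (suc n) h = trans (+-cong (h 0 (s≤s z≤n)) (sum-0 n (λ i l → h (suc i) (s≤s l)))) (+-identityˡ 0#)

  sum-skip : ∀ n j (f : ℕ → Carrier) → j ≤ n → sum (suc n) f ≈ f j + sum n (λ k → f (skip j k))
  sum-skip n zero f h = refl
  sum-skip (suc n) (suc j) f (s≤s h) = begin
    f 0 + sum (suc n) (λ i → f (suc i)) ≈⟨ +-congˡ (sum-skip n j (λ i → f (suc i)) h) ⟩
    f 0 + (f (suc j) + sum n _) ≈⟨ sym (+-assoc _ _ _) ⟩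
    f 0 + f (suc j) + sum n _ ≈⟨ +-congʳ (+-comm _ _) ⟩
    f (suc j) + f 0 + sum n _ ≈⟨ +-assoc _ _ _ ⟩
    f (suc j) + (f 0 + sum n _) ∎

  sum-+ : ∀ n (f g : ℕ → Carrier) → sum n (λ i → f i + g i) ≈ sum n f + sum n g
  sum-+ zero f g = sym (+-identityˡ _)
  sum-+ (suc n) f g = trans (+-congˡ (sum-+ n _ _)) (interchange _ _ _ _)

  sum-*ˡ : ∀ n c (f : ℕ → Carrier) → sum n (λ i → c * f i) ≈ c * sum n f
  sum-*ˡ zero c f = sym (zeroʳ c)
  sum-*ˡ (suc n) c f = trans (+-congˡ (sum-*ˡ n c _)) (sym (distribˡ c _ _))

  sum-*ʳ : ∀ n c (f : ℕ → Carrier) → sum n (λ i → f i * c) ≈ sum n f * c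
  sum-*ʳ n c f = trans (sum-cong n (λ i _ → *-comm _ _)) (trans (sum-*ˡ n c f) (*-comm _ _))

  sum-last : ∀ n (f : ℕ → Carrier) → sum (suc n) f ≈ sum n f + f n
  sum-last zero f = +-comm _ _
  sum-last (suc n) f = trans (+-congˡ (sum-last n (λ i → f (suc i)))) (sym (+-assoc _ _ _))

record ℤ-Algebra : Set₁ where
  field ring : CommutativeRing 0ℓ 0ℓ
  open CommutativeRing ring public hiding (ring; zero)
  field
    ι : ℤ → Carrier
    ι-+ : ∀ x y → ι (x ℤ.+ y) ≈ ι x + ι y
    ι-* : ∀ x y → ι (x ℤ.* y) ≈ ι x * ι y
    ι-neg : ∀ x → ι (ℤ.- x) ≈ - ι x
    ι-0 : ι (+ 0) ≈ 0#
    ι-1 : ι (+ 1) ≈ 1#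

module Solver (A : ℤ-Algebra) where
  open ℤ-Algebra A
  open import Algebra.Solver.Ring.AlmostCommutativeRing using (fromCommutativeRing; _-Raw-AlmostCommutative⟶_)
  morphism : CommutativeRing.rawRing ℤₚ.+-*-commutativeRing -Raw-AlmostCommutative⟶ fromCommutativeRing ring
  morphism = record { ⟦_⟧ = ι ; +-homo = ι-+ ; *-homo = ι-* ; -‿homo = ι-neg ; 0-homo = ι-0 ; 1-homo = ι-1 }
  weak-dec : ∀ x y → Maybe (ι x ≈ ι y)
  weak-dec x y with x ℤ.≟ y
  ... | yes e = just (reflexive (cong ι e))
  ... | no _ = nothing
  open import Algebra.Solver.Ring (CommutativeRing.rawRing ℤₚ.+-*-commutativeRing) (fromCommutativeRing ring) morphism weak-dec public

skip-≥ : ∀ {j k} → j ≤ k → skip j k ≡ suc k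
skip-≥ z≤n = P.refl
skip-≥ (s≤s h) = cong suc (skip-≥ h)

skip-< : ∀ {j k} → j ≤ k → skip (suc k) j ≡ j
skip-< z≤n = P.refl
skip-< (s≤s h) = cong suc (skip-< h)

skip-skip : ∀ {j k} → j ≤ k → ∀ l → skip j (skip k l) ≡ skip (suc k) (skip j l)
skip-skip z≤n l = P.refl
skip-skip (s≤s h) zero = P.refl
skip-skip (s≤s h) (suc l) = cong suc (skip-skip h l)

module Cons {A : Set} where
  infixr 5 _▹_
  _▹_ : A → (ℕ → A) → ℕ → A
  (v ▹ r) zero = v
  (v ▹ r) (suc i) = r i
open Cons public

abs-^ : ∀ z n → ∣ z ℤ.^ n ∣ ≡ ∣ z ∣ ^ n
abs-^ z zero = P.refl
abs-^ z (suc n) = P.trans (abs-* z _) (cong (∣ z ∣ ℕ.*_) (abs-^ z n))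

power≢0 : ∀ {z} → z ≢ 0ℤ → ∀ n → z ℤ.^ n ≢ 0ℤ
power≢0 z≢0 zero ()
power≢0 {z} z≢0 (suc n) e = [ z≢0 , power≢0 z≢0 n ]′ (i*j≡0⇒i≡0∨j≡0 z e)

suc≤2^ : ∀ n → suc n ≤ 2 ^ n
suc≤2^ zero = ≤-refl
suc≤2^ (suc n) = ≤-trans (+-mono-≤ (m^n>0 2 n) (suc≤2^ n)) (≤-reflexive (cong (2 ^ n ℕ.+_) (P.sym (ℕₚ.+-identityʳ _))))

module Determinant (A : CommutativeRing 0ℓ 0ℓ) where
  open CommutativeRing A
  open Sum A
  open import Algebra.Properties.Ring ring using (-‿distribʳ-*; -‿distribˡ-*; -‿+-comm; -0#≈0#; -‿involutive)
  open import Algebra.Properties.CommutativeSemigroup +-commutativeSemigroup using (interchange)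
  open import Relation.Binary.Reasoning.Setoid setoid

  Row : Set
  Row = ℕ → Carrier

  alt : ℕ → Row → Carrier
  alt zero f = 0#
  alt (suc n) f = f 0 - alt n (λ i → f (suc i))

  det : ℕ → (ℕ → Row) → Carrier
  det zero M = 1#
  det (suc n) M = alt (suc n) (λ j → M 0 j * det n (λ i k → M (suc i) (skip j k)))

  alt-cong : ∀ n {f g : Row} → (∀ i → i < n → f i ≈ g i) → alt n f ≈ alt n g
  alt-cong zero h = refl
  alt-cong (suc n) h = +-cong (h 0 (s≤s z≤n)) (-‿cong (alt-cong n (λ i l → h (suc i) (s≤s l))))

  alt-zero : ∀ n {f : Row} → (∀ i → i < n → f i ≈ 0#) → alt n f ≈ 0#
  alt-zero zero h = refl
  alt-zero (suc n) h = trans (+-cong (h 0 (s≤s z≤n)) (trans (-‿cong (alt-zero n (λ i l → h (suc i) (s≤s l)))) -0#≈0#)) (+-identityˡ _)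

  alt-+ : ∀ n (f g : Row) → alt n (λ i → f i + g i) ≈ alt n f + alt n g
  alt-+ zero f g = sym (+-identityˡ _)
  alt-+ (suc n) f g = begin
    f 0 + g 0 - alt n (λ i → f (suc i) + g (suc i)) ≈⟨ +-congˡ (-‿cong (alt-+ n _ _)) ⟩
    f 0 + g 0 - (alt n _ + alt n _) ≈⟨ +-congˡ (sym (-‿+-comm _ _)) ⟩
    f 0 + g 0 + (- alt n _ + - alt n _) ≈⟨ interchange _ _ _ _ ⟩
    _ ∎

  alt-* : ∀ n c (f : Row) → alt n (λ i → c * f i) ≈ c * alt n f
  alt-* zero c f = sym (zeroʳ c)
  alt-* (suc n) c f = begin
    c * f 0 - alt n (λ i → c * f (suc i)) ≈⟨ +-congˡ (-‿cong (alt-* n c _)) ⟩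
    c * f 0 - c * alt n _ ≈⟨ +-congˡ (-‿distribʳ-* c _) ⟩
    c * f 0 + c * - alt n _ ≈⟨ sym (distribˡ c _ _) ⟩
    c * (f 0 - alt n _) ∎

  x-x : ∀ {x y} → x ≈ y → x - y ≈ 0#
  x-x {x} {y} h = trans (+-congʳ h) (-‿inverseʳ y)

  Mult : ℕ → ((ℕ → Row) → Carrier) → Set
  Mult zero D = ∀ r r' → D r ≈ D r'
  Mult (suc n) D =
    (∀ {r r'} → (∀ i j → r i j ≈ r' i j) → D r ≈ D r') ×
    (∀ u v r → D ((λ j → u j + v j) ▹ r) ≈ D (u ▹ r) + D (v ▹ r)) ×
    (∀ c v r → D ((λ j → c * v j) ▹ r) ≈ c * D (v ▹ r)) ×
    (∀ v → Mult n (λ r → D (v ▹ r)))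

  ▹-cong : ∀ {v v' : Row} {r r' : ℕ → Row} → (∀ j → v j ≈ v' j) → (∀ i j → r i j ≈ r' i j) →
           ∀ i j → (v ▹ r) i j ≈ (v' ▹ r') i j
  ▹-cong h h' zero j = h j
  ▹-cong h h' (suc i) j = h' i j

  ▹-eta : ∀ (r : ℕ → Row) i j → r i j ≈ (r 0 ▹ (λ k → r (suc k))) i j
  ▹-eta r zero j = refl
  ▹-eta r (suc i) j = refl

  Mult-ext : ∀ n {D D'} → (∀ r → D r ≈ D' r) → Mult n D → Mult n D'
  Mult-ext zero e m = λ r r' → trans (sym (e r)) (trans (m r r') (e r'))
  Mult-ext (suc n) e (c , a , s , m) =
    (λ h → trans (sym (e _)) (trans (c h) (e _))) ,
    (λ u v r → trans (sym (e _)) (trans (a u v r) (+-cong (e _) (e _)))) ,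
    (λ k v r → trans (sym (e _)) (trans (s k v r) (*-congˡ (e _)))) ,
    (λ v → Mult-ext n (λ r → e _) (m v))

  Mult-sub : ∀ n {D D'} → Mult n D → Mult n D' → Mult n (λ r → D r - D' r)
  Mult-sub zero m m' = λ r r' → +-cong (m r r') (-‿cong (m' r r'))
  Mult-sub (suc n) (c , a , s , m) (c' , a' , s' , m') =
    (λ h → +-cong (c h) (-‿cong (c' h))) ,
    (λ u v r → trans (+-cong (a u v r) (-‿cong (a' u v r)))
       (trans (+-congˡ (sym (-‿+-comm _ _))) (interchange _ _ _ _))) ,
    (λ k v r → trans (+-cong (s k v r) (-‿cong (s' k v r)))
       (trans (+-congˡ (-‿distribʳ-* k _)) (sym (distribˡ k _ _)))) ,
    (λ v → Mult-sub n (m v) (m' v))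

  Mult-zero : ∀ n → Mult n (λ _ → 0#)
  Mult-zero zero = λ _ _ → refl
  Mult-zero (suc n) = (λ _ → refl) , (λ _ _ _ → sym (+-identityˡ 0#)) , (λ k _ _ → sym (zeroʳ k)) , (λ _ → Mult-zero n)

  Mult-scale : ∀ n c {D} → Mult n D → Mult n (λ r → c * D r)
  Mult-scale zero c m = λ r r' → *-congˡ (m r r')
  Mult-scale (suc n) c (g , a , s , m) =
    (λ h → *-congˡ (g h)) ,
    (λ u v r → trans (*-congˡ (a u v r)) (distribˡ c _ _)) ,
    (λ k v r → trans (*-congˡ (s k v r)) (trans (sym (*-assoc c k _)) (trans (*-congʳ (*-comm c k)) (*-assoc k c _)))) ,
    (λ v → Mult-scale n c (m v))

  pull : (ℕ → ℕ) → (ℕ → Row) → ℕ → Row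
  pull σ r i k = r i (σ k)

  Mult-cong : ∀ n {D} → Mult n D → ∀ {r r'} → (∀ i j → r i j ≈ r' i j) → D r ≈ D r'
  Mult-cong zero m h = m _ _
  Mult-cong (suc n) m h = proj₁ m h

  pull-▹ : ∀ σ v r i k → pull σ (v ▹ r) i k ≈ ((λ j → v (σ j)) ▹ pull σ r) i k
  pull-▹ σ v r zero k = refl
  pull-▹ σ v r (suc i) k = refl

  Mult-pull : ∀ n σ {D} → Mult n D → Mult n (λ r → D (pull σ r))
  Mult-pull zero σ m = λ r r' → m _ _
  Mult-pull (suc n) σ {D} M@(g , a , s , m) =
    (λ h → g (λ i k → h i (σ k))) ,
    (λ u v r → trans (g (pull-▹ σ _ r)) (trans (a _ _ _) (+-cong (g (λ i k → sym (pull-▹ σ u r i k))) (g (λ i k → sym (pull-▹ σ v r i k)))))) ,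
    (λ c v r → trans (g (pull-▹ σ _ r)) (trans (s c _ _) (*-congˡ (g (λ i k → sym (pull-▹ σ v r i k)))))) ,
    (λ v → Mult-ext n (λ r → g (λ i k → sym (pull-▹ σ v r i k))) (Mult-pull n σ (m (λ j → v (σ j)))))

  Mult-alt : ∀ n N {D : ℕ → (ℕ → Row) → Carrier} → (∀ j → Mult n (D j)) → Mult n (λ r → alt N (λ j → D j r))
  Mult-alt n zero m = Mult-zero n
  Mult-alt n (suc N) m = Mult-sub n (m 0) (Mult-alt n N (λ j → m (suc j)))

  det-Mult : ∀ n → Mult n (det n)
  det-cons : ∀ n v → Mult n (λ r → det (suc n) (v ▹ r))
  det-cong : ∀ n {M N : ℕ → Row} → (∀ i j → M i j ≈ N i j) → det n M ≈ det n N

  det-cong n h = Mult-cong n (det-Mult n) h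
  det-cons n v = Mult-alt n (suc n) (λ j → Mult-scale n (v j) (Mult-pull n (skip j) (det-Mult n)))
  det-Mult zero = λ _ _ → refl
  det-Mult (suc n) =
    (λ h → alt-cong (suc n) (λ j _ → *-cong (h 0 j) (det-cong n (λ i k → h (suc i) (skip j k))))) ,
    (λ u v r → trans (alt-cong (suc n) (λ j _ → distribʳ (mn r j) (u j) (v j))) (alt-+ (suc n) (λ j → u j * mn r j) (λ j → v j * mn r j))) ,
    (λ c v r → trans (alt-cong (suc n) (λ j _ → *-assoc c (v j) (mn r j))) (alt-* (suc n) c (λ j → v j * mn r j))) ,
    det-cons n
    where
    mn : (ℕ → Row) → ℕ → Carrier
    mn r j = det n (λ i k → r i (skip j k))

  Kills : Row → ℕ → ((ℕ → Row) → Carrier) → Set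
  Kills v n D = ∀ r i → i < n → (∀ j → r i j ≈ v j) → D r ≈ 0#

  Alt : ℕ → ((ℕ → Row) → Carrier) → Set
  Alt zero D = 1# ≈ 1#
  Alt (suc n) D = (∀ v → Kills v n (λ r → D (v ▹ r))) × (∀ v → Alt n (λ r → D (v ▹ r)))

  Alt-ext : ∀ n {D D'} → (∀ r → D r ≈ D' r) → Alt n D → Alt n D'
  Alt-ext zero e x = x
  Alt-ext (suc n) e (k , x) = (λ v r i l h → trans (sym (e _)) (k v r i l h)) , (λ v → Alt-ext n (λ r → e _) (x v))

  Alt-zero : ∀ n → Alt n (λ _ → 0#)
  Alt-zero zero = refl
  Alt-zero (suc n) = (λ v r i l h → refl) , (λ v → Alt-zero n)

  Alt-sub : ∀ n {D D'} → Alt n D → Alt n D' → Alt n (λ r → D r - D' r)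
  Alt-sub zero x y = refl
  Alt-sub (suc n) (k , x) (k' , x') =
    (λ v r i l h → x-x (trans (k v r i l h) (sym (k' v r i l h)))) , (λ v → Alt-sub n (x v) (x' v))

  Alt-scale : ∀ n c {D} → Alt n D → Alt n (λ r → c * D r)
  Alt-scale zero c x = refl
  Alt-scale (suc n) c (k , x) =
    (λ v r i l h → trans (*-congˡ (k v r i l h)) (zeroʳ c)) , (λ v → Alt-scale n c (x v))

  Alt-pull : ∀ n σ {D} → Mult n D → Alt n D → Alt n (λ r → D (pull σ r))
  Alt-pull zero σ m x = refl
  Alt-pull (suc n) σ (g , _ , _ , m) (k , x) =
    (λ v r i l h → trans (g (pull-▹ σ v r)) (k _ _ i l (λ j → h (σ j)))) ,
    (λ v → Alt-ext n (λ r → g (λ i k → sym (pull-▹ σ v r i k))) (Alt-pull n σ (m _) (x _)))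

  Alt-alt : ∀ n N {D : ℕ → (ℕ → Row) → Carrier} → (∀ j → Alt n (D j)) → Alt n (λ r → alt N (λ j → D j r))
  Alt-alt n zero m = Alt-zero n
  Alt-alt n (suc N) m = Alt-sub n (m 0) (Alt-alt n N (λ j → m (suc j)))

  alt-sym : ∀ N (H : ℕ → Row) → (∀ j k → j ≤ k → H j k ≈ H (suc k) j) →
            alt (suc N) (λ j → alt N (H j)) ≈ 0#
  alt-sym zero H h = trans (+-identityˡ _) -0#≈0#
  alt-sym (suc N) H h = begin
    (alt (suc N) (H 0)) - alt (suc N) (λ j → H (suc j) 0 - alt N (λ k → H (suc j) (suc k)))
      ≈⟨ +-congˡ (-‿cong lem) ⟩
    alt (suc N) (H 0) - (alt (suc N) (λ j → H (suc j) 0))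
      ≈⟨ x-x (alt-cong (suc N) (λ k _ → h 0 k z≤n)) ⟩
    0# ∎
    where
    neg : ∀ n (f : Row) → alt n (λ i → - f i) ≈ - alt n f
    neg zero f = sym -0#≈0#
    neg (suc n) f = trans (+-congˡ (-‿cong (neg n _))) (-‿+-comm _ _)
    lem : alt (suc N) (λ j → H (suc j) 0 - alt N (λ k → H (suc j) (suc k))) ≈ alt (suc N) (λ j → H (suc j) 0)
    lem = begin
      _ ≈⟨ alt-+ (suc N) (λ j → H (suc j) 0) (λ j → - alt N (λ k → H (suc j) (suc k))) ⟩
      alt (suc N) (λ j → H (suc j) 0) + alt (suc N) (λ j → - alt N (λ k → H (suc j) (suc k)))
        ≈⟨ +-congˡ (trans (neg (suc N) (λ j → alt N (λ k → H (suc j) (suc k)))) (trans (-‿cong (alt-sym N (λ j k → H (suc j) (suc k)) (λ j k l → h (suc j) (suc k) (s≤s l)))) -0#≈0#)) ⟩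
      _ + 0# ≈⟨ +-identityʳ _ ⟩
      _ ∎

  det-rep : ∀ n v r → det (suc (suc n)) (v ▹ (v ▹ r)) ≈ 0#
  det-rep n v r = trans (alt-cong (suc (suc n)) {f} {λ j → alt (suc n) (H j)} (λ j _ → sym (alt-* (suc n) (v j) (h j))))
                    (alt-sym (suc n) H sy)
    where
    h : ℕ → Row
    h j k = v (skip j k) * det n (λ i l → r i (skip j (skip k l)))
    f : Row
    f j = v j * alt (suc n) (h j)
    H : ℕ → Row
    H j k = v j * (v (skip j k) * det n (λ i l → r i (skip j (skip k l))))
    sy : ∀ j k → j ≤ k → H j k ≈ H (suc k) j
    sy j k h = begin
      v j * (v (skip j k) * d) ≈⟨ *-congˡ (*-congʳ (reflexive (cong v (skip-≥ h)))) ⟩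
      v j * (v (suc k) * d) ≈⟨ sym (*-assoc _ _ _) ⟩
      v j * v (suc k) * d ≈⟨ *-congʳ (*-comm _ _) ⟩
      v (suc k) * v j * d ≈⟨ *-assoc _ _ _ ⟩
      v (suc k) * (v j * d) ≈⟨ *-congˡ (*-cong (reflexive (cong v (P.sym (skip-< h)))) (det-cong n (λ i l → reflexive (cong (r i) (skip-skip h l))))) ⟩
      H (suc k) j ∎
      where d = det n (λ i l → r i (skip j (skip k l)))

  module _ {D : (ℕ → Row) → Carrier} {n} (M : Mult (suc (suc n)) D) where
    swap₀ : (∀ v r → D (v ▹ (v ▹ r)) ≈ 0#) → ∀ u v r → D (u ▹ (v ▹ r)) ≈ - D (v ▹ (u ▹ r))
    swap₀ rep u v r = begin
      a ≈⟨ sym (+-identityʳ a) ⟩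
      a + 0# ≈⟨ +-congˡ (sym (-‿inverseʳ b)) ⟩
      a + (b - b) ≈⟨ sym (+-assoc a b _) ⟩
      a + b - b ≈⟨ +-congʳ lem ⟩
      0# - b ≈⟨ +-identityˡ _ ⟩
      - b ∎
      where
      a = D (u ▹ (v ▹ r))
      b = D (v ▹ (u ▹ r))
      add₁ = proj₁ (proj₂ M)
      add₂ : ∀ w x y → D (w ▹ ((λ j → x j + y j) ▹ r)) ≈ D (w ▹ (x ▹ r)) + D (w ▹ (y ▹ r))
      add₂ w x y = proj₁ (proj₂ (proj₂ (proj₂ (proj₂ M)) w)) x y r
      lem : a + b ≈ 0#
      lem = begin
        a + b ≈⟨ +-cong (sym (+-identityˡ a)) (sym (+-identityʳ b)) ⟩
        (0# + a) + (b + 0#) ≈⟨ +-cong (+-congʳ (sym (rep u r))) (+-congˡ (sym (rep v r))) ⟩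
        (D (u ▹ (u ▹ r)) + a) + (b + D (v ▹ (v ▹ r))) ≈⟨ +-cong (sym (add₂ u u v)) (sym (add₂ v u v)) ⟩
        D (u ▹ (_ ▹ r)) + D (v ▹ (_ ▹ r)) ≈⟨ sym (add₁ u v _) ⟩
        D ((λ j → u j + v j) ▹ ((λ j → u j + v j) ▹ r)) ≈⟨ rep _ r ⟩
        0# ∎

  det-Alt : ∀ n → Alt n (det n)
  det-Alt-cons : ∀ n v → Alt n (λ r → det (suc n) (v ▹ r))
  det-Alt-cons n v = Alt-alt n (suc n) (λ j → Alt-scale n (v j) (Alt-pull n (skip j) (det-Mult n) (det-Alt n)))
  det-Alt zero = refl
  det-Alt (suc n) = kill n , det-Alt-cons n
    where
    kill : ∀ n v → Kills v n (λ r → det (suc n) (v ▹ r))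
    kill (suc n) v r zero l h = trans (det-cong (suc (suc n)) (▹-cong {v} (λ _ → refl) (λ i j → trans (▹-eta r i j) (▹-cong {r 0} {v} {λ k → r (suc k)} h (λ _ _ → refl) i j)))) (det-rep n v (λ k → r (suc k)))
    kill (suc n) v r (suc i) (s≤s l) h = begin
      det (suc (suc n)) (v ▹ r) ≈⟨ det-cong (suc (suc n)) (▹-cong {v} (λ _ → refl) (▹-eta r)) ⟩
      det (suc (suc n)) (v ▹ (r 0 ▹ r')) ≈⟨ swap₀ (det-Mult (suc (suc n))) (det-rep n) v (r 0) r' ⟩
      - det (suc (suc n)) (r 0 ▹ (v ▹ r')) ≈⟨ -‿cong (proj₁ (det-Alt-cons (suc n) (r 0)) v r' i l h) ⟩
      - 0# ≈⟨ -0#≈0# ⟩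
      0# ∎
      where r' = λ k → r (suc k)

  drop : ∀ n {D} v → Mult n D → Kills v n D → ∀ (c : Row) r → D (λ i j → c i * v j + r i j) ≈ D r
  drop zero v m k c r = m _ _
  drop (suc n) {D} v M@(g , a , s , m) k c r = begin
    D (λ i j → c i * v j + r i j) ≈⟨ g (▹-eta _) ⟩
    D ((λ j → c 0 * v j + r 0 j) ▹ R) ≈⟨ a _ _ _ ⟩
    D ((λ j → c 0 * v j) ▹ R) + D (r 0 ▹ R) ≈⟨ +-congʳ (trans (s _ _ _) (trans (*-congˡ (k _ 0 (s≤s z≤n) (λ _ → refl))) (zeroʳ _))) ⟩
    0# + D (r 0 ▹ R) ≈⟨ +-identityˡ _ ⟩
    D (r 0 ▹ R) ≈⟨ drop n v (m (r 0)) (λ r' i l h → k _ (suc i) (s≤s l) h) (λ i → c (suc i)) (λ i → r (suc i)) ⟩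
    D (r 0 ▹ (λ i → r (suc i))) ≈⟨ g (λ i j → sym (▹-eta r i j)) ⟩
    D r ∎
    where R = λ i j → c (suc i) * v j + r (suc i) j

  sgn : ℕ → Carrier → Carrier
  sgn zero x = x
  sgn (suc a) x = - sgn a x

  sgn-cong : ∀ a {x y} → x ≈ y → sgn a x ≈ sgn a y
  sgn-cong zero h = h
  sgn-cong (suc a) h = -‿cong (sgn-cong a h)

  sgn-*ʳ : ∀ a c x → c * sgn a x ≈ sgn a (c * x)
  sgn-*ʳ zero c x = refl
  sgn-*ʳ (suc a) c x = trans (sym (-‿distribʳ-* c _)) (-‿cong (sgn-*ʳ a c x))

  alt-sgn : ∀ n (f : Row) → alt n f ≈ sum n (λ a → sgn a (f a))
  alt-sgn zero f = refl
  alt-sgn (suc n) f = +-congˡ (trans (-‿cong (alt-sgn n _)) (neg n _))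
    where
    neg : ∀ n (f : Row) → - sum n f ≈ sum n (λ i → - f i)
    neg zero f = -0#≈0#
    neg (suc n) f = trans (sym (-‿+-comm _ _)) (+-congˡ (neg n _))

  rotate : ∀ n {D} → Mult (suc n) D → Alt (suc n) D → ∀ a → a ≤ n → ∀ (b : ℕ → Row) →
           D (b a ▹ (λ k → b (skip a k))) ≈ sgn a (D b)
  rotate n M X zero l b = proj₁ M (λ i j → sym (▹-eta b i j))
  rotate (suc n) {D} M X (suc a) (s≤s l) b = begin
    D (b (suc a) ▹ (λ k → b (skip (suc a) k))) ≈⟨ proj₁ M (▹-cong (λ _ → refl) (▹-eta _)) ⟩
    D (b (suc a) ▹ (b 0 ▹ (λ k → b (suc (skip a k))))) ≈⟨ swap₀ M (λ v r → proj₁ X v (v ▹ r) 0 (s≤s z≤n) (λ _ → refl)) _ _ _ ⟩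
    - D (b 0 ▹ (b (suc a) ▹ (λ k → b (suc (skip a k))))) ≈⟨ -‿cong (rotate n (proj₂ (proj₂ (proj₂ M)) (b 0)) (proj₂ X (b 0)) a l (λ i → b (suc i))) ⟩
    - sgn a (D (b 0 ▹ (λ i → b (suc i)))) ≈⟨ -‿cong (sgn-cong a (proj₁ M (λ i j → sym (▹-eta b i j)))) ⟩
    - sgn a (D b) ∎

  comb : ℕ → Row → (ℕ → Row) → Row
  comb n c b j = sum n (λ a → c a * b a j)

  sum-lin : ∀ {n D} → Mult (suc n) D → ∀ N (c : Row) (b : ℕ → Row) r →
            D (comb N c b ▹ r) ≈ sum N (λ a → c a * D (b a ▹ r))
  sum-lin {D = D} M@(g , a , s , m) zero c b r = begin
    D ((λ _ → 0#) ▹ r) ≈⟨ g (▹-cong (λ _ → sym (zeroˡ 0#)) (λ _ _ → refl)) ⟩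
    D ((λ _ → 0# * 0#) ▹ r) ≈⟨ s 0# (λ _ → 0#) r ⟩
    0# * _ ≈⟨ zeroˡ _ ⟩
    0# ∎
  sum-lin M@(g , a , s , m) (suc N) c b r = trans (a _ _ r) (+-cong (s _ _ r) (sum-lin M N _ _ r))

  expand : ∀ n {D} → Mult n D → Alt n D → ∀ (A : ℕ → Row) b →
           D (λ i → comb n (A i) b) ≈ det n A * D b
  expand zero m x A b = trans (m _ _) (sym (*-identityˡ _))
  expand (suc n) {D} M@(g , ad , s , m) X A b = begin
    D (λ i → comb N (A i) b) ≈⟨ g (▹-eta _) ⟩
    D (comb N (A 0) b ▹ rest) ≈⟨ sum-lin M N (A 0) b rest ⟩
    sum N (λ a → A 0 a * D (b a ▹ rest)) ≈⟨ sum-cong N {λ a → A 0 a * D (b a ▹ rest)} {λ a → A 0 a * sgn a (mn a * D b)} (λ a l → *-congˡ (step a l)) ⟩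
    sum N (λ a → A 0 a * sgn a (mn a * D b)) ≈⟨ sum-cong N {λ a → A 0 a * sgn a (mn a * D b)} {λ a → sgn a (D b * (A 0 a * mn a))} (λ a _ → trans (sgn-*ʳ a (A 0 a) (mn a * D b)) (sgn-cong a (trans (sym (*-assoc (A 0 a) (mn a) (D b))) (*-comm _ _)))) ⟩
    sum N (λ a → sgn a (D b * (A 0 a * mn a))) ≈⟨ sym (alt-sgn N (λ a → D b * (A 0 a * mn a))) ⟩
    alt N (λ a → D b * (A 0 a * mn a)) ≈⟨ alt-* N (D b) (λ a → A 0 a * mn a) ⟩
    D b * det N A ≈⟨ *-comm _ _ ⟩
    det N A * D b ∎
    where
    N = suc n
    rest : ℕ → Row
    rest i = comb N (A (suc i)) b
    mn : ℕ → Carrier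
    mn a = det n (λ i k → A (suc i) (skip a k))
    step : ∀ a → a < N → D (b a ▹ rest) ≈ sgn a (mn a * D b)
    step a (s≤s l) = begin
      D (b a ▹ rest) ≈⟨ g (▹-cong (λ _ → refl) (λ i j → sum-skip n a (λ a₁ → A (suc i) a₁ * b a₁ j) l)) ⟩
      D (b a ▹ (λ i j → A (suc i) a * b a j + comb n (λ k → A (suc i) (skip a k)) (λ k → b (skip a k)) j))
        ≈⟨ drop n (b a) (m (b a)) (proj₁ X (b a)) (λ i → A (suc i) a) _ ⟩
      D (b a ▹ (λ i → comb n (λ k → A (suc i) (skip a k)) (λ k → b (skip a k))))
        ≈⟨ expand n (m (b a)) (proj₂ X (b a)) (λ i k → A (suc i) (skip a k)) (λ k → b (skip a k)) ⟩
      mn a * D (b a ▹ (λ k → b (skip a k))) ≈⟨ *-congˡ (rotate n M X a l b) ⟩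
      mn a * sgn a (D b) ≈⟨ sgn-*ʳ a _ _ ⟩
      sgn a (mn a * D b) ∎

  det-* : ∀ n (M N : ℕ → Row) → det n (λ i j → sum n (λ a → M i a * N a j)) ≈ det n M * det n N
  det-* n M N = expand n (det-Mult n) (det-Alt n) M N

  scale : ℕ → Carrier → Carrier → Carrier
  scale zero c x = x
  scale (suc n) c x = c * scale n c x

  scale-* : ∀ n c x y → x * scale n c y ≈ scale n c (x * y)
  scale-* zero c x y = refl
  scale-* (suc n) c x y = trans (sym (*-assoc x c _)) (trans (*-congʳ (*-comm x c)) (trans (*-assoc c x _) (*-congˡ (scale-* n c x y))))

  scale-alt : ∀ k n c (f : Row) → alt n (λ j → scale k c (f j)) ≈ scale k c (alt n f)
  scale-alt zero n c f = refl
  scale-alt (suc k) n c f = trans (alt-* n c (λ j → scale k c (f j))) (*-congˡ (scale-alt k n c f))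

  det-scale : ∀ n (c : Carrier) (M : ℕ → Row) → det n (λ i j → c * M i j) ≈ scale n c (det n M)
  det-scale zero c M = refl
  det-scale (suc n) c M = begin
    alt (suc n) (λ j → c * M 0 j * det n (λ i k → c * M (suc i) (skip j k)))
      ≈⟨ alt-cong (suc n) (λ j _ → trans (*-assoc c (M 0 j) _) (*-congˡ (trans (*-congˡ (det-scale n c (λ i k → M (suc i) (skip j k)))) (scale-* n c (M 0 j) (mn j))))) ⟩
    alt (suc n) (λ j → c * scale n c (M 0 j * mn j)) ≈⟨ alt-* (suc n) c (λ j → scale n c (M 0 j * mn j)) ⟩
    c * alt (suc n) (λ j → scale n c (M 0 j * mn j)) ≈⟨ *-congˡ (scale-alt n (suc n) c (λ j → M 0 j * mn j)) ⟩
    c * scale n c (det (suc n) M) ∎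
    where
    mn : ℕ → Carrier
    mn j = det n (λ i k → M (suc i) (skip j k))

  alt-swap : ∀ m n (f : ℕ → Row) → alt m (λ i → alt n (f i)) ≈ alt n (λ j → alt m (λ i → f i j))
  alt-swap zero n f = sym (alt-zero n {λ _ → 0#} (λ _ _ → refl))
  alt-swap (suc m) n f = trans (+-congˡ (-‿cong (alt-swap m n (λ i → f (suc i))))) (trans (+-congˡ (sym (neg n _))) (sym (alt-+ n (f 0) _)))
    where
    neg : ∀ n (f : Row) → alt n (λ i → - f i) ≈ - alt n f
    neg zero f = sym -0#≈0#
    neg (suc n) f = trans (+-congˡ (-‿cong (neg n _))) (-‿+-comm _ _)

  det-column : ∀ n (M : ℕ → Row) →
    det (suc n) M ≈ alt (suc n) (λ b → M b 0 * det n (λ i k → M (skip b i) (suc k)))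
  det-column zero M = refl
  det-column (suc n) M = +-congˡ (-‿cong (begin
    alt (suc n) (λ j → M 0 (suc j) * det (suc n) (λ i k → M (suc i) (skip (suc j) k)))
      ≈⟨ alt-cong (suc n) {λ j → M 0 (suc j) * det (suc n) (λ i k → M (suc i) (skip (suc j) k))} {λ j → alt (suc n) (λ b → M 0 (suc j) * (M (suc b) 0 * minor b j))}
           (λ j _ → trans (*-congˡ (det-column n (λ i k → M (suc i) (skip (suc j) k)))) (sym (alt-* (suc n) (M 0 (suc j)) (λ b → M (suc b) 0 * minor b j)))) ⟩
    alt (suc n) (λ j → alt (suc n) (λ b → M 0 (suc j) * (M (suc b) 0 * minor b j)))
      ≈⟨ alt-swap (suc n) (suc n) (λ j b → M 0 (suc j) * (M (suc b) 0 * minor b j)) ⟩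
    alt (suc n) (λ b → alt (suc n) (λ j → M 0 (suc j) * (M (suc b) 0 * minor b j)))
      ≈⟨ alt-cong (suc n) {λ b → alt (suc n) (λ j → M 0 (suc j) * (M (suc b) 0 * minor b j))} {λ b → M (suc b) 0 * alt (suc n) (λ j → M 0 (suc j) * minor b j)}
           (λ b _ → trans (alt-cong (suc n) (λ j _ → x*yz (M 0 (suc j)) (M (suc b) 0) (minor b j))) (alt-* (suc n) (M (suc b) 0) (λ j → M 0 (suc j) * minor b j))) ⟩
    alt (suc n) (λ b → M (suc b) 0 * det (suc n) (λ i k → M (skip (suc b) i) (suc k))) ∎))
    where
    minor : ℕ → ℕ → Carrier
    minor b j = det n (λ i k → M (suc (skip b i)) (suc (skip j k)))
    x*yz : ∀ x y z → x * (y * z) ≈ y * (x * z)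
    x*yz x y z = trans (sym (*-assoc x y z)) (trans (*-congʳ (*-comm x y)) (*-assoc y x z))

  det-transpose : ∀ n (M : ℕ → Row) → det n (λ i j → M j i) ≈ det n M
  det-transpose zero M = refl
  det-transpose (suc n) M = trans (alt-cong (suc n) (λ j _ → *-congˡ {M j 0} (det-transpose n (λ i k → M (skip j i) (suc k))))) (sym (det-column n M))

-- A finitely supported ℤ-valued measure; a polynomial is a measure on exponents, studied through its pairings with functions.
Meas : Set → Set
Meas X = List (ℤ × X)

Support : {X : Set} → (X → Set) → Meas X → Set
Support Q = All (λ e → Q (proj₂ e))

scaleBy : {X : Set} → (X → ℤ) → Meas X → Meas X
scaleBy χ = map (λ e → (proj₁ e ℤ.* χ (proj₂ e) , proj₂ e))

pushforward : {X Y : Set} → (X → Y) → Meas X → Meas Y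
pushforward f = map (λ e → (proj₁ e , f (proj₂ e)))

shiftBy : {X Y Z : Set} → (X → Y → Z) → ℤ × X → Meas Y → Meas Z
shiftBy _∙_ (c , x) = map (λ e → (c ℤ.* proj₁ e , x ∙ proj₂ e))

convolve : {X Y Z : Set} → (X → Y → Z) → Meas X → Meas Y → Meas Z
convolve _∙_ [] q = []
convolve _∙_ (e ∷ p) q = shiftBy _∙_ e q ++ convolve _∙_ p q

neg : {X : Set} → Meas X → Meas X
neg = map (λ e → (ℤ.- proj₁ e , proj₂ e))

norm : {X : Set} → Meas X → ℕ
norm [] = 0
norm ((c , _) ∷ p) = ∣ c ∣ ℕ.+ norm p

module Pairing (A : ℤ-Algebra) where
  open ℤ-Algebra A
  open Sum ring
  open import Algebra.Properties.CommutativeSemigroup +-commutativeSemigroup using (interchange)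
  open import Algebra.Properties.Ring (CommutativeRing.ring ring) using (-‿distribˡ-*; -‿+-comm; -0#≈0#)
  open import Relation.Binary.Reasoning.Setoid setoid

  private variable X Y Z : Set

  ⟨_,_⟩ : Meas X → (X → Carrier) → Carrier
  ⟨ [] , g ⟩ = 0#
  ⟨ (c , x) ∷ p , g ⟩ = ι c * g x + ⟨ p , g ⟩

  pair-congOn : ∀ {Q : X → Set} {g h : X → Carrier} → (∀ x → Q x → g x ≈ h x) → ∀ {p} → Support Q p → ⟨ p , g ⟩ ≈ ⟨ p , h ⟩
  pair-congOn e [] = refl
  pair-congOn e (q ∷ s) = +-cong (*-congˡ (e _ q)) (pair-congOn e s)

  pair-cong : ∀ (p : Meas X) {g h : X → Carrier} → (∀ x → g x ≈ h x) → ⟨ p , g ⟩ ≈ ⟨ p , h ⟩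
  pair-cong [] e = refl
  pair-cong (_ ∷ p) e = +-cong (*-congˡ (e _)) (pair-cong p e)

  pair-0 : ∀ (p : Meas X) → ⟨ p , (λ _ → 0#) ⟩ ≈ 0#
  pair-0 [] = refl
  pair-0 (_ ∷ p) = trans (+-cong (zeroʳ _) (pair-0 p)) (+-identityˡ 0#)

  pair-0On : ∀ {Q : X → Set} {g : X → Carrier} → (∀ x → Q x → g x ≈ 0#) → ∀ {p} → Support Q p → ⟨ p , g ⟩ ≈ 0#
  pair-0On e {p} s = trans (pair-congOn e s) (pair-0 p)

  pair-+ : ∀ (p : Meas X) (g h : X → Carrier) → ⟨ p , (λ x → g x + h x) ⟩ ≈ ⟨ p , g ⟩ + ⟨ p , h ⟩
  pair-+ [] g h = sym (+-identityˡ 0#)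
  pair-+ ((c , x) ∷ p) g h = trans (+-cong (distribˡ _ _ _) (pair-+ p g h)) (interchange _ _ _ _)

  pair-* : ∀ (p : Meas X) k (g : X → Carrier) → ⟨ p , (λ x → k * g x) ⟩ ≈ k * ⟨ p , g ⟩
  pair-* [] k g = sym (zeroʳ k)
  pair-* ((c , x) ∷ p) k g = begin
    ι c * (k * g x) + ⟨ p , (λ x → k * g x) ⟩ ≈⟨ +-cong (trans (sym (*-assoc _ _ _)) (trans (*-congʳ (*-comm _ _)) (*-assoc _ _ _))) (pair-* p k g) ⟩
    k * (ι c * g x) + k * ⟨ p , g ⟩ ≈⟨ sym (distribˡ k _ _) ⟩
    _ ∎

  pair-*ʳ : ∀ (p : Meas X) k (g : X → Carrier) → ⟨ p , (λ x → g x * k) ⟩ ≈ ⟨ p , g ⟩ * k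
  pair-*ʳ p k g = trans (pair-cong p (λ _ → *-comm _ _)) (trans (pair-* p k g) (*-comm _ _))

  pair-sum : ∀ (p : Meas X) n (g : ℕ → X → Carrier) → ⟨ p , (λ x → sum n (λ i → g i x)) ⟩ ≈ sum n (λ i → ⟨ p , g i ⟩)
  pair-sum p zero g = pair-0 p
  pair-sum p (suc n) g = trans (pair-+ p _ _) (+-congˡ (pair-sum p n (λ i → g (suc i))))

  pair-++ : ∀ (p q : Meas X) (g : X → Carrier) → ⟨ p ++ q , g ⟩ ≈ ⟨ p , g ⟩ + ⟨ q , g ⟩
  pair-++ [] q g = sym (+-identityˡ _)
  pair-++ (_ ∷ p) q g = trans (+-congˡ (pair-++ p q g)) (sym (+-assoc _ _ _))

  pair-neg : ∀ (p : Meas X) (g : X → Carrier) → ⟨ neg p , g ⟩ ≈ - ⟨ p , g ⟩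
  pair-neg [] g = sym -0#≈0#
  pair-neg ((c , x) ∷ p) g = trans (+-cong (trans (*-congʳ (ι-neg c)) (sym (-‿distribˡ-* _ _))) (pair-neg p g)) (-‿+-comm _ _)

  pair-scaleBy : ∀ (p : Meas X) χ (g : X → Carrier) → ⟨ scaleBy χ p , g ⟩ ≈ ⟨ p , (λ x → ι (χ x) * g x) ⟩
  pair-scaleBy [] χ g = refl
  pair-scaleBy ((c , x) ∷ p) χ g = +-cong (trans (*-congʳ (ι-* c (χ x))) (*-assoc _ _ _)) (pair-scaleBy p χ g)

  pair-push : ∀ (p : Meas X) (f : X → Y) (g : Y → Carrier) → ⟨ pushforward f p , g ⟩ ≈ ⟨ p , (λ x → g (f x)) ⟩
  pair-push [] f g = refl
  pair-push (_ ∷ p) f g = +-congˡ (pair-push p f g)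

  pair-shiftBy : ∀ (_∙_ : X → Y → Z) c x (q : Meas Y) (g : Z → Carrier) →
                 ⟨ shiftBy _∙_ (c , x) q , g ⟩ ≈ ι c * ⟨ q , (λ y → g (x ∙ y)) ⟩
  pair-shiftBy _∙_ c x [] g = sym (zeroʳ _)
  pair-shiftBy _∙_ c x ((d , y) ∷ q) g = trans (+-cong (trans (*-congʳ (ι-* c d)) (*-assoc _ _ _)) (pair-shiftBy _∙_ c x q g)) (sym (distribˡ _ _ _))

  pair-convolve : ∀ (_∙_ : X → Y → Z) p q (g : Z → Carrier) →
                  ⟨ convolve _∙_ p q , g ⟩ ≈ ⟨ p , (λ x → ⟨ q , (λ y → g (x ∙ y)) ⟩) ⟩
  pair-convolve _∙_ [] q g = refl
  pair-convolve _∙_ ((c , x) ∷ p) q g = trans (pair-++ (shiftBy _∙_ (c , x) q) _ g) (+-cong (pair-shiftBy _∙_ c x q g) (pair-convolve _∙_ p q g))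

  pair-swap : ∀ (p : Meas X) (q : Meas Y) (G : X → Y → Carrier) →
              ⟨ p , (λ x → ⟨ q , G x ⟩) ⟩ ≈ ⟨ q , (λ y → ⟨ p , (λ x → G x y) ⟩) ⟩
  pair-swap [] q G = sym (pair-0 q)
  pair-swap ((c , x) ∷ p) q G = begin
    ι c * ⟨ q , G x ⟩ + ⟨ p , (λ x → ⟨ q , G x ⟩) ⟩ ≈⟨ +-cong (sym (pair-* q (ι c) (G x))) (pair-swap p q G) ⟩
    ⟨ q , (λ y → ι c * G x y) ⟩ + ⟨ q , _ ⟩ ≈⟨ sym (pair-+ q _ _) ⟩
    _ ∎

  pair-split : ∀ (p : Meas X) (q : Meas Y) (g : X → Carrier) (h : Y → Carrier) →
               ⟨ p , (λ x → ⟨ q , (λ y → g x * h y) ⟩) ⟩ ≈ ⟨ p , g ⟩ * ⟨ q , h ⟩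
  pair-split p q g h = trans (pair-cong p (λ x → pair-* q (g x) h)) (pair-*ʳ p ⟨ q , h ⟩ g)

ℤ-alg : ℤ-Algebra
ℤ-alg = record { ring = ℤₚ.+-*-commutativeRing ; ι = λ z → z ; ι-+ = λ _ _ → P.refl ; ι-* = λ _ _ → P.refl
               ; ι-neg = λ _ → P.refl ; ι-0 = P.refl ; ι-1 = P.refl }

norm-++ : {X : Set} (p q : Meas X) → norm (p ++ q) ≡ norm p ℕ.+ norm q
norm-++ [] q = P.refl
norm-++ ((c , _) ∷ p) q = P.trans (cong (∣ c ∣ ℕ.+_) (norm-++ p q)) (P.sym (ℕₚ.+-assoc ∣ c ∣ _ _))

norm-neg : {X : Set} (p : Meas X) → norm (neg p) ≡ norm p
norm-neg [] = P.refl
norm-neg ((c , _) ∷ p) = cong₂ ℕ._+_ (∣-i∣≡∣i∣ c) (norm-neg p)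

norm-push : {X Y : Set} (f : X → Y) (p : Meas X) → norm (pushforward f p) ≡ norm p
norm-push f [] = P.refl
norm-push f ((c , _) ∷ p) = cong (∣ c ∣ ℕ.+_) (norm-push f p)

norm-scaleBy : {X : Set} {Q : X → Set} {χ : X → ℤ} {B : ℕ} → (∀ x → Q x → ∣ χ x ∣ ≤ B) →
               ∀ {p} → Support Q p → norm (scaleBy χ p) ≤ norm p ℕ.* B
norm-scaleBy h [] = ℕ.z≤n
norm-scaleBy {χ = χ} {B} h {(c , x) ∷ p} (q ∷ s) = begin
  ∣ c ℤ.* χ x ∣ ℕ.+ norm (scaleBy χ p) ≡⟨ cong (ℕ._+ _) (abs-* c (χ x)) ⟩
  ∣ c ∣ ℕ.* ∣ χ x ∣ ℕ.+ norm (scaleBy χ p) ≤⟨ +-mono-≤ (*-monoʳ-≤ ∣ c ∣ (h x q)) (norm-scaleBy h s) ⟩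
  ∣ c ∣ ℕ.* B ℕ.+ norm p ℕ.* B ≡⟨ P.sym (ℕₚ.*-distribʳ-+ B ∣ c ∣ (norm p)) ⟩
  (∣ c ∣ ℕ.+ norm p) ℕ.* B ∎
  where open ℕₚ.≤-Reasoning

norm-shiftBy : {X Y Z : Set} (_∙_ : X → Y → Z) (c : ℤ) (x : X) (q : Meas Y) → norm (shiftBy _∙_ (c , x) q) ≡ ∣ c ∣ ℕ.* norm q
norm-shiftBy _∙_ c x [] = P.sym (ℕₚ.*-zeroʳ ∣ c ∣)
norm-shiftBy _∙_ c x ((d , y) ∷ q) = P.trans (cong₂ ℕ._+_ (abs-* c d) (norm-shiftBy _∙_ c x q)) (P.sym (ℕₚ.*-distribˡ-+ ∣ c ∣ ∣ d ∣ _))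

norm-convolve : {X Y Z : Set} (_∙_ : X → Y → Z) (p : Meas X) (q : Meas Y) → norm (convolve _∙_ p q) ≡ norm p ℕ.* norm q
norm-convolve _∙_ [] q = P.refl
norm-convolve _∙_ ((c , x) ∷ p) q = P.trans (norm-++ (shiftBy _∙_ (c , x) q) _)
  (P.trans (cong₂ ℕ._+_ (norm-shiftBy _∙_ c x q) (norm-convolve _∙_ p q)) (P.sym (ℕₚ.*-distribʳ-+ (norm q) ∣ c ∣ (norm p))))

Support-++ : {X : Set} {Q : X → Set} {p q : Meas X} → Support Q p → Support Q q → Support Q (p ++ q)
Support-++ [] t = t
Support-++ (a ∷ s) t = a ∷ Support-++ s t

Support-map : {X Y : Set} {Q : X → Set} {R : Y → Set} {f : ℤ × X → ℤ × Y} → (∀ c x → Q x → R (proj₂ (f (c , x)))) →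
              ∀ {p} → Support Q p → Support R (map f p)
Support-map h [] = []
Support-map h (q ∷ s) = h _ _ q ∷ Support-map h s

Support-convolve : {X Y Z : Set} {Q : X → Set} {R : Y → Set} {S : Z → Set} {_∙_ : X → Y → Z} → (∀ x y → Q x → R y → S (x ∙ y)) →
                   ∀ {p q} → Support Q p → Support R q → Support S (convolve _∙_ p q)
Support-convolve h [] t = []
Support-convolve h {(c , x) ∷ p} (a ∷ s) t = Support-++ (Support-map (λ _ y r → h x y a r) t) (Support-convolve h s t)

private
  module Pℤ = Pairing ℤ-alg
  module S = Solver ℤ-alg
  module 𝕊 = Sum ℤₚ.+-*-commutativeRing
  module N = +-*-Solver

Exp : ℕ → Set
Exp = Vec ℕ

infixl 6 _⊞_
_⊞_ : ∀ {m} → Exp m → Exp m → Exp m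
_⊞_ = zipWith ℕ._+_

infix 4 _⊑ᵛ_
_⊑ᵛ_ : ∀ {m} → Exp m → Exp m → Set
_⊑ᵛ_ = Pointwise _≤_

dot : ∀ {m} → Vec ℕ m → Exp m → ℕ
dot [] [] = 0
dot (w ∷ ws) (i ∷ I) = w ℕ.* i ℕ.+ dot ws I

binom : ℕ → ℕ → ℕ
binom j zero = 1
binom zero (suc a) = 0
binom (suc j) (suc a) = binom j a ℕ.+ binom j (suc a)

binomᵛ : ∀ {m} → Exp m → Exp m → ℕ
binomᵛ [] [] = 1
binomᵛ (j ∷ J) (a ∷ A) = binom j a ℕ.* binomᵛ J A

binom-step : ∀ j a → (+ suc a) ℤ.* + binom j (suc a) ≡ (+ j ℤ.- + a) ℤ.* + binom j a
binom-step zero zero = P.refl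
binom-step zero (suc a) = P.trans (ℤₚ.*-zeroʳ (+ suc (suc a))) (P.sym (ℤₚ.*-zeroʳ (+ 0 ℤ.- + suc a)))
binom-step (suc j) zero = begin
  + 1 ℤ.* + (1 ℕ.+ binom j 1) ≡⟨ ℤₚ.*-identityˡ _ ⟩
  + 1 ℤ.+ + binom j 1 ≡⟨ cong (λ z → + 1 ℤ.+ z) (P.trans (P.sym (ℤₚ.*-identityˡ _)) (binom-step j 0)) ⟩
  + 1 ℤ.+ (+ j ℤ.- + 0) ℤ.* + 1 ≡⟨ solve 1 (λ x → con (+ 1) :+ (x :- con (+ 0)) :* con (+ 1) := (con (+ 1) :+ x :- con (+ 0)) :* con (+ 1)) P.refl (+ j) ⟩
  (+ suc j ℤ.- + 0) ℤ.* + 1 ∎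
  where open P.≡-Reasoning
        open Solver ℤ-alg
binom-step (suc j) (suc a) = begin
  (+ 1 ℤ.+ A) ℤ.* (x ℤ.+ y) ≡⟨ solve 3 (λ A x y → (con (+ 1) :+ A) :* (x :+ y) := A :* x :+ x :+ (con (+ 1) :+ A) :* y) P.refl A x y ⟩
  A ℤ.* x ℤ.+ x ℤ.+ (+ 1 ℤ.+ A) ℤ.* y ≡⟨ cong₂ (λ u v → u ℤ.+ x ℤ.+ v) (binom-step j a) (binom-step j (suc a)) ⟩
  (+ j ℤ.- + a) ℤ.* z ℤ.+ x ℤ.+ (+ j ℤ.- A) ℤ.* x ≡⟨ cong (λ u → u ℤ.+ (+ j ℤ.- A) ℤ.* x) (ℤₚ.+-comm ((+ j ℤ.- + a) ℤ.* z) x) ⟩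
  x ℤ.+ (+ j ℤ.- + a) ℤ.* z ℤ.+ (+ j ℤ.- A) ℤ.* x ≡⟨ solve 4 (λ j a x z → x :+ (j :- a) :* z :+ (j :- (con (+ 1) :+ a)) :* x := (con (+ 1) :+ j :- (con (+ 1) :+ a)) :* (z :+ x)) P.refl (+ j) (+ a) x z ⟩
  (+ suc j ℤ.- A) ℤ.* (z ℤ.+ x) ∎
  where
  open P.≡-Reasoning
  open Solver ℤ-alg
  A = + suc a
  x = + binom j (suc a)
  y = + binom j (suc (suc a))
  z = + binom j a

module Taylor (A : ℤ-Algebra) where
  open ℤ-Algebra A
  open Sum ring
  open Pairing A
  open import Algebra.Properties.CommutativeSemigroup +-commutativeSemigroup using (interchange)
  open import Algebra.Properties.CommutativeSemigroup *-commutativeSemigroup using () renaming (interchange to *-interchange)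
  open import Relation.Binary.Reasoning.Setoid setoid
  open Solver A using (solve; _:=_; _:+_; _:*_; con)

  infixr 8 _↑_
  _↑_ : Carrier → ℕ → Carrier
  x ↑ zero = 1#
  x ↑ suc n = x * x ↑ n

  ↑-cong : ∀ {x y} → x ≈ y → ∀ n → x ↑ n ≈ y ↑ n
  ↑-cong e zero = refl
  ↑-cong e (suc n) = *-cong e (↑-cong e n)

  ↑-+ : ∀ y a b → y ↑ (a ℕ.+ b) ≈ y ↑ a * y ↑ b
  ↑-+ y zero b = sym (*-identityˡ _)
  ↑-+ y (suc a) b = trans (*-congˡ (↑-+ y a b)) (sym (*-assoc y _ _))

  -- The coefficient of τ^i in (x + τ)^j.
  taylor : Carrier → ℕ → ℕ → Carrier
  taylor x zero zero = 1#
  taylor x (suc i) zero = 0#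
  taylor x zero (suc j) = x * taylor x zero j
  taylor x (suc i) (suc j) = x * taylor x (suc i) j + taylor x i j

  taylorξ : ∀ {m} → Carrier → Exp m → Exp m → Carrier
  taylorξ ξ [] [] = 1#
  taylorξ ξ (i ∷ I) (j ∷ J) = taylor ξ i j * taylorξ ξ I J

  taylorᵛ : ∀ {m} → Vec Carrier m → Vec Carrier m → (d I J : Exp m) → Carrier
  taylorᵛ [] [] [] [] [] = 1#
  taylorᵛ (x ∷ xs) (y ∷ ys) (d ∷ ds) (i ∷ I) (j ∷ J) = (taylor x i j * y ↑ (d ∸ j)) * taylorᵛ xs ys ds I J

  taylor-> : ∀ x {i j} → j < i → taylor x i j ≈ 0#
  taylor-> x {suc i} {zero} l = refl
  taylor-> x {suc i} {suc j} (s≤s l) = trans (+-cong (trans (*-congˡ (taylor-> x (m<n⇒m<1+n l))) (zeroʳ x)) (taylor-> x l)) (+-identityˡ 0#)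

  taylor-euler : ∀ x i j → ι (+ j) * taylor x i j ≈ ι (+ i) * taylor x i j + ι (+ suc i) * (x * taylor x (suc i) j)
  taylor-euler x zero zero = sym (trans (+-congˡ (trans (*-congˡ (zeroʳ x)) (zeroʳ _))) (+-identityʳ _))
  taylor-euler x (suc i) zero = begin
    ι (+ 0) * 0# ≈⟨ zeroʳ _ ⟩
    0# ≈⟨ sym (+-identityˡ 0#) ⟩
    0# + 0# ≈⟨ +-cong (sym (zeroʳ _)) (sym (trans (*-congˡ (zeroʳ x)) (zeroʳ _))) ⟩
    ι (+ suc i) * 0# + ι (+ suc (suc i)) * (x * 0#) ∎
  taylor-euler x zero (suc j) = begin
    ι (+ suc j) * (x * u) ≈⟨ trans (*-congʳ (ι-+ (+ 1) (+ j))) (*-congʳ (+-congʳ ι-1)) ⟩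
    (1# + ι (+ j)) * (x * u) ≈⟨ trans (distribʳ _ _ _) (+-congʳ (*-identityˡ _)) ⟩
    x * u + ι (+ j) * (x * u) ≈⟨ +-congˡ (solve 3 (λ j x u → j :* (x :* u) := x :* (j :* u)) refl (ι (+ j)) x u) ⟩
    x * u + x * (ι (+ j) * u) ≈⟨ +-congˡ (*-congˡ (taylor-euler x zero j)) ⟩
    x * u + x * (ι (+ 0) * u + ι (+ 1) * (x * v)) ≈⟨ solve 3 (λ x u v → x :* u :+ x :* (con (+ 0) :* u :+ con (+ 1) :* (x :* v)) := con (+ 0) :* (x :* u) :+ con (+ 1) :* (x :* (x :* v :+ u))) refl x u v ⟩
    ι (+ 0) * (x * u) + ι (+ 1) * (x * (x * v + u)) ∎
    where u = taylor x 0 j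
          v = taylor x 1 j
  taylor-euler x (suc i) (suc j) = begin
    ι (+ suc j) * (x * v + u) ≈⟨ trans (*-congʳ (ι-+ (+ 1) (+ j))) (*-congʳ (+-congʳ ι-1)) ⟩
    (1# + ι (+ j)) * (x * v + u) ≈⟨ trans (distribʳ _ _ _) (+-congʳ (*-identityˡ _)) ⟩
    x * v + u + ι (+ j) * (x * v + u) ≈⟨ +-congˡ (solve 4 (λ j x u v → j :* (x :* v :+ u) := x :* (j :* v) :+ j :* u) refl (ι (+ j)) x u v) ⟩
    x * v + u + (x * (ι (+ j) * v) + ι (+ j) * u) ≈⟨ +-congˡ (+-cong (*-congˡ (trans (taylor-euler x (suc i) j) (+-cong (*-congʳ s1) (*-congʳ s2)))) (trans (taylor-euler x i j) (+-congˡ (*-congʳ s1)))) ⟩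
    x * v + u + (x * ((1# + a) * v + (1# + (1# + a)) * (x * t)) + (a * u + (1# + a) * (x * v)))
      ≈⟨ trans (+-congˡ (+-cong (*-congˡ (+-cong (*-congʳ (+-congʳ (sym ι-1))) (*-congʳ (+-cong (sym ι-1) (+-congʳ (sym ι-1)))))) (+-congˡ (*-congʳ (+-congʳ (sym ι-1))))))
          (solve 5 (λ a x u v t → x :* v :+ u :+ (x :* ((con (+ 1) :+ a) :* v :+ (con (+ 1) :+ (con (+ 1) :+ a)) :* (x :* t)) :+ (a :* u :+ (con (+ 1) :+ a) :* (x :* v)))
            := (con (+ 1) :+ a) :* (x :* v :+ u) :+ (con (+ 1) :+ (con (+ 1) :+ a)) :* (x :* (x :* t :+ v))) refl a x u v t) ⟩
    (ι (+ 1) + a) * (x * v + u) + (ι (+ 1) + (ι (+ 1) + a)) * (x * (x * t + v))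
      ≈⟨ +-cong (*-congʳ (sym (ι-+ (+ 1) (+ i)))) (*-congʳ (trans (+-congˡ (sym (ι-+ (+ 1) (+ i)))) (sym (ι-+ (+ 1) (+ suc i))))) ⟩
    ι (+ suc i) * (x * v + u) + ι (+ suc (suc i)) * (x * (x * t + v)) ∎
    where
    u = taylor x i j
    v = taylor x (suc i) j
    t = taylor x (suc (suc i)) j
    a = ι (+ i)
    s1 : ι (+ suc i) ≈ 1# + a
    s1 = trans (ι-+ (+ 1) (+ i)) (+-congʳ ι-1)
    s2 : ι (+ suc (suc i)) ≈ 1# + (1# + a)
    s2 = trans (ι-+ (+ 1) (+ suc i)) (+-cong ι-1 s1)

  anti : ℕ → (ℕ → ℕ → Carrier) → Carrier
  anti zero f = f 0 0
  anti (suc i) f = f 0 (suc i) + anti i (λ a b → f (suc a) b)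

  anti-cong : ∀ i {f g : ℕ → ℕ → Carrier} → (∀ a b → a ℕ.+ b ≡ i → f a b ≈ g a b) → anti i f ≈ anti i g
  anti-cong zero h = h 0 0 P.refl
  anti-cong (suc i) h = +-cong (h 0 (suc i) P.refl) (anti-cong i (λ a b e → h (suc a) b (cong suc e)))

  anti-0 : ∀ i → anti i (λ _ _ → 0#) ≈ 0#
  anti-0 zero = refl
  anti-0 (suc i) = trans (+-congˡ (anti-0 i)) (+-identityˡ 0#)

  anti-+ : ∀ i (f g : ℕ → ℕ → Carrier) → anti i (λ a b → f a b + g a b) ≈ anti i f + anti i g
  anti-+ zero f g = refl
  anti-+ (suc i) f g = trans (+-congˡ (anti-+ i _ _)) (interchange _ _ _ _)

  anti-* : ∀ i c (f : ℕ → ℕ → Carrier) → anti i (λ a b → c * f a b) ≈ c * anti i f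
  anti-* zero c f = refl
  anti-* (suc i) c f = trans (+-congˡ (anti-* i c _)) (sym (distribˡ c _ _))

  anti-pair : ∀ {X : Set} (p : Meas X) i (f : ℕ → ℕ → X → Carrier) →
              ⟨ p , (λ x → anti i (λ a b → f a b x)) ⟩ ≈ anti i (λ a b → ⟨ p , f a b ⟩)
  anti-pair p zero f = refl
  anti-pair p (suc i) f = trans (pair-+ p _ _) (+-congˡ (anti-pair p i (λ a b → f (suc a) b)))

  taylor-leibniz : ∀ x i j j′ → taylor x i (j ℕ.+ j′) ≈ anti i (λ a b → taylor x a j * taylor x b j′)
  taylor-leibniz x zero zero j′ = sym (*-identityˡ _)
  taylor-leibniz x (suc i) zero j′ = sym (trans (+-cong (*-identityˡ _) (trans (anti-cong i (λ a b _ → zeroˡ _)) (anti-0 i))) (+-identityʳ _))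
  taylor-leibniz x zero (suc j) j′ = trans (*-congˡ (taylor-leibniz x zero j j′)) (sym (*-assoc x _ _))
  taylor-leibniz x (suc i) (suc j) j′ = begin
    x * taylor x (suc i) (j ℕ.+ j′) + taylor x i (j ℕ.+ j′) ≈⟨ +-cong (*-congˡ (taylor-leibniz x (suc i) j j′)) (taylor-leibniz x i j j′) ⟩
    x * (T 0 * T′ (suc i) + anti i (λ a b → T (suc a) * T′ b)) + anti i (λ a b → T a * T′ b)
      ≈⟨ +-congʳ (trans (distribˡ x _ _) (+-cong (sym (*-assoc x _ _)) (sym (anti-* i x _)))) ⟩
    x * T 0 * T′ (suc i) + anti i (λ a b → x * (T (suc a) * T′ b)) + anti i (λ a b → T a * T′ b)
      ≈⟨ trans (+-assoc _ _ _) (+-congˡ (sym (anti-+ i _ _))) ⟩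
    x * T 0 * T′ (suc i) + anti i (λ a b → x * (T (suc a) * T′ b) + T a * T′ b)
      ≈⟨ +-congˡ (anti-cong i (λ a b _ → trans (+-congʳ (sym (*-assoc x _ _))) (sym (distribʳ _ _ _)))) ⟩
    _ ∎
    where
    T = λ a → taylor x a j
    T′ = λ b → taylor x b j′

  -- With x = ξ y + L, the left side is the coefficient of τ^a in (x + τ)^j y^(d-j).
  taylor-shift : ∀ ξ y L d a j → j ≤ d →
    taylor (ξ * y + L) a j * y ↑ (d ∸ j) ≈ sum (suc d) (λ i → taylor ξ i j * (taylor L a i * y ↑ (d ∸ i)))
  taylor-shift ξ y L d a zero l = begin
    taylor x a 0 * y ↑ d ≈⟨ *-congʳ (same a) ⟩
    taylor L a 0 * y ↑ d ≈⟨ sym (*-identityˡ _) ⟩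
    1# * (taylor L a 0 * y ↑ d) ≈⟨ sym (+-identityʳ _) ⟩
    1# * (taylor L a 0 * y ↑ d) + 0# ≈⟨ +-congˡ (sym (sum-0 d (λ i _ → zeroˡ _))) ⟩
    _ ∎
    where
    x = ξ * y + L
    same : ∀ a → taylor x a 0 ≈ taylor L a 0
    same zero = refl
    same (suc a) = refl
  taylor-shift ξ y L (suc d) a (suc j) (s≤s l) = begin
    taylor x a (suc j) * y ↑ (d ∸ j) ≈⟨ *-congʳ (rec x a j) ⟩
    (x * t + prev x a j) * y ↑ (d ∸ j) ≈⟨ solve 6 (λ ξ y L t p Y → ((ξ :* y :+ L) :* t :+ p) :* Y := ξ :* (t :* (y :* Y)) :+ (L :* (t :* Y) :+ p :* Y)) refl ξ y L t (prev x a j) (y ↑ (d ∸ j)) ⟩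
    ξ * (t * (y * y ↑ (d ∸ j))) + (L * (t * y ↑ (d ∸ j)) + prev x a j * y ↑ (d ∸ j))
      ≈⟨ +-cong (*-congˡ (trans (*-congˡ (reflexive (cong (y ↑_) (P.sym (+-∸-assoc 1 l))))) (taylor-shift ξ y L (suc d) a j (m≤n⇒m≤1+n l))))
                (+-cong (*-congˡ (taylor-shift ξ y L d a j l)) (prevIH a)) ⟩
    ξ * sum (suc (suc d)) F + (L * sum (suc d) G + sum (suc d) K)
      ≈⟨ +-congˡ (trans (+-congʳ (sym (sum-*ˡ (suc d) L G))) (sym (sum-+ (suc d) (λ i → L * G i) K))) ⟩
    ξ * (F 0 + sum (suc d) (λ i → F (suc i))) + sum (suc d) (λ i → L * G i + K i)
      ≈⟨ trans (+-congʳ (trans (distribˡ ξ _ _) (+-congˡ (sym (sum-*ˡ (suc d) ξ (λ i → F (suc i))))))) (trans (+-assoc _ _ _) (+-congˡ (sym (sum-+ (suc d) (λ i → ξ * F (suc i)) (λ i → L * G i + K i))))) ⟩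
    ξ * F 0 + sum (suc d) (λ i → ξ * F (suc i) + (L * G i + K i))
      ≈⟨ +-cong (sym (*-assoc ξ _ _)) (sum-cong (suc d) (λ i _ → term i)) ⟩
    sum (suc (suc d)) (λ i → taylor ξ i (suc j) * (taylor L a i * y ↑ (suc d ∸ i))) ∎
    where
    x = ξ * y + L
    t = taylor x a j
    prev : Carrier → ℕ → ℕ → Carrier
    prev x zero j = 0#
    prev x (suc a) j = taylor x a j
    rec : ∀ x a j → taylor x a (suc j) ≈ x * taylor x a j + prev x a j
    rec x zero j = sym (+-identityʳ _)
    rec x (suc a) j = refl
    F = λ i → taylor ξ i j * (taylor L a i * y ↑ (suc d ∸ i))
    G = λ i → taylor ξ i j * (taylor L a i * y ↑ (d ∸ i))
    K = λ i → taylor ξ i j * (prev L a i * y ↑ (d ∸ i))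
    prevIH : ∀ a → prev x a j * y ↑ (d ∸ j) ≈ sum (suc d) (λ i → taylor ξ i j * (prev L a i * y ↑ (d ∸ i)))
    prevIH zero = trans (zeroˡ _) (sym (sum-0 (suc d) {λ i → taylor ξ i j * (0# * y ↑ (d ∸ i))} (λ i _ → trans (*-congˡ (zeroˡ _)) (zeroʳ _))))
    prevIH (suc a) = taylor-shift ξ y L d a j l
    term : ∀ i → ξ * F (suc i) + (L * G i + K i) ≈ taylor ξ (suc i) (suc j) * (taylor L a (suc i) * y ↑ (d ∸ i))
    term i = trans (+-congʳ (*-congˡ (*-congˡ (*-congʳ (rec L a i))))) (trans
      (solve 7 (λ ξ L u v w p Y → ξ :* (u :* ((L :* w :+ p) :* Y)) :+ (L :* (v :* (w :* Y)) :+ v :* (p :* Y)) := (ξ :* u :+ v) :* ((L :* w :+ p) :* Y)) refl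
        ξ L (taylor ξ (suc i) j) (taylor ξ i j) (taylor L a i) (prev L a i) (y ↑ (d ∸ i)))
      (*-congˡ (*-congʳ (sym (rec L a i)))))

inc : ∀ {m} → Fin m → Exp m → Exp m
inc Fin.zero (i ∷ I) = suc i ∷ I
inc (Fin.suc k) (i ∷ I) = i ∷ inc k I

dot-inc : ∀ {m} (k : Fin m) w I → dot w (inc k I) ≡ lookup w k ℕ.+ dot w I
dot-inc Fin.zero (w ∷ ws) (i ∷ I) = P.trans (cong (ℕ._+ dot ws I) (*-suc w i)) (ℕₚ.+-assoc w _ _)
dot-inc (Fin.suc k) (w ∷ ws) (i ∷ I) = P.trans (cong (w ℕ.* i ℕ.+_) (dot-inc k ws I))
  (solve 3 (λ a b c → a :+ (b :+ c) := b :+ (a :+ c)) P.refl (w ℕ.* i) (lookup ws k) (dot ws I))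
  where open +-*-Solver

dot-⊞ : ∀ {m} (w I J : Exp m) → dot w (I ⊞ J) ≡ dot w I ℕ.+ dot w J
dot-⊞ [] [] [] = P.refl
dot-⊞ (w ∷ ws) (i ∷ I) (j ∷ J) = P.trans (cong₂ ℕ._+_ (ℕₚ.*-distribˡ-+ w i j) (dot-⊞ ws I J))
  (solve 4 (λ a b c d → a :+ b :+ (c :+ d) := a :+ c :+ (b :+ d)) P.refl (w ℕ.* i) (w ℕ.* j) (dot ws I) (dot ws J))
  where open +-*-Solver

∸-⊞ : ∀ {j d j′ d′} → j ≤ d → j′ ≤ d′ → (d ℕ.+ d′) ∸ (j ℕ.+ j′) ≡ (d ∸ j) ℕ.+ (d′ ∸ j′)
∸-⊞ {j} {d} {j′} {d′} l l′ = P.trans (P.sym (∸-+-assoc (d ℕ.+ d′) j j′))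
  (P.trans (cong (_∸ j′) (+-∸-comm d′ l)) (+-∸-assoc (d ∸ j) l′))

module Index (A : ℤ-Algebra)
  (torsion-free : ∀ k z → ℤ-Algebra._≈_ A (ℤ-Algebra._*_ A (ℤ-Algebra.ι A (+ suc k)) z) (ℤ-Algebra.0# A) → ℤ-Algebra._≈_ A z (ℤ-Algebra.0# A)) where
  open ℤ-Algebra A
  open Sum ring
  open Pairing A
  open Taylor A
  open import Algebra.Properties.CommutativeSemigroup *-commutativeSemigroup using () renaming (interchange to *-interchange)
  open import Relation.Binary.Reasoning.Setoid setoid
  open Solver A using (solve; _:=_; _:+_; _:*_; con)

  antiᵛ : ∀ {m} → Exp m → (Exp m → Exp m → Carrier) → Carrier
  antiᵛ [] f = f [] []
  antiᵛ (i ∷ I) f = anti i (λ a b → antiᵛ I (λ A B → f (a ∷ A) (b ∷ B)))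

  antiᵛ-cong : ∀ {m} (I : Exp m) {f g : Exp m → Exp m → Carrier} → (∀ A B → A ⊞ B ≡ I → f A B ≈ g A B) → antiᵛ I f ≈ antiᵛ I g
  antiᵛ-cong [] h = h [] [] P.refl
  antiᵛ-cong (i ∷ I) h = anti-cong i (λ a b e → antiᵛ-cong I (λ A B e′ → h (a ∷ A) (b ∷ B) (cong₂ _∷_ e e′)))

  antiᵛ-0 : ∀ {m} (I : Exp m) → antiᵛ I (λ _ _ → 0#) ≈ 0#
  antiᵛ-0 [] = refl
  antiᵛ-0 (i ∷ I) = trans (anti-cong i (λ a b _ → antiᵛ-0 I)) (anti-0 i)

  antiᵛ-* : ∀ {m} (I : Exp m) c (f : Exp m → Exp m → Carrier) → antiᵛ I (λ a b → c * f a b) ≈ c * antiᵛ I f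
  antiᵛ-* [] c f = refl
  antiᵛ-* (i ∷ I) c f = trans (anti-cong i (λ a b _ → antiᵛ-* I c (λ A B → f (a ∷ A) (b ∷ B)))) (anti-* i c (λ a b → antiᵛ I (λ A B → f (a ∷ A) (b ∷ B))))

  antiᵛ-pair : ∀ {m} {X : Set} (p : Meas X) (I : Exp m) (f : Exp m → Exp m → X → Carrier) →
               ⟨ p , (λ x → antiᵛ I (λ A B → f A B x)) ⟩ ≈ antiᵛ I (λ A B → ⟨ p , f A B ⟩)
  antiᵛ-pair p [] f = refl
  antiᵛ-pair p (i ∷ I) f = trans (anti-pair p i (λ a b x → antiᵛ I (λ A B → f (a ∷ A) (b ∷ B) x)))
                             (anti-cong i (λ a b _ → antiᵛ-pair p I (λ A B → f (a ∷ A) (b ∷ B))))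

  taylorᵛ-leibniz : ∀ {m} (xs ys : Vec Carrier m) {d d′ J J′} I → J ⊑ᵛ d → J′ ⊑ᵛ d′ →
    taylorᵛ xs ys (d ⊞ d′) I (J ⊞ J′) ≈ antiᵛ I (λ A B → taylorᵛ xs ys d A J * taylorᵛ xs ys d′ B J′)
  taylorᵛ-leibniz [] [] [] [] [] = sym (*-identityˡ _)
  taylorᵛ-leibniz (x ∷ xs) (y ∷ ys) {d ∷ ds} {d′ ∷ ds′} {j ∷ J} {j′ ∷ J′} (i ∷ I) (l ∷ ls) (l′ ∷ ls′) = begin
    (taylor x i (j ℕ.+ j′) * y ↑ ((d ℕ.+ d′) ∸ (j ℕ.+ j′))) * taylorᵛ xs ys (ds ⊞ ds′) I (J ⊞ J′)
      ≈⟨ *-cong (*-cong (taylor-leibniz x i j j′) (trans (reflexive (cong (y ↑_) (∸-⊞ l l′))) (↑-+ y (d ∸ j) (d′ ∸ j′)))) (taylorᵛ-leibniz xs ys I ls ls′) ⟩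
    (anti i F * (y ↑ (d ∸ j) * y ↑ (d′ ∸ j′))) * antiᵛ I G
      ≈⟨ trans (*-assoc _ _ _) (trans (*-comm _ _) (sym (anti-* i _ F))) ⟩
    anti i (λ a b → (y ↑ (d ∸ j) * y ↑ (d′ ∸ j′)) * antiᵛ I G * F a b)
      ≈⟨ anti-cong i (λ a b _ → trans (*-congʳ (*-comm _ _)) (trans (*-assoc _ _ _) (trans (*-comm _ _) (trans (sym (antiᵛ-* I _ G)) (antiᵛ-cong I (λ A B _ →
           solve 6 (λ y y′ t t′ u u′ → (y :* y′ :* (t :* t′)) :* (u :* u′) := ((t :* y) :* u) :* ((t′ :* y′) :* u′)) refl
             (y ↑ (d ∸ j)) (y ↑ (d′ ∸ j′)) (taylor x a j) (taylor x b j′) (taylorᵛ xs ys ds A J) (taylorᵛ xs ys ds′ B J′))))))) ⟩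
    antiᵛ (i ∷ I) (λ A B → taylorᵛ (x ∷ xs) (y ∷ ys) (d ∷ ds) A (j ∷ J) * taylorᵛ (x ∷ xs) (y ∷ ys) (d′ ∷ ds′) B (j′ ∷ J′)) ∎
    where
    F : ℕ → ℕ → Carrier
    F a b = taylor x a j * taylor x b j′
    G : Exp _ → Exp _ → Carrier
    G A B = taylorᵛ xs ys ds A J * taylorᵛ xs ys ds′ B J′

  taylorᵛ-euler : ∀ {m} (xs ys : Vec Carrier m) d (k : Fin m) I J →
    ι (+ lookup J k) * taylorᵛ xs ys d I J ≈ ι (+ lookup I k) * taylorᵛ xs ys d I J + (ι (+ suc (lookup I k)) * lookup xs k) * taylorᵛ xs ys d (inc k I) J
  taylorᵛ-euler (x ∷ xs) (y ∷ ys) (d ∷ ds) Fin.zero (i ∷ I) (j ∷ J) = begin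
    ι (+ j) * ((t * Y) * T) ≈⟨ solve 4 (λ j t Y T → j :* ((t :* Y) :* T) := (j :* t) :* (Y :* T)) refl (ι (+ j)) t Y T ⟩
    (ι (+ j) * t) * (Y * T) ≈⟨ *-congʳ (taylor-euler x i j) ⟩
    (ι (+ i) * t + ι (+ suc i) * (x * u)) * (Y * T)
      ≈⟨ solve 7 (λ i i′ t u x Y T → (i :* t :+ i′ :* (x :* u)) :* (Y :* T) := i :* ((t :* Y) :* T) :+ (i′ :* x) :* ((u :* Y) :* T)) refl (ι (+ i)) (ι (+ suc i)) t u x Y T ⟩
    _ ∎
    where
    t = taylor x i j
    u = taylor x (suc i) j
    Y = y ↑ (d ∸ j)
    T = taylorᵛ xs ys ds I J
  taylorᵛ-euler (x ∷ xs) (y ∷ ys) (d ∷ ds) (Fin.suc k) (i ∷ I) (j ∷ J) = begin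
    n * (t * T) ≈⟨ solve 3 (λ n t T → n :* (t :* T) := t :* (n :* T)) refl n t T ⟩
    t * (n * T) ≈⟨ *-congˡ (taylorᵛ-euler xs ys ds k I J) ⟩
    t * (a * T + b * S) ≈⟨ solve 5 (λ t a T b S → t :* (a :* T :+ b :* S) := a :* (t :* T) :+ b :* (t :* S)) refl t a T b S ⟩
    a * (t * T) + b * (t * S) ∎
    where
    n = ι (+ lookup J k)
    a = ι (+ lookup I k)
    b = ι (+ suc (lookup I k)) * lookup xs k
    t = taylor x i j * y ↑ (d ∸ j)
    T = taylorᵛ xs ys ds I J
    S = taylorᵛ xs ys ds (inc k I) J

  module Vanishing {m} (xs ys : Vec Carrier m) (w : Vec ℕ m) where
    -- p vanishes to weighted order t at the point with homogeneous coordinates xs, ys.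
    record Van (d : Exp m) (t : ℕ) (p : Meas (Exp m)) : Set where
      constructor van
      field at : ∀ I → dot w I < t → ⟨ p , taylorᵛ xs ys d I ⟩ ≈ 0#
    open Van public

    Van-mono : ∀ {d s t p} → s ≤ t → Van d t p → Van d s p
    Van-mono l v = van λ I h → at v I (<-≤-trans h l)

    Van-++ : ∀ {d t p q} → Van d t p → Van d t q → Van d t (p ++ q)
    Van-++ {p = p} {q} u v = van λ I h → trans (pair-++ p q _) (trans (+-cong (at u I h) (at v I h)) (+-identityˡ 0#))

    Van-neg : ∀ {d t p} → Van d t p → Van d t (neg p)
    Van-neg {p = p} v = van λ I h → trans (pair-neg p _) (trans (-‿cong (at v I h)) -0#≈0#)
      where open import Algebra.Properties.Ring (CommutativeRing.ring ring) using (-0#≈0#)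

    Van-⊗ : ∀ {d d′ s t p q} → Support (_⊑ᵛ d) p → Support (_⊑ᵛ d′) q → Van d s p → Van d′ t q → Van (d ⊞ d′) (s ℕ.+ t) (convolve _⊞_ p q)
    Van-⊗ {d} {d′} {s} {t} {p} {q} sp sq u v = van λ I h → begin
      ⟨ convolve _⊞_ p q , taylorᵛ xs ys (d ⊞ d′) I ⟩ ≈⟨ pair-convolve _⊞_ p q _ ⟩
      ⟨ p , (λ J → ⟨ q , (λ J′ → taylorᵛ xs ys (d ⊞ d′) I (J ⊞ J′)) ⟩) ⟩
        ≈⟨ pair-congOn (λ J l → pair-congOn (λ J′ l′ → taylorᵛ-leibniz xs ys I l l′) sq) sp ⟩
      ⟨ p , (λ J → ⟨ q , (λ J′ → antiᵛ I (λ A B → taylorᵛ xs ys d A J * taylorᵛ xs ys d′ B J′)) ⟩) ⟩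
        ≈⟨ pair-cong p (λ J → antiᵛ-pair q I (λ A B J′ → taylorᵛ xs ys d A J * taylorᵛ xs ys d′ B J′)) ⟩
      ⟨ p , (λ J → antiᵛ I (λ A B → ⟨ q , (λ J′ → taylorᵛ xs ys d A J * taylorᵛ xs ys d′ B J′) ⟩)) ⟩
        ≈⟨ antiᵛ-pair p I (λ A B J → ⟨ q , (λ J′ → taylorᵛ xs ys d A J * taylorᵛ xs ys d′ B J′) ⟩) ⟩
      antiᵛ I (λ A B → ⟨ p , (λ J → ⟨ q , (λ J′ → taylorᵛ xs ys d A J * taylorᵛ xs ys d′ B J′) ⟩) ⟩)
        ≈⟨ antiᵛ-cong I (λ A B e → trans (pair-split p q _ _) (term A B (≤-<-trans (≤-reflexive (P.trans (P.sym (dot-⊞ w A B)) (cong (dot w) e))) h))) ⟩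
      antiᵛ I (λ _ _ → 0#) ≈⟨ antiᵛ-0 I ⟩
      0# ∎
      where
      term : ∀ A B → dot w A ℕ.+ dot w B < s ℕ.+ t → ⟨ p , taylorᵛ xs ys d A ⟩ * ⟨ q , taylorᵛ xs ys d′ B ⟩ ≈ 0#
      term A B l with dot w A <? s
      ... | yes l₁ = trans (*-congʳ (at u A l₁)) (zeroˡ _)
      ... | no l₁ = trans (*-congˡ (at v B (+-cancelˡ-< s (dot w B) t (≤-<-trans (+-monoˡ-≤ (dot w B) (≮⇒≥ l₁)) l)))) (zeroʳ _)

    data Low (d : Exp m) (t : ℕ) (g : Exp m → Carrier) : Set where
      basis : ∀ I → dot w I < t → (∀ J → g J ≈ taylorᵛ xs ys d I J) → Low d t g
      combine : ∀ a {f} b {h} → Low d t f → Low d t h → (∀ J → g J ≈ a * f J + b * h J) → Low d t g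

    van-low : ∀ {d t p g} → Van d t p → Low d t g → ⟨ p , g ⟩ ≈ 0#
    van-low {p = p} v (basis I l e) = trans (pair-cong p e) (at v I l)
    van-low {p = p} {g} v (combine a {f} b {h} x y e) = begin
      ⟨ p , g ⟩ ≈⟨ pair-cong p e ⟩
      ⟨ p , (λ J → a * f J + b * h J) ⟩ ≈⟨ pair-+ p _ _ ⟩
      ⟨ p , (λ J → a * f J) ⟩ + ⟨ p , (λ J → b * h J) ⟩ ≈⟨ +-cong (pair-* p a f) (pair-* p b h) ⟩
      a * ⟨ p , f ⟩ + b * ⟨ p , h ⟩ ≈⟨ +-cong (trans (*-congˡ (van-low v x)) (zeroʳ a)) (trans (*-congˡ (van-low v y)) (zeroʳ b)) ⟩
      0# + 0# ≈⟨ +-identityˡ 0# ⟩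
      0# ∎

    Low-mono : ∀ {d s t g} → s ≤ t → Low d s g → Low d t g
    Low-mono l (basis I h e) = basis I (<-≤-trans h l) e
    Low-mono l (combine a b x y e) = combine a b (Low-mono l x) (Low-mono l y) e

    Low-ext : ∀ {d t g g′} → (∀ J → g′ J ≈ g J) → Low d t g → Low d t g′
    Low-ext h (basis I l e) = basis I l (λ J → trans (h J) (e J))
    Low-ext h (combine a b x y e) = combine a b x y (λ J → trans (h J) (e J))

    Low-euler : ∀ {d t g} k → Low d t g → Low d (lookup w k ℕ.+ t) (λ J → ι (+ lookup J k) * g J)
    Low-euler {d} {t} {g} k (basis I l e) =
      combine (ι (+ lookup I k)) (ι (+ suc (lookup I k)) * lookup xs k)
        (basis I (<-≤-trans l (m≤n+m t (lookup w k))) (λ _ → refl))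
        (basis (inc k I) (≤-trans (≤-reflexive (cong suc (dot-inc k w I))) (≤-trans (≤-reflexive (P.sym (+-suc (lookup w k) (dot w I)))) (+-monoʳ-≤ (lookup w k) l))) (λ _ → refl))
        (λ J → trans (*-congˡ (e J)) (taylorᵛ-euler xs ys d k I J))
    Low-euler k (combine a b x y e) = combine a b (Low-euler k x) (Low-euler k y)
      (λ J → trans (*-congˡ (e J)) (solve 5 (λ n a f b h → n :* (a :* f :+ b :* h) := a :* (n :* f) :+ b :* (n :* h)) refl (ι (+ lookup J k)) a _ b _))

    infixr 8 _!
    _! : ℕ → ℕ
    zero ! = 1
    suc a ! = suc a ℕ.* a !

    Low-binom : ∀ {d t g} k a → Low d t g → Low d (lookup w k ℕ.* a ℕ.+ t) (λ J → ι (+ (a !)) * (ι (+ binom (lookup J k) a) * g J))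
    Low-binom {d} {t} {g} k zero x = Low-ext (λ J → trans (*-cong ι-1 (trans (*-congʳ ι-1) (*-identityˡ _))) (*-identityˡ _))
      (Low-mono (m≤n+m t _) x)
    Low-binom {d} {t} {g} k (suc a) x = combine 1# (ι (ℤ.- + a))
        (subst (λ n → Low d n (λ J → ι (+ lookup J k) * (ι (+ (a !)) * (ι (+ binom (lookup J k) a) * g J)))) eq (Low-euler k y))
        (Low-mono (≤-trans (m≤n+m _ (lookup w k)) (≤-reflexive eq)) y)
        (λ J → let j = lookup J k ; B = binom j a ; F = ι (+ (a !)) in begin
          ι (+ (suc a ℕ.* a !)) * (ι (+ binom j (suc a)) * g J) ≈⟨ *-congʳ (trans (reflexive (cong ι (pos-* (suc a) (a !)))) (ι-* _ _)) ⟩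
          (ι (+ suc a) * F) * (ι (+ binom j (suc a)) * g J)
            ≈⟨ solve 4 (λ s F B g → (s :* F) :* (B :* g) := F :* ((s :* B) :* g)) refl (ι (+ suc a)) F (ι (+ binom j (suc a))) (g J) ⟩
          F * ((ι (+ suc a) * ι (+ binom j (suc a))) * g J)
            ≈⟨ *-congˡ (*-congʳ (trans (sym (ι-* _ _)) (trans (reflexive (cong ι (binom-step j a))) (trans (ι-* _ _) (*-congʳ (ι-+ _ _)))))) ⟩
          F * (((ι (+ j) + ι (ℤ.- + a)) * ι (+ B)) * g J)
            ≈⟨ solve 5 (λ j a F B g → F :* (((j :+ a) :* B) :* g) := j :* (F :* (B :* g)) :+ a :* (F :* (B :* g))) refl (ι (+ j)) (ι (ℤ.- + a)) F (ι (+ B)) (g J) ⟩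
          ι (+ j) * (F * (ι (+ B) * g J)) + ι (ℤ.- + a) * (F * (ι (+ B) * g J)) ≈⟨ +-congʳ (sym (*-identityˡ _)) ⟩
          _ ∎)
      where
      y = Low-binom k a x
      eq : lookup w k ℕ.+ (lookup w k ℕ.* a ℕ.+ t) ≡ lookup w k ℕ.* suc a ℕ.+ t
      eq = P.trans (P.sym (ℕₚ.+-assoc (lookup w k) _ t)) (cong (ℕ._+ t) (P.sym (*-suc (lookup w k) a)))

    factorial-≢0 : ∀ a → 0 < a !
    factorial-≢0 zero = s≤s z≤n
    factorial-≢0 (suc a) = *-mono-≤ {1} {suc a} {1} (s≤s z≤n) (factorial-≢0 a)

    Van-binom : ∀ {d t p} k a → Van d (lookup w k ℕ.* a ℕ.+ t) p → Van d t (scaleBy (λ J → + binom (lookup J k) a) p)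
    Van-binom {d} {t} {p} k a v = van λ I l → let T = taylorᵛ xs ys d I in cancel (a !) (factorial-≢0 a) (begin
      F * ⟨ scaleBy (λ J → + binom (lookup J k) a) p , T ⟩ ≈⟨ *-congˡ (pair-scaleBy p _ T) ⟩
      F * ⟨ p , (λ J → ι (+ binom (lookup J k) a) * T J) ⟩ ≈⟨ sym (pair-* p F _) ⟩
      ⟨ p , (λ J → F * (ι (+ binom (lookup J k) a) * T J)) ⟩ ≈⟨ van-low v (Low-binom k a (basis I l (λ _ → refl))) ⟩
      0# ∎)
      where
      F = ι (+ (a !))
      cancel : ∀ n {z} → 0 < n → ι (+ n) * z ≈ 0# → z ≈ 0#
      cancel (suc n) _ h = torsion-free n _ h

    Van-ext : ∀ {d t p q} → (∀ g → ⟨ p , g ⟩ ≈ ⟨ q , g ⟩) → Van d t p → Van d t q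
    Van-ext e v = van λ I l → trans (sym (e _)) (at v I l)

    Van-binoms : ∀ {d n t} p (σ : Fin n → Fin m) (B : Exp n) → Van d (dot (Vec.tabulate (lookup w ∘ σ)) B ℕ.+ t) p →
                 Van d t (scaleBy (λ J → + binomᵛ (Vec.tabulate (lookup J ∘ σ)) B) p)
    Van-binoms p σ [] v = Van-ext {p = p} (λ g → sym (trans (pair-scaleBy p _ g) (pair-cong p (λ J → trans (*-congʳ ι-1) (*-identityˡ _))))) v
    Van-binoms {d} {t = t} p σ (b ∷ B) v = Van-ext {p = scaleBy f (scaleBy h p)} (λ g → begin
        ⟨ scaleBy f (scaleBy h p) , g ⟩ ≈⟨ trans (pair-scaleBy (scaleBy h p) f g) (pair-scaleBy p h _) ⟩
        ⟨ p , (λ J → ι (h J) * (ι (f J) * g J)) ⟩ ≈⟨ pair-cong p (λ J → trans (sym (*-assoc _ _ _)) (*-congʳ (trans (sym (ι-* _ _)) (reflexive (cong ι (P.sym (pos-* (binom (lookup J (σ Fin.zero)) b) _))))))) ⟩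
        ⟨ p , (λ J → ι (+ (binom (lookup J (σ Fin.zero)) b ℕ.* binomᵛ (Vec.tabulate (lookup J ∘ σ ∘ Fin.suc)) B)) * g J) ⟩ ≈⟨ sym (pair-scaleBy p _ g) ⟩
        _ ∎)
      (Van-binoms (scaleBy h p) (σ ∘ Fin.suc) B (Van-binom {p = p} (σ Fin.zero) b (subst (λ n → Van d n p) (ℕₚ.+-assoc (lookup w (σ Fin.zero) ℕ.* b) _ t) v)))
      where
      h = λ J → + binom (lookup J (σ Fin.zero)) b
      f = λ J → + binomᵛ (Vec.tabulate (lookup J ∘ σ ∘ Fin.suc)) B

    Van-θ : ∀ {d t} p (B : Exp m) → Van d (dot w B ℕ.+ t) p → Van d t (scaleBy (λ J → + binomᵛ J B) p)
    Van-θ {d} {t} p B v = Van-ext {p = scaleBy (λ J → + binomᵛ (Vec.tabulate (lookup J ∘ id)) B) p}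
      (λ g → trans (pair-scaleBy p _ g) (trans (pair-cong p (λ J → *-congʳ (reflexive (cong (λ K → ι (+ binomᵛ K B)) (tabulate∘lookup J))))) (sym (pair-scaleBy p _ g))))
      (Van-binoms p id B (subst (λ u → Van d (dot u B ℕ.+ t) p) (P.sym (tabulate∘lookup w)) v))
      where open import Data.Vec.Properties using (tabulate∘lookup)

open Pairing ℤ-alg public using () renaming (⟨_,_⟩ to ⟪_,_⟫)

infix 4 _≋_
record _≋_ {X : Set} (p q : Meas X) : Set where
  constructor same
  field pairings : ∀ g → ⟪ p , g ⟫ ≡ ⟪ q , g ⟫
open _≋_ public

module _ (A : ℤ-Algebra) where
  open ℤ-Algebra A
  open Pairing A

  pair-ι : ∀ {X : Set} (p : Meas X) (g : X → ℤ) → ⟨ p , (λ x → ι (g x)) ⟩ ≈ ι ⟪ p , g ⟫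
  pair-ι [] g = sym ι-0
  pair-ι ((c , x) ∷ p) g = trans (+-cong (sym (ι-* c (g x))) (pair-ι p g)) (sym (ι-+ _ _))

0ᵛ : ∀ {m} → Exp m
0ᵛ = replicate _ 0

Poly : ℕ → Set
Poly m = Meas (Exp m)

infixl 7 _⊗_
_⊗_ : ∀ {m} → Poly m → Poly m → Poly m
_⊗_ = convolve _⊞_

pair-⊗ : ∀ {m} (p q : Poly m) g → ⟪ p ⊗ q , g ⟫ ≡ ⟪ p , (λ J → ⟪ q , (λ J′ → g (J ⊞ J′)) ⟫) ⟫
pair-⊗ p q g = Pℤ.pair-convolve _⊞_ p q g

one : ∀ {m} → Poly m
one = (1ℤ , 0ᵛ) ∷ []

⊞-comm : ∀ {m} (I J : Exp m) → I ⊞ J ≡ J ⊞ I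
⊞-comm = zipWith-comm ℕₚ.+-comm

polyRing : ℕ → CommutativeRing 0ℓ 0ℓ
polyRing m = record
  { Carrier = Poly m ; _≈_ = _≋_ ; _+_ = _++_ ; _*_ = _⊗_ ; -_ = neg ; 0# = [] ; 1# = one
  ; isCommutativeRing = record
    { isRing = record
      { +-isAbelianGroup = record
        { isGroup = record
          { isMonoid = record
            { isSemigroup = record
              { isMagma = record
                { isEquivalence = record { refl = same (λ _ → P.refl) ; sym = λ e → same (λ g → P.sym (pairings e g)) ; trans = λ e f → same (λ g → P.trans (pairings e g) (pairings f g)) }
                ; ∙-cong = λ {p} {q} {r} {s} e f → same (λ g → P.trans (Pℤ.pair-++ p r g) (P.trans (cong₂ ℤ._+_ (pairings e g) (pairings f g)) (P.sym (Pℤ.pair-++ q s g)))) }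
              ; assoc = λ p q r → same (λ g → P.trans (Pℤ.pair-++ (p ++ q) r g) (P.trans (cong (ℤ._+ ⟪ r , g ⟫) (Pℤ.pair-++ p q g))
                  (P.trans (ℤₚ.+-assoc ⟪ p , g ⟫ _ _) (P.sym (P.trans (Pℤ.pair-++ p (q ++ r) g) (cong (λ z → ⟪ p , g ⟫ ℤ.+ z) (Pℤ.pair-++ q r g))))))) }
            ; identity = (λ p → same (λ g → P.refl)) , (λ p → same (λ g → P.trans (Pℤ.pair-++ p [] g) (ℤₚ.+-identityʳ _))) }
          ; inverse = (λ p → same (λ g → P.trans (Pℤ.pair-++ (neg p) p g) (P.trans (cong (ℤ._+ ⟪ p , g ⟫) (Pℤ.pair-neg p g)) (ℤₚ.+-inverseˡ ⟪ p , g ⟫)))) ,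
                      (λ p → same (λ g → P.trans (Pℤ.pair-++ p (neg p) g) (P.trans (cong (λ z → ⟪ p , g ⟫ ℤ.+ z) (Pℤ.pair-neg p g)) (ℤₚ.+-inverseʳ ⟪ p , g ⟫))))
          ; ⁻¹-cong = λ {p} {q} e → same (λ g → P.trans (Pℤ.pair-neg p g) (P.trans (cong ℤ.-_ (pairings e g)) (P.sym (Pℤ.pair-neg q g)))) }
        ; comm = λ p q → same (λ g → P.trans (Pℤ.pair-++ p q g) (P.trans (ℤₚ.+-comm ⟪ p , g ⟫ _) (P.sym (Pℤ.pair-++ q p g)))) }
      ; *-cong = λ {p} {q} {r} {s} e f → same (λ g → P.trans (pair-⊗ p r g) (P.trans (P.trans (Pℤ.pair-cong p (λ J → pairings f (λ J′ → g (J ⊞ J′)))) (pairings e _)) (P.sym (pair-⊗ q s g))))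
      ; *-assoc = λ p q r → same (λ g → P.trans (pair-⊗ (p ⊗ q) r g) (P.trans (pair-⊗ p q _) (P.sym (P.trans (pair-⊗ p (q ⊗ r) g)
          (Pℤ.pair-cong p (λ J → P.trans (pair-⊗ q r _) (Pℤ.pair-cong q (λ J′ → Pℤ.pair-cong r (λ J″ → cong g (P.sym (zipWith-assoc ℕₚ.+-assoc J J′ J″)))))))))))
      ; *-identity = (λ p → idˡ p) , (λ p → same (λ g → P.trans (pairings (comm p one) g) (pairings (idˡ p) g)))
      ; distrib = (λ p q r → dˡ p q r) , (λ p q r → same (λ g → P.trans (pairings (comm (q ++ r) p) g) (P.trans (pairings (dˡ p q r) g)
          (P.trans (Pℤ.pair-++ (p ⊗ q) (p ⊗ r) g) (P.trans (cong₂ ℤ._+_ (pairings (comm p q) g) (pairings (comm p r) g)) (P.sym (Pℤ.pair-++ (q ⊗ p) (r ⊗ p) g))))))) }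
    ; *-comm = comm } }
  where
  comm : ∀ (p q : Poly m) → p ⊗ q ≋ q ⊗ p
  comm p q = same (λ g → P.trans (pair-⊗ p q g) (P.trans (Pℤ.pair-swap p q (λ J J′ → g (J ⊞ J′)))
    (P.trans (Pℤ.pair-cong q (λ J′ → Pℤ.pair-cong p (λ J → cong g (⊞-comm J J′)))) (P.sym (pair-⊗ q p g)))))
  idˡ : ∀ (p : Poly m) → one ⊗ p ≋ p
  idˡ p = same (λ g → P.trans (pair-⊗ one p g) (P.trans (ℤₚ.+-identityʳ _) (P.trans (ℤₚ.*-identityˡ _) (Pℤ.pair-cong p (λ J → cong g (zipWith-identityˡ ℕₚ.+-identityˡ J))))))
  dˡ : ∀ (p q r : Poly m) → p ⊗ (q ++ r) ≋ (p ⊗ q) ++ (p ⊗ r)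
  dˡ p q r = same (λ g → P.trans (pair-⊗ p (q ++ r) g) (P.trans (Pℤ.pair-cong p (λ J → Pℤ.pair-++ q r _)) (P.trans (Pℤ.pair-+ p _ _)
    (P.trans (cong₂ ℤ._+_ (P.sym (pair-⊗ p q g)) (P.sym (pair-⊗ p r g))) (P.sym (Pℤ.pair-++ (p ⊗ q) (p ⊗ r) g))))))

module PolyDet (m : ℕ) = Determinant (polyRing m)
module ℤDet = Determinant ℤₚ.+-*-commutativeRing

infixr 7 _⊙_
_⊙_ : ∀ {m} → ℕ → Exp m → Exp m
zero ⊙ d = 0ᵛ
suc n ⊙ d = d ⊞ (n ⊙ d)

norm-sub : ∀ {m} (p q : Poly m) → norm (p ++ neg q) ≡ norm p ℕ.+ norm q
norm-sub p q = P.trans (norm-++ p (neg q)) (cong (norm p ℕ.+_) (norm-neg q))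

module _ {m : ℕ} where
  open PolyDet m

  norm-alt : ∀ n (f : ℕ → Poly m) B → (∀ j → norm (f j) ≤ B) → norm (alt n f) ≤ n ℕ.* B
  norm-alt zero f B h = z≤n
  norm-alt (suc n) f B h = ≤-trans (≤-reflexive (norm-sub (f 0) _)) (+-mono-≤ (h 0) (norm-alt n (λ j → f (suc j)) B (λ j → h (suc j))))

  norm-det : ∀ n (M : ℕ → ℕ → Poly m) B → (∀ i j → norm (M i j) ≤ B) → norm (det n M) ≤ (n ℕ.* B) ^ n
  norm-det zero M B h = ≤-refl
  norm-det (suc n) M B h = begin
    norm (det (suc n) M) ≤⟨ norm-alt (suc n) (λ j → M 0 j ⊗ det n (λ i k → M (suc i) (skip j k))) (B ℕ.* (n ℕ.* B) ^ n) (λ j → ≤-trans (≤-reflexive (norm-convolve _⊞_ (M 0 j) (det n (λ i k → M (suc i) (skip j k))))) (*-mono-≤ (h 0 j) (norm-det n (λ i k → M (suc i) (skip j k)) B (λ i k → h (suc i) (skip j k))))) ⟩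
    suc n ℕ.* (B ℕ.* (n ℕ.* B) ^ n) ≡⟨ P.sym (ℕₚ.*-assoc (suc n) B _) ⟩
    (suc n ℕ.* B) ℕ.* (n ℕ.* B) ^ n ≤⟨ *-monoʳ-≤ (suc n ℕ.* B) (^-monoˡ-≤ n (m≤n+m (n ℕ.* B) B)) ⟩
    (suc n ℕ.* B) ^ suc n ∎
    where open ℕₚ.≤-Reasoning

  ⊞-mono : ∀ {k} {I J K L : Exp k} → I ⊑ᵛ K → J ⊑ᵛ L → (I ⊞ J) ⊑ᵛ (K ⊞ L)
  ⊞-mono [] [] = []
  ⊞-mono (a ∷ x) (b ∷ y) = +-mono-≤ a b ∷ ⊞-mono x y

  ⊑-refl : ∀ {k} (I : Exp k) → I ⊑ᵛ I
  ⊑-refl [] = []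
  ⊑-refl (i ∷ I) = ≤-refl ∷ ⊑-refl I

  support-alt : ∀ {Q : Exp m → Set} n {f : ℕ → Poly m} → (∀ j → Support Q (f j)) → Support Q (alt n f)
  support-alt zero h = []
  support-alt (suc n) h = Support-++ (h 0) (Support-map (λ _ _ x → x) (support-alt n (λ j → h (suc j))))

  support-det : ∀ {Q : Exp m → Set} → Q 0ᵛ → (∀ I J → Q I → Q J → Q (I ⊞ J)) → ∀ n {M : ℕ → ℕ → Poly m} → (∀ i j → Support Q (M i j)) → Support Q (det n M)
  support-det q₀ q₊ zero h = q₀ ∷ []
  support-det q₀ q₊ (suc n) {M} h = support-alt (suc n) {λ j → M 0 j ⊗ det n (λ i k → M (suc i) (skip j k))}
    (λ j → Support-convolve q₊ (h 0 j) (support-det q₀ q₊ n (λ i k → h (suc i) (skip j k))))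

  module _ {d : Exp m} where

    box-det : ∀ n {M : ℕ → ℕ → Poly m} → (∀ i j → Support (_⊑ᵛ d) (M i j)) → Support (_⊑ᵛ (n ⊙ d)) (det n M)
    box-det zero h = ⊑-refl 0ᵛ ∷ []
    box-det (suc n) {M} h = support-alt (suc n) {λ j → M 0 j ⊗ det n (λ i k → M (suc i) (skip j k))} (λ j → Support-convolve (λ _ _ → ⊞-mono) (h 0 j) (box-det n (λ i k → h (suc i) (skip j k))))

sumℕ : ℕ → (ℕ → ℕ) → ℕ
sumℕ zero f = 0
sumℕ (suc n) f = f 0 ℕ.+ sumℕ n (λ i → f (suc i))

sumℕ-skip : ∀ n j (f : ℕ → ℕ) → j ≤ n → sumℕ (suc n) f ≡ f j ℕ.+ sumℕ n (λ k → f (skip j k))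
sumℕ-skip n zero f h = P.refl
sumℕ-skip (suc n) (suc j) f (s≤s h) = P.trans (cong (f 0 ℕ.+_) (sumℕ-skip n j (λ i → f (suc i)) h))
  (solve 3 (λ a b c → a :+ (b :+ c) := b :+ (a :+ c)) P.refl (f 0) (f (suc j)) (sumℕ n _))
  where open +-*-Solver

skip-bound : ∀ j {k n} → k < n → skip j k < suc n
skip-bound zero l = s≤s l
skip-bound (suc j) {zero} l = s≤s z≤n
skip-bound (suc j) {suc k} (s≤s l) = s≤s (skip-bound j l)

-- A measure whose leading point is D, with coefficient k: it pairs with functions vanishing below D as k times evaluation at D.
Lead : {X : Set} → (X → Set) → (X → ℕ) → X → ℤ → Meas X → Set
Lead Q ω D k p = ∀ g → (∀ x → Q x → ω x < ω D → g x ≡ 0ℤ) → ⟪ p , g ⟫ ≡ k ℤ.* g D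

record Top {m} (ω : Exp m → ℕ) (n : ℕ) (k : ℤ) (p : Poly m) : Set where
  constructor top
  field leading : ∀ (g : ℕ → ℤ) → (∀ a → a < n → g a ≡ 0ℤ) → ⟪ p , (λ J → g (ω J)) ⟫ ≡ k ℤ.* g n
open Top public

module _ {m} (ω : Exp m → ℕ) (ω-⊞ : ∀ I J → ω (I ⊞ J) ≡ ω I ℕ.+ ω J) (ω-0 : ω 0ᵛ ≡ 0) where
  open PolyDet m

  Top-⊗ : ∀ {a k b l p q} → Top ω a k p → Top ω b l q → Top ω (a ℕ.+ b) (k ℤ.* l) (p ⊗ q)
  Top-⊗ {a} {k} {b} {l} {p} {q} x y = top λ g h → begin
    ⟪ p ⊗ q , (λ J → g (ω J)) ⟫ ≡⟨ pair-⊗ p q _ ⟩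
    ⟪ p , (λ J → ⟪ q , (λ J′ → g (ω (J ⊞ J′))) ⟫) ⟫ ≡⟨ Pℤ.pair-cong p (λ J → Pℤ.pair-cong q (λ J′ → cong g (ω-⊞ J J′))) ⟩
    ⟪ p , (λ J → ⟪ q , (λ J′ → g (ω J ℕ.+ ω J′)) ⟫) ⟫
      ≡⟨ leading x (λ c → ⟪ q , (λ J′ → g (c ℕ.+ ω J′)) ⟫) (λ c c<a → P.trans (leading y (λ e → g (c ℕ.+ e)) (λ e e<b → h _ (+-mono-< c<a e<b)))
           (P.trans (cong (l ℤ.*_) (h _ (+-monoˡ-< b c<a))) (ℤₚ.*-zeroʳ l))) ⟩
    k ℤ.* ⟪ q , (λ J′ → g (a ℕ.+ ω J′)) ⟫ ≡⟨ cong (k ℤ.*_) (leading y (λ e → g (a ℕ.+ e)) (λ e e<b → h _ (+-monoʳ-< a e<b))) ⟩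
    k ℤ.* (l ℤ.* g (a ℕ.+ b)) ≡⟨ P.sym (ℤₚ.*-assoc k l _) ⟩
    k ℤ.* l ℤ.* g (a ℕ.+ b) ∎
    where open P.≡-Reasoning

  Top-sub : ∀ {a k l p q} → Top ω a k p → Top ω a l q → Top ω a (k ℤ.- l) (p ++ neg q)
  Top-sub {a} {k} {l} {p} {q} x y = top λ g h → P.trans (Pℤ.pair-++ p (neg q) _) (P.trans (cong₂ ℤ._+_ (leading x g h) (P.trans (Pℤ.pair-neg q _) (cong ℤ.-_ (leading y g h))))
    (P.trans (cong (λ z → k ℤ.* g a ℤ.+ z) (ℤₚ.neg-distribˡ-* l (g a))) (P.sym (ℤₚ.*-distribʳ-+ (g a) k (ℤ.- l)))))

  Top-alt : ∀ n {f : ℕ → Poly m} {κ : ℕ → ℤ} {a} → (∀ j → j < n → Top ω a (κ j) (f j)) → Top ω a (ℤDet.alt n κ) (alt n f)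
  Top-alt zero h = top λ g _ → P.refl
  Top-alt (suc n) h = Top-sub (h 0 (s≤s z≤n)) (Top-alt n (λ j l → h (suc j) (s≤s l)))

  Top-det : ∀ n {M : ℕ → ℕ → Poly m} {K : ℕ → ℕ → ℤ} {a : ℕ → ℕ} → (∀ i j → j < n → Top ω (a j) (K i j) (M i j)) → Top ω (sumℕ n a) (ℤDet.det n K) (det n M)
  Top-det zero h = top λ g _ → P.trans (ℤₚ.+-identityʳ _) (cong (λ z → 1ℤ ℤ.* g z) ω-0)
  Top-det (suc n) {M} {K} {a} h = Top-alt (suc n) λ { j (s≤s l) →
    subst (λ s → Top ω s (K 0 j ℤ.* ℤDet.det n (λ i k → K (suc i) (skip j k))) (M 0 j ⊗ det n (λ i k → M (suc i) (skip j k))))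
      (P.sym (sumℕ-skip n j a l)) (Top-⊗ (h 0 j (s≤s l)) (Top-det n (λ i k lk → h (suc i) (skip j k) (skip-bound j lk)))) }

module DetVan (A : ℤ-Algebra)
  (torsion-free : ∀ k z → ℤ-Algebra._≈_ A (ℤ-Algebra._*_ A (ℤ-Algebra.ι A (+ suc k)) z) (ℤ-Algebra.0# A) → ℤ-Algebra._≈_ A z (ℤ-Algebra.0# A))
  {m : ℕ} (xs ys : Vec (ℤ-Algebra.Carrier A) m) (w : Vec ℕ m) where
  open Index A torsion-free
  open Vanishing xs ys w
  open PolyDet m

  Van-alt : ∀ n {f : ℕ → Poly m} {d t} → (∀ j → j < n → Van d t (f j)) → Van d t (alt n f)
  Van-alt zero h = van λ _ _ → ℤ-Algebra.refl A
  Van-alt (suc n) h = Van-++ (h 0 (s≤s z≤n)) (Van-neg (Van-alt n (λ j l → h (suc j) (s≤s l))))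

  Van-det : ∀ n {M : ℕ → ℕ → Poly m} {d} {τ : ℕ → ℕ} → (∀ i j → Support (_⊑ᵛ d) (M i j)) → (∀ i j → Van d (τ j) (M i j)) → Van (n ⊙ d) (sumℕ n τ) (det n M)
  Van-det zero b h = van λ _ ()
  Van-det (suc n) {M} {d} {τ} b h = Van-alt (suc n) λ { j (s≤s l) →
    subst (λ s → Van (d ⊞ (n ⊙ d)) s (M 0 j ⊗ det n (λ i k → M (suc i) (skip j k)))) (P.sym (sumℕ-skip n j τ l))
      (Van-⊗ (b 0 j) (box-det n (λ i k → b (suc i) (skip j k))) (h 0 j) (Van-det n (λ i k → b (suc i) (skip j k)) (λ i k → h (suc i) (skip j k)))) }

χ : ∀ {m} → Exp m → Exp m → ℤ
χ I J = + binomᵛ J I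

binom-euler : ∀ j i → + j ℤ.* + binom j i ≡ + i ℤ.* + binom j i ℤ.+ + suc i ℤ.* + binom j (suc i)
binom-euler j i = P.trans (solve 3 (λ j i b → j :* b := i :* b :+ (j :- i) :* b) P.refl (+ j) (+ i) (+ binom j i))
  (cong (λ z → + i ℤ.* + binom j i ℤ.+ z) (P.sym (binom-step j i)))
  where open S

χ-euler : ∀ {m} (k : Fin m) I J → + lookup J k ℤ.* χ I J ≡ + lookup I k ℤ.* χ I J ℤ.+ + suc (lookup I k) ℤ.* χ (inc k I) J
χ-euler Fin.zero (i ∷ I) (j ∷ J) = begin
  + j ℤ.* + (binom j i ℕ.* binomᵛ J I) ≡⟨ cong (+ j ℤ.*_) (pos-* (binom j i) _) ⟩
  + j ℤ.* (B ℤ.* T) ≡⟨ P.sym (ℤₚ.*-assoc (+ j) B T) ⟩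
  + j ℤ.* B ℤ.* T ≡⟨ cong (ℤ._* T) (binom-euler j i) ⟩
  (+ i ℤ.* B ℤ.+ + suc i ℤ.* B′) ℤ.* T ≡⟨ solve 5 (λ i i′ B B′ T → (i :* B :+ i′ :* B′) :* T := i :* (B :* T) :+ i′ :* (B′ :* T)) P.refl (+ i) (+ suc i) B B′ T ⟩
  + i ℤ.* (B ℤ.* T) ℤ.+ + suc i ℤ.* (B′ ℤ.* T) ≡⟨ cong₂ (λ u v → + i ℤ.* u ℤ.+ + suc i ℤ.* v) (P.sym (pos-* (binom j i) _)) (P.sym (pos-* (binom j (suc i)) _)) ⟩
  _ ∎
  where
  open P.≡-Reasoning
  open S
  B = + binom j i
  B′ = + binom j (suc i)
  T = + binomᵛ J I
χ-euler (Fin.suc k) (i ∷ I) (j ∷ J) = begin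
  n ℤ.* + (binom j i ℕ.* binomᵛ J I) ≡⟨ cong (n ℤ.*_) (pos-* (binom j i) _) ⟩
  n ℤ.* (B ℤ.* χ I J) ≡⟨ solve 3 (λ n B T → n :* (B :* T) := B :* (n :* T)) P.refl n B (χ I J) ⟩
  B ℤ.* (n ℤ.* χ I J) ≡⟨ cong (B ℤ.*_) (χ-euler k I J) ⟩
  B ℤ.* (a ℤ.* χ I J ℤ.+ b ℤ.* χ (inc k I) J) ≡⟨ solve 5 (λ B a T b U → B :* (a :* T :+ b :* U) := a :* (B :* T) :+ b :* (B :* U)) P.refl B a (χ I J) b (χ (inc k I) J) ⟩
  a ℤ.* (B ℤ.* χ I J) ℤ.+ b ℤ.* (B ℤ.* χ (inc k I) J) ≡⟨ cong₂ (λ u v → a ℤ.* u ℤ.+ b ℤ.* v) (P.sym (pos-* (binom j i) _)) (P.sym (pos-* (binom j i) _)) ⟩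
  _ ∎
  where
  open P.≡-Reasoning
  open S
  n = + lookup J k
  B = + binom j i
  a = + lookup I k
  b = + suc (lookup I k)

sum-inc : ∀ {m} (k : Fin m) I → Vec.sum (inc k I) ≡ suc (Vec.sum I)
sum-inc Fin.zero (i ∷ I) = P.refl
sum-inc (Fin.suc k) (i ∷ I) = P.trans (cong (i ℕ.+_) (sum-inc k I)) (+-suc i _)

χ-0 : ∀ {m} (J : Exp m) → χ 0ᵛ J ≡ 1ℤ
χ-0 [] = P.refl
χ-0 (j ∷ J) = P.trans (cong +_ (ℕₚ.+-identityʳ _)) (χ-0 J)

sum-0ᵛ : ∀ m → Vec.sum (0ᵛ {m}) ≡ 0
sum-0ᵛ zero = P.refl
sum-0ᵛ (suc m) = sum-0ᵛ m

differ : ∀ {m} (I J : Exp m) → I ≢ J → ∃ λ k → lookup I k ≢ lookup J k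
differ [] [] h = ⊥-elim (h P.refl)
differ (i ∷ I) (j ∷ J) h with i ℕ.≟ j
... | no ne = Fin.zero , ne
... | yes P.refl = let k , ne = differ I J (λ e → h (cong (i ∷_) e)) in Fin.suc k , ne

separate : ∀ {m} n (D : Exp m) c rest → length rest ≡ n → Support (_≢ D) rest →
           (∀ I → Vec.sum I ≤ n → ⟪ (c , D) ∷ rest , χ I ⟫ ≡ 0ℤ) → c ≡ 0ℤ
separate {m} zero D c [] _ _ h = begin
  c ≡⟨ P.sym (ℤₚ.*-identityʳ c) ⟩
  c ℤ.* 1ℤ ≡⟨ cong (c ℤ.*_) (P.sym (χ-0 D)) ⟩
  c ℤ.* χ 0ᵛ D ≡⟨ P.sym (ℤₚ.+-identityʳ _) ⟩
  c ℤ.* χ 0ᵛ D ℤ.+ 0ℤ ≡⟨ h 0ᵛ (≤-reflexive (sum-0ᵛ m)) ⟩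
  0ℤ ∎
  where open P.≡-Reasoning
separate {m} (suc n) D c ((c₁ , D₁) ∷ rest) len (ne ∷ s) h = conclude (i*j≡0⇒i≡0∨j≡0 c smaller)
  where
  k = proj₁ (differ D₁ D ne)
  t = + lookup D₁ k
  u : Exp m → ℤ
  u J = + lookup J k ℤ.- t
  p = (c , D) ∷ (c₁ , D₁) ∷ rest
  kill : ∀ I → Vec.sum I ≤ n → ⟪ (c ℤ.* u D , D) ∷ scaleBy u rest , χ I ⟫ ≡ 0ℤ
  kill I l = begin
    c ℤ.* u D ℤ.* χ I D ℤ.+ ⟪ scaleBy u rest , χ I ⟫ ≡⟨ cong₂ ℤ._+_ (ℤₚ.*-assoc c (u D) (χ I D)) (Pℤ.pair-scaleBy rest u (χ I)) ⟩
    c ℤ.* (u D ℤ.* χ I D) ℤ.+ ⟪ rest , uχ ⟫ ≡⟨ cong (λ z → c ℤ.* (u D ℤ.* χ I D) ℤ.+ z) (P.sym (P.trans (cong (ℤ._+ ⟪ rest , uχ ⟫)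
        (P.trans (cong (λ z → c₁ ℤ.* (z ℤ.* χ I D₁)) (ℤₚ.+-inverseʳ t)) (ℤₚ.*-zeroʳ c₁))) (ℤₚ.+-identityˡ ⟪ rest , uχ ⟫))) ⟩
    ⟪ p , uχ ⟫ ≡⟨ Pℤ.pair-cong p (λ J → P.trans (solve 3 (λ j t x → (j :- t) :* x := j :* x :- t :* x) P.refl (+ lookup J k) t (χ I J))
        (P.trans (cong (ℤ._- t ℤ.* χ I J) (χ-euler k I J)) (solve 5 (λ i i′ t x y → i :* x :+ i′ :* y :- t :* x := (i :- t) :* x :+ i′ :* y) P.refl (+ lookup I k) (+ suc (lookup I k)) t (χ I J) (χ (inc k I) J)))) ⟩
    ⟪ p , (λ J → a ℤ.* χ I J ℤ.+ b ℤ.* χ (inc k I) J) ⟫ ≡⟨ P.trans (Pℤ.pair-+ p (λ J → a ℤ.* χ I J) (λ J → b ℤ.* χ (inc k I) J)) (cong₂ ℤ._+_ (Pℤ.pair-* p a (χ I)) (Pℤ.pair-* p b (χ (inc k I)))) ⟩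
    a ℤ.* ⟪ p , χ I ⟫ ℤ.+ b ℤ.* ⟪ p , χ (inc k I) ⟫ ≡⟨ cong₂ (λ x y → a ℤ.* x ℤ.+ b ℤ.* y) (h I (m≤n⇒m≤1+n l)) (h (inc k I) (≤-trans (≤-reflexive (sum-inc k I)) (s≤s l))) ⟩
    a ℤ.* 0ℤ ℤ.+ b ℤ.* 0ℤ ≡⟨ cong₂ ℤ._+_ (ℤₚ.*-zeroʳ a) (ℤₚ.*-zeroʳ b) ⟩
    0ℤ ∎
    where
    open P.≡-Reasoning
    open S
    uχ : Exp m → ℤ
    uχ J = u J ℤ.* χ I J
    a = + lookup I k ℤ.- t
    b = + suc (lookup I k)
  smaller : c ℤ.* u D ≡ 0ℤ
  smaller = separate n D (c ℤ.* u D) (scaleBy u rest) (P.trans (length-map _ rest) (ℕₚ.suc-injective len)) (Support-map (λ _ _ q → q) s) kill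
  conclude : c ≡ 0ℤ ⊎ u D ≡ 0ℤ → c ≡ 0ℤ
  conclude (inj₁ e) = e
  conclude (inj₂ e) = ⊥-elim (proj₂ (differ D₁ D ne) (P.sym (ℤₚ.+-injective (ℤₚ.i-j≡0⇒i≡j _ _ e))))

altMeas : ∀ {X : Set} → ℕ → (ℕ → ℤ) → (ℕ → X) → Meas X
altMeas zero c D = []
altMeas (suc n) c D = (c 0 , D 0) ∷ neg (altMeas n (λ i → c (suc i)) (λ i → D (suc i)))

pair-altMeas : ∀ {X : Set} n c (D : ℕ → X) g → ⟪ altMeas n c D , g ⟫ ≡ ℤDet.alt n (λ j → c j ℤ.* g (D j))
pair-altMeas zero c D g = P.refl
pair-altMeas (suc n) c D g = cong (λ z → c 0 ℤ.* g (D 0) ℤ.+ z) (P.trans (Pℤ.pair-neg (altMeas n _ _) g) (cong ℤ.-_ (pair-altMeas n _ _ g)))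

altMeas-length : ∀ {X : Set} n c (D : ℕ → X) → length (altMeas n c D) ≡ n
altMeas-length zero c D = P.refl
altMeas-length (suc n) c D = cong suc (P.trans (length-map _ (altMeas n _ _)) (altMeas-length n _ _))

altMeas-support : ∀ {X : Set} {Q : X → Set} n c (D : ℕ → X) → (∀ i → i < n → Q (D i)) → Support Q (altMeas n c D)
altMeas-support zero c D h = []
altMeas-support (suc n) c D h = h 0 (s≤s z≤n) ∷ Support-map (λ _ _ q → q) (altMeas-support n _ _ (λ i l → h (suc i) (s≤s l)))

interpolate : ∀ {m} l (D : ℕ → Exp m) (κ : ℕ → ℤ) → (∀ a b → a < b → b < l → D a ≢ D b) → (∀ a → a < l → κ a ≢ 0ℤ) →
  ¬ ¬ (∃ λ (I : ℕ → Exp m) → (∀ i → Vec.sum (I i) ≤ l ∸ suc i) × ℤDet.det l (λ i j → κ j ℤ.* χ (I i) (D j)) ≢ 0ℤ)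
interpolate {m} zero D κ _ _ k = k ((λ _ → 0ᵛ) , (λ i → ≤-trans (≤-reflexive (sum-0ᵛ m)) z≤n) , λ ())
interpolate {m} (suc l) D κ ne nz k = interpolate l (λ i → D (suc i)) (λ i → κ (suc i)) (λ a b x y → ne _ _ (s≤s x) (s≤s y)) (λ a x → nz _ (s≤s x)) next
  where
  next : (∃ λ (I : ℕ → Exp m) → (∀ i → Vec.sum (I i) ≤ l ∸ suc i) × ℤDet.det l (λ i j → κ (suc j) ℤ.* χ (I i) (D (suc j))) ≢ 0ℤ) → ⊥
  next (I , b , nd) = conclude (i*j≡0⇒i≡0∨j≡0 (κ 0) (separate l (D 0) (κ 0 ℤ.* minor 0) (neg rest) (P.trans (length-map _ rest) (altMeas-length l _ _))
      (Support-map (λ _ _ q → q) (altMeas-support l _ (λ i → D (suc i)) (λ i x e → ne 0 (suc i) (s≤s z≤n) (s≤s x) (P.sym e)))) kill))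
    where
    minor : ℕ → ℤ
    minor j = ℤDet.det l (λ i a → κ (skip j a) ℤ.* χ (I i) (D (skip j a)))
    rest = altMeas l (λ i → κ (suc i) ℤ.* minor (suc i)) (λ i → D (suc i))
    kill : ∀ I₀ → Vec.sum I₀ ≤ l → ⟪ altMeas (suc l) (λ j → κ j ℤ.* minor j) D , χ I₀ ⟫ ≡ 0ℤ
    kill I₀ x with ℤDet.det (suc l) (λ i j → κ j ℤ.* χ ((I₀ ▹ I) i) (D j)) ℤ.≟ 0ℤ
    ... | no nd′ = ⊥-elim (k ((I₀ ▹ I) , (λ { zero → x ; (suc i) → b i }) , nd′))
    ... | yes e = P.trans (pair-altMeas (suc l) (λ j → κ j ℤ.* minor j) D (χ I₀)) (P.trans (ℤDet.alt-cong (suc l) {λ j → κ j ℤ.* minor j ℤ.* χ I₀ (D j)} {λ j → κ j ℤ.* χ I₀ (D j) ℤ.* minor j}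
        (λ j _ → S.solve 3 (λ a b c → a S.:* b S.:* c S.:= a S.:* c S.:* b) P.refl (κ j) (minor j) (χ I₀ (D j)))) e)
    conclude : κ 0 ≡ 0ℤ ⊎ minor 0 ≡ 0ℤ → ⊥
    conclude (inj₁ e) = nz 0 (s≤s z≤n) e
    conclude (inj₂ e) = nd e

-- Mixed radix encoding of the box of exponents bounded by d.
enc : ∀ {m} → Exp m → Exp m → ℕ
enc [] [] = 0
enc (d ∷ ds) (j ∷ J) = j ℕ.+ suc d ℕ.* enc ds J

dec : ∀ {m} → Exp m → ℕ → Exp m
dec [] n = []
dec (d ∷ ds) n = n % suc d ∷ dec ds (n / suc d)

dec-⊑ : ∀ {m} (d : Exp m) n → dec d n ⊑ᵛ d
dec-⊑ [] n = []
dec-⊑ (d ∷ ds) n = ≤-pred (DM.m%n<n n (suc d)) ∷ dec-⊑ ds _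

dec-digit : ∀ {m} d (ds : Exp m) j n → j ≤ d → dec (d ∷ ds) (j ℕ.+ suc d ℕ.* n) ≡ j ∷ dec ds n
dec-digit d ds j n l = cong₂ _∷_
  (P.trans (cong (λ k → (j ℕ.+ k) % suc d) (ℕₚ.*-comm (suc d) n)) (P.trans (DM.[m+kn]%n≡m%n j n (suc d)) (DM.m<n⇒m%n≡m (s≤s l))))
  (cong (dec ds) (P.trans (cong (λ k → (j ℕ.+ k) / suc d) (ℕₚ.*-comm (suc d) n)) (P.trans (DM.+-distrib-/-∣ʳ j (divides n P.refl))
    (P.trans (cong₂ ℕ._+_ (DM.m<n⇒m/n≡0 (s≤s l)) (DM.m*n/n≡m n (suc d))) P.refl))))

dec-enc : ∀ {m} {d J : Exp m} → J ⊑ᵛ d → dec d (enc d J) ≡ J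
dec-enc [] = P.refl
dec-enc {d = d ∷ ds} {j ∷ J} (l ∷ ls) = P.trans (dec-digit d ds j (enc ds J) l) (cong (j ∷_) (dec-enc ls))

enc-mono : ∀ {m} {d J : Exp m} → J ⊑ᵛ d → enc d J ≤ enc d d
enc-mono [] = z≤n
enc-mono {d = d ∷ ds} (l ∷ ls) = +-mono-≤ l (*-monoʳ-≤ (suc d) (enc-mono ls))

enc-⊞ : ∀ {m} (d I J : Exp m) → enc d (I ⊞ J) ≡ enc d I ℕ.+ enc d J
enc-⊞ [] [] [] = P.refl
enc-⊞ (d ∷ ds) (i ∷ I) (j ∷ J) = P.trans (cong (λ k → i ℕ.+ j ℕ.+ suc d ℕ.* k) (enc-⊞ ds I J))
  (solve 5 (λ i j d a b → i :+ j :+ d :* (a :+ b) := i :+ d :* a :+ (j :+ d :* b)) P.refl i j (suc d) (enc ds I) (enc ds J))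
  where open +-*-Solver

enc-0 : ∀ {m} (d : Exp m) → enc d 0ᵛ ≡ 0
enc-0 [] = P.refl
enc-0 (d ∷ ds) = P.trans (cong (suc d ℕ.*_) (enc-0 ds)) (ℕₚ.*-zeroʳ (suc d))

δ : ℕ → ℕ → ℤ
δ a b with a ℕ.≟ b
... | yes _ = 1ℤ
... | no _ = 0ℤ

δ-≡ : ∀ {a b} → a ≡ b → δ a b ≡ 1ℤ
δ-≡ {a} {b} e with a ℕ.≟ b
... | yes _ = P.refl
... | no ne = ⊥-elim (ne e)

δ-≢ : ∀ {a b} → a ≢ b → δ a b ≡ 0ℤ
δ-≢ {a} {b} ne with a ℕ.≟ b
... | yes e = ⊥-elim (ne e)
... | no _ = P.refl

δ-≤1 : ∀ a b → ∣ δ a b ∣ ≤ 1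
δ-≤1 a b with a ℕ.≟ b
... | yes _ = s≤s z≤n
... | no _ = z≤n

δ-sift : ∀ {a b} {u v : ℤ} → (a ≡ b → u ≡ v) → δ a b ℤ.* u ≡ δ a b ℤ.* v
δ-sift {a} {b} h with a ℕ.≟ b
... | yes e = cong (1ℤ ℤ.*_) (h e)
... | no _ = P.refl

module _ {m : ℕ} (d : ℕ) (ds : Exp m) where
  private
    X = Exp (suc m)
    Box : X → Set
    Box = _⊑ᵛ (d ∷ ds)
    N : ℕ → ℕ → ℕ
    N e r = e ℕ.+ suc d ℕ.* r

  pivot-row : X → ℕ
  pivot-row x = enc ds (Vec.tail x)

  -- Coefficients of exponents with code at least n vanish.
  Below : ℕ → Meas X → Set
  Below n p = ∀ g → (∀ x → Box x → enc (d ∷ ds) x < n → g x ≡ 0ℤ) → ⟪ p , g ⟫ ≡ 0ℤ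

  DeadCol DeadRow : ℕ → Meas X → Set
  DeadCol e p = ∀ (g : X → ℤ) → ⟪ p , (λ x → δ (Vec.head x) e ℤ.* g x) ⟫ ≡ 0ℤ
  DeadRow r p = ∀ (g : X → ℤ) → ⟪ p , (λ x → δ (pivot-row x) r ℤ.* g x) ⟫ ≡ 0ℤ

  coefAt : ℕ → Meas X → ℤ
  coefAt n p = ⟪ p , (λ x → δ (enc (d ∷ ds) x) n) ⟫

  leading-coef : ∀ {n p} → Support Box p → Below (suc n) p → ∀ g → (∀ x → Box x → enc (d ∷ ds) x < n → g x ≡ 0ℤ) →
                 ⟪ p , g ⟫ ≡ coefAt n p ℤ.* g (dec (d ∷ ds) n)
  leading-coef {n} {p} s b g h = begin
    ⟪ p , g ⟫ ≡⟨ Pℤ.pair-cong p (λ x → S.solve 2 (λ g c → g S.:= c S.:+ (g S.:- c)) P.refl (g x) (δ (enc D x) n ℤ.* g x)) ⟩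
    ⟪ p , (λ x → δ (enc D x) n ℤ.* g x ℤ.+ (g x ℤ.- δ (enc D x) n ℤ.* g x)) ⟫ ≡⟨ Pℤ.pair-+ p _ _ ⟩
    ⟪ p , (λ x → δ (enc D x) n ℤ.* g x) ⟫ ℤ.+ ⟪ p , (λ x → g x ℤ.- δ (enc D x) n ℤ.* g x) ⟫ ≡⟨ cong₂ ℤ._+_
        (Pℤ.pair-congOn (λ x q → δ-sift {enc D x} {n} {g x} {g (dec D n)} (λ e → cong g (P.trans (P.sym (dec-enc q)) (cong (dec D) e)))) s) (b _ high) ⟩
    ⟪ p , (λ x → δ (enc D x) n ℤ.* g (dec D n)) ⟫ ℤ.+ 0ℤ ≡⟨ P.trans (ℤₚ.+-identityʳ _) (Pℤ.pair-*ʳ p (g (dec D n)) (λ x → δ (enc D x) n)) ⟩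
    coefAt n p ℤ.* g (dec D n) ∎
    where
    open P.≡-Reasoning
    D = d ∷ ds
    high : ∀ x → Box x → enc D x < suc n → g x ℤ.- δ (enc D x) n ℤ.* g x ≡ 0ℤ
    high x q l with m≤n⇒m<n∨m≡n (≤-pred l)
    ... | inj₁ l′ = P.trans (cong₂ (λ u v → u ℤ.- v) (h x q l′) (P.trans (cong (δ (enc D x) n ℤ.*_) (h x q l′)) (ℤₚ.*-zeroʳ (δ (enc D x) n)))) P.refl
    ... | inj₂ e = P.trans (cong (λ u → g x ℤ.- u) (P.trans (cong (ℤ._* g x) (δ-≡ e)) (ℤₚ.*-identityˡ (g x)))) (ℤₚ.+-inverseʳ (g x))

  record Decomposition (p : Meas X) : Set where
    field
      rank : ℕ
      scalar : ℤ
      scalar≢0 : scalar ≢ 0ℤ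
      left : ℕ → Meas (Exp m)
      right : ℕ → Meas ℕ
      expansion : ∀ g → scalar ℤ.* ⟪ p , g ⟫ ≡ 𝕊.sum rank (λ a → ⟪ left a , (λ J → ⟪ right a , (λ j → g (j ∷ J)) ⟫) ⟫)
      D : ℕ → Exp m
      e : ℕ → ℕ
      κ κ′ : ℕ → ℤ
      κ≢0 : ∀ a → a < rank → κ a ≢ 0ℤ
      κ′≢0 : ∀ a → a < rank → κ′ a ≢ 0ℤ
      left-lead : ∀ a → a < rank → Lead (_⊑ᵛ ds) (enc ds) (D a) (κ a) (left a)
      right-lead : ∀ a → a < rank → Lead (_≤ d) (λ j → j) (e a) (κ′ a) (right a)
      e≤d : ∀ a → a < rank → e a ≤ d
      e-fresh : ∀ a → a < rank → ¬ DeadCol (e a) p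
      D-fresh : ∀ a → a < rank → ¬ DeadRow (enc ds (D a)) p
      e-distinct : ∀ a b → a < b → b < rank → e a ≢ e b
      D-distinct : ∀ a b → a < b → b < rank → D a ≢ D b

  module Step (n : ℕ) (p : Meas X) (s : Support Box p) (b : Below (suc n) p) (ρ≢0 : coefAt n p ≢ 0ℤ) where
    private
      ρ = coefAt n p
      e₀ = n % suc d
      D₀ = dec ds (n / suc d)
      r₀ = enc ds D₀
      e₀≤d : e₀ ≤ d
      e₀≤d = ≤-pred (DM.m%n<n n (suc d))

    code : N e₀ r₀ ≡ n
    code with N e₀ r₀ ℕ.≟ n
    ... | yes q = q
    ... | no ne = ⊥-elim (ρ≢0 (Pℤ.pair-0On {Q = Box} (λ x q → δ-≢ (λ c → ne (P.trans (P.sym (cong (enc (d ∷ ds)) (P.trans (P.sym (dec-enc q)) (cong (dec (d ∷ ds)) c)))) c))) s))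

    φ : Meas (Exp m)
    φ = pushforward Vec.tail (scaleBy (λ x → δ (Vec.head x) e₀) p)
    ψ : Meas ℕ
    ψ = pushforward Vec.head (scaleBy (λ x → δ (pivot-row x) r₀) p)

    pair-φ : ∀ g → ⟪ φ , g ⟫ ≡ ⟪ p , (λ x → δ (Vec.head x) e₀ ℤ.* g (Vec.tail x)) ⟫
    pair-φ g = P.trans (Pℤ.pair-push (scaleBy _ p) Vec.tail g) (Pℤ.pair-scaleBy p _ _)
    pair-ψ : ∀ g → ⟪ ψ , g ⟫ ≡ ⟪ p , (λ x → δ (pivot-row x) r₀ ℤ.* g (Vec.head x)) ⟫
    pair-ψ g = P.trans (Pℤ.pair-push (scaleBy _ p) Vec.head g) (Pℤ.pair-scaleBy p _ _)

    φ-box : Support (_⊑ᵛ ds) φ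
    φ-box = Support-map (λ { _ (_ ∷ _) (_ ∷ ls) → ls }) (Support-map (λ _ _ q → q) s)
    ψ-box : Support (_≤ d) ψ
    ψ-box = Support-map (λ { _ (_ ∷ _) (l ∷ _) → l }) (Support-map (λ _ _ q → q) s)

    small-row : ∀ {j J r} → j ≤ d → enc ds J < r → enc (d ∷ ds) (j ∷ J) < suc d ℕ.* r
    small-row {j} {J} {r} l q = ≤-trans (+-monoˡ-≤ (suc d ℕ.* enc ds J) (s≤s l)) (≤-trans (≤-reflexive (P.sym (*-suc (suc d) _))) (*-monoʳ-≤ (suc d) q))

    φ-lead : Lead (_⊑ᵛ ds) (enc ds) D₀ ρ φ
    φ-lead g h = P.trans (pair-φ g) (P.trans (leading-coef s b _ low) (cong (ρ ℤ.*_) (P.trans (cong (ℤ._* g D₀) (δ-≡ {n % suc d} P.refl)) (ℤₚ.*-identityˡ _))))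
      where
      low : ∀ x → Box x → enc (d ∷ ds) x < n → δ (Vec.head x) e₀ ℤ.* g (Vec.tail x) ≡ 0ℤ
      low (j ∷ J) (lj ∷ lJ) l with j ℕ.≟ e₀
      ... | no _ = P.refl
      ... | yes P.refl with enc ds J <? r₀
      ...   | yes l′ = P.trans (ℤₚ.*-identityˡ _) (h J lJ l′)
      ...   | no ge = ⊥-elim (<⇒≱ l (≤-trans (≤-reflexive (P.sym code)) (+-monoʳ-≤ e₀ (*-monoʳ-≤ (suc d) (≮⇒≥ ge)))))

    ψ-lead : Lead (_≤ d) (λ j → j) e₀ ρ ψ
    ψ-lead g h = P.trans (pair-ψ g) (P.trans (leading-coef s b _ low) (cong (ρ ℤ.*_) (P.trans (cong (ℤ._* g e₀) (δ-≡ {r₀} P.refl)) (ℤₚ.*-identityˡ _))))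
      where
      low : ∀ x → Box x → enc (d ∷ ds) x < n → δ (pivot-row x) r₀ ℤ.* g (Vec.head x) ≡ 0ℤ
      low (j ∷ J) (lj ∷ lJ) l with enc ds J ℕ.≟ r₀
      ... | no _ = P.refl
      ... | yes er with j <? e₀
      ...   | yes l′ = P.trans (ℤₚ.*-identityˡ _) (h j lj l′)
      ...   | no ge = ⊥-elim (<⇒≱ l (≤-trans (≤-reflexive (P.sym code)) (+-mono-≤ (≮⇒≥ ge) (≤-reflexive (cong (suc d ℕ.*_) (P.sym er))))))

    pivot : ⟪ p , (λ x → δ (Vec.head x) e₀ ℤ.* δ (pivot-row x) r₀) ⟫ ≡ ρ
    pivot = P.trans (P.sym (pair-φ (λ J → δ (enc ds J) r₀)))
      (P.trans (φ-lead _ (λ J _ l → δ-≢ (<⇒≢ l))) (P.trans (cong (ρ ℤ.*_) (δ-≡ {r₀} P.refl)) (ℤₚ.*-identityʳ ρ)))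

    φψ : Meas X
    φψ = convolve (λ J j → j ∷ J) φ ψ
    pair-φψ : ∀ g → ⟪ φψ , g ⟫ ≡ ⟪ φ , (λ J → ⟪ ψ , (λ j → g (j ∷ J)) ⟫) ⟫
    pair-φψ g = Pℤ.pair-convolve _ φ ψ g

    p′ : Meas X
    p′ = scaleBy (λ _ → ρ) p ++ neg φψ

    pair-p′ : ∀ g → ⟪ p′ , g ⟫ ≡ ρ ℤ.* ⟪ p , g ⟫ ℤ.- ⟪ φ , (λ J → ⟪ ψ , (λ j → g (j ∷ J)) ⟫) ⟫
    pair-p′ g = P.trans (Pℤ.pair-++ (scaleBy _ p) (neg φψ) g)
      (cong₂ ℤ._+_ (P.trans (Pℤ.pair-scaleBy p _ g) (Pℤ.pair-* p ρ g)) (P.trans (Pℤ.pair-neg φψ g) (cong ℤ.-_ (pair-φψ g))))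

    p′-box : Support Box p′
    p′-box = Support-++ (Support-map (λ _ _ q → q) s) (Support-map (λ _ _ q → q) (Support-convolve (λ _ _ ls l → l ∷ ls) φ-box ψ-box))

    cancel : ∀ {g} → ⟪ φ , (λ J → ⟪ ψ , (λ j → g (j ∷ J)) ⟫) ⟫ ≡ ρ ℤ.* ⟪ p , g ⟫ → ⟪ p′ , g ⟫ ≡ 0ℤ
    cancel {g} q = P.trans (pair-p′ g) (P.trans (cong (λ z → ρ ℤ.* ⟪ p , g ⟫ ℤ.- z) q) (ℤₚ.+-inverseʳ (ρ ℤ.* ⟪ p , g ⟫)))

    p′-below : Below n p′
    p′-below g h = cancel {g} (P.trans (φ-lead (λ J → ⟪ ψ , (λ j → g (j ∷ J)) ⟫) lowφ)
        (cong (ρ ℤ.*_) (P.trans (ψ-lead (λ j → g (j ∷ D₀)) lowψ) (P.sym (leading-coef s b g h)))))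
      where
      lowψ : ∀ j → j ≤ d → j < e₀ → g (j ∷ D₀) ≡ 0ℤ
      lowψ j l′ l = h _ (l′ ∷ dec-⊑ ds _) (<-≤-trans (+-monoˡ-< (suc d ℕ.* r₀) l) (≤-reflexive code))
      lowφ : ∀ J → J ⊑ᵛ ds → enc ds J < r₀ → ⟪ ψ , (λ j → g (j ∷ J)) ⟫ ≡ 0ℤ
      lowφ J lJ l = Pℤ.pair-0On {Q = _≤ d} (λ j q → h _ (q ∷ lJ) (<-≤-trans (small-row q l) (≤-trans (m≤n+m _ e₀) (≤-reflexive code)))) ψ-box

    col-dead : DeadCol e₀ p′
    col-dead g = cancel {λ x → δ (Vec.head x) e₀ ℤ.* g x} (begin
      ⟪ φ , (λ J → ⟪ ψ , (λ j → δ j e₀ ℤ.* g (j ∷ J)) ⟫) ⟫ ≡⟨ Pℤ.pair-cong φ (λ J → Pℤ.pair-cong ψ (λ j → δ-sift {j} {e₀} {g (j ∷ J)} {g (e₀ ∷ J)} (λ q → cong (λ i → g (i ∷ J)) q))) ⟩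
      ⟪ φ , (λ J → ⟪ ψ , (λ j → δ j e₀ ℤ.* g (e₀ ∷ J)) ⟫) ⟫ ≡⟨ Pℤ.pair-cong φ (λ J → P.trans (Pℤ.pair-*ʳ ψ (g (e₀ ∷ J)) (λ j → δ j e₀)) (cong (ℤ._* g (e₀ ∷ J)) ψ-col)) ⟩
      ⟪ φ , (λ J → ρ ℤ.* g (e₀ ∷ J)) ⟫ ≡⟨ Pℤ.pair-* φ ρ (λ J → g (e₀ ∷ J)) ⟩
      ρ ℤ.* ⟪ φ , (λ J → g (e₀ ∷ J)) ⟫ ≡⟨ cong (ρ ℤ.*_) (pair-φ (λ J → g (e₀ ∷ J))) ⟩
      ρ ℤ.* ⟪ p , (λ x → δ (Vec.head x) e₀ ℤ.* g (e₀ ∷ Vec.tail x)) ⟫ ≡⟨ cong (ρ ℤ.*_) (Pℤ.pair-cong p (λ { (j ∷ J) → δ-sift {j} {e₀} {g (e₀ ∷ J)} {g (j ∷ J)} (λ q → cong (λ i → g (i ∷ J)) (P.sym q)) })) ⟩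
      ρ ℤ.* ⟪ p , (λ x → δ (Vec.head x) e₀ ℤ.* g x) ⟫ ∎)
      where
      open P.≡-Reasoning
      ψ-col : ⟪ ψ , (λ j → δ j e₀) ⟫ ≡ ρ
      ψ-col = P.trans (ψ-lead (λ j → δ j e₀) (λ j _ l → δ-≢ (<⇒≢ l))) (P.trans (cong (ρ ℤ.*_) (δ-≡ {e₀} P.refl)) (ℤₚ.*-identityʳ ρ))

    row-of : ∀ {J} → J ⊑ᵛ ds → enc ds J ≡ r₀ → J ≡ D₀
    row-of l q = P.trans (P.sym (dec-enc l)) (P.trans (cong (dec ds) q) (dec-enc (dec-⊑ ds (n / suc d))))

    row-dead : DeadRow r₀ p′
    row-dead g = cancel {λ x → δ (pivot-row x) r₀ ℤ.* g x} (begin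
      ⟪ φ , (λ J → ⟪ ψ , (λ j → δ (enc ds J) r₀ ℤ.* g (j ∷ J)) ⟫) ⟫ ≡⟨ Pℤ.pair-cong φ (λ J → Pℤ.pair-* ψ (δ (enc ds J) r₀) (λ j → g (j ∷ J))) ⟩
      ⟪ φ , (λ J → δ (enc ds J) r₀ ℤ.* ⟪ ψ , (λ j → g (j ∷ J)) ⟫) ⟫ ≡⟨ φ-lead _ (λ J _ l → cong (ℤ._* ⟪ ψ , (λ j → g (j ∷ J)) ⟫) (δ-≢ (<⇒≢ l))) ⟩
      ρ ℤ.* (δ r₀ r₀ ℤ.* ⟪ ψ , (λ j → g (j ∷ D₀)) ⟫) ≡⟨ cong (ρ ℤ.*_) (P.trans (cong (ℤ._* ⟪ ψ , (λ j → g (j ∷ D₀)) ⟫) (δ-≡ {r₀} P.refl)) (ℤₚ.*-identityˡ _)) ⟩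
      ρ ℤ.* ⟪ ψ , (λ j → g (j ∷ D₀)) ⟫ ≡⟨ cong (ρ ℤ.*_) (pair-ψ (λ j → g (j ∷ D₀))) ⟩
      ρ ℤ.* ⟪ p , (λ x → δ (pivot-row x) r₀ ℤ.* g (Vec.head x ∷ D₀)) ⟫ ≡⟨ cong (ρ ℤ.*_) (Pℤ.pair-congOn (λ { (j ∷ J) (_ ∷ l) → δ-sift {enc ds J} {r₀} {g (j ∷ D₀)} {g (j ∷ J)} (λ q → cong (λ K → g (j ∷ K)) (P.sym (row-of l q))) }) s) ⟩
      ρ ℤ.* ⟪ p , (λ x → δ (pivot-row x) r₀ ℤ.* g x) ⟫ ∎)
      where open P.≡-Reasoning

    x*yz : ∀ x y z → x ℤ.* (y ℤ.* z) ≡ y ℤ.* (x ℤ.* z)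
    x*yz = S.solve 3 (λ x y z → x S.:* (y S.:* z) S.:= y S.:* (x S.:* z)) P.refl

    col-dead-old : ∀ {e} → DeadCol e p → DeadCol e p′
    col-dead-old {e} dd g = cancel {λ x → δ (Vec.head x) e ℤ.* g x} (P.trans (P.trans (Pℤ.pair-cong φ (λ J → P.trans (pair-ψ (λ j → δ j e ℤ.* g (j ∷ J)))
        (P.trans (Pℤ.pair-cong p (λ x → x*yz (δ (pivot-row x) r₀) (δ (Vec.head x) e) (g (Vec.head x ∷ J)))) (dd (λ x → δ (pivot-row x) r₀ ℤ.* g (Vec.head x ∷ J)))))) (Pℤ.pair-0 φ))
      (P.sym (P.trans (cong (ρ ℤ.*_) (dd g)) (ℤₚ.*-zeroʳ ρ))))

    row-dead-old : ∀ {r} → DeadRow r p → DeadRow r p′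
    row-dead-old {r} dd g = cancel {λ x → δ (pivot-row x) r ℤ.* g x} (P.trans (P.trans (Pℤ.pair-cong φ (λ J → Pℤ.pair-* ψ (δ (enc ds J) r) (λ j → g (j ∷ J))))
        (P.trans (pair-φ (λ J → δ (enc ds J) r ℤ.* ⟪ ψ , (λ j → g (j ∷ J)) ⟫)) (P.trans (Pℤ.pair-cong p (λ x → x*yz (δ (Vec.head x) e₀) (δ (pivot-row x) r) ⟪ ψ , (λ j → g (j ∷ Vec.tail x)) ⟫))
          (dd (λ x → δ (Vec.head x) e₀ ℤ.* ⟪ ψ , (λ j → g (j ∷ Vec.tail x)) ⟫)))))
      (P.sym (P.trans (cong (ρ ℤ.*_) (dd g)) (ℤₚ.*-zeroʳ ρ))))

    col-fresh : ¬ DeadCol e₀ p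
    col-fresh dd = ρ≢0 (P.trans (P.sym pivot) (dd (λ x → δ (pivot-row x) r₀)))
    row-fresh : ¬ DeadRow r₀ p
    row-fresh dd = ρ≢0 (P.trans (P.sym pivot) (P.trans (Pℤ.pair-cong p (λ x → ℤₚ.*-comm (δ (Vec.head x) e₀) (δ (pivot-row x) r₀))) (dd (λ x → δ (Vec.head x) e₀))))

    extend : Decomposition p′ → Decomposition p
    extend r = record
      { rank = suc rank ; scalar = scalar ℤ.* ρ ; scalar≢0 = *-≢0 scalar≢0 ρ≢0
      ; left = scaleBy (λ _ → scalar) φ ▹ left ; right = ψ ▹ right
      ; expansion = λ g → begin
          scalar ℤ.* ρ ℤ.* ⟪ p , g ⟫ ≡⟨ S.solve 4 (λ c ρ p f → c S.:* ρ S.:* p S.:= c S.:* f S.:+ c S.:* (ρ S.:* p S.:- f)) P.refl scalar ρ ⟪ p , g ⟫ (F g) ⟩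
          scalar ℤ.* F g ℤ.+ scalar ℤ.* (ρ ℤ.* ⟪ p , g ⟫ ℤ.- F g) ≡⟨ cong₂ ℤ._+_ (P.sym (scaled (λ J → ⟪ ψ , (λ j → g (j ∷ J)) ⟫))) (P.trans (cong (scalar ℤ.*_) (P.sym (pair-p′ g))) (expansion g)) ⟩
          _ ∎
      ; D = D₀ ▹ D ; e = e₀ ▹ e ; κ = (scalar ℤ.* ρ) ▹ κ ; κ′ = ρ ▹ κ′
      ; κ≢0 = λ { zero _ → *-≢0 scalar≢0 ρ≢0 ; (suc a) (s≤s l) → κ≢0 a l }
      ; κ′≢0 = λ { zero _ → ρ≢0 ; (suc a) (s≤s l) → κ′≢0 a l }
      ; left-lead = λ { zero _ g h → P.trans (scaled g) (P.trans (cong (scalar ℤ.*_) (φ-lead g h)) (P.sym (ℤₚ.*-assoc scalar ρ _))) ; (suc a) (s≤s l) → left-lead a l }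
      ; right-lead = λ { zero _ → ψ-lead ; (suc a) (s≤s l) → right-lead a l }
      ; e≤d = λ { zero _ → e₀≤d ; (suc a) (s≤s l) → e≤d a l }
      ; e-fresh = λ { zero _ → col-fresh ; (suc a) (s≤s l) dd → e-fresh a l (col-dead-old dd) }
      ; D-fresh = λ { zero _ → row-fresh ; (suc a) (s≤s l) dd → D-fresh a l (row-dead-old dd) }
      ; e-distinct = λ { zero (suc b) _ (s≤s l) q → e-fresh b l (subst (λ i → DeadCol i p′) q col-dead) ; (suc a) (suc b) (s≤s x) (s≤s l) → e-distinct a b x l }
      ; D-distinct = λ { zero (suc b) _ (s≤s l) q → D-fresh b l (subst (λ i → DeadRow (enc ds i) p′) q row-dead) ; (suc a) (suc b) (s≤s x) (s≤s l) → D-distinct a b x l } }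
      where
      open Decomposition r
      open P.≡-Reasoning
      F : (X → ℤ) → ℤ
      F g = ⟪ φ , (λ J → ⟪ ψ , (λ j → g (j ∷ J)) ⟫) ⟫
      scaled : ∀ g → ⟪ scaleBy (λ _ → scalar) φ , g ⟫ ≡ scalar ℤ.* ⟪ φ , g ⟫
      scaled g = P.trans (Pℤ.pair-scaleBy φ _ g) (Pℤ.pair-* φ scalar g)
      *-≢0 : ∀ {x y} → x ≢ 0ℤ → y ≢ 0ℤ → x ℤ.* y ≢ 0ℤ
      *-≢0 {x} a b q with i*j≡0⇒i≡0∨j≡0 x q
      ... | inj₁ z = a z
      ... | inj₂ z = b z

  decompose-below : ∀ n p → Support Box p → Below n p → Decomposition p
  decompose-below zero p s b = record
    { rank = 0 ; scalar = 1ℤ ; scalar≢0 = λ () ; left = λ _ → [] ; right = λ _ → []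
    ; expansion = λ g → P.trans (ℤₚ.*-identityˡ _) (b g (λ _ _ ()))
    ; D = λ _ → 0ᵛ ; e = λ _ → 0 ; κ = λ _ → 1ℤ ; κ′ = λ _ → 1ℤ
    ; κ≢0 = λ _ () ; κ′≢0 = λ _ () ; left-lead = λ _ () ; right-lead = λ _ () ; e≤d = λ _ () ; e-fresh = λ _ () ; D-fresh = λ _ ()
    ; e-distinct = λ _ _ _ () ; D-distinct = λ _ _ _ () }
  decompose-below (suc n) p s b with coefAt n p ℤ.≟ 0ℤ
  ... | yes z = decompose-below n p s (λ g h → P.trans (leading-coef s b g h) (cong (ℤ._* g (dec (d ∷ ds) n)) z))
  ... | no nz = extend (decompose-below n p′ p′-box p′-below)
    where open Step n p s b nz

  decompose : ∀ p → Support Box p → Decomposition p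
  decompose p s = decompose-below (suc (enc (d ∷ ds) (d ∷ ds))) p s (λ g h → Pℤ.pair-0On {Q = Box} (λ x q → h x q (s≤s (enc-mono q))) s)

binom-≤ : ∀ j a → binom j a ≤ 2 ^ j
binom-≤ j zero = m^n>0 2 j
binom-≤ zero (suc a) = z≤n
binom-≤ (suc j) (suc a) = ≤-trans (+-mono-≤ (binom-≤ j a) (binom-≤ j (suc a))) (≤-reflexive (cong (2 ^ j ℕ.+_) (P.sym (ℕₚ.+-identityʳ _))))

binomᵛ-≤ : ∀ {m} {d : Exp m} J A → J ⊑ᵛ d → binomᵛ J A ≤ 2 ^ Vec.sum d
binomᵛ-≤ [] [] [] = ≤-refl
binomᵛ-≤ {d = d ∷ ds} (j ∷ J) (a ∷ A) (l ∷ ls) = ≤-trans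
  (*-mono-≤ (≤-trans (binom-≤ j a) (^-monoʳ-≤ 2 l)) (binomᵛ-≤ J A ls)) (≤-reflexive (P.sym (^-distribˡ-+-* 2 d (Vec.sum ds))))

n≤2^n : ∀ n → n ≤ 2 ^ n
n≤2^n zero = z≤n
n≤2^n (suc n) = ≤-trans (+-mono-≤ (m^n>0 2 n) (n≤2^n n)) (≤-reflexive (cong (2 ^ n ℕ.+_) (P.sym (ℕₚ.+-identityʳ _))))

⊙-∷ : ∀ {m} n d (ds : Exp m) → n ⊙ (d ∷ ds) ≡ n ℕ.* d ∷ n ⊙ ds
⊙-∷ zero d ds = P.refl
⊙-∷ (suc n) d ds = cong ((d ∷ ds) ⊞_) (⊙-∷ n d ds)

sum-⊙ : ∀ {m} n (d : Exp m) → Vec.sum (n ⊙ d) ≡ n ℕ.* Vec.sum d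
sum-⊙ n [] = P.trans (cong Vec.sum (nil n)) (P.sym (ℕₚ.*-zeroʳ n))
  where
  nil : ∀ n → n ⊙ [] ≡ []
  nil zero = P.refl
  nil (suc n) = cong ([] ⊞_) (nil n)
sum-⊙ n (d ∷ ds) = P.trans (cong Vec.sum (⊙-∷ n d ds)) (P.trans (cong (n ℕ.* d ℕ.+_) (sum-⊙ n ds)) (P.sym (ℕₚ.*-distribˡ-+ n d _)))

data Weights (L : ℕ) : ∀ {m} → Vec ℕ m → Exp m → Set where
  [] : Weights L [] []
  _∷_ : ∀ {m w d} {ws : Vec ℕ m} {ds} → w ℕ.* d ≡ L → Weights L ws ds → Weights L (w ∷ ws) (d ∷ ds)

Chain : ℕ → ∀ {m} → Exp m → Set
Chain E [] = ⊤
Chain E (d ∷ []) = ⊤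
Chain E (d ∷ d′ ∷ ds) = E ℕ.* d ≤ d′ × Chain E (d′ ∷ ds)

Weights-⊙ : ∀ {m L} n {w : Vec ℕ m} {d} → Weights L w d → Weights (n ℕ.* L) w (n ⊙ d)
Weights-⊙ {L = L} n {[]} {[]} [] = subst (Weights (n ℕ.* L) []) (nil (n ⊙ [])) []
  where
  nil : (v : Exp 0) → [] ≡ v
  nil [] = P.refl
Weights-⊙ n {w ∷ ws} {d ∷ ds} (e ∷ es) = subst (Weights _ (w ∷ ws)) (P.sym (⊙-∷ n d ds))
  (P.trans (solve 3 (λ w n d → w :* (n :* d) := n :* (w :* d)) P.refl w n d) (cong (n ℕ.*_) e) ∷ Weights-⊙ n es)
  where open +-*-Solver

Chain-⊙ : ∀ {m E} n (d : Exp m) → Chain E d → Chain E (n ⊙ d)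
Chain-⊙ n [] c with n ⊙ []
... | [] = tt
Chain-⊙ {E = E} n (d ∷ []) c = subst (Chain E) (P.sym (⊙-∷ n d [])) (one-elt (n ⊙ []))
  where
  one-elt : (v : Exp 0) → Chain E (n ℕ.* d ∷ v)
  one-elt [] = tt
Chain-⊙ {E = E} n (d ∷ d′ ∷ ds) (c , cs) = subst (Chain E) (P.sym (P.trans (⊙-∷ n d (d′ ∷ ds)) (cong (n ℕ.* d ∷_) (⊙-∷ n d′ ds))))
  (≤-trans (≤-reflexive (solve 3 (λ E n d → E :* (n :* d) := n :* (E :* d)) P.refl E n d)) (*-monoʳ-≤ n c)
  , subst (Chain E) (⊙-∷ n d′ ds) (Chain-⊙ n (d′ ∷ ds) cs))
  where open +-*-Solver

Chain-mono : ∀ {m E E′} (d : Exp m) → E′ ≤ E → Chain E d → Chain E′ d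
Chain-mono [] l c = tt
Chain-mono (d ∷ []) l c = tt
Chain-mono (d ∷ d′ ∷ ds) l (c , cs) = ≤-trans (*-monoˡ-≤ d l) c , Chain-mono (d′ ∷ ds) l cs

Chain-dot : ∀ {m E L} d (ds ws : Exp m) → 1 ≤ E → Chain E (d ∷ ds) → Weights L ws ds → ∀ I → E ℕ.* d ℕ.* dot ws I ≤ L ℕ.* Vec.sum I
Chain-dot {E = E} {L} d ds ws E≥1 = go ws ds d (≤-refl)
  where
  open +-*-Solver
  go : ∀ {k} (ws ds : Exp k) d₁ → d ≤ d₁ → Chain E (d₁ ∷ ds) → Weights L ws ds → ∀ I → E ℕ.* d ℕ.* dot ws I ≤ L ℕ.* Vec.sum I
  go [] [] d₁ _ _ _ [] = ≤-reflexive (P.trans (ℕₚ.*-zeroʳ (E ℕ.* d)) (P.sym (ℕₚ.*-zeroʳ L)))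
  go (w ∷ ws) (d₂ ∷ ds) d₁ l (c , cs) (e ∷ es) (i ∷ I) = begin
    E ℕ.* d ℕ.* (w ℕ.* i ℕ.+ dot ws I) ≡⟨ solve 4 (λ a w i t → a :* (w :* i :+ t) := w :* a :* i :+ a :* t) P.refl (E ℕ.* d) w i (dot ws I) ⟩
    w ℕ.* (E ℕ.* d) ℕ.* i ℕ.+ E ℕ.* d ℕ.* dot ws I ≤⟨ +-mono-≤ (*-monoˡ-≤ i (≤-trans (*-monoʳ-≤ w Ed≤d₂) (≤-reflexive e)))
          (go ws ds d₂ (≤-trans (≤-trans (≤-reflexive (P.sym (ℕₚ.*-identityˡ d))) (*-monoˡ-≤ d E≥1)) Ed≤d₂) cs es I) ⟩
    L ℕ.* i ℕ.+ L ℕ.* Vec.sum I ≡⟨ P.sym (ℕₚ.*-distribˡ-+ L i _) ⟩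
    L ℕ.* (i ℕ.+ Vec.sum I) ∎
    where
    open ℕₚ.≤-Reasoning
    Ed≤d₂ : E ℕ.* d ≤ d₂
    Ed≤d₂ = ≤-trans (*-monoʳ-≤ E l) c

m<suc[m/n]*n : ∀ m n .{{_ : ℕ.NonZero n}} → m < suc (m / n) ℕ.* n
m<suc[m/n]*n m n = ≤-trans (≤-reflexive (cong suc (DM.m≡m%n+[m/n]*n m n))) (+-monoˡ-≤ (m / n ℕ.* n) (DM.m%n<n m n))

triangle : (t s w : ℕ) → ℕ → ℕ
triangle t s w l = sumℕ l (λ j → t ∸ (s ℕ.+ w ℕ.* (l ∸ suc j)))

triangle-≥ : ∀ e {t s w L l d} → L ≤ suc e ℕ.* t → 4 ℕ.* suc e ℕ.* s ≤ L → w ℕ.* d ≡ L → l ≤ suc d →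
             l ℕ.* L ≤ 4 ℕ.* suc e ℕ.* (4 ℕ.* suc e) ℕ.* triangle t s w l
triangle-≥ e {l = zero} _ _ _ _ = z≤n
triangle-≥ e {t} {s} {w} {L} {suc l} {d} ht hs hw (s≤s hl) = begin
  suc l ℕ.* L ≤⟨ *-monoˡ-≤ L (≤-trans ((m<suc[m/n]*n l c)) (≤-reflexive (ℕₚ.*-comm (suc k) c))) ⟩
  c ℕ.* suc k ℕ.* L ≡⟨ ℕₚ.*-assoc c (suc k) L ⟩
  c ℕ.* (suc k ℕ.* L) ≤⟨ *-monoʳ-≤ c (≤-trans (part (suc k) (λ j lj → term j (≤-pred lj))) (*-monoʳ-≤ c (tri-mono (s≤s (DM.m/n≤m l c))))) ⟩
  c ℕ.* (c ℕ.* triangle t s w (suc l)) ≡⟨ P.sym (ℕₚ.*-assoc c c _) ⟩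
  c ℕ.* c ℕ.* triangle t s w (suc l) ∎
  where
  open ℕₚ.≤-Reasoning
  open +-*-Solver
  c = 4 ℕ.* suc e
  k = l / c
  f : ℕ → ℕ
  f j = t ∸ (s ℕ.+ w ℕ.* j)
  part : ∀ n → (∀ j → j < n → L ≤ c ℕ.* f j) → n ℕ.* L ≤ c ℕ.* triangle t s w n
  part zero h = z≤n
  part (suc n) h = ≤-trans (+-mono-≤ (h n ≤-refl) (part n (λ j lj → h j (m<n⇒m<1+n lj)))) (≤-reflexive (P.sym (ℕₚ.*-distribˡ-+ c (f n) _)))
  tri-mono : ∀ {a b} → a ≤ b → triangle t s w a ≤ triangle t s w b
  tri-mono {b = zero} z≤n = z≤n
  tri-mono {a} {suc b} l with m≤n⇒m<n∨m≡n l
  ... | inj₁ (s≤s l′) = ≤-trans (tri-mono l′) (m≤n+m _ (f b))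
  ... | inj₂ P.refl = ≤-refl
  term : ∀ j → j ≤ k → L ≤ c ℕ.* f j
  term j lj = +-cancelʳ-≤ (2 ℕ.* L) L (c ℕ.* f j) (begin
    L ℕ.+ 2 ℕ.* L ≤⟨ m≤m+n _ L ⟩
    L ℕ.+ 2 ℕ.* L ℕ.+ L ≡⟨ solve 1 (λ L → L :+ con 2 :* L :+ L := con 4 :* L) P.refl L ⟩
    4 ℕ.* L ≤⟨ *-monoʳ-≤ 4 ht ⟩
    4 ℕ.* (suc e ℕ.* t) ≡⟨ P.sym (ℕₚ.*-assoc 4 (suc e) t) ⟩
    c ℕ.* t ≤⟨ *-monoʳ-≤ c (m≤n+m∸n t (s ℕ.+ w ℕ.* j)) ⟩
    c ℕ.* (s ℕ.+ w ℕ.* j ℕ.+ f j) ≡⟨ solve 5 (λ c s w j f → c :* (s :+ w :* j :+ f) := c :* f :+ (c :* s :+ w :* (j :* c))) P.refl c s w j (f j) ⟩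
    c ℕ.* f j ℕ.+ (c ℕ.* s ℕ.+ w ℕ.* (j ℕ.* c)) ≤⟨ +-monoʳ-≤ (c ℕ.* f j) (+-mono-≤ hs (≤-trans (*-monoʳ-≤ w (≤-trans (*-monoˡ-≤ c lj) (≤-trans (DM.m/n*n≤m l c) hl))) (≤-reflexive hw))) ⟩
    c ℕ.* f j ℕ.+ (L ℕ.+ L) ≡⟨ solve 2 (λ a L → a :+ (L :+ L) := a :+ con 2 :* L) P.refl (c ℕ.* f j) L ⟩
    c ℕ.* f j ℕ.+ 2 ℕ.* L ∎)

distinct-≤ : ∀ l d (e : ℕ → ℕ) → (∀ a → a < l → e a ≤ d) → (∀ a b → a < b → b < l → e a ≢ e b) → l ≤ suc d
distinct-≤ l d e h ne = Finₚ.injective⇒≤ {f = f} inj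
  where
  f : Fin l → Fin (suc d)
  f i = Fin.fromℕ< (s≤s (h (toℕ i) (Finₚ.toℕ<n i)))
  inj : ∀ {i j} → f i ≡ f j → i ≡ j
  inj {i} {j} q with <-cmp (toℕ i) (toℕ j) | P.trans (P.sym (Finₚ.toℕ-fromℕ< _)) (P.trans (cong toℕ q) (Finₚ.toℕ-fromℕ< _))
  ... | tri≈ _ x _ | _ = Finₚ.toℕ-injective x
  ... | tri< x _ _ | r = ⊥-elim (ne _ _ x (Finₚ.toℕ<n j) r)
  ... | tri> _ _ x | r = ⊥-elim (ne _ _ x (Finₚ.toℕ<n i) (P.sym r))

low-cost : ∀ {m E L} c d (ds ws : Exp m) → 1 ≤ d → 1 ≤ E → c ≤ E → Chain E (d ∷ ds) → Weights L ws ds →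
           ∀ I → Vec.sum I ≤ d → c ℕ.* dot ws I ≤ L
low-cost {E = E} {L} c d ds ws d≥1 E≥1 c≤E ch wds I small = ≤-trans (*-monoˡ-≤ (dot ws I) c≤E) (*-cancelˡ-≤ d {{ℕ.>-nonZero d≥1}} (begin
  d ℕ.* (E ℕ.* dot ws I) ≡⟨ solve 3 (λ d E t → d :* (E :* t) := E :* d :* t) P.refl d E (dot ws I) ⟩
  E ℕ.* d ℕ.* dot ws I ≤⟨ Chain-dot d ds ws E≥1 ch wds I ⟩
  L ℕ.* Vec.sum I ≤⟨ *-monoʳ-≤ L small ⟩
  L ℕ.* d ≡⟨ ℕₚ.*-comm L d ⟩
  d ℕ.* L ∎))
  where
  open +-*-Solver
  open ℕₚ.≤-Reasoning

m*n≤o⇒n≤o/m : ∀ m n o .{{_ : ℕ.NonZero m}} → m ℕ.* n ≤ o → n ≤ o / m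
m*n≤o⇒n≤o/m m n o h = ≤-trans (≤-reflexive (P.sym (DM.m*n/n≡m n m))) (DM./-monoˡ-≤ m (≤-trans (≤-reflexive (ℕₚ.*-comm n m)) h))

det-size : ∀ l B → (l ℕ.* 2 ^ B) ^ l ≤ 2 ^ (l ℕ.* (l ℕ.+ B))
det-size l B = begin
  (l ℕ.* 2 ^ B) ^ l ≤⟨ ^-monoˡ-≤ l (*-monoˡ-≤ (2 ^ B) (n≤2^n l)) ⟩
  (2 ^ l ℕ.* 2 ^ B) ^ l ≡⟨ cong (_^ l) (P.sym (^-distribˡ-+-* 2 l B)) ⟩
  (2 ^ (l ℕ.+ B)) ^ l ≡⟨ ^-*-assoc 2 (l ℕ.+ B) l ⟩
  2 ^ ((l ℕ.+ B) ℕ.* l) ≡⟨ cong (2 ^_) (ℕₚ.*-comm (l ℕ.+ B) l) ⟩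
  2 ^ (l ℕ.* (l ℕ.+ B)) ∎
  where open ℕₚ.≤-Reasoning

scaled-size : ∀ {l d h σ L E F} → 1 ≤ d → l ≤ suc d → 4 ℕ.* F ≤ E → E ℕ.* (h ℕ.+ (d ℕ.+ σ)) ≤ L → ∀ {k} → k ≤ d ℕ.+ σ →
              F ℕ.* (l ℕ.* (l ℕ.+ (h ℕ.+ (d ℕ.+ σ))) ℕ.+ l ℕ.* k) ≤ l ℕ.* L
scaled-size {l} {d} {h} {σ} {L} {E} {F} d≥1 l≤ FE hE {k} hk = begin
  F ℕ.* (l ℕ.* (l ℕ.+ (h ℕ.+ (d ℕ.+ σ))) ℕ.+ l ℕ.* k) ≤⟨ *-monoʳ-≤ F (+-mono-≤ (*-monoʳ-≤ l (+-monoˡ-≤ _ (≤-trans l≤ (+-monoˡ-≤ d d≥1)))) (*-monoʳ-≤ l hk)) ⟩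
  F ℕ.* (l ℕ.* (d ℕ.+ d ℕ.+ (h ℕ.+ (d ℕ.+ σ))) ℕ.+ l ℕ.* (d ℕ.+ σ)) ≤⟨ m≤m+n _ (F ℕ.* (l ℕ.* (con3 ℕ.* h ℕ.+ 2 ℕ.* σ))) ⟩
  F ℕ.* (l ℕ.* (d ℕ.+ d ℕ.+ (h ℕ.+ (d ℕ.+ σ))) ℕ.+ l ℕ.* (d ℕ.+ σ)) ℕ.+ F ℕ.* (l ℕ.* (con3 ℕ.* h ℕ.+ 2 ℕ.* σ))
    ≡⟨ solve 5 (λ F l d h σ → F :* (l :* (d :+ d :+ (h :+ (d :+ σ))) :+ l :* (d :+ σ)) :+ F :* (l :* (con 3 :* h :+ con 2 :* σ)) := l :* (con 4 :* F :* (h :+ (d :+ σ)))) P.refl F l d h σ ⟩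
  l ℕ.* (4 ℕ.* F ℕ.* (h ℕ.+ (d ℕ.+ σ))) ≤⟨ *-monoʳ-≤ l (≤-trans (*-monoˡ-≤ (h ℕ.+ (d ℕ.+ σ)) FE) hE) ⟩
  l ℕ.* L ∎
  where
  open +-*-Solver
  open ℕₚ.≤-Reasoning
  con3 = 3

index-clash : ∀ {c S lL a b} → 0 < lL → lL ≤ c ℕ.* c ℕ.* S → S ≤ a ℕ.+ b → 4 ℕ.* (c ℕ.* c) ℕ.* a ≤ lL → 4 ℕ.* (c ℕ.* c) ℕ.* b ≤ lL → ⊥
index-clash {c} {S} {lL} {a} {b} pos h₁ h₂ ha hb = <⇒≱ (+-monoʳ-< (lL ℕ.+ lL) (<-≤-trans pos (m≤m+n lL lL))) (begin
  lL ℕ.+ lL ℕ.+ (lL ℕ.+ lL) ≡⟨ solve 1 (λ x → x :+ x :+ (x :+ x) := con 4 :* x) P.refl lL ⟩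
  4 ℕ.* lL ≤⟨ *-monoʳ-≤ 4 (≤-trans h₁ (*-monoʳ-≤ (c ℕ.* c) h₂)) ⟩
  4 ℕ.* (c ℕ.* c ℕ.* (a ℕ.+ b)) ≡⟨ solve 3 (λ c a b → con 4 :* (c :* (a :+ b)) := con 4 :* c :* a :+ con 4 :* c :* b) P.refl (c ℕ.* c) a b ⟩
  4 ℕ.* (c ℕ.* c) ℕ.* a ℕ.+ 4 ℕ.* (c ℕ.* c) ℕ.* b ≤⟨ +-mono-≤ ha hb ⟩
  lL ℕ.+ lL ≡⟨ P.sym (ℕₚ.+-identityʳ _) ⟩
  lL ℕ.+ lL ℕ.+ 0 ∎)
  where
  open +-*-Solver
  open ℕₚ.≤-Reasoning

∸-split : ∀ {a K t} → a ≤ K → 0 < t ∸ K → a ℕ.+ (t ∸ K) ≤ t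
∸-split {a} {K} {t} h pos = ≤-trans (+-monoˡ-≤ (t ∸ K) h) (≤-reflexive (m+[n∸m]≡n {K} {t} (<⇒≤ (m∸n≢0⇒n<m {t} {K} (λ q → <⇒≢ pos (P.sym q))))))

module RothLemma (A : ℤ-Algebra)
  (ι-injective : ∀ z → ℤ-Algebra._≈_ A (ℤ-Algebra.ι A z) (ℤ-Algebra.0# A) → z ≡ 0ℤ)
  (no-zero-divisors : ∀ x y → ℤ-Algebra._≈_ A (ℤ-Algebra._*_ A x y) (ℤ-Algebra.0# A) → ℤ-Algebra._≈_ A x (ℤ-Algebra.0# A) ⊎ ℤ-Algebra._≈_ A y (ℤ-Algebra.0# A))
  (stable : ∀ x → ¬ ¬ (ℤ-Algebra._≈_ A x (ℤ-Algebra.0# A)) → ℤ-Algebra._≈_ A x (ℤ-Algebra.0# A))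
  (pair-resp : ∀ {X : Set} (p q : Meas X) → p ≋ q → ∀ g → ℤ-Algebra._≈_ A (Pairing.⟨_,_⟩ A p g) (Pairing.⟨_,_⟩ A q g))
  (κ₀ : ℕ) where
  open ℤ-Algebra A
  open Pairing A
  open Taylor A using (taylor; taylorᵛ; _↑_)
  open import Relation.Binary.Reasoning.Setoid setoid

  torsion-free : ∀ k z → ι (+ suc k) * z ≈ 0# → z ≈ 0#
  torsion-free k z h with no-zero-divisors (ι (+ suc k)) z h
  ... | inj₂ q = q
  ... | inj₁ q with ι-injective (+ suc k) q
  ... | ()

  open Index A torsion-free using (module Vanishing)

  taylor₁ : Carrier → Carrier → ℕ → ℕ → ℕ → Carrier
  taylor₁ x y d i j = taylor x i j * y ↑ (d ∸ j)

  -- An integer polynomial of degree d and norm 2^h vanishes at (x : y) to order at most κ₀ (h + d) / w.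
  Height : Carrier → Carrier → ℕ → Set
  Height x y w = ∀ d h i (p : Meas ℕ) → Support (_≤ d) p → norm p ≤ 2 ^ h → ¬ (p ≋ []) →
    (∀ i′ → i′ < i → ⟨ p , taylor₁ x y d i′ ⟩ ≈ 0#) → w ℕ.* i ≤ κ₀ ℕ.* (h ℕ.+ d)

  data Heights : ∀ {m} → Vec Carrier m → Vec Carrier m → Vec ℕ m → Set where
    [] : Heights [] [] []
    _∷_ : ∀ {m x y w} {xs ys : Vec Carrier m} {ws} → Height x y w → Heights xs ys ws → Heights (x ∷ xs) (y ∷ ys) (w ∷ ws)

  SmallIndex : ℕ → ℕ → ℕ → Set
  SmallIndex m e E = ∀ (xs ys : Vec Carrier m) (w d : Exp m) L h (p : Poly m) → Heights xs ys w → Weights L w d → Chain E d → 0 < L →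
    E ℕ.* (h ℕ.+ Vec.sum d) ≤ L → Support (_⊑ᵛ d) p → norm p ≤ 2 ^ h → ¬ (p ≋ []) →
    ¬ ¬ (∃ λ I → suc e ℕ.* dot w I ≤ L × ¬ (⟨ p , taylorᵛ xs ys d I ⟩ ≈ 0#))

  constant : ∀ {m} → ℤ → Poly m
  constant c = (c , 0ᵛ) ∷ []

  pair-const : ∀ {m} c (p : Poly m) g → ⟪ constant c ⊗ p , g ⟫ ≡ c ℤ.* ⟪ p , g ⟫
  pair-const c p g = P.trans (pair-⊗ (constant c) p g) (P.trans (ℤₚ.+-identityʳ _)
    (cong (c ℤ.*_) (Pℤ.pair-cong p (λ J → cong g (P.trans (⊞-comm 0ᵛ J) (zipWith-identityʳ ℕₚ.+-identityʳ J))))))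

  product : ∀ x y → ¬ (x ≈ 0#) → ¬ (y ≈ 0#) → ¬ (x * y ≈ 0#)
  product x y a b q with no-zero-divisors x y q
  ... | inj₁ z = a z
  ... | inj₂ z = b z

  small-index-0 : ∀ e → SmallIndex 0 e 1
  small-index-0 e [] [] [] [] L h p _ _ _ _ _ _ _ p≢0 k = p≢0 (same (λ g → P.trans (Pℤ.pair-cong p (λ { [] → P.sym (ℤₚ.*-identityʳ (g [])) }))
    (P.trans (Pℤ.pair-* p (g []) (λ _ → 1ℤ)) (P.trans (cong (g [] ℤ.*_) zero-mass) (ℤₚ.*-zeroʳ (g []))))))
    where
    zero-mass : ⟪ p , (λ _ → 1ℤ) ⟫ ≡ 0ℤ
    zero-mass = ι-injective _ (trans (sym (pair-ι A p (λ _ → 1ℤ))) (trans (pair-cong p (λ { [] → ι-1 }))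
      (stable _ (λ q → k ([] , ≤-trans (≤-reflexive (ℕₚ.*-zeroʳ (suc e))) z≤n , q)))))

  record Counterexample (m : ℕ) : Set where
    field
      e E′ : ℕ
      ih : SmallIndex m (4 ℕ.* ((4 ℕ.* suc e) ℕ.* (4 ℕ.* suc e))) E′
      x y : Carrier
      xs ys : Vec Carrier m
      w : ℕ
      ws : Vec ℕ m
      d : ℕ
      ds : Exp m
      L h E : ℕ
      p : Poly (suc m)
      E-≥₁ : 4 ℕ.* suc e ≤ E
      E-≥₂ : 4 ℕ.* E′ ≤ E
      E-≥₃ : 4 ℕ.* (4 ℕ.* ((4 ℕ.* suc e) ℕ.* (4 ℕ.* suc e))) ℕ.* κ₀ ≤ E
      E-≥₄ : E′ ≤ E
      hx : Height x y w
      hxs : Heights xs ys ws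
      wd : w ℕ.* d ≡ L
      wds : Weights L ws ds
      ch : Chain E (d ∷ ds)
      0<L : 0 < L
      size : E ℕ.* (h ℕ.+ Vec.sum (d ∷ ds)) ≤ L
      box : Support (_⊑ᵛ (d ∷ ds)) p
      nm : norm p ≤ 2 ^ h
      p≢0 : ¬ (p ≋ [])
      vanish : ∀ I → suc e ℕ.* dot (w ∷ ws) I ≤ L → ⟨ p , taylorᵛ (x ∷ xs) (y ∷ ys) (d ∷ ds) I ⟩ ≈ 0#

  module Wronskian {m : ℕ} (counterexample : Counterexample m) where
    open Counterexample counterexample

    private module Δ = Decomposition (decompose d ds p box)
    private
      l = Δ.rank
      c = 4 ℕ.* suc e
      t = suc (L / suc e)
      s₀ = L / c
      Σd = Vec.sum (d ∷ ds)
      B = h ℕ.+ Σd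
      h′ = l ℕ.* (l ℕ.+ B)
    open Vanishing (x ∷ xs) (y ∷ ys) (w ∷ ws)
    open Sum (polyRing (suc m)) using (sum)
    open PolyDet (suc m) using (det; det-cong; det-*; det-transpose; det-scale; scale)
    open CommutativeRing (polyRing (suc m)) using () renaming (trans to ≋-trans; sym to ≋-sym; *-congˡ to ⊗-congˡ)

    d≥1 : 1 ≤ d
    d≥1 with d ℕ.≟ 0
    ... | yes P.refl = ⊥-elim (<⇒≢ 0<L (P.trans (P.sym (ℕₚ.*-zeroʳ w)) wd))
    ... | no ne = n≢0⇒n>0 ne

    l≤d+1 : l ≤ suc d
    l≤d+1 = distinct-≤ l d Δ.e Δ.e≤d Δ.e-distinct

    p-van : Van (d ∷ ds) t p
    p-van = van λ I q → vanish I (≤-trans (*-monoʳ-≤ (suc e) (≤-pred q)) (≤-trans (≤-reflexive (ℕₚ.*-comm (suc e) _)) (DM.m/n*n≤m L (suc e))))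

    sum-pair : ∀ n (f : ℕ → Poly (suc m)) g → ⟪ sum n f , g ⟫ ≡ 𝕊.sum n (λ a → ⟪ f a , g ⟫)
    sum-pair zero f g = P.refl
    sum-pair (suc n) f g = P.trans (Pℤ.pair-++ (f 0) _ g) (cong (λ z → ⟪ f 0 , g ⟫ ℤ.+ z) (sum-pair n (λ i → f (suc i)) g))

    module Chosen (I : ℕ → Exp m) (I-small : ∀ i → Vec.sum (I i) ≤ l ∸ suc i) (I-det : ℤDet.det l (λ i j → Δ.κ j ℤ.* χ (I i) (Δ.D j)) ≢ 0ℤ)
      (J : ℕ → Exp 1) (J-small : ∀ j → Vec.sum (J j) ≤ l ∸ suc j) (J-det : ℤDet.det l (λ i j → Δ.κ′ j ℤ.* χ (J i) (Δ.e j ∷ [])) ≢ 0ℤ) where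

      χ₁ : ℕ → ℕ → ℤ
      χ₁ j n = + binom n (Vec.head (J j))

      χ-J : ∀ j n → χ (J j) (n ∷ []) ≡ χ₁ j n
      χ-J j n with J j
      ... | a ∷ [] = cong +_ (ℕₚ.*-identityʳ (binom n a))

      op : ℕ → ℕ → Exp (suc m)
      op i j = Vec.head (J j) ∷ I i

      M : ℕ → ℕ → Poly (suc m)
      M i j = scaleBy (χ (op i j)) p

      U₀ V₀ : ℕ → ℕ → Poly (suc m)
      U₀ i a = pushforward (0 ∷_) (scaleBy (χ (I i)) (Δ.left a))
      V₀ a j = pushforward (_∷ 0ᵛ) (scaleBy (χ₁ j) (Δ.right a))

      W u v : Poly (suc m)
      W = det l M
      u = det l U₀
      v = det l (λ j a → V₀ a j)

      pair-UV : ∀ i a j g → ⟪ U₀ i a ⊗ V₀ a j , g ⟫ ≡ ⟪ Δ.left a , (λ K → ⟪ Δ.right a , (λ n → χ (op i j) (n ∷ K) ℤ.* g (n ∷ K)) ⟫) ⟫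
      pair-UV i a j g = P.trans (pair-⊗ (U₀ i a) (V₀ a j) g) (P.trans (Pℤ.pair-push (scaleBy (χ (I i)) (Δ.left a)) (0 ∷_) _) (P.trans (Pℤ.pair-scaleBy (Δ.left a) (χ (I i)) _)
        (Pℤ.pair-cong (Δ.left a) (λ K → P.trans (cong (χ (I i) K ℤ.*_) (P.trans (Pℤ.pair-push (scaleBy (χ₁ j) (Δ.right a)) (_∷ 0ᵛ) _) (Pℤ.pair-scaleBy (Δ.right a) (χ₁ j) _)))
          (P.trans (P.sym (Pℤ.pair-* (Δ.right a) (χ (I i) K) (λ n → χ₁ j n ℤ.* g ((0 ∷ K) ⊞ (n ∷ 0ᵛ))))) (Pℤ.pair-cong (Δ.right a) (λ n →
            P.trans (P.sym (ℤₚ.*-assoc (χ (I i) K) (χ₁ j n) _)) (cong₂ ℤ._*_ (P.trans (ℤₚ.*-comm (χ (I i) K) (χ₁ j n)) (P.sym (pos-* (binom n (Vec.head (J j))) (binomᵛ K (I i)))))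
              (cong (λ K′ → g (n ∷ K′)) (zipWith-identityʳ ℕₚ.+-identityʳ K)))))))))) 

      factor : ∀ i j → constant Δ.scalar ⊗ M i j ≋ sum l (λ a → U₀ i a ⊗ V₀ a j)
      factor i j = same λ g → P.trans (pair-const Δ.scalar (M i j) g) (P.trans (cong (Δ.scalar ℤ.*_) (Pℤ.pair-scaleBy p (χ (op i j)) g))
        (P.trans (Δ.expansion (λ X → χ (op i j) X ℤ.* g X)) (P.sym (P.trans (sum-pair l (λ a → U₀ i a ⊗ V₀ a j) g) (𝕊.sum-cong l (λ a _ → pair-UV i a j g))))))

      W-factor : scale l (constant Δ.scalar) W ≋ u ⊗ v
      W-factor = ≋-trans (≋-sym (det-scale l (constant Δ.scalar) M)) (≋-trans (det-cong l factor) (≋-trans (det-* l U₀ V₀) (⊗-congˡ {u} (≋-sym (det-transpose l V₀)))))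

      scalars : ℕ → Carrier
      scalars zero = 1#
      scalars (suc n) = ι Δ.scalar * scalars n

      pair-scale : ∀ n q g → ⟨ scale n (constant Δ.scalar) q , g ⟩ ≈ scalars n * ⟨ q , g ⟩
      pair-scale zero q g = sym (*-identityˡ _)
      pair-scale (suc n) q g = begin
        ⟨ constant Δ.scalar ⊗ q′ , g ⟩ ≈⟨ pair-convolve _⊞_ (constant Δ.scalar) q′ g ⟩
        ι Δ.scalar * ⟨ q′ , (λ K → g (0ᵛ ⊞ K)) ⟩ + 0# ≈⟨ +-identityʳ _ ⟩
        ι Δ.scalar * ⟨ q′ , (λ K → g (0ᵛ ⊞ K)) ⟩ ≈⟨ *-congˡ (pair-cong q′ (λ K → reflexive (cong g (P.trans (⊞-comm 0ᵛ K) (zipWith-identityʳ ℕₚ.+-identityʳ K))))) ⟩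
        ι Δ.scalar * ⟨ q′ , g ⟩ ≈⟨ *-congˡ (pair-scale n q g) ⟩
        ι Δ.scalar * (scalars n * ⟨ q , g ⟩) ≈⟨ sym (*-assoc _ _ _) ⟩
        scalars (suc n) * ⟨ q , g ⟩ ∎
        where q′ = scale n (constant Δ.scalar) q

      C : Carrier
      C = scalars l

      scalars≢0 : ∀ n → ¬ (scalars n ≈ 0#)
      scalars≢0 zero q with ι-injective (+ 1) (trans ι-1 q)
      ... | ()
      scalars≢0 (suc n) = product _ _ (λ q → Δ.scalar≢0 (ι-injective _ q)) (scalars≢0 n)

      u-support : Support (λ X → Vec.head X ≡ 0) u
      u-support = support-det P.refl (λ { (a ∷ _) (b ∷ _) q r → cong₂ ℕ._+_ q r }) l (λ i a → push-support (scaleBy (χ (I i)) (Δ.left a)))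
        where
        push-support : (q : Meas (Exp m)) → Support (λ X → Vec.head X ≡ 0) (pushforward (0 ∷_) q)
        push-support [] = []
        push-support (_ ∷ q) = P.refl ∷ push-support q

      v-support : Support (λ X → Vec.tail X ≡ 0ᵛ) v
      v-support = support-det P.refl (λ { (a ∷ _) (b ∷ _) q r → P.trans (cong₂ _⊞_ q r) (zipWith-identityʳ ℕₚ.+-identityʳ 0ᵛ) }) l (λ j a → push-support (scaleBy (χ₁ j) (Δ.right a)))
        where
        push-support : (q : Meas ℕ) → Support (λ X → Vec.tail X ≡ 0ᵛ) (pushforward (_∷ 0ᵛ) q)
        push-support [] = []
        push-support (_ ∷ q) = P.refl ∷ push-support q

      split : ∀ (g₁ : ℕ → Carrier) (g₂ : Exp m → Carrier) →
              C * ⟨ W , (λ X → g₁ (Vec.head X) * g₂ (Vec.tail X)) ⟩ ≈ ⟨ v , (λ X → g₁ (Vec.head X)) ⟩ * ⟨ u , (λ X → g₂ (Vec.tail X)) ⟩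
      split g₁ g₂ = begin
        C * ⟨ W , g ⟩ ≈⟨ sym (pair-scale l W g) ⟩
        ⟨ scale l (constant Δ.scalar) W , g ⟩ ≈⟨ pair-resp _ _ W-factor g ⟩
        ⟨ u ⊗ v , g ⟩ ≈⟨ pair-convolve _⊞_ u v g ⟩
        ⟨ u , (λ X → ⟨ v , (λ Y → g (X ⊞ Y)) ⟩) ⟩ ≈⟨ pair-congOn (λ X qx → pair-congOn (λ Y qy → on X Y qx qy) v-support) u-support ⟩
        ⟨ u , (λ X → ⟨ v , (λ Y → g₂ (Vec.tail X) * g₁ (Vec.head Y)) ⟩) ⟩ ≈⟨ pair-split u v _ _ ⟩
        ⟨ u , (λ X → g₂ (Vec.tail X)) ⟩ * ⟨ v , (λ X → g₁ (Vec.head X)) ⟩ ≈⟨ *-comm _ _ ⟩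
        _ ∎
        where
        g : Exp (suc m) → Carrier
        g X = g₁ (Vec.head X) * g₂ (Vec.tail X)
        on : ∀ X Y → Vec.head X ≡ 0 → Vec.tail Y ≡ 0ᵛ → g (X ⊞ Y) ≈ g₂ (Vec.tail X) * g₁ (Vec.head Y)
        on (_ ∷ K) (n ∷ _) P.refl P.refl = trans (*-comm _ _) (*-congʳ (reflexive (cong g₂ (zipWith-identityʳ ℕₚ.+-identityʳ K))))

      nA nB : ℕ
      nA = sumℕ l (λ a → enc ds (Δ.D a))
      nB = sumℕ l Δ.e

      kA kB : ℤ
      kA = ℤDet.det l (λ i j → Δ.κ j ℤ.* χ (I i) (Δ.D j))
      kB = ℤDet.det l (λ i j → Δ.κ′ j ℤ.* χ (J i) (Δ.e j ∷ []))

      u-top : Top (λ X → enc ds (Vec.tail X)) nA kA u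
      u-top = Top-det _ (λ { (_ ∷ a) (_ ∷ b) → enc-⊞ ds a b }) (enc-0 ds) l (λ i a a<l → top λ g hg →
        P.trans (P.trans (Pℤ.pair-push (scaleBy (χ (I i)) (Δ.left a)) (0 ∷_) _) (Pℤ.pair-scaleBy (Δ.left a) (χ (I i)) _))
          (P.trans (Δ.left-lead a a<l (λ K → χ (I i) K ℤ.* g (enc ds K)) (λ K _ lt → P.trans (cong (χ (I i) K ℤ.*_) (hg _ lt)) (ℤₚ.*-zeroʳ (χ (I i) K))))
            (P.sym (ℤₚ.*-assoc (Δ.κ a) (χ (I i) (Δ.D a)) _))))

      v-top : Top Vec.head nB kB v
      v-top = Top-det _ (λ { (_ ∷ _) (_ ∷ _) → P.refl }) P.refl l (λ j a a<l → top λ g hg →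
        P.trans (P.trans (Pℤ.pair-push (scaleBy (χ₁ j) (Δ.right a)) (_∷ 0ᵛ) _) (Pℤ.pair-scaleBy (Δ.right a) (χ₁ j) _))
          (P.trans (Δ.right-lead a a<l (λ n → χ₁ j n ℤ.* g n) (λ n _ lt → P.trans (cong (χ₁ j n ℤ.*_) (hg _ lt)) (ℤₚ.*-zeroʳ (χ₁ j n))))
            (P.trans (P.sym (ℤₚ.*-assoc (Δ.κ′ a) (χ₁ j (Δ.e a)) _)) (cong (λ z → Δ.κ′ a ℤ.* z ℤ.* g (Δ.e a)) (P.sym (χ-J j (Δ.e a)))))))

      top-δ : ∀ {ω n k q} → Top {suc m} ω n k q → ⟨ q , (λ X → ι (δ (ω X) n)) ⟩ ≈ ι k
      top-δ {ω} {n} {k} {q} tp = trans (pair-ι A q (λ X → δ (ω X) n)) (reflexive (cong ι (P.trans (leading tp (λ a → δ a n) (λ a lt → δ-≢ (<⇒≢ lt)))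
        (P.trans (cong (k ℤ.*_) (δ-≡ {n} P.refl)) (ℤₚ.*-identityʳ k)))))

      Ut : Poly m
      Ut = pushforward Vec.tail (scaleBy (λ X → δ (Vec.head X) nB) W)
      Vt : Meas ℕ
      Vt = pushforward Vec.head (scaleBy (λ X → δ (enc ds (Vec.tail X)) nA) W)

      pair-Ut : ∀ g₂ → C * ⟨ Ut , g₂ ⟩ ≈ ι kB * ⟨ u , (λ X → g₂ (Vec.tail X)) ⟩
      pair-Ut g₂ = trans (*-congˡ (trans (pair-push (scaleBy _ W) Vec.tail g₂) (pair-scaleBy W _ _))) (trans (split (λ n → ι (δ n nB)) g₂) (*-congʳ (top-δ v-top)))

      pair-Vt : ∀ g₁ → C * ⟨ Vt , g₁ ⟩ ≈ ⟨ v , (λ X → g₁ (Vec.head X)) ⟩ * ι kA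
      pair-Vt g₁ = trans (*-congˡ (trans (pair-push (scaleBy _ W) Vec.head g₁) (trans (pair-scaleBy W _ _) (pair-cong W (λ X → *-comm _ _)))))
        (trans (split g₁ (λ K → ι (δ (enc ds K) nA))) (*-congˡ (top-δ u-top)))

      kA≢0 : ¬ (ι kA ≈ 0#)
      kA≢0 q = I-det (ι-injective _ q)
      kB≢0 : ¬ (ι kB ≈ 0#)
      kB≢0 q = J-det (ι-injective _ q)

      Ut≢0 : ¬ (Ut ≋ [])
      Ut≢0 q = product _ _ kB≢0 kA≢0 (trans (*-congˡ (sym (top-δ u-top))) (trans (sym (pair-Ut (λ K → ι (δ (enc ds K) nA)))) (trans (*-congˡ (pair-resp Ut [] q _)) (zeroʳ C))))

      Vt≢0 : ¬ (Vt ≋ [])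
      Vt≢0 q = product _ _ kB≢0 kA≢0 (trans (*-congʳ (sym (top-δ v-top))) (trans (sym (pair-Vt (λ n → ι (δ n nB)))) (trans (*-congˡ (pair-resp Vt [] q _)) (zeroʳ C))))

      nonvanishing : ∀ g₁ g₂ → ¬ (⟨ Vt , g₁ ⟩ ≈ 0#) → ¬ (⟨ Ut , g₂ ⟩ ≈ 0#) → ¬ (⟨ W , (λ X → g₁ (Vec.head X) * g₂ (Vec.tail X)) ⟩ ≈ 0#)
      nonvanishing g₁ g₂ a b q = product _ _ (nz a (pair-Vt g₁) (λ z → trans (*-congʳ z) (zeroˡ _))) (nz b (pair-Ut g₂) (λ z → trans (*-congˡ z) (zeroʳ _)))
        (trans (sym (split g₁ g₂)) (trans (*-congˡ q) (zeroʳ C)))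
        where
        nz : ∀ {r s f} → ¬ (r ≈ 0#) → C * r ≈ f → (s ≈ 0# → f ≈ 0#) → ¬ (s ≈ 0#)
        nz r≢0 eq k z = product _ _ (scalars≢0 l) r≢0 (trans eq (k z))

      head-≤ : ∀ (v : Exp 1) → Vec.head v ≤ Vec.sum v
      head-≤ (a ∷ []) = m≤m+n a 0

      I-cost : ∀ i → dot ws (I i) ≤ s₀
      I-cost i = m*n≤o⇒n≤o/m c (dot ws (I i)) L (low-cost c d ds ws d≥1 (≤-trans (s≤s z≤n) E-≥₁) E-≥₁ ch wds (I i)
        (≤-trans (I-small i) (≤-trans (∸-monoʳ-≤ l (s≤s (z≤n {i}))) (∸-monoˡ-≤ 1 l≤d+1))))

      K : ℕ → ℕ
      K j = s₀ ℕ.+ w ℕ.* (l ∸ suc j)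

      op-cost : ∀ i j → dot (w ∷ ws) (op i j) ≤ K j
      op-cost i j = ≤-trans (+-mono-≤ (*-monoʳ-≤ w (≤-trans (head-≤ (J j)) (J-small j))) (I-cost i)) (≤-reflexive (ℕₚ.+-comm _ s₀))

      M-box : ∀ i j → Support (_⊑ᵛ (d ∷ ds)) (M i j)
      M-box i j = Support-map (λ _ _ q → q) box

      M-van : ∀ i j → Van (d ∷ ds) (t ∸ K j) (M i j)
      M-van i j with t ∸ K j ℕ.≟ 0
      ... | yes q = subst (λ n → Van (d ∷ ds) n (M i j)) (P.sym q) (van λ _ ())
      ... | no q = Van-θ p (op i j) (Van-mono (∸-split {K = K j} {t} (op-cost i j) (n≢0⇒n>0 q)) p-van)

      W-van : Van (l ⊙ (d ∷ ds)) (triangle t s₀ w l) W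
      W-van = DetVan.Van-det A torsion-free (x ∷ xs) (y ∷ ys) (w ∷ ws) l M-box M-van

      W-box : Support (_⊑ᵛ (l ℕ.* d ∷ l ⊙ ds)) W
      W-box = subst (λ v → Support (_⊑ᵛ v) W) (⊙-∷ l d ds) (box-det l M-box)

      W-norm : norm W ≤ 2 ^ h′
      W-norm = ≤-trans (norm-det l M (2 ^ B) (λ i j → ≤-trans (norm-scaleBy {χ = χ (op i j)} (λ X q → binomᵛ-≤ X (op i j) q) box)
        (≤-trans (*-monoˡ-≤ (2 ^ Σd) nm) (≤-reflexive (P.sym (^-distribˡ-+-* 2 h Σd)))))) (det-size l B)

      restrict-norm : ∀ {Y : Set} (f : Exp (suc m) → Y) (χ′ : Exp (suc m) → ℤ) → (∀ X → ∣ χ′ X ∣ ≤ 1) → norm (pushforward f (scaleBy χ′ W)) ≤ 2 ^ h′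
      restrict-norm f χ′ hχ = ≤-trans (≤-reflexive (norm-push f (scaleBy χ′ W))) (≤-trans (norm-scaleBy (λ X _ → hχ X) W-box) (≤-trans (≤-reflexive (ℕₚ.*-identityʳ _)) W-norm))

      Ut-box : Support (_⊑ᵛ (l ⊙ ds)) Ut
      Ut-box = Support-map (λ { _ (_ ∷ _) (_ ∷ q) → q }) (Support-map (λ _ _ q → q) W-box)
      Vt-box : Support (_≤ l ℕ.* d) Vt
      Vt-box = Support-map (λ { _ (_ ∷ _) (q ∷ _) → q }) (Support-map (λ _ _ q → q) W-box)

      l≥1 : 1 ≤ l
      l≥1 with l ℕ.≟ 0
      ... | no ne = n≢0⇒n>0 ne
      ... | yes q = ⊥-elim (p≢0 (same λ g → [ (λ z → ⊥-elim (Δ.scalar≢0 z)) , (λ z → z) ]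
          (i*j≡0⇒i≡0∨j≡0 Δ.scalar (P.trans (Δ.expansion g) (cong (λ n → 𝕊.sum n (λ a → ⟪ Δ.left a , (λ J → ⟪ Δ.right a , (λ j → g (j ∷ J)) ⟫) ⟫)) q)))))

      0<lL : 0 < l ℕ.* L
      0<lL = *-mono-< {0} l≥1 0<L

      w≥1 : 0 < w
      w≥1 with w ℕ.≟ 0
      ... | no ne = n≢0⇒n>0 ne
      ... | yes P.refl = ⊥-elim (<⇒≢ 0<L wd)

      Kv : ℕ
      Kv = κ₀ ℕ.* (h′ ℕ.+ l ℕ.* d)

      instance
        w-nonZero : ℕ.NonZero w
        w-nonZero = ℕ.>-nonZero w≥1

      contradiction : ∀ i′ I′ → w ℕ.* i′ ≤ Kv → 4 ℕ.* (c ℕ.* c) ℕ.* dot ws I′ ≤ l ℕ.* L →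
        ¬ (⟨ Vt , taylor₁ x y (l ℕ.* d) i′ ⟩ ≈ 0#) → ¬ (⟨ Ut , taylorᵛ xs ys (l ⊙ ds) I′ ⟩ ≈ 0#) → ⊥
      contradiction i′ I′ hi hI nV nU = index-clash {c} {triangle t s₀ w l} {l ℕ.* L} {w ℕ.* i′} {dot ws I′} 0<lL
        (triangle-≥ e {t} {s₀} {w} {L} {l} {d} (≤-trans (<⇒≤ (m<suc[m/n]*n L (suc e))) (≤-reflexive (ℕₚ.*-comm t (suc e)))) (≤-trans (≤-reflexive (ℕₚ.*-comm c s₀)) (DM.m/n*n≤m L c)) wd l≤d+1)
        (≮⇒≥ (λ lt → nonvanishing _ _ nV nU (trans (pair-cong W (λ { (_ ∷ _) → refl })) (at W-van′ (i′ ∷ I′) lt))))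
        (≤-trans (*-monoʳ-≤ (4 ℕ.* (c ℕ.* c)) hi) (≤-trans (≤-reflexive (P.sym (ℕₚ.*-assoc (4 ℕ.* (c ℕ.* c)) κ₀ _)))
          (scaled-size {l} {d} {h} {Vec.sum ds} {L} {E} {4 ℕ.* (c ℕ.* c) ℕ.* κ₀} d≥1 l≤d+1 (≤-trans (≤-reflexive (P.sym (ℕₚ.*-assoc 4 (4 ℕ.* (c ℕ.* c)) κ₀))) E-≥₃) size (m≤m+n d _))))
        hI
        where
        W-van′ : Van (l ℕ.* d ∷ l ⊙ ds) (triangle t s₀ w l) W
        W-van′ = subst (λ v → Van v (triangle t s₀ w l) W) (⊙-∷ l d ds) W-van

      tail-chain : ∀ {k} (v : Exp k) → Chain E (d ∷ v) → Chain E v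
      tail-chain [] _ = tt
      tail-chain (_ ∷ _) (_ , q) = q

      absurd : ⊥
      absurd = ih xs ys ws (l ⊙ ds) (l ℕ.* L) h′ Ut hxs (Weights-⊙ l wds) (Chain-⊙ l ds (Chain-mono ds E-≥₄ (tail-chain ds ch))) 0<lL
        (≤-trans (≤-reflexive (cong (λ z → E′ ℕ.* (h′ ℕ.+ z)) (sum-⊙ l ds))) (scaled-size {l} {d} {h} {Vec.sum ds} {L} {E} {E′} d≥1 l≤d+1 E-≥₂ size (m≤n+m _ d)))
        Ut-box (restrict-norm Vec.tail (λ X → δ (Vec.head X) nB) (λ X → δ-≤1 (Vec.head X) nB)) Ut≢0
        λ { (I′ , small , nU) → <⇒≱ (<-≤-trans (m<suc[m/n]*n Kv w) (≤-reflexive (ℕₚ.*-comm (suc (Kv / w)) w)))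
          (hx (l ℕ.* d) h′ (suc (Kv / w)) Vt Vt-box (restrict-norm Vec.head (λ X → δ (enc ds (Vec.tail X)) nA) (λ X → δ-≤1 (enc ds (Vec.tail X)) nA)) Vt≢0 (λ i′ lt → stable _ (λ nV →
            contradiction i′ I′ (≤-trans (*-monoʳ-≤ w (≤-pred lt)) (≤-trans (≤-reflexive (ℕₚ.*-comm w _)) (DM.m/n*n≤m Kv w)))
              (≤-trans (m≤n+m _ (dot ws I′)) small) nV nU))) }

  small-index-suc : ∀ m e → (∀ e′ → ∃ λ E → 1 ≤ E × SmallIndex m e′ E) → ∃ λ E → 1 ≤ E × SmallIndex (suc m) e E
  small-index-suc m e rec with rec (4 ℕ.* ((4 ℕ.* suc e) ℕ.* (4 ℕ.* suc e)))
  ... | E′ , _ , ih = E , ≤-trans (s≤s z≤n) (m≤m+n a (b ℕ.+ q)) , λ { (x ∷ xs) (y ∷ ys) (w ∷ ws) (d ∷ ds) L h p (hx ∷ hxs) (wd ∷ wds) ch pos size box nm p≢0 k →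
      let module Wr = Wronskian (record
            { e = e ; E′ = E′ ; ih = ih ; x = x ; y = y ; xs = xs ; ys = ys ; w = w ; ws = ws ; d = d ; ds = ds ; L = L ; h = h ; E = E ; p = p
            ; E-≥₁ = m≤m+n a _ ; E-≥₂ = ≤-trans (m≤m+n b q) (m≤n+m _ a) ; E-≥₃ = ≤-trans (m≤n+m q b) (m≤n+m _ a)
            ; E-≥₄ = ≤-trans (≤-trans (m≤n*m E′ 4) (m≤m+n b q)) (m≤n+m _ a)
            ; hx = hx ; hxs = hxs ; wd = wd ; wds = wds ; ch = ch ; 0<L = pos ; size = size ; box = box ; nm = nm ; p≢0 = p≢0
            ; vanish = λ I le → stable _ (λ nz → k (I , le , nz)) })
          module Δ = Decomposition (decompose d ds p box)
      in interpolate Δ.rank Δ.D Δ.κ Δ.D-distinct Δ.κ≢0 λ { (I , I-small , I-det) →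
         interpolate Δ.rank (λ a → Δ.e a ∷ []) Δ.κ′ (λ a b l l′ q → Δ.e-distinct a b l l′ (cong Vec.head q)) Δ.κ′≢0 λ { (J , J-small , J-det) →
         Wr.Chosen.absurd I I-small I-det J J-small J-det } } }
    where
    a = 4 ℕ.* suc e
    b = 4 ℕ.* E′
    q = 4 ℕ.* (4 ℕ.* ((4 ℕ.* suc e) ℕ.* (4 ℕ.* suc e))) ℕ.* κ₀
    E = a ℕ.+ (b ℕ.+ q)

  -- Roth's lemma.
  small-index : ∀ m e → ∃ λ E → 1 ≤ E × SmallIndex m e E
  small-index zero e = 1 , ≤-refl , small-index-0 e
  small-index (suc m) e = small-index-suc m e (small-index m)

-- Vanishing to order i at (x : y) forces divisibility by y^i, once a second point (p : q) is available.
module Divisibility (A : ℤ-Algebra)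
  (no-zero-divisors : ∀ x y → ℤ-Algebra._≈_ A (ℤ-Algebra._*_ A x y) (ℤ-Algebra.0# A) → ℤ-Algebra._≈_ A x (ℤ-Algebra.0# A) ⊎ ℤ-Algebra._≈_ A y (ℤ-Algebra.0# A))
  (x y p q : ℤ-Algebra.Carrier A) (y≢0 : ¬ (ℤ-Algebra._≈_ A y (ℤ-Algebra.0# A))) where
  open ℤ-Algebra A
  open Pairing A
  open Sum ring
  open Taylor A
  open import Relation.Binary.Reasoning.Setoid setoid
  open Solver A using (solve; _:=_; _:+_; _:*_; _:-_; :-_; con)

  Series : Set
  Series = ℕ → Carrier

  shift : Series → Series
  shift f zero = 0#
  shift f (suc k) = f k

  lin : Carrier → Carrier → Series → Series
  lin a b f k = a * f k + b * shift f k

  lin-cong : ∀ a b {f g : Series} → (∀ k → f k ≈ g k) → ∀ k → lin a b f k ≈ lin a b g k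
  lin-cong a b h zero = +-cong (*-congˡ (h 0)) refl
  lin-cong a b h (suc k) = +-cong (*-congˡ (h (suc k))) (*-congˡ (h k))

  ypow : ℕ → Series
  ypow zero zero = 1#
  ypow zero (suc k) = 0#
  ypow (suc e) = lin y q (ypow e)

  -- Coefficients in τ of (x + τ p)^j (y + τ q)^e.
  mono : ℕ → ℕ → Series
  mono zero e = ypow e
  mono (suc j) e = lin x p (mono j e)

  mono-deg : ∀ j e k → j ℕ.+ e < k → mono j e k ≈ 0#
  lin-deg : ∀ a b (f : Series) n → (∀ k → n < k → f k ≈ 0#) → ∀ k → suc n < k → lin a b f k ≈ 0#
  lin-deg a b f n h (suc k) (s≤s l) = trans (+-cong (trans (*-congˡ (h (suc k) (m<n⇒m<1+n l))) (zeroʳ a)) (trans (*-congˡ (h k l)) (zeroʳ b))) (+-identityˡ 0#)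
  mono-deg zero zero (suc k) l = refl
  mono-deg zero (suc e) k l = lin-deg y q (ypow e) e (mono-deg zero e) k l
  mono-deg (suc j) e k l = lin-deg x p (mono j e) (j ℕ.+ e) (mono-deg j e) k l

  lin-comm : ∀ a b c d f k → lin a b (lin c d f) k ≈ lin c d (lin a b f) k
  lin-comm a b c d f zero = trans (drop-0 b) (trans (*-congˡ (drop-0 d)) (trans (solve 3 (λ a c f → a :* (c :* f) := c :* (a :* f)) refl a c (f 0)) (trans (*-congˡ (sym (drop-0 b))) (sym (drop-0 d)))))
    where
    drop-0 : ∀ {u} w → u + w * 0# ≈ u
    drop-0 w = trans (+-congˡ (zeroʳ w)) (+-identityʳ _)
  lin-comm a b c d f (suc zero) = solve 7 (λ a b c d f g z → a :* (c :* f :+ d :* g) :+ b :* (c :* g :+ d :* z) := c :* (a :* f :+ b :* g) :+ d :* (a :* g :+ b :* z)) refl a b c d (f 1) (f 0) 0#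
  lin-comm a b c d f (suc (suc k)) = solve 7 (λ a b c d f g z → a :* (c :* f :+ d :* g) :+ b :* (c :* g :+ d :* z) := c :* (a :* f :+ b :* g) :+ d :* (a :* g :+ b :* z)) refl a b c d (f (suc (suc k))) (f (suc k)) (f k)

  mono-y : ∀ j e k → lin y q (mono j e) k ≈ mono j (suc e) k
  mono-y zero e k = refl
  mono-y (suc j) e k = trans (lin-comm y q x p (mono j e) k) (lin-cong x p (mono-y j e) k)

  s : Carrier
  s = p * y - q * x

  coef : ℕ → ℕ → Series
  coef zero n k = ypow n k
  coef (suc i) zero k = 0#
  coef (suc i) (suc n) zero = 0#
  coef (suc i) (suc n) (suc k) = s * coef i n k

  mono-step : ∀ j e k → y ↑ suc j * mono (suc j) e k ≈ x * (y ↑ j * mono j (suc e) k) + s * (y ↑ j * shift (mono j e) k)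
  mono-step j e k = begin
    (y * Y) * (x * f + p * g) ≈⟨ solve 7 (λ x y p q Y f g → (y :* Y) :* (x :* f :+ p :* g) := x :* (Y :* (y :* f :+ q :* g)) :+ (p :* y :- q :* x) :* (Y :* g)) refl x y p q Y f g ⟩
    x * (Y * (y * f + q * g)) + s * (Y * g) ≈⟨ +-congʳ (*-congˡ (*-congˡ (mono-y j e k))) ⟩
    _ ∎
    where
    Y = y ↑ j
    f = mono j e k
    g = shift (mono j e) k

  mono-taylor : ∀ j e k → y ↑ j * mono j e k ≈ sum (suc k) (λ i → taylor x i j * coef i (j ℕ.+ e) k)
  mono-taylor zero e k = sym (trans (+-congˡ (sum-0 k (λ i _ → zeroˡ _))) (+-identityʳ _))
  mono-taylor (suc j) e k = trans (mono-step j e k) (trans (+-congʳ (*-congˡ (trans (mono-taylor j (suc e) k) (reflexive (cong (λ n → sum (suc k) (λ i → taylor x i j * coef i n k)) (+-suc j e)))))) (go k))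
    where
    n = j ℕ.+ e
    T = λ i → taylor x i j
    go : ∀ k → x * sum (suc k) (λ i → T i * coef i (suc n) k) + s * (y ↑ j * shift (mono j e) k) ≈ sum (suc k) (λ i → taylor x i (suc j) * coef i (suc n) k)
    go zero = trans (+-cong (trans (*-congˡ (+-identityʳ _)) (sym (*-assoc x _ _))) (trans (*-congˡ (zeroʳ _)) (zeroʳ s))) refl
    go (suc k) = begin
      x * (T 0 * coef 0 (suc n) (suc k) + sum (suc k) (λ i → T (suc i) * (s * coef i n k))) + s * (y ↑ j * mono j e k)
        ≈⟨ +-cong (trans (distribˡ x _ _) (+-cong (sym (*-assoc x _ _)) (sym (sum-*ˡ (suc k) x (λ i → T (suc i) * (s * coef i n k))))))
                  (trans (*-congˡ (mono-taylor j e k)) (sym (sum-*ˡ (suc k) s (λ i → T i * coef i n k)))) ⟩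
      x * T 0 * coef 0 (suc n) (suc k) + sum (suc k) (λ i → x * (T (suc i) * (s * coef i n k))) + sum (suc k) (λ i → s * (T i * coef i n k))
        ≈⟨ trans (+-assoc _ _ _) (+-congˡ (sym (sum-+ (suc k) (λ i → x * (T (suc i) * (s * coef i n k))) (λ i → s * (T i * coef i n k))))) ⟩
      x * T 0 * coef 0 (suc n) (suc k) + sum (suc k) (λ i → x * (T (suc i) * (s * coef i n k)) + s * (T i * coef i n k))
        ≈⟨ +-congˡ (sum-cong (suc k) (λ i _ → solve 5 (λ x s t u c → x :* (t :* (s :* c)) :+ s :* (u :* c) := (x :* t :+ u) :* (s :* c)) refl x s (T (suc i)) (T i) (coef i n k))) ⟩
      _ ∎

  module _ (σ τ : Carrier) where
    ev : ℕ → Series → Carrier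
    ev zero f = f 0
    ev (suc n) f = σ ↑ suc n * f 0 + τ * ev n (λ k → f (suc k))

    ev-lin : ∀ n a b (f g : Series) → ev n (λ k → a * f k + b * g k) ≈ a * ev n f + b * ev n g
    ev-lin zero a b f g = refl
    ev-lin (suc n) a b f g = trans (+-congˡ (*-congˡ (ev-lin n a b _ _)))
      (solve 8 (λ S τ a b f g F G → S :* (a :* f :+ b :* g) :+ τ :* (a :* F :+ b :* G) := a :* (S :* f :+ τ :* F) :+ b :* (S :* g :+ τ :* G)) refl
        (σ ↑ suc n) τ a b (f 0) (g 0) (ev n (λ k → f (suc k))) (ev n (λ k → g (suc k))))

    ev-top : ∀ n f → ev (suc n) f ≈ σ * ev n f + τ ↑ suc n * f (suc n)
    ev-top zero f = +-cong (*-congʳ (*-identityʳ σ)) (*-congʳ (sym (*-identityʳ τ)))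
    ev-top (suc n) f = trans (+-congˡ (*-congˡ (ev-top n (λ k → f (suc k)))))
      (solve 7 (λ σ τ S T f F g → σ :* S :* f :+ τ :* (σ :* F :+ T :* g) := σ :* (S :* f :+ τ :* F) :+ τ :* T :* g) refl σ τ (σ ↑ suc n) (τ ↑ suc n) (f 0) (ev n (λ k → f (suc k))) (f (suc (suc n))))

    ev-shift : ∀ n f → ev (suc n) (shift f) ≈ τ * ev n f
    ev-shift n f = trans (+-congʳ (zeroʳ _)) (+-identityˡ _)

    ev-step : ∀ n a b f → f (suc n) ≈ 0# → ev (suc n) (lin a b f) ≈ (σ * a + τ * b) * ev n f
    ev-step n a b f z = begin
      ev (suc n) (lin a b f) ≈⟨ ev-lin (suc n) a b f (shift f) ⟩
      a * ev (suc n) f + b * ev (suc n) (shift f) ≈⟨ +-cong (*-congˡ (trans (ev-top n f) (trans (+-congˡ (trans (*-congˡ z) (zeroʳ _))) (+-identityʳ _)))) (*-congˡ (ev-shift n f)) ⟩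
      a * (σ * ev n f) + b * (τ * ev n f) ≈⟨ solve 5 (λ a b σ τ f → a :* (σ :* f) :+ b :* (τ :* f) := (σ :* a :+ τ :* b) :* f) refl a b σ τ (ev n f) ⟩
      _ ∎

    ev-mono : ∀ j e → ev (j ℕ.+ e) (mono j e) ≈ (σ * x + τ * p) ↑ j * (σ * y + τ * q) ↑ e
    ev-mono zero zero = sym (*-identityˡ 1#)
    ev-mono zero (suc e) = trans (ev-step e y q (ypow e) (mono-deg zero e (suc e) ≤-refl)) (trans (*-congˡ (trans (ev-mono zero e) (*-identityˡ _))) (sym (*-identityˡ _)))
    ev-mono (suc j) e = trans (ev-step (j ℕ.+ e) x p (mono j e) (mono-deg j e _ ≤-refl)) (trans (*-congˡ (ev-mono j e)) (sym (*-assoc _ _ _)))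

    ev-pair : ∀ n (P : Meas ℕ) (f : ℕ → Series) → ev n (λ k → ⟨ P , (λ j → f j k) ⟩) ≈ ⟨ P , (λ j → ev n (f j)) ⟩
    ev-pair zero P f = refl
    ev-pair (suc n) P f = sym (trans (pair-+ P _ _) (+-cong (pair-* P (σ ↑ suc n) (λ j → f j 0)) (trans (pair-* P τ _) (*-congˡ (sym (ev-pair n P (λ j k → f j (suc k))))))))

    ev-divisible : ∀ i n f → (∀ k → k < i → f k ≈ 0#) → ∃ λ Z → ev n f ≈ τ ↑ i * Z
    ev-divisible zero n f h = ev n f , sym (*-identityˡ _)
    ev-divisible (suc i) zero f h = 0# , trans (h 0 (s≤s z≤n)) (sym (zeroʳ _))
    ev-divisible (suc i) (suc n) f h with ev-divisible i n (λ k → f (suc k)) (λ k l → h (suc k) (s≤s l))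
    ... | Z , e = Z , trans (+-cong (trans (*-congˡ (h 0 (s≤s z≤n))) (zeroʳ _)) (*-congˡ e)) (trans (+-identityˡ _) (sym (*-assoc _ _ _)))

  ↑-nonzero : ∀ n z → y ↑ n * z ≈ 0# → z ≈ 0#
  ↑-nonzero zero z h = trans (sym (*-identityˡ z)) h
  ↑-nonzero (suc n) z h with no-zero-divisors y (y ↑ n * z) (trans (sym (*-assoc _ _ _)) h)
  ... | inj₁ e = ⊥-elim (y≢0 e)
  ... | inj₂ e = ↑-nonzero n z e

  module _ (d : ℕ) (P : Meas ℕ) (box : Support (_≤ d) P) (i₀ : ℕ)
    (vanish : ∀ i → i < i₀ → ⟨ P , (λ j → taylor x i j * y ↑ (d ∸ j)) ⟩ ≈ 0#) where

    mono-vanish : ∀ k → k < i₀ → ⟨ P , (λ j → mono j (d ∸ j) k) ⟩ ≈ 0#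
    mono-vanish k k<i = ↑-nonzero d _ (begin
      y ↑ d * ⟨ P , (λ j → mono j (d ∸ j) k) ⟩ ≈⟨ sym (pair-* P (y ↑ d) _) ⟩
      ⟨ P , (λ j → y ↑ d * mono j (d ∸ j) k) ⟩ ≈⟨ pair-congOn (λ j l → trans (*-congʳ (trans (reflexive (cong (y ↑_) (P.sym (m∸n+n≡m l)))) (↑-+ y (d ∸ j) j)))
          (trans (*-assoc _ _ _) (trans (*-congˡ (trans (mono-taylor j (d ∸ j) k) (reflexive (cong (λ n → sum (suc k) (λ i → taylor x i j * coef i n k)) (m+[n∸m]≡n l)))))
            (trans (sym (sum-*ˡ (suc k) (y ↑ (d ∸ j)) (λ i → taylor x i j * coef i d k))) (sum-cong (suc k) {λ i → y ↑ (d ∸ j) * (taylor x i j * coef i d k)} {λ i → (taylor x i j * y ↑ (d ∸ j)) * coef i d k} (λ i _ → trans (sym (*-assoc (y ↑ (d ∸ j)) (taylor x i j) (coef i d k))) (*-congʳ (*-comm _ _)))))))) box ⟩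
      ⟨ P , (λ j → sum (suc k) (λ i → (taylor x i j * y ↑ (d ∸ j)) * coef i d k)) ⟩ ≈⟨ pair-sum P (suc k) (λ i j → (taylor x i j * y ↑ (d ∸ j)) * coef i d k) ⟩
      sum (suc k) (λ i → ⟨ P , (λ j → (taylor x i j * y ↑ (d ∸ j)) * coef i d k) ⟩)
        ≈⟨ sum-0 (suc k) {λ i → ⟨ P , (λ j → (taylor x i j * y ↑ (d ∸ j)) * coef i d k) ⟩} (λ i l → trans (pair-*ʳ P (coef i d k) _) (trans (*-congʳ (vanish i (≤-trans l k<i))) (zeroˡ _))) ⟩
      0# ∎)

    leading-divisible : ∃ λ Z → ι ⟪ P , (λ j → δ j d) ⟫ * (q * x - y * p) ↑ d ≈ (- y) ↑ i₀ * Z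
    leading-divisible with ev-divisible q (- y) i₀ d (λ k → ⟨ P , (λ j → mono j (d ∸ j) k) ⟩) mono-vanish
    ... | Z , e = Z , trans (sym (begin
      ev q (- y) d (λ k → ⟨ P , (λ j → mono j (d ∸ j) k) ⟩) ≈⟨ ev-pair q (- y) d P (λ j → mono j (d ∸ j)) ⟩
      ⟨ P , (λ j → ev q (- y) d (mono j (d ∸ j))) ⟩ ≈⟨ pair-congOn (λ j l → trans (reflexive (cong (λ n → ev q (- y) n (mono j (d ∸ j))) (P.sym (m+[n∸m]≡n l)))) (trans (ev-mono q (- y) j (d ∸ j)) (point j l))) box ⟩
      ⟨ P , (λ j → ι (δ j d) * r ↑ d) ⟩ ≈⟨ pair-*ʳ P (r ↑ d) (λ j → ι (δ j d)) ⟩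
      ⟨ P , (λ j → ι (δ j d)) ⟩ * r ↑ d ≈⟨ *-congʳ (pair-ι A P (λ j → δ j d)) ⟩
      ι ⟪ P , (λ j → δ j d) ⟫ * r ↑ d ∎)) e
      where
      r = q * x - y * p
      r₁ : q * x + (- y) * p ≈ r
      r₁ = solve 4 (λ x y p q → q :* x :+ (:- y) :* p := q :* x :- y :* p) refl x y p q
      r₂ : q * y + (- y) * q ≈ 0#
      r₂ = trans (solve 2 (λ y q → q :* y :+ (:- y) :* q := q :* y :- q :* y) refl y q) (-‿inverseʳ _)
      point : ∀ j → j ≤ d → (q * x + (- y) * p) ↑ j * (q * y + (- y) * q) ↑ (d ∸ j) ≈ ι (δ j d) * r ↑ d
      point j l with j ℕ.≟ d
      ... | yes P.refl = trans (*-cong (↑-cong r₁ j) (reflexive (cong ((q * y + (- y) * q) ↑_) (n∸n≡0 j)))) (trans (*-comm _ _) (*-congʳ (sym ι-1)))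
      ... | no ne = trans (*-congˡ (zero-pow (d ∸ j) (m<n⇒0<n∸m (≤∧≢⇒< l ne)))) (trans (zeroʳ _) (sym (trans (*-congʳ ι-0) (zeroˡ _))))
        where
        zero-pow : ∀ n → 0 < n → (q * y + (- y) * q) ↑ n ≈ 0#
        zero-pow (suc n) _ = trans (*-congʳ r₂) (zeroˡ _)

boxSize : ∀ {m} → Exp m → ℕ
boxSize [] = 1
boxSize (d ∷ ds) = suc d ℕ.* boxSize ds

enc-< : ∀ {m} {d J : Exp m} → J ⊑ᵛ d → enc d J < boxSize d
enc-< [] = s≤s z≤n
enc-< {d = d ∷ ds} {j ∷ J} (l ∷ ls) = ≤-trans (+-monoˡ-≤ (suc d ℕ.* enc ds J) (s≤s l))
  (≤-trans (≤-reflexive (P.sym (*-suc (suc d) (enc ds J)))) (*-monoʳ-≤ (suc d) (enc-< ls)))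

enc-dec : ∀ {m} (d : Exp m) n → n < boxSize d → enc d (dec d n) ≡ n
enc-dec [] zero h = P.refl
enc-dec [] (suc n) (s≤s ())
enc-dec (d ∷ ds) n h = P.trans (cong (λ k → n % suc d ℕ.+ suc d ℕ.* k) (enc-dec ds (n / suc d) (DM.m<n*o⇒m/o<n (<-≤-trans h (≤-reflexive (ℕₚ.*-comm (suc d) _))))))
  (P.trans (cong (n % suc d ℕ.+_) (ℕₚ.*-comm (suc d) (n / suc d))) (P.sym (DM.m≡m%n+[m/n]*n n (suc d))))

boxSize-replicate : ∀ n x → boxSize (replicate n x) ≡ suc x ^ n
boxSize-replicate zero x = P.refl
boxSize-replicate (suc n) x = cong (suc x ℕ.*_) (boxSize-replicate n x)

at : ∀ {n} → Vec ℕ n → ℕ → ℕ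
at [] i = 0
at (x ∷ xs) zero = x
at (x ∷ xs) (suc i) = at xs i

at-≤ : ∀ {n x} {v : Vec ℕ n} → v ⊑ᵛ replicate n x → ∀ i → at v i ≤ x
at-≤ [] i = z≤n
at-≤ (l ∷ ls) zero = l
at-≤ (l ∷ ls) (suc i) = at-≤ ls i

at-ext : ∀ {n} (u v : Vec ℕ n) → (∀ i → i < n → at u i ≡ at v i) → u ≡ v
at-ext [] [] h = P.refl
at-ext (x ∷ u) (y ∷ v) h = cong₂ _∷_ (h 0 (s≤s z≤n)) (at-ext u v (λ i l → h (suc i) (s≤s l)))

build : ∀ n → (ℕ → ℕ) → Vec ℕ n
build zero f = []
build (suc n) f = f 0 ∷ build n (λ i → f (suc i))

at-build : ∀ n f i → i < n → at (build n f) i ≡ f i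
at-build (suc n) f zero l = P.refl
at-build (suc n) f (suc i) (s≤s l) = at-build n _ i l

build-⊑ : ∀ n {f x} → (∀ i → i < n → f i ≤ x) → build n f ⊑ᵛ replicate n x
build-⊑ zero h = []
build-⊑ (suc n) h = h 0 (s≤s z≤n) ∷ build-⊑ n (λ i l → h (suc i) (s≤s l))

sum-abs : ∀ n {f : ℕ → ℤ} {B} → (∀ i → i < n → ∣ f i ∣ ≤ B) → ∣ 𝕊.sum n f ∣ ≤ n ℕ.* B
sum-abs zero h = z≤n
sum-abs (suc n) {f} h = ≤-trans (∣i+j∣≤∣i∣+∣j∣ (f 0) _) (+-mono-≤ (h 0 (s≤s z≤n)) (sum-abs n (λ i l → h (suc i) (s≤s l))))

0≤shifted : ∀ z b → ∣ z ∣ ≤ b → + ∣ z ℤ.+ + b ∣ ≡ z ℤ.+ + b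
0≤shifted (+ n) b h = P.refl
0≤shifted ℤ.-[1+ n ] b h = ℤₚ.0≤i⇒+∣i∣≡i (subst (0ℤ ℤ.≤_) (P.sym (ℤₚ.⊖-≥ h)) (ℤ.+≤+ z≤n))

search : ∀ {P Q : ℕ → Set} n → (∀ i → i < n → P i ⊎ Q i) → (∃ λ i → i < n × P i) ⊎ (∀ i → i < n → Q i)
search zero h = inj₂ (λ _ ())
search (suc n) h with h n ≤-refl | search n (λ i l → h i (m<n⇒m<1+n l))
... | inj₁ p | _ = inj₁ (n , ≤-refl , p)
... | inj₂ q | inj₁ (i , l , p) = inj₁ (i , m<n⇒m<1+n l , p)
... | inj₂ q | inj₂ qs = inj₂ (λ i l → [ (λ l′ → qs i l′) , (λ { P.refl → q }) ]′ (m≤n⇒m<n∨m≡n (≤-pred l)))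

power-gap : ∀ M N X → 1 ≤ X → 1 ≤ N → M ℕ.+ M ≤ N → suc (X ℕ.* X) ^ M < suc X ^ N
power-gap M N X X≥1 N≥1 h with M ℕ.≟ 0
... | yes P.refl = <-≤-trans (s≤s X≥1) (≤-trans (≤-reflexive (P.sym (ℕₚ.*-identityʳ (suc X)))) (^-monoʳ-≤ (suc X) N≥1))
... | no ne = <-≤-trans (^-monoˡ-< M {{ℕ.≢-nonZero ne}} gap) (≤-trans (≤-reflexive eq) (^-monoʳ-≤ (suc X) h))
  where
  gap : suc (X ℕ.* X) < suc X ℕ.* suc X
  gap = s≤s (≤-trans (+-mono-≤ X≥1 (*-monoʳ-≤ X (n≤1+n X))) ≤-refl)
  eq : (suc X ℕ.* suc X) ^ M ≡ suc X ^ (M ℕ.+ M)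
  eq = P.trans (^-dist M) (P.sym (^-distribˡ-+-* (suc X) M M))
    where
    open +-*-Solver
    ^-dist : ∀ M → (suc X ℕ.* suc X) ^ M ≡ suc X ^ M ℕ.* suc X ^ M
    ^-dist zero = P.refl
    ^-dist (suc M) = P.trans (cong (suc X ℕ.* suc X ℕ.*_) (^-dist M)) (solve 2 (λ a b → a :* a :* (b :* b) := a :* b :* (a :* b)) P.refl (suc X) (suc X ^ M))

module SiegelBox (M N B : ℕ) (A : ℕ → ℕ → ℤ) (N≥1 : 1 ≤ N) (B≥1 : 1 ≤ B) (MN : M ℕ.+ M ≤ N)
  (bound : ∀ i j → i < M → j < N → ∣ A i j ∣ ≤ B) where
  X = 2 ℕ.* (N ℕ.* B)
  dX = replicate N X
  Y = N ℕ.* (B ℕ.* X)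
  dY = replicate M (Y ℕ.+ Y)
  gap : boxSize dY < boxSize dX
  gap = subst₂ _<_ (P.sym (P.trans (boxSize-replicate M (Y ℕ.+ Y)) (cong (λ k → suc k ^ M) (solve 3 (λ N B X → N :* (B :* X) :+ N :* (B :* X) := con 2 :* (N :* B) :* X) P.refl N B X)))) (P.sym (boxSize-replicate N X))
    (power-gap M N X (≤-trans (s≤s z≤n) (*-monoʳ-≤ 2 (*-mono-≤ N≥1 B≥1))) N≥1 MN)
    where open +-*-Solver
  value : ℕ → ℕ → ℤ
  value n i = 𝕊.sum N (λ j → A i j ℤ.* + at (dec dX n) j)
  code : ℕ → Vec ℕ M
  code n = build M (λ i → ∣ value n i ℤ.+ + Y ∣)
  value-≤ : ∀ n i → i < M → ∣ value n i ∣ ≤ Y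
  value-≤ n i l = sum-abs N (λ j lj → ≤-trans (≤-reflexive (abs-* (A i j) _)) (*-mono-≤ (bound i j l lj) (at-≤ (dec-⊑ dX n) j)))
  code-⊑ : ∀ n → code n ⊑ᵛ dY
  code-⊑ n = build-⊑ M (λ i l → ≤-trans (∣i+j∣≤∣i∣+∣j∣ (value n i) (+ Y)) (+-monoˡ-≤ Y (value-≤ n i l)))
  box : Fin (boxSize dX) → Fin (boxSize dY)
  box n = Fin.fromℕ< (enc-< (code-⊑ (toℕ n)))

siegel : ∀ M N B (A : ℕ → ℕ → ℤ) → 1 ≤ N → 1 ≤ B → M ℕ.+ M ≤ N → (∀ i j → i < M → j < N → ∣ A i j ∣ ≤ B) →
  ∃ λ (x : ℕ → ℤ) → (∀ j → ∣ x j ∣ ≤ 2 ℕ.* (N ℕ.* B)) × (∃ λ j → j < N × x j ≢ 0ℤ) × (∀ i → i < M → 𝕊.sum N (λ j → A i j ℤ.* x j) ≡ 0ℤ)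
siegel M N B A N≥1 B≥1 MN bound with Finₚ.pigeonhole (SiegelBox.gap M N B A N≥1 B≥1 MN bound) (SiegelBox.box M N B A N≥1 B≥1 MN bound)
... | i₁ , i₂ , lt , same-box = x , x-≤ , nonzero , solves
  where
  open SiegelBox M N B A N≥1 B≥1 MN bound
  n₁ = toℕ i₁
  n₂ = toℕ i₂
  same-code : code n₁ ≡ code n₂
  same-code = P.trans (P.sym (dec-enc (code-⊑ n₁))) (P.trans (cong (dec dY) (P.trans (P.sym (Finₚ.toℕ-fromℕ< _)) (P.trans (cong toℕ same-box) (Finₚ.toℕ-fromℕ< _)))) (dec-enc (code-⊑ n₂)))
  a₁ a₂ : ℕ → ℕ
  a₁ = at (dec dX n₁)
  a₂ = at (dec dX n₂)
  x : ℕ → ℤ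
  x j = + a₁ j ℤ.- + a₂ j
  x-≤ : ∀ j → ∣ x j ∣ ≤ X
  x-≤ j = ≤-trans (≤-reflexive (cong ∣_∣ (ℤₚ.m-n≡m⊖n (a₁ j) (a₂ j)))) (≤-trans (ℤₚ.∣m⊝n∣≤m⊔n (a₁ j) (a₂ j)) (⊔-lub (at-≤ (dec-⊑ dX n₁) j) (at-≤ (dec-⊑ dX n₂) j)))
  nonzero : ∃ λ j → j < N × x j ≢ 0ℤ
  nonzero with search {λ j → x j ≢ 0ℤ} {λ j → a₁ j ≡ a₂ j} N (λ j _ → test j)
    where
    test : ∀ j → x j ≢ 0ℤ ⊎ a₁ j ≡ a₂ j
    test j with a₁ j ℕ.≟ a₂ j
    ... | yes e = inj₂ e
    ... | no ne = inj₁ (λ z → ne (ℤₚ.+-injective (ℤₚ.i-j≡0⇒i≡j _ _ z)))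
  ... | inj₁ r = r
  ... | inj₂ q = ⊥-elim (<⇒≢ lt (P.trans (P.sym (enc-dec dX n₁ (Finₚ.toℕ<n i₁))) (P.trans (cong (enc dX) (at-ext _ _ q)) (enc-dec dX n₂ (Finₚ.toℕ<n i₂)))))
  solves : ∀ i → i < M → 𝕊.sum N (λ j → A i j ℤ.* x j) ≡ 0ℤ
  solves i l = P.trans (𝕊.sum-cong N {λ j → A i j ℤ.* x j} {λ j → A i j ℤ.* + a₁ j ℤ.+ ℤ.-1ℤ ℤ.* (A i j ℤ.* + a₂ j)} (λ j _ → S.solve 3 (λ A a b → A S.:* (a S.:- b) S.:= A S.:* a S.:+ S.con ℤ.-1ℤ S.:* (A S.:* b)) P.refl (A i j) (+ a₁ j) (+ a₂ j)))
    (P.trans (𝕊.sum-+ N (λ j → A i j ℤ.* + a₁ j) (λ j → ℤ.-1ℤ ℤ.* (A i j ℤ.* + a₂ j))) (P.trans (cong₂ ℤ._+_ same-value (𝕊.sum-*ˡ N ℤ.-1ℤ (λ j → A i j ℤ.* + a₂ j)))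
      (S.solve 1 (λ v → v S.:+ S.con ℤ.-1ℤ S.:* v S.:= S.con 0ℤ) P.refl (value n₂ i))))
    where
    shifted : ∀ n → at (code n) i ≡ ∣ value n i ℤ.+ + Y ∣
    shifted n = at-build M _ i l
    same-value : value n₁ i ≡ value n₂ i
    same-value = ℤ-cancelʳ (+ Y) (value n₁ i) (value n₂ i) (P.trans (P.sym (0≤shifted (value n₁ i) Y (value-≤ n₁ i l))) (P.trans (cong +_ (P.trans (P.sym (shifted n₁)) (P.trans (cong (λ v → at v i) same-code) (shifted n₂)))) (0≤shifted (value n₂ i) Y (value-≤ n₂ i l))))

sum-append : ∀ m n (f : ℕ → ℤ) → 𝕊.sum (m ℕ.+ n) f ≡ 𝕊.sum m f ℤ.+ 𝕊.sum n (λ i → f (m ℕ.+ i))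
sum-append zero n f = P.sym (ℤₚ.+-identityˡ _)
sum-append (suc m) n f = P.trans (cong (λ z → f 0 ℤ.+ z) (sum-append m n (λ i → f (suc i)))) (P.sym (ℤₚ.+-assoc (f 0) _ _))

sum-digits : ∀ a b (f : ℕ → ℤ) → 𝕊.sum (a ℕ.* b) f ≡ 𝕊.sum b (λ n → 𝕊.sum a (λ j → f (j ℕ.+ a ℕ.* n)))
sum-digits a zero f = cong (λ k → 𝕊.sum k f) (ℕₚ.*-zeroʳ a)
sum-digits a (suc b) f = P.trans (cong (λ k → 𝕊.sum k f) (*-suc a b)) (P.trans (sum-append a (a ℕ.* b) f) (cong₂ ℤ._+_
  (𝕊.sum-cong a {f} {λ j → f (j ℕ.+ a ℕ.* 0)} (λ j _ → cong f (P.sym (P.trans (cong (j ℕ.+_) (ℕₚ.*-zeroʳ a)) (ℕₚ.+-identityʳ j)))))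
  (P.trans (sum-digits a b (λ i → f (a ℕ.+ i))) (𝕊.sum-cong b {λ n → 𝕊.sum a (λ j → f (a ℕ.+ (j ℕ.+ a ℕ.* n)))} {λ n → 𝕊.sum a (λ j → f (j ℕ.+ a ℕ.* suc n))} (λ n _ →
    𝕊.sum-cong a {λ j → f (a ℕ.+ (j ℕ.+ a ℕ.* n))} {λ j → f (j ℕ.+ a ℕ.* suc n)} (λ j _ → cong f (solve 3 (λ a j n → a :+ (j :+ a :* n) := j :+ a :* (con 1 :+ n)) P.refl a j n)))))))
  where open +-*-Solver

sumBox : ∀ {m} → Exp m → (Exp m → ℤ) → ℤ
sumBox r f = 𝕊.sum (boxSize r) (λ n → f (dec r n))

sumBox-∷ : ∀ {m} r (rs : Exp m) f → sumBox (r ∷ rs) f ≡ sumBox rs (λ J → 𝕊.sum (suc r) (λ j → f (j ∷ J)))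
sumBox-∷ r rs f = P.trans (sum-digits (suc r) (boxSize rs) (λ n → f (dec (r ∷ rs) n)))
  (𝕊.sum-cong (boxSize rs) {λ n → 𝕊.sum (suc r) (λ j → f (dec (r ∷ rs) (j ℕ.+ suc r ℕ.* n)))} {λ n → 𝕊.sum (suc r) (λ j → f (j ∷ dec rs n))} (λ n _ →
    𝕊.sum-cong (suc r) {λ j → f (dec (r ∷ rs) (j ℕ.+ suc r ℕ.* n))} {λ j → f (j ∷ dec rs n)} (λ j l → cong f (dec-digit r rs j n (≤-pred l)))))

spread₁ : ℕ → ℕ → ℕ → ℤ
spread₁ w r j = + w ℤ.* (+ r ℤ.- + 2 ℤ.* + j)

-- Twice the deviation of the weighted degree from its mean over the box.
spread : ∀ {m} → Vec ℕ m → Exp m → Exp m → ℤ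
spread [] [] [] = 0ℤ
spread (w ∷ ws) (r ∷ rs) (j ∷ J) = spread₁ w r j ℤ.+ spread ws rs J

sum-const : ∀ n c → 𝕊.sum n (λ _ → c) ≡ + n ℤ.* c
sum-const zero c = P.refl
sum-const (suc n) c = P.trans (cong (λ z → c ℤ.+ z) (sum-const n c)) (S.solve 2 (λ n c → c S.:+ n S.:* c S.:= (S.con 1ℤ S.:+ n) S.:* c) P.refl (+ n) c)

mean₁ : ∀ w r → 𝕊.sum (suc r) (spread₁ w r) ≡ 0ℤ
mean₁ w r = P.trans (go (suc r)) (S.solve 2 (λ w r → w S.:* ((S.con 1ℤ S.:+ r) S.:* (r S.:- (S.con 1ℤ S.:+ r S.:- S.con 1ℤ))) S.:= S.con 0ℤ) P.refl (+ w) (+ r))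
  where
  go : ∀ n → 𝕊.sum n (spread₁ w r) ≡ + w ℤ.* (+ n ℤ.* (+ r ℤ.- (+ n ℤ.- 1ℤ)))
  go zero = P.sym (ℤₚ.*-zeroʳ (+ w))
  go (suc n) = P.trans (𝕊.sum-last n (spread₁ w r)) (P.trans (cong (ℤ._+ spread₁ w r n) (go n))
    (S.solve 3 (λ w r n → w S.:* (n S.:* (r S.:- (n S.:- S.con 1ℤ))) S.:+ w S.:* (r S.:- S.con (+ 2) S.:* n) S.:= w S.:* ((S.con 1ℤ S.:+ n) S.:* (r S.:- (S.con 1ℤ S.:+ n S.:- S.con 1ℤ)))) P.refl (+ w) (+ r) (+ n)))

square₁ : ℕ → ℕ → ℤ
square₁ w r = 𝕊.sum (suc r) (λ j → spread₁ w r j ℤ.* spread₁ w r j)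

variance-∷ : ∀ {m} w r (ws rs : Exp m) → sumBox (r ∷ rs) (λ J → spread (w ∷ ws) (r ∷ rs) J ℤ.* spread (w ∷ ws) (r ∷ rs) J)
  ≡ + boxSize rs ℤ.* square₁ w r ℤ.+ + suc r ℤ.* sumBox rs (λ J → spread ws rs J ℤ.* spread ws rs J)
variance-∷ w r ws rs = P.trans (sumBox-∷ r rs (λ J → spread (w ∷ ws) (r ∷ rs) J ℤ.* spread (w ∷ ws) (r ∷ rs) J)) (P.trans
  (𝕊.sum-cong (boxSize rs) {λ n → 𝕊.sum (suc r) (λ j → (u j ℤ.+ v n) ℤ.* (u j ℤ.+ v n))} {λ n → square₁ w r ℤ.+ + suc r ℤ.* (v n ℤ.* v n)} (λ n _ → inner (v n)))
  (P.trans (𝕊.sum-+ (boxSize rs) (λ _ → square₁ w r) (λ n → + suc r ℤ.* (v n ℤ.* v n)))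
    (cong₂ ℤ._+_ (sum-const (boxSize rs) (square₁ w r)) (𝕊.sum-*ˡ (boxSize rs) (+ suc r) (λ n → v n ℤ.* v n)))))
  where
  u = spread₁ w r
  v : ℕ → ℤ
  v n = spread ws rs (dec rs n)
  inner : ∀ t → 𝕊.sum (suc r) (λ j → (u j ℤ.+ t) ℤ.* (u j ℤ.+ t)) ≡ square₁ w r ℤ.+ + suc r ℤ.* (t ℤ.* t)
  inner t = P.trans (𝕊.sum-cong (suc r) {λ j → (u j ℤ.+ t) ℤ.* (u j ℤ.+ t)} {λ j → u j ℤ.* u j ℤ.+ (+ 2 ℤ.* t ℤ.* u j ℤ.+ t ℤ.* t)} (λ j _ →
      S.solve 2 (λ u t → (u S.:+ t) S.:* (u S.:+ t) S.:= u S.:* u S.:+ (S.con (+ 2) S.:* t S.:* u S.:+ t S.:* t)) P.refl (u j) t))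
    (P.trans (𝕊.sum-+ (suc r) (λ j → u j ℤ.* u j) (λ j → + 2 ℤ.* t ℤ.* u j ℤ.+ t ℤ.* t)) (cong (λ z → square₁ w r ℤ.+ z)
      (P.trans (𝕊.sum-+ (suc r) (λ j → + 2 ℤ.* t ℤ.* u j) (λ _ → t ℤ.* t)) (P.trans (cong₂ ℤ._+_
        (P.trans (𝕊.sum-*ˡ (suc r) (+ 2 ℤ.* t) u) (P.trans (cong (+ 2 ℤ.* t ℤ.*_) (mean₁ w r)) (ℤₚ.*-zeroʳ (+ 2 ℤ.* t)))) (sum-const (suc r) (t ℤ.* t))) (ℤₚ.+-identityˡ _)))))

sum-mono : ∀ n {f g : ℕ → ℤ} → (∀ i → i < n → f i ℤ.≤ g i) → 𝕊.sum n f ℤ.≤ 𝕊.sum n g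
sum-mono zero h = ℤₚ.≤-refl
sum-mono (suc n) h = ℤₚ.+-mono-≤ (h 0 (s≤s z≤n)) (sum-mono n (λ i l → h (suc i) (s≤s l)))

square-abs : ∀ z → z ℤ.* z ≡ + (∣ z ∣ ℕ.* ∣ z ∣)
square-abs (+ n) = P.sym (pos-* n n)
square-abs ℤ.-[1+ n ] = P.refl

square-≤ : ∀ z L → ∣ z ∣ ≤ L → z ℤ.* z ℤ.≤ + (L ℕ.* L)
square-≤ z L h = subst (ℤ._≤ + (L ℕ.* L)) (P.sym (square-abs z)) (ℤ.+≤+ (*-mono-≤ h h))

spread₁-≤ : ∀ w r j → j ≤ r → ∣ spread₁ w r j ∣ ≤ w ℕ.* r
spread₁-≤ w r j l = ≤-trans (≤-reflexive (abs-* (+ w) _)) (*-monoʳ-≤ w (≤-trans (≤-reflexive (cong ∣_∣ eq))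
  (≤-trans (∣i+j∣≤∣i∣+∣j∣ (+ (r ∸ j)) (ℤ.- + j)) (≤-trans (≤-reflexive (cong (r ∸ j ℕ.+_) (∣-i∣≡∣i∣ (+ j)))) (≤-reflexive (m∸n+n≡m l))))))
  where
  eq : + r ℤ.- + 2 ℤ.* + j ≡ + (r ∸ j) ℤ.- + j
  eq = P.trans (cong (λ k → + k ℤ.- + 2 ℤ.* + j) (P.sym (m∸n+n≡m l))) (S.solve 2 (λ a j → a S.:+ j S.:- S.con (+ 2) S.:* j S.:= a S.:- j) P.refl (+ (r ∸ j)) (+ j))

variance : ∀ {m L} {w r : Exp m} → Weights L w r → sumBox r (λ J → spread w r J ℤ.* spread w r J) ℤ.≤ + (boxSize r ℕ.* (m ℕ.* (L ℕ.* L)))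
variance [] = ℤ.+≤+ z≤n
variance {suc m} {L} {w ∷ ws} {r ∷ rs} (e ∷ es) = ℤₚ.≤-trans (ℤₚ.≤-reflexive (variance-∷ w r ws rs)) (ℤₚ.≤-trans
  (ℤₚ.+-mono-≤ (ℤₚ.*-monoˡ-≤-nonNeg (+ boxSize rs) (ℤₚ.≤-trans (sum-mono (suc r) (λ j l → square-≤ (spread₁ w r j) L (≤-trans (spread₁-≤ w r j (≤-pred l)) (≤-reflexive e)))) (ℤₚ.≤-reflexive (sum-const (suc r) (+ (L ℕ.* L))))))
                (ℤₚ.*-monoˡ-≤-nonNeg (+ suc r) (variance es)))
  (ℤₚ.≤-reflexive (P.trans (cong₂ ℤ._+_ (P.trans (cong (+ boxSize rs ℤ.*_) (P.sym (pos-* (suc r) (L ℕ.* L)))) (P.sym (pos-* (boxSize rs) _))) (P.sym (pos-* (suc r) _)))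
    (P.trans (P.sym (ℤₚ.pos-+ (boxSize rs ℕ.* (suc r ℕ.* (L ℕ.* L))) _)) (cong +_ (solve 4 (λ b r m L → b :* (r :* L) :+ r :* (b :* (m :* L)) := r :* b :* ((con 1 :+ m) :* L)) P.refl (boxSize rs) (suc r) m (L ℕ.* L)))))))
  where open +-*-Solver

spread-dot : ∀ {m L} {w r : Exp m} → Weights L w r → ∀ J → spread w r J ≡ + (m ℕ.* L) ℤ.- + 2 ℤ.* + dot w J
spread-dot [] [] = P.refl
spread-dot {suc m} {L} {w ∷ ws} {r ∷ rs} (e ∷ es) (j ∷ J) = P.trans (cong₂ ℤ._+_ (P.trans (S.solve 3 (λ w r j → w S.:* (r S.:- S.con (+ 2) S.:* j) S.:= w S.:* r S.:- S.con (+ 2) S.:* (w S.:* j)) P.refl (+ w) (+ r) (+ j))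
    (cong₂ (λ a b → a ℤ.- + 2 ℤ.* b) (P.trans (P.sym (pos-* w r)) (cong +_ e)) (P.sym (pos-* w j)))) (spread-dot es J))
  (S.solve 4 (λ L a m b → L S.:- S.con (+ 2) S.:* a S.:+ (m S.:- S.con (+ 2) S.:* b) S.:= L S.:+ m S.:- S.con (+ 2) S.:* (a S.:+ b)) P.refl (+ L) (+ (w ℕ.* j)) (+ (m ℕ.* L)) (+ dot ws J))

collect : ∀ {A : Set} {Q : A → Set} → (∀ a → Dec (Q a)) → ℕ → (ℕ → A) → List A
collect Q? zero f = []
collect Q? (suc n) f with Q? (f 0)
... | yes _ = f 0 ∷ collect Q? n (λ i → f (suc i))
... | no _ = collect Q? n (λ i → f (suc i))

collect-any : ∀ {A : Set} {Q : A → Set} (Q? : ∀ a → Dec (Q a)) n f i → i < n → Q (f i) → Any (_≡ f i) (collect Q? n f)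
collect-any Q? (suc n) f i l q with Q? (f 0)
collect-any Q? (suc n) f zero l q | yes _ = here P.refl
collect-any Q? (suc n) f zero l q | no nq = ⊥-elim (nq q)
collect-any Q? (suc n) f (suc i) (s≤s l) q | yes _ = there (collect-any Q? n _ i l q)
collect-any Q? (suc n) f (suc i) (s≤s l) q | no _ = collect-any Q? n _ i l q

collect-count : ∀ {A : Set} {Q : A → Set} (Q? : ∀ a → Dec (Q a)) n f (g : A → ℤ) B → (∀ a → 0ℤ ℤ.≤ g a) → (∀ a → Q a → + B ℤ.≤ g a) →
  + (length (collect Q? n f) ℕ.* B) ℤ.≤ 𝕊.sum n (λ i → g (f i))
collect-count Q? zero f g B nn h = ℤ.+≤+ z≤n
collect-count Q? (suc n) f g B nn h with Q? (f 0)
... | yes q = ℤₚ.+-mono-≤ (h (f 0) q) (collect-count Q? n (λ i → f (suc i)) g B nn h)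
... | no _ = ℤₚ.≤-trans (ℤₚ.≤-reflexive (P.sym (ℤₚ.+-identityˡ _))) (ℤₚ.+-mono-≤ (nn (f 0)) (collect-count Q? n (λ i → f (suc i)) g B nn h))

lowExps : ∀ {m} → Vec ℕ m → Exp m → ℕ → List (Exp m)
lowExps w r T = collect (λ I → dot w I <? T) (boxSize r) (dec r)

-- Chebyshev's inequality.
lowExps-count : ∀ {m L} {w r : Exp m} → Weights L w r → ∀ T u → T ℕ.+ T ℕ.+ (u ℕ.+ u) ≡ m ℕ.* L →
  length (lowExps w r T) ℕ.* ((u ℕ.+ u) ℕ.* (u ℕ.+ u)) ≤ boxSize r ℕ.* (m ℕ.* (L ℕ.* L))
lowExps-count {m} {L} {w} {r} es T u eq = ℤₚ.drop‿+≤+ (ℤₚ.≤-trans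
  (collect-count (λ I → dot w I <? T) (boxSize r) (dec r) (λ J → spread w r J ℤ.* spread w r J) ((u ℕ.+ u) ℕ.* (u ℕ.+ u))
    (λ J → subst (0ℤ ℤ.≤_) (P.sym (square-abs (spread w r J))) (ℤ.+≤+ z≤n)) far) (variance es))
  where
  far : ∀ J → dot w J < T → + ((u ℕ.+ u) ℕ.* (u ℕ.+ u)) ℤ.≤ spread w r J ℤ.* spread w r J
  far J l = subst (+ ((u ℕ.+ u) ℕ.* (u ℕ.+ u)) ℤ.≤_) (P.sym (P.trans (cong (λ z → z ℤ.* z) val) (P.sym (pos-* k k)))) (ℤ.+≤+ (*-mono-≤ 2u≤k 2u≤k))
    where
    t = dot w J
    k = (T ∸ t) ℕ.+ (T ∸ t) ℕ.+ (u ℕ.+ u)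
    2u≤k : u ℕ.+ u ≤ k
    2u≤k = m≤n+m (u ℕ.+ u) ((T ∸ t) ℕ.+ (T ∸ t))
    val : spread w r J ≡ + k
    val = P.trans (spread-dot es J) (P.trans (cong (λ z → + z ℤ.- + 2 ℤ.* + t) (P.trans (P.sym eq) (cong (λ z → z ℕ.+ z ℕ.+ (u ℕ.+ u)) (P.sym (m∸n+n≡m (<⇒≤ l))))))
      (S.solve 3 (λ a t u → a S.:+ t S.:+ (a S.:+ t) S.:+ (u S.:+ u) S.:- S.con (+ 2) S.:* t S.:= a S.:+ a S.:+ (u S.:+ u)) P.refl (+ (T ∸ t)) (+ t) (+ u)))

excess : ∀ {m} → Exp m → Exp m → ℕ
excess [] [] = 0
excess (j ∷ J) (i ∷ I) = (j ∸ i) ℕ.+ excess J I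

excess-≤ : ∀ {m} {r : Exp m} J I → J ⊑ᵛ r → excess J I ≤ Vec.sum r
excess-≤ [] [] [] = z≤n
excess-≤ (j ∷ J) (i ∷ I) (l ∷ ls) = +-mono-≤ (≤-trans (m∸n≤m j i) l) (excess-≤ J I ls)

tabulateL : ∀ {X : Set} → ℕ → (ℕ → ℤ) → (ℕ → X) → Meas X
tabulateL zero c f = []
tabulateL (suc n) c f = (c 0 , f 0) ∷ tabulateL n (λ i → c (suc i)) (λ i → f (suc i))

tabulateL-support : ∀ {X : Set} {Q : X → Set} n c f → (∀ i → Q (f i)) → Support Q (tabulateL n c f)
tabulateL-support zero c f h = []
tabulateL-support (suc n) c f h = h 0 ∷ tabulateL-support n _ _ (λ i → h (suc i))

tabulateL-norm : ∀ {X : Set} n c (f : ℕ → X) B → (∀ i → ∣ c i ∣ ≤ B) → norm (tabulateL n c f) ≤ n ℕ.* B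
tabulateL-norm zero c f B h = z≤n
tabulateL-norm (suc n) c f B h = +-mono-≤ (h 0) (tabulateL-norm n _ _ B (λ i → h (suc i)))

tabulateL-pair : ∀ {X : Set} n c (f : ℕ → X) g → ⟪ tabulateL n c f , g ⟫ ≡ 𝕊.sum n (λ i → c i ℤ.* g (f i))
tabulateL-pair zero c f g = P.refl
tabulateL-pair (suc n) c f g = cong (λ z → c 0 ℤ.* g (f 0) ℤ.+ z) (tabulateL-pair n _ _ g)

nth : List (ℕ → ℤ) → ℕ → ℕ → ℤ
nth [] i = λ _ → 0ℤ
nth (a ∷ as) zero = a
nth (a ∷ as) (suc i) = nth as i

nth-All : ∀ {Q : (ℕ → ℤ) → Set} as → All Q as → ∀ i → i < length as → Q (nth as i)
nth-All (a ∷ as) (q ∷ qs) zero l = q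
nth-All (a ∷ as) (q ∷ qs) (suc i) (s≤s l) = nth-All as qs i l

All-nth : ∀ {Q : (ℕ → ℤ) → Set} as → (∀ i → i < length as → Q (nth as i)) → All Q as
All-nth [] h = []
All-nth (a ∷ as) h = h 0 (s≤s z≤n) ∷ All-nth as (λ i l → h (suc i) (s≤s l))

rows : ℕ → (ℕ → ℕ → ℤ) → List (ℕ → ℤ)
rows zero f = []
rows (suc D) f = f 0 ∷ rows D (λ s → f (suc s))

rows-length : ∀ D f → length (rows D f) ≡ D
rows-length zero f = P.refl
rows-length (suc D) f = cong suc (rows-length D _)

rows-All : ∀ {Q : (ℕ → ℤ) → Set} D f → (∀ s → s < D → Q (f s)) → All Q (rows D f)
rows-All zero f h = []
rows-All (suc D) f h = h 0 (s≤s z≤n) ∷ rows-All D _ (λ s l → h (suc s) (s≤s l))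

All-rows : ∀ {Q : (ℕ → ℤ) → Set} D f → All Q (rows D f) → ∀ s → s < D → Q (f s)
All-rows (suc D) f (q ∷ qs) zero l = q
All-rows (suc D) f (q ∷ qs) (suc s) (s≤s l) = All-rows D _ qs s l

allRows : {X : Set} → ℕ → (X → ℕ → ℕ → ℤ) → List X → List (ℕ → ℤ)
allRows D f [] = []
allRows D f (x ∷ xs) = rows D (f x) ++ allRows D f xs

allRows-length : ∀ {X : Set} D f (xs : List X) → length (allRows D f xs) ≡ length xs ℕ.* D
allRows-length D f [] = P.refl
allRows-length D f (x ∷ xs) = P.trans (length-++ (rows D (f x))) (cong₂ ℕ._+_ (rows-length D (f x)) (allRows-length D f xs))
  where open import Data.List.Properties using (length-++)

allRows-All : ∀ {X : Set} {Q : (ℕ → ℤ) → Set} D f (xs : List X) → (∀ x s → s < D → Q (f x s)) → All Q (allRows D f xs)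
allRows-All D f [] h = []
allRows-All D f (x ∷ xs) h = ++⁺ (rows-All D (f x) (h x)) (allRows-All D f xs h)
  where open import Data.List.Relation.Unary.All.Properties using (++⁺)

All-allRows : ∀ {X : Set} {Q : (ℕ → ℤ) → Set} D f (xs : List X) → All Q (allRows D f xs) → ∀ {x} → Any (_≡ x) xs → ∀ s → s < D → Q (f x s)
All-allRows D f (x ∷ xs) q (here P.refl) = All-rows D (f x) (++⁻ˡ (rows D (f x)) q)
  where open import Data.List.Relation.Unary.All.Properties using (++⁻ˡ)
All-allRows D f (x ∷ xs) q (there a) = All-allRows D f xs (++⁻ʳ (rows D (f x)) q) a
  where open import Data.List.Relation.Unary.All.Properties using (++⁻ʳ)

boxSize-≤ : ∀ {m} (r : Exp m) → boxSize r ≤ 2 ^ Vec.sum r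
boxSize-≤ [] = s≤s z≤n
boxSize-≤ (r ∷ rs) = ≤-trans (*-mono-≤ (suc≤2^ r) (boxSize-≤ rs)) (≤-reflexive (P.sym (^-distribˡ-+-* 2 r (Vec.sum rs))))

boxSize>0 : ∀ {m} (r : Exp m) → 1 ≤ boxSize r
boxSize>0 [] = s≤s z≤n
boxSize>0 (r ∷ rs) = *-mono-≤ {1} {suc r} (s≤s z≤n) (boxSize>0 rs)

δ-suc : ∀ i j → δ (suc i) (suc j) ≡ δ i j
δ-suc i j with i ℕ.≟ j
... | yes P.refl = δ-≡ {suc i} P.refl
... | no ne = δ-≢ (λ q → ne (ℕₚ.suc-injective q))

sift : ∀ n j → j < n → ∀ (x : ℕ → ℤ) → 𝕊.sum n (λ i → x i ℤ.* δ i j) ≡ x j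
sift (suc n) zero l x = P.trans (cong₂ ℤ._+_ (ℤₚ.*-identityʳ (x 0)) (𝕊.sum-0 n {λ i → x (suc i) ℤ.* δ (suc i) 0} (λ i _ → ℤₚ.*-zeroʳ (x (suc i))))) (ℤₚ.+-identityʳ (x 0))
sift (suc n) (suc j) (s≤s l) x = P.trans (cong₂ ℤ._+_ (ℤₚ.*-zeroʳ (x 0)) (P.trans (𝕊.sum-cong n {λ i → x (suc i) ℤ.* δ (suc i) (suc j)} {λ i → x (suc i) ℤ.* δ i j} (λ i _ → cong (x (suc i) ℤ.*_) (δ-suc i j))) (sift n j l (λ i → x (suc i))))) (ℤₚ.+-identityˡ _)

module Aux (A : ℤ-Algebra)
  (cancel : ∀ k z → k ≢ 0ℤ → ℤ-Algebra._≈_ A (ℤ-Algebra._*_ A (ℤ-Algebra.ι A k) z) (ℤ-Algebra.0# A) → ℤ-Algebra._≈_ A z (ℤ-Algebra.0# A))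
  (ξ : ℤ-Algebra.Carrier A) (D′ : ℕ) (f : ℕ → ℤ) (lead≢0 : f (suc D′) ≢ 0ℤ) (φ : ℕ) (f-≤ : ∀ s → s ≤ suc D′ → ∣ f s ∣ ≤ 2 ^ φ) where
  open ℤ-Algebra A
  open Pairing A
  open Sum ring
  open Taylor A using (taylor; taylorξ; ↑-+; _↑_)
  open import Relation.Binary.Reasoning.Setoid setoid
  open Solver A using (solve; _:=_; _:+_; _:*_; _:-_; :-_; con)
  private
    D = suc D′
    c₀ = f D

  -- c₀^n ξ^n = Σ_{s<D} reduce n s ξ^s.
  reduce : ℕ → ℕ → ℤ
  reduce zero s = δ s 0
  reduce (suc n) zero = ℤ.- (reduce n D′ ℤ.* f 0)
  reduce (suc n) (suc s) = c₀ ℤ.* reduce n s ℤ.- reduce n D′ ℤ.* f (suc s)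

  φ′ : ℕ
  φ′ = suc φ

  reduce-≤ : ∀ n s → s < D → ∣ reduce n s ∣ ≤ (2 ^ φ′) ^ n
  reduce-≤ zero zero l = ≤-refl
  reduce-≤ zero (suc s) l = z≤n
  reduce-≤ (suc n) zero l = ≤-trans (≤-reflexive (P.trans (∣-i∣≡∣i∣ (reduce n D′ ℤ.* f 0)) (P.trans (abs-* (reduce n D′) (f 0)) (ℕₚ.*-comm ∣ reduce n D′ ∣ ∣ f 0 ∣))))
    (*-mono-≤ (≤-trans (f-≤ 0 z≤n) (^-monoʳ-≤ 2 (n≤1+n φ))) (reduce-≤ n D′ ≤-refl))
  reduce-≤ (suc n) (suc s) l = ≤-trans (∣i+j∣≤∣i∣+∣j∣ (c₀ ℤ.* reduce n s) (ℤ.- (reduce n D′ ℤ.* f (suc s)))) (≤-trans (+-mono-≤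
    (≤-trans (≤-reflexive (abs-* c₀ (reduce n s))) (*-mono-≤ (f-≤ D ≤-refl) (reduce-≤ n s (<-trans ≤-refl l))))
    (≤-trans (≤-reflexive (P.trans (∣-i∣≡∣i∣ (reduce n D′ ℤ.* f (suc s))) (P.trans (abs-* (reduce n D′) (f (suc s))) (ℕₚ.*-comm ∣ reduce n D′ ∣ _))))
      (*-mono-≤ (f-≤ (suc s) (<⇒≤ l)) (reduce-≤ n D′ ≤-refl))))
    (≤-reflexive (solve′ (2 ^ φ) ((2 ^ φ′) ^ n))))
    where
    solve′ : ∀ a b → a ℕ.* b ℕ.+ a ℕ.* b ≡ (2 ℕ.* a) ℕ.* b
    solve′ a b = P.trans (P.sym (ℕₚ.*-distribʳ-+ b a a)) (cong (λ z → (a ℕ.+ z) ℕ.* b) (P.sym (ℕₚ.+-identityʳ a)))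

  root-form : (sum (suc D) (λ s → ι (f s) * ξ ↑ s) ≈ 0#) → ∀ n → ι (c₀ ℤ.^ n) * ξ ↑ n ≈ sum D (λ s → ι (reduce n s) * ξ ↑ s)
  root-form root zero = trans (trans (*-congʳ ι-1) (*-identityˡ 1#)) (sym (trans (+-cong (trans (*-congʳ ι-1) (*-identityˡ 1#)) (sum-0 D′ (λ s _ → trans (*-congʳ ι-0) (zeroˡ _)))) (+-identityʳ 1#)))
  root-form root (suc n) = begin
    ι (c₀ ℤ.* c₀ ℤ.^ n) * (ξ * ξ ↑ n) ≈⟨ *-congʳ (ι-* c₀ (c₀ ℤ.^ n)) ⟩
    (ι c₀ * ι (c₀ ℤ.^ n)) * (ξ * ξ ↑ n) ≈⟨ solve 4 (λ c k x X → (c :* k) :* (x :* X) := (c :* x) :* (k :* X)) refl (ι c₀) (ι (c₀ ℤ.^ n)) ξ (ξ ↑ n) ⟩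
    (ι c₀ * ξ) * (ι (c₀ ℤ.^ n) * ξ ↑ n) ≈⟨ *-congˡ (root-form root n) ⟩
    (ι c₀ * ξ) * sum D e ≈⟨ *-congˡ (sum-last D′ e) ⟩
    (ι c₀ * ξ) * (sum D′ e + ι a * ξ ↑ D′) ≈⟨ solve 5 (λ c x s a X → (c :* x) :* (s :+ a :* X) := (c :* x) :* s :+ a :* (c :* (x :* X))) refl (ι c₀) ξ (sum D′ e) (ι a) (ξ ↑ D′) ⟩
    (ι c₀ * ξ) * sum D′ e + ι a * (ι c₀ * ξ ↑ D) ≈⟨ +-cong (sym (sum-*ˡ D′ (ι c₀ * ξ) e)) (*-congˡ leading-term) ⟩
    sum D′ (λ s → (ι c₀ * ξ) * e s) + ι a * (- (g 0 + sum D′ (λ s → g (suc s)))) ≈⟨ solve 4 (λ S a g G → S :+ a :* (:- (g :+ G)) := (:- (a :* g)) :+ (S :+ (:- a) :* G)) refl _ (ι a) (g 0) (sum D′ (λ s → g (suc s))) ⟩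
    - (ι a * g 0) + (sum D′ (λ s → (ι c₀ * ξ) * e s) + (- ι a) * sum D′ (λ s → g (suc s)))
      ≈⟨ +-cong first (trans (+-congˡ (sym (sum-*ˡ D′ (- ι a) (λ s → g (suc s))))) (trans (sym (sum-+ D′ (λ s → (ι c₀ * ξ) * e s) (λ s → (- ι a) * g (suc s)))) (sum-cong D′ {λ s → (ι c₀ * ξ) * e s + (- ι a) * g (suc s)} {λ s → ι (reduce (suc n) (suc s)) * ξ ↑ suc s} (λ s _ → next s)))) ⟩
    ι (reduce (suc n) 0) * ξ ↑ 0 + sum D′ (λ s → ι (reduce (suc n) (suc s)) * ξ ↑ suc s) ∎
    where
    a = reduce n D′
    e g : ℕ → Carrier
    e s = ι (reduce n s) * ξ ↑ s
    g s = ι (f s) * ξ ↑ s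
    leading-term : ι c₀ * ξ ↑ D ≈ - (g 0 + sum D′ (λ s → g (suc s)))
    leading-term = trans (sym (+-identityˡ _)) (trans (+-congʳ (sym (-‿inverseˡ (sum D g)))) (trans (+-assoc _ _ _) (trans (+-congˡ (trans (sym (sum-last D g)) root)) (+-identityʳ _))))
    first : - (ι a * g 0) ≈ ι (reduce (suc n) 0) * 1#
    first = trans (-‿cong (trans (*-congˡ (*-identityʳ _)) (sym (ι-* a (f 0))))) (trans (sym (ι-neg _)) (sym (*-identityʳ _)))
    next : ∀ s → (ι c₀ * ξ) * e s + (- ι a) * g (suc s) ≈ ι (reduce (suc n) (suc s)) * ξ ↑ suc s
    next s = trans (solve 6 (λ c x r X a f → (c :* x) :* (r :* X) :+ (:- a) :* (f :* (x :* X)) := (c :* r :- a :* f) :* (x :* X)) refl (ι c₀) ξ (ι (reduce n s)) (ξ ↑ s) (ι a) (ι (f (suc s))))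
      (*-congʳ (trans (+-cong (sym (ι-* c₀ (reduce n s))) (trans (-‿cong (sym (ι-* a (f (suc s))))) (sym (ι-neg _)))) (sym (ι-+ _ _))))

  taylor-binom : ∀ i j → taylor ξ i j ≈ ι (+ binom j i) * ξ ↑ (j ∸ i)
  taylor-binom zero zero = sym (trans (*-congʳ ι-1) (*-identityˡ _))
  taylor-binom (suc i) zero = sym (trans (*-congʳ ι-0) (zeroˡ _))
  taylor-binom zero (suc j) = trans (*-congˡ (taylor-binom zero j)) (trans (sym (*-assoc _ _ _)) (trans (*-congʳ (*-comm _ _)) (*-assoc _ _ _)))
  taylor-binom (suc i) (suc j) = trans (+-cong (*-congˡ (taylor-binom (suc i) j)) (taylor-binom i j)) (trans (+-congʳ lift) (trans (sym (distribʳ _ _ _))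
    (*-congʳ (trans (sym (ι-+ (+ binom j (suc i)) (+ binom j i))) (reflexive (cong (λ k → ι (+ k)) (ℕₚ.+-comm (binom j (suc i)) (binom j i))))))))
    where
    binom-> : ∀ j i → j < i → binom j i ≡ 0
    binom-> zero (suc i) l = P.refl
    binom-> (suc j) (suc i) (s≤s l) = cong₂ ℕ._+_ (binom-> j i l) (binom-> j (suc i) (m<n⇒m<1+n l))
    lift : ξ * (ι (+ binom j (suc i)) * ξ ↑ (j ∸ suc i)) ≈ ι (+ binom j (suc i)) * ξ ↑ (j ∸ i)
    lift with suc i ≤? j
    ... | yes l = trans (solve 3 (λ x b X → x :* (b :* X) := b :* (x :* X)) refl ξ (ι (+ binom j (suc i))) (ξ ↑ (j ∸ suc i))) (*-congˡ (reflexive (cong (ξ ↑_) (P.sym (+-∸-assoc 1 l)))))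
    ... | no g = trans (*-congˡ (trans (*-congʳ z) (zeroˡ _))) (trans (zeroʳ ξ) (sym (trans (*-congʳ z) (zeroˡ _))))
      where
      z : ι (+ binom j (suc i)) ≈ 0#
      z = trans (reflexive (cong (λ k → ι (+ k)) (binom-> j (suc i) (≰⇒> g)))) ι-0

  taylorξ-binom : ∀ {m} (I J : Exp m) → taylorξ ξ I J ≈ ι (+ binomᵛ J I) * ξ ↑ excess J I
  taylorξ-binom [] [] = sym (trans (*-congʳ ι-1) (*-identityˡ _))
  taylorξ-binom (i ∷ I) (j ∷ J) = trans (*-cong (taylor-binom i j) (taylorξ-binom I J)) (trans (solve 4 (λ a b c d → (a :* b) :* (c :* d) := (a :* c) :* (b :* d)) refl (ι (+ binom j i)) (ξ ↑ (j ∸ i)) (ι (+ binomᵛ J I)) (ξ ↑ excess J I))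
    (*-cong (trans (sym (ι-* _ _)) (reflexive (cong ι (P.sym (pos-* (binom j i) _))))) (sym (↑-+ ξ (j ∸ i) (excess J I)))))

  coefficient : ∀ {m} → ℕ → Exp m → ℕ → Exp m → ℤ
  coefficient R I s J = + binomᵛ J I ℤ.* (c₀ ℤ.^ (R ∸ excess J I) ℤ.* reduce (excess J I) s)

  coefficient-≤ : ∀ {m} (r I J : Exp m) s → J ⊑ᵛ r → s < D → ∣ coefficient (Vec.sum r) I s J ∣ ≤ 2 ^ ((1 ℕ.+ φ′) ℕ.* Vec.sum r)
  coefficient-≤ r I J s l sD = ≤-trans (≤-reflexive (P.trans (abs-* (+ binomᵛ J I) _) (cong (binomᵛ J I ℕ.*_) (P.trans (abs-* (c₀ ℤ.^ (R ∸ x)) (reduce x s)) (cong (ℕ._* ∣ reduce x s ∣) (abs-^ c₀ (R ∸ x)))))))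
    (≤-trans (*-mono-≤ (binomᵛ-≤ J I l) (≤-trans (*-mono-≤ (^-monoˡ-≤ (R ∸ x) (≤-trans (f-≤ D ≤-refl) (^-monoʳ-≤ 2 (n≤1+n φ)))) (reduce-≤ x s sD))
      (≤-reflexive (P.trans (P.sym (^-distribˡ-+-* (2 ^ φ′) (R ∸ x) x)) (P.trans (cong ((2 ^ φ′) ^_) (m∸n+n≡m (excess-≤ J I l))) (^-*-assoc 2 φ′ R))))))
      (≤-reflexive (P.sym (^-distribˡ-+-* 2 R (φ′ ℕ.* R)))))
    where
    R = Vec.sum r
    x = excess J I

  coefficient-sum : (sum (suc D) (λ s → ι (f s) * ξ ↑ s) ≈ 0#) → ∀ {m} (r I J : Exp m) → J ⊑ᵛ r →
    ι (c₀ ℤ.^ Vec.sum r) * taylorξ ξ I J ≈ sum D (λ s → ι (coefficient (Vec.sum r) I s J) * ξ ↑ s)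
  coefficient-sum root r I J l = begin
    ι (c₀ ℤ.^ R) * taylorξ ξ I J ≈⟨ *-cong (trans (reflexive (cong ι (P.trans (cong (c₀ ℤ.^_) (P.sym (m∸n+n≡m (excess-≤ J I l)))) (ℤₚ.^-distribˡ-+-* c₀ (R ∸ x) x)))) (ι-* _ _)) (taylorξ-binom I J) ⟩
    (ι (c₀ ℤ.^ (R ∸ x)) * ι (c₀ ℤ.^ x)) * (ι b * ξ ↑ x) ≈⟨ solve 4 (λ u v b X → (u :* v) :* (b :* X) := (b :* u) :* (v :* X)) refl (ι (c₀ ℤ.^ (R ∸ x))) (ι (c₀ ℤ.^ x)) (ι b) (ξ ↑ x) ⟩
    (ι b * ι (c₀ ℤ.^ (R ∸ x))) * (ι (c₀ ℤ.^ x) * ξ ↑ x) ≈⟨ *-congˡ (root-form root x) ⟩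
    (ι b * ι (c₀ ℤ.^ (R ∸ x))) * sum D (λ s → ι (reduce x s) * ξ ↑ s) ≈⟨ sym (sum-*ˡ D _ (λ s → ι (reduce x s) * ξ ↑ s)) ⟩
    sum D (λ s → (ι b * ι (c₀ ℤ.^ (R ∸ x))) * (ι (reduce x s) * ξ ↑ s)) ≈⟨ sum-cong D {λ s → (ι b * ι (c₀ ℤ.^ (R ∸ x))) * (ι (reduce x s) * ξ ↑ s)} {λ s → ι (coefficient R I s J) * ξ ↑ s} (λ s _ → trans (sym (*-assoc _ _ _)) (*-congʳ (trans (*-assoc _ _ _) (trans (*-congˡ (sym (ι-* _ _))) (sym (ι-* _ _)))))) ⟩
    sum D (λ s → ι (coefficient R I s J) * ξ ↑ s) ∎
    where
    R = Vec.sum r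
    x = excess J I
    b = + binomᵛ J I

  module _ (root : sum (suc D) (λ s → ι (f s) * ξ ↑ s) ≈ 0#) {m : ℕ} (w r : Exp m) (T : ℕ)
    (few : length (lowExps w r T) ℕ.* D ℕ.+ length (lowExps w r T) ℕ.* D ≤ boxSize r) (R≥1 : 1 ≤ Vec.sum r) where
    private
      N = boxSize r
      R = Vec.sum r
      B = 2 ^ ((1 ℕ.+ φ′) ℕ.* R)
      eqs = allRows D (λ I s n → coefficient R I s (dec r n)) (lowExps w r T)
      M = length eqs
      M≡ : M ≡ length (lowExps w r T) ℕ.* D
      M≡ = allRows-length D (λ I s n → coefficient R I s (dec r n)) (lowExps w r T)
      solution = siegel M N B (nth eqs) (boxSize>0 r) (m^n>0 2 ((1 ℕ.+ φ′) ℕ.* R)) (subst (λ k → k ℕ.+ k ≤ N) (P.sym M≡) few)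
        (λ i j li lj → nth-All {λ a → ∀ j → ∣ a j ∣ ≤ B} eqs (allRows-All D _ (lowExps w r T) (λ I s sD j → coefficient-≤ r I (dec r j) s (dec-⊑ r j) sD)) i li j)
      x = proj₁ solution

    auxiliary : Poly m
    auxiliary = tabulateL N x (dec r)

    auxiliary-box : Support (_⊑ᵛ r) auxiliary
    auxiliary-box = tabulateL-support N x (dec r) (dec-⊑ r)

    auxiliary-norm : norm auxiliary ≤ 2 ^ ((4 ℕ.+ φ′) ℕ.* R)
    auxiliary-norm = ≤-trans (tabulateL-norm N x (dec r) _ (proj₁ (proj₂ solution))) (≤-trans
      (*-mono-≤ (boxSize-≤ r) (*-mono-≤ (^-monoʳ-≤ 2 R≥1) (*-monoˡ-≤ B (boxSize-≤ r))))
      (≤-reflexive (P.trans (cong (2 ^ R ℕ.*_) (P.trans (cong (2 ^ R ℕ.*_) (P.sym (^-distribˡ-+-* 2 R _))) (P.sym (^-distribˡ-+-* 2 R _)))) (P.trans (P.sym (^-distribˡ-+-* 2 R _))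
        (cong (2 ^_) (solve′ 2 (λ R q → R N+ (R N+ (R N+ ((con′ 1 N+ q) N* R))) N= (con′ 4 N+ q) N* R) P.refl R φ′))))))
      where open +-*-Solver renaming (solve to solve′; _:+_ to _N+_; _:*_ to _N*_; _:=_ to _N=_; con to con′)

    auxiliary≢0 : ¬ (auxiliary ≋ [])
    auxiliary≢0 e = refute (proj₁ (proj₂ (proj₂ solution)))
      where
      refute : ¬ ∃ λ j → j < N × x j ≢ 0ℤ
      refute (j , l , xj≢0) = xj≢0 (P.trans (P.sym (sift N j l x))
        (P.trans (𝕊.sum-cong N {λ i → x i ℤ.* δ i j} {λ i → x i ℤ.* δ (enc r (dec r i)) j} (λ i l → cong (λ k → x i ℤ.* δ k j) (P.sym (enc-dec r i l))))
          (P.trans (P.sym (tabulateL-pair N x (dec r) (λ J → δ (enc r J) j))) (pairings e (λ J → δ (enc r J) j)))))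

    auxiliary-vanishes : ∀ I → I ⊑ᵛ r → dot w I < T → ⟨ auxiliary , taylorξ ξ I ⟩ ≈ 0#
    auxiliary-vanishes I lI l = cancel (c₀ ℤ.^ R) _ (power≢0 lead≢0 R) (begin
      ι (c₀ ℤ.^ R) * ⟨ auxiliary , taylorξ ξ I ⟩ ≈⟨ sym (pair-* auxiliary _ _) ⟩
      ⟨ auxiliary , (λ J → ι (c₀ ℤ.^ R) * taylorξ ξ I J) ⟩ ≈⟨ pair-congOn (λ J q → coefficient-sum root r I J q) auxiliary-box ⟩
      ⟨ auxiliary , (λ J → sum D (λ s → ι (coefficient R I s J) * ξ ↑ s)) ⟩ ≈⟨ pair-sum auxiliary D (λ s J → ι (coefficient R I s J) * ξ ↑ s) ⟩
      sum D (λ s → ⟨ auxiliary , (λ J → ι (coefficient R I s J) * ξ ↑ s) ⟩) ≈⟨ sum-0 D {λ s → ⟨ auxiliary , (λ J → ι (coefficient R I s J) * ξ ↑ s) ⟩} (λ s sD → trans (pair-*ʳ auxiliary (ξ ↑ s) _) (trans (*-congʳ (trans (pair-ι A auxiliary (coefficient R I s)) (trans (reflexive (cong ι (equation s sD))) ι-0))) (zeroˡ _))) ⟩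
      0# ∎)
      where
      member : Any (_≡ I) (lowExps w r T)
      member = subst (λ K → Any (_≡ K) (lowExps w r T)) (dec-enc lI) (collect-any _ N (dec r) (enc r I) (enc-< lI) (subst (λ K → dot w K < T) (P.sym (dec-enc lI)) l))
      equation : ∀ s → s < D → ⟪ auxiliary , coefficient R I s ⟫ ≡ 0ℤ
      equation s sD = P.trans (tabulateL-pair N x (dec r) (coefficient R I s)) (P.trans (𝕊.sum-cong N {λ i → x i ℤ.* coefficient R I s (dec r i)} {λ i → coefficient R I s (dec r i) ℤ.* x i} (λ i _ → ℤₚ.*-comm (x i) (coefficient R I s (dec r i))))
        (All-allRows {Q = λ a → 𝕊.sum N (λ j → a j ℤ.* x j) ≡ 0ℤ} D _ (lowExps w r T) (All-nth eqs (proj₂ (proj₂ (proj₂ solution)))) member s sD))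

-- A ring of real numbers with an upper bound relation for absolute values.
record BoundedAlgebra : Set₁ where
  field alg : ℤ-Algebra
  open ℤ-Algebra alg public
  infix 4 _⊑_
  field
    _⊑_ : Carrier → ℕ → Set
    ⊑-≈ : ∀ {x y n} → x ≈ y → x ⊑ n → y ⊑ n
    ⊑-+ : ∀ {x y m n} → x ⊑ m → y ⊑ n → x + y ⊑ m ℕ.+ n
    ⊑-* : ∀ {x y m n} → x ⊑ m → y ⊑ n → x * y ⊑ m ℕ.* n
    ⊑-ι : ∀ z → ι z ⊑ ∣ z ∣
    ⊑-int : ∀ {z n} → ι z ⊑ n → ∣ z ∣ ≤ n
    ⊑-mono : ∀ {x m n} → m ≤ n → x ⊑ m → x ⊑ n
    ⊑-cancel : ∀ k {x n} → ι (+ suc k) * x ⊑ suc k ℕ.* n → x ⊑ n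
    ⊑-zero : ∀ {x} → x ⊑ 0 → x ≈ 0#

merge₄ : ∀ a b c d → 2 ^ a ℕ.* (2 ^ b ℕ.* 2 ^ c) ℕ.* 2 ^ d ≡ 2 ^ (a ℕ.+ (b ℕ.+ c) ℕ.+ d)
merge₄ a b c d = P.sym (P.trans (^-distribˡ-+-* 2 (a ℕ.+ (b ℕ.+ c)) d) (cong (ℕ._* 2 ^ d) (P.trans (^-distribˡ-+-* 2 a (b ℕ.+ c)) (cong (2 ^ a ℕ.*_) (^-distribˡ-+-* 2 b c)))))

merge₄′ : ∀ a b c d → 2 ^ a ℕ.* ((2 ^ b ℕ.* 2 ^ c) ℕ.* 2 ^ d) ≡ 2 ^ (a ℕ.+ (b ℕ.+ c ℕ.+ d))
merge₄′ a b c d = P.sym (P.trans (^-distribˡ-+-* 2 a (b ℕ.+ c ℕ.+ d)) (cong (2 ^ a ℕ.*_) (P.trans (^-distribˡ-+-* 2 (b ℕ.+ c) d) (cong (ℕ._* 2 ^ d) (^-distribˡ-+-* 2 b c)))))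

module Bounds (𝔸 : BoundedAlgebra) where
  open BoundedAlgebra 𝔸
  open Sum ring
  open Pairing alg
  open Taylor alg using (taylor; taylorξ; taylorᵛ; taylor->; taylor-shift; _↑_)
  open import Relation.Binary.Reasoning.Setoid setoid
  open Solver alg using (solve; _:=_; _:+_; _:*_; _:-_; :-_; con)
  open import Algebra.Properties.Ring (CommutativeRing.ring ring) using (-‿distribˡ-*)

  two^ : ℕ → Carrier
  two^ n = ι (+ (2 ^ n))

  two^-+ : ∀ a b → two^ (a ℕ.+ b) ≈ two^ a * two^ b
  two^-+ a b = trans (reflexive (cong (λ k → ι (+ k)) (^-distribˡ-+-* 2 a b))) (trans (reflexive (cong ι (pos-* (2 ^ a) (2 ^ b)))) (ι-* _ _))

  ≈0⇒⊑0 : ∀ {x} → x ≈ 0# → x ⊑ 0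
  ≈0⇒⊑0 e = ⊑-≈ (trans ι-0 (sym e)) (⊑-ι 0ℤ)

  0⊑ : ∀ {x} n → x ≈ 0# → x ⊑ n
  0⊑ n e = ⊑-mono z≤n (≈0⇒⊑0 e)

  cancel-pos : ∀ k {x n} → 1 ≤ k → ι (+ k) * x ⊑ k ℕ.* n → x ⊑ n
  cancel-pos (suc k) _ h = ⊑-cancel k h

  two^-drop : ∀ a {x n} → two^ a * x ⊑ n → x ⊑ n
  two^-drop a {x} {n} h = cancel-pos (2 ^ a) (m^n>0 2 a) (⊑-mono (m≤n*m n (2 ^ a) {{ℕ.>-nonZero (m^n>0 2 a)}}) h)

  two^-≤ : ∀ {a b x n} → a ≤ b → two^ b * x ⊑ n → two^ a * x ⊑ n
  two^-≤ {a} {b} {x} l h = two^-drop (b ∸ a) (⊑-≈ (trans (*-congʳ (trans (reflexive (cong two^ (P.sym (m∸n+n≡m l)))) (two^-+ (b ∸ a) a))) (*-assoc _ _ _)) h)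

  ι-cancel : ∀ k z → k ≢ 0ℤ → ι k * z ≈ 0# → z ≈ 0#
  ι-cancel (+ zero) z ne h = ⊥-elim (ne P.refl)
  ι-cancel (+ suc k) z ne h = ⊑-zero (⊑-cancel k (⊑-mono z≤n (≈0⇒⊑0 h)))
  ι-cancel ℤ.-[1+ k ] z ne h = ⊑-zero (⊑-cancel k (⊑-mono z≤n (≈0⇒⊑0 (trans (sym (-‿involutive _)) (trans (-‿cong (trans (-‿distribˡ-* _ _) (trans (*-congʳ (sym (ι-neg (+ suc k)))) h))) -0#≈0#)))))
    where open import Algebra.Properties.Ring (CommutativeRing.ring ring) using (-‿involutive; -0#≈0#)

  ⊑-↑ : ∀ {x n} k → x ⊑ n → x ↑ k ⊑ n ^ k
  ⊑-↑ zero h = ⊑-≈ ι-1 (⊑-ι 1ℤ)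
  ⊑-↑ (suc k) h = ⊑-* h (⊑-↑ k h)

  ⊑-pair : ∀ {X : Set} {Q : X → Set} {g : X → Carrier} {B} → (∀ x → Q x → g x ⊑ B) → ∀ {p} → Support Q p → ⟨ p , g ⟩ ⊑ norm p ℕ.* B
  ⊑-pair h All.[] = ≈0⇒⊑0 refl
  ⊑-pair {B = B} h {(c , x) ∷ p} (q All.∷ s) = ⊑-mono (≤-reflexive (P.sym (ℕₚ.*-distribʳ-+ B ∣ c ∣ (norm p)))) (⊑-+ (⊑-* (⊑-ι c) (h x q)) (⊑-pair h s))

  taylor-⊑ : ∀ {ξ χ} → ξ ⊑ 2 ^ χ → ∀ i j → taylor ξ i j ⊑ 2 ^ ((1 ℕ.+ χ) ℕ.* j)
  taylor-⊑ {χ = χ} h zero zero = ⊑-mono (m^n>0 2 ((1 ℕ.+ χ) ℕ.* 0)) (⊑-≈ ι-1 (⊑-ι 1ℤ))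
  taylor-⊑ h (suc i) zero = 0⊑ _ refl
  taylor-⊑ {ξ} {χ} h zero (suc j) = ⊑-mono (≤-trans (≤-reflexive (P.sym (^-distribˡ-+-* 2 χ _))) (^-monoʳ-≤ 2 (≤-trans (+-monoˡ-≤ _ (n≤1+n χ)) (≤-reflexive (P.sym (*-suc (1 ℕ.+ χ) j)))))) (⊑-* h (taylor-⊑ {χ = χ} h zero j))
  taylor-⊑ {ξ} {χ} h (suc i) (suc j) = ⊑-mono (≤-trans (+-monoʳ-≤ _ (m≤n*m _ (2 ^ χ) {{ℕ.>-nonZero (m^n>0 2 χ)}})) (≤-reflexive
      (P.trans (cong₂ ℕ._+_ (P.sym (^-distribˡ-+-* 2 χ _)) (P.trans (P.sym (^-distribˡ-+-* 2 χ _)) (P.sym (ℕₚ.+-identityʳ _)))) (cong (2 ^_) (P.sym (*-suc (1 ℕ.+ χ) j))))))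
    (⊑-+ (⊑-* h (taylor-⊑ {χ = χ} h (suc i) j)) (taylor-⊑ {χ = χ} h i j))

  -- A factor G for each of the i - a powers of L in the binomial expansion of taylor L a i.
  taylor-small : ∀ {L G κ} → two^ G * L ⊑ 2 ^ κ → ∀ a i → two^ (G ℕ.* (i ∸ a)) * taylor L a i ⊑ 2 ^ ((1 ℕ.+ κ) ℕ.* i)
  taylor-small {L} {G} {κ} h zero zero = ⊑-mono (m^n>0 2 ((1 ℕ.+ κ) ℕ.* 0)) (⊑-≈ (sym (trans (*-identityʳ _) (reflexive (cong two^ (ℕₚ.*-zeroʳ G))))) (⊑-ι 1ℤ))
  taylor-small h (suc a) zero = 0⊑ _ (zeroʳ _)
  taylor-small {L} {G} {κ} h zero (suc i) = ⊑-≈ eq (⊑-mono (≤-trans (≤-reflexive (P.sym (^-distribˡ-+-* 2 κ _))) (^-monoʳ-≤ 2 (≤-trans (+-monoˡ-≤ _ (n≤1+n κ)) (≤-reflexive (P.sym (*-suc (1 ℕ.+ κ) i)))))) (⊑-* h (taylor-small {L} {G} {κ} h zero i)))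
    where
    eq : (two^ G * L) * (two^ (G ℕ.* i) * taylor L 0 i) ≈ two^ (G ℕ.* suc i) * (L * taylor L 0 i)
    eq = trans (solve 4 (λ g L k t → (g :* L) :* (k :* t) := (g :* k) :* (L :* t)) refl (two^ G) L (two^ (G ℕ.* i)) (taylor L 0 i)) (*-congʳ (trans (sym (two^-+ G (G ℕ.* i))) (reflexive (cong two^ (P.sym (*-suc G i))))))
  taylor-small {L} {G} {κ} h (suc a) (suc i) = ⊑-mono bound (⊑-≈ (sym (distribˡ _ _ _)) (⊑-+ first (taylor-small {L} {G} {κ} h a i)))
    where
    Q = 2 ^ ((1 ℕ.+ κ) ℕ.* i)
    first : two^ (G ℕ.* (i ∸ a)) * (L * taylor L (suc a) i) ⊑ 2 ^ κ ℕ.* Q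
    first with suc a ≤? i
    ... | no g = 0⊑ _ (trans (*-congˡ (trans (*-congˡ (taylor-> L (≰⇒> g))) (zeroʳ L))) (zeroʳ _))
    ... | yes l = ⊑-≈ eq (⊑-* h (taylor-small {L} {G} {κ} h (suc a) i))
      where
      eq : (two^ G * L) * (two^ (G ℕ.* (i ∸ suc a)) * taylor L (suc a) i) ≈ two^ (G ℕ.* (i ∸ a)) * (L * taylor L (suc a) i)
      eq = trans (solve 4 (λ g L k t → (g :* L) :* (k :* t) := (g :* k) :* (L :* t)) refl (two^ G) L (two^ (G ℕ.* (i ∸ suc a))) (taylor L (suc a) i))
        (*-congʳ (trans (sym (two^-+ G _)) (reflexive (cong two^ (P.trans (P.sym (*-suc G (i ∸ suc a))) (cong (G ℕ.*_) (P.sym (+-∸-assoc 1 l))))))))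
    bound : 2 ^ κ ℕ.* Q ℕ.+ Q ≤ 2 ^ ((1 ℕ.+ κ) ℕ.* suc i)
    bound = ≤-trans (+-monoʳ-≤ _ (m≤n*m Q (2 ^ κ) {{ℕ.>-nonZero (m^n>0 2 κ)}})) (≤-reflexive
      (P.trans (cong₂ ℕ._+_ (P.sym (^-distribˡ-+-* 2 κ _)) (P.trans (P.sym (^-distribˡ-+-* 2 κ _)) (P.sym (ℕₚ.+-identityʳ _)))) (cong (2 ^_) (P.sym (*-suc (1 ℕ.+ κ) i)))))

  boxSum : ∀ {m} → Exp m → (Exp m → Carrier) → Carrier
  boxSum [] f = f []
  boxSum (r ∷ rs) f = sum (suc r) (λ i → boxSum rs (λ I → f (i ∷ I)))

  boxSum-cong : ∀ {m} (r : Exp m) {f g} → (∀ I → I ⊑ᵛ r → f I ≈ g I) → boxSum r f ≈ boxSum r g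
  boxSum-cong [] h = h [] []
  boxSum-cong (r ∷ rs) {f} {g} h = sum-cong (suc r) {λ i → boxSum rs (λ I → f (i ∷ I))} {λ i → boxSum rs (λ I → g (i ∷ I))} (λ i l → boxSum-cong rs (λ I q → h (i ∷ I) (≤-pred l ∷ q)))

  boxSum-*ˡ : ∀ {m} (r : Exp m) c f → boxSum r (λ I → c * f I) ≈ c * boxSum r f
  boxSum-*ˡ [] c f = refl
  boxSum-*ˡ (r ∷ rs) c f = trans (sum-cong (suc r) {λ i → boxSum rs (λ I → c * f (i ∷ I))} {λ i → c * boxSum rs (λ I → f (i ∷ I))} (λ i _ → boxSum-*ˡ rs c (λ I → f (i ∷ I)))) (sum-*ˡ (suc r) c (λ i → boxSum rs (λ I → f (i ∷ I))))

  boxSum-pair : ∀ {m} {X : Set} (p : Meas X) (r : Exp m) (f : Exp m → X → Carrier) → ⟨ p , (λ x → boxSum r (λ I → f I x)) ⟩ ≈ boxSum r (λ I → ⟨ p , f I ⟩)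
  boxSum-pair p [] f = refl
  boxSum-pair p (r ∷ rs) f = trans (pair-sum p (suc r) (λ i x → boxSum rs (λ I → f (i ∷ I) x))) (sum-cong (suc r) {λ i → ⟨ p , (λ x → boxSum rs (λ I → f (i ∷ I) x)) ⟩} {λ i → boxSum rs (λ I → ⟨ p , f (i ∷ I) ⟩)} (λ i _ → boxSum-pair p rs (λ I → f (i ∷ I))))

  ⊑-sum : ∀ n {f : ℕ → Carrier} {B} → (∀ i → i < n → f i ⊑ B) → sum n f ⊑ n ℕ.* B
  ⊑-sum zero h = ≈0⇒⊑0 refl
  ⊑-sum (suc n) h = ⊑-+ (h 0 (s≤s z≤n)) (⊑-sum n (λ i l → h (suc i) (s≤s l)))

  ⊑-boxSum : ∀ {m} (r : Exp m) {f B} → (∀ I → I ⊑ᵛ r → f I ⊑ B) → boxSum r f ⊑ 2 ^ Vec.sum r ℕ.* B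
  ⊑-boxSum [] {B = B} h = ⊑-mono (≤-reflexive (P.sym (ℕₚ.*-identityˡ B))) (h [] [])
  ⊑-boxSum (r ∷ rs) {f} {B} h = ⊑-mono (≤-trans (*-monoˡ-≤ _ (suc≤2^ r)) (≤-reflexive (P.trans (P.sym (ℕₚ.*-assoc (2 ^ r) _ B)) (cong (ℕ._* B) (P.sym (^-distribˡ-+-* 2 r (Vec.sum rs)))))))
    (⊑-sum (suc r) {λ i → boxSum rs (λ I → f (i ∷ I))} (λ i l → ⊑-boxSum rs (λ I q → h (i ∷ I) (≤-pred l ∷ q))))

  module _ (ξ : Carrier) where
    taylorξ-⊑ : ∀ {m χ} {r : Exp m} → ξ ⊑ 2 ^ χ → ∀ I J → J ⊑ᵛ r → taylorξ ξ I J ⊑ 2 ^ ((1 ℕ.+ χ) ℕ.* Vec.sum r)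
    taylorξ-⊑ {χ = χ} h [] [] [] = ⊑-mono (m^n>0 2 ((1 ℕ.+ χ) ℕ.* 0)) (⊑-≈ ι-1 (⊑-ι 1ℤ))
    taylorξ-⊑ {χ = χ} {r ∷ rs} h (i ∷ I) (j ∷ J) (l ∷ ls) = ⊑-mono (≤-trans (*-monoˡ-≤ _ (^-monoʳ-≤ 2 (*-monoʳ-≤ (1 ℕ.+ χ) l)))
      (≤-reflexive (P.trans (P.sym (^-distribˡ-+-* 2 ((1 ℕ.+ χ) ℕ.* r) _)) (cong (2 ^_) (P.sym (ℕₚ.*-distribˡ-+ (1 ℕ.+ χ) r _)))))) (⊑-* (taylor-⊑ {χ = χ} h i j) (taylorξ-⊑ {χ = χ} h I J ls))

    data Shifts : ∀ {m} → Vec Carrier m → Vec Carrier m → Vec Carrier m → Set where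
      [] : Shifts [] [] []
      _∷_ : ∀ {m x y L} {xs ys Ls : Vec Carrier m} → x ≈ ξ * y + L → Shifts xs ys Ls → Shifts (x ∷ xs) (y ∷ ys) (L ∷ Ls)

    taylor-cong : ∀ {x y} → x ≈ y → ∀ i j → taylor x i j ≈ taylor y i j
    taylor-cong e zero zero = refl
    taylor-cong e (suc i) zero = refl
    taylor-cong e zero (suc j) = *-cong e (taylor-cong e zero j)
    taylor-cong e (suc i) (suc j) = +-cong (*-cong e (taylor-cong e (suc i) j)) (taylor-cong e i j)

    taylorᵛ-shift : ∀ {m} {xs ys Ls : Vec Carrier m} → Shifts xs ys Ls → ∀ {r J} A → J ⊑ᵛ r →
      taylorᵛ xs ys r A J ≈ boxSum r (λ I → taylorξ ξ I J * taylorᵛ Ls ys r A I)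
    taylorᵛ-shift [] [] [] = sym (*-identityˡ 1#)
    taylorᵛ-shift {suc m} {x ∷ xs} {y ∷ ys} {L ∷ Ls} (e ∷ es) {r ∷ rs} {j ∷ J} (a ∷ A) (l ∷ ls) = begin
      (taylor x a j * y ↑ (r ∸ j)) * taylorᵛ xs ys rs A J ≈⟨ *-cong (trans (*-congʳ (taylor-cong e a j)) (taylor-shift ξ y L r a j l)) (taylorᵛ-shift es A ls) ⟩
      sum (suc r) F * G ≈⟨ sym (sum-*ʳ (suc r) G F) ⟩
      sum (suc r) (λ i → F i * G) ≈⟨ sum-cong (suc r) {λ i → F i * G} {λ i → boxSum rs (λ I → taylorξ ξ (i ∷ I) (j ∷ J) * taylorᵛ (L ∷ Ls) (y ∷ ys) (r ∷ rs) (a ∷ A) (i ∷ I))} (λ i _ →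
          trans (sym (boxSum-*ˡ rs (F i) _)) (boxSum-cong rs (λ I _ → solve 4 (λ a b c d → (a :* b) :* (c :* d) := (a :* c) :* (b :* d)) refl (taylor ξ i j) (taylor L a i * y ↑ (r ∸ i)) (taylorξ ξ I J) (taylorᵛ Ls ys rs A I)))) ⟩
      _ ∎
      where
      F : ℕ → Carrier
      F i = taylor ξ i j * (taylor L a i * y ↑ (r ∸ i))
      G : Carrier
      G = boxSum rs (λ I → taylorξ ξ I J * taylorᵛ Ls ys rs A I)

  gain : ∀ {m} → Vec ℕ m → Exp m → Exp m → ℕ
  gain [] [] [] = 0
  gain (G ∷ Gs) (a ∷ A) (i ∷ I) = G ℕ.* (i ∸ a) ℕ.+ gain Gs A I

  -- Place data: 2^G L is bounded, and so is y / 2^ℓ.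
  data Close (κ : ℕ) : ∀ {m} → Vec ℕ m → Vec ℕ m → Vec Carrier m → Vec Carrier m → Set where
    [] : Close κ [] [] [] []
    _∷_ : ∀ {m G ℓ y L} {Gs ℓs : Vec ℕ m} {ys Ls} → (two^ G * L ⊑ 2 ^ κ) × (y ⊑ 2 ^ (ℓ ℕ.+ κ)) → Close κ Gs ℓs ys Ls → Close κ (G ∷ Gs) (ℓ ∷ ℓs) (y ∷ ys) (L ∷ Ls)

  term-⊑ : ∀ {κ m} {Gs ℓs : Vec ℕ m} {ys Ls} → Close κ Gs ℓs ys Ls → ∀ {r} A I → I ⊑ᵛ r →
    two^ (gain Gs A I ℕ.+ dot ℓs I) * taylorᵛ Ls ys r A I ⊑ 2 ^ ((1 ℕ.+ (κ ℕ.+ κ)) ℕ.* Vec.sum r ℕ.+ dot ℓs r)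
  term-⊑ {κ} [] {[]} [] [] [] = ⊑-mono (m^n>0 2 ((1 ℕ.+ (κ ℕ.+ κ)) ℕ.* 0 ℕ.+ 0)) (⊑-≈ (sym (*-identityʳ _)) (⊑-ι 1ℤ))
  term-⊑ {κ} {suc m} {G ∷ Gs} {ℓ ∷ ℓs} {y ∷ ys} {L ∷ Ls} ((hL , hy) ∷ cs) {r ∷ rs} (a ∷ A) (i ∷ I) (l ∷ ls) =
    ⊑-≈ eq (⊑-mono bound (⊑-* (⊑-* (taylor-small {L} {G} {κ} hL a i) (⊑-* (⊑-ι (+ (2 ^ (ℓ ℕ.* i)))) (⊑-↑ (r ∸ i) hy))) (term-⊑ cs A I ls)))
    where
    eq : ((two^ (G ℕ.* (i ∸ a)) * taylor L a i) * (two^ (ℓ ℕ.* i) * y ↑ (r ∸ i))) * (two^ (gain Gs A I ℕ.+ dot ℓs I) * taylorᵛ Ls ys rs A I)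
       ≈ two^ (G ℕ.* (i ∸ a) ℕ.+ gain Gs A I ℕ.+ (ℓ ℕ.* i ℕ.+ dot ℓs I)) * ((taylor L a i * y ↑ (r ∸ i)) * taylorᵛ Ls ys rs A I)
    eq = trans (solve 6 (λ g t k Y s T → ((g :* t) :* (k :* Y)) :* (s :* T) := ((g :* k) :* s) :* ((t :* Y) :* T)) refl (two^ (G ℕ.* (i ∸ a))) (taylor L a i) (two^ (ℓ ℕ.* i)) (y ↑ (r ∸ i)) (two^ (gain Gs A I ℕ.+ dot ℓs I)) (taylorᵛ Ls ys rs A I))
      (*-congʳ (trans (*-congʳ (sym (two^-+ (G ℕ.* (i ∸ a)) (ℓ ℕ.* i)))) (trans (sym (two^-+ (G ℕ.* (i ∸ a) ℕ.+ ℓ ℕ.* i) (gain Gs A I ℕ.+ dot ℓs I))) (reflexive (cong two^ (N.solve 4 (λ a b c d → a N.:+ b N.:+ (c N.:+ d) N.:= a N.:+ c N.:+ (b N.:+ d)) P.refl (G ℕ.* (i ∸ a)) (ℓ ℕ.* i) (gain Gs A I) (dot ℓs I)))))))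
    bound : 2 ^ ((1 ℕ.+ κ) ℕ.* i) ℕ.* (2 ^ (ℓ ℕ.* i) ℕ.* (2 ^ (ℓ ℕ.+ κ)) ^ (r ∸ i)) ℕ.* 2 ^ ((1 ℕ.+ (κ ℕ.+ κ)) ℕ.* Vec.sum rs ℕ.+ dot ℓs rs)
      ≤ 2 ^ ((1 ℕ.+ (κ ℕ.+ κ)) ℕ.* (r ℕ.+ Vec.sum rs) ℕ.+ (ℓ ℕ.* r ℕ.+ dot ℓs rs))
    bound = ≤-trans (≤-reflexive (P.trans (cong (λ z → 2 ^ ((1 ℕ.+ κ) ℕ.* i) ℕ.* (2 ^ (ℓ ℕ.* i) ℕ.* z) ℕ.* 2 ^ e₄) (^-*-assoc 2 (ℓ ℕ.+ κ) (r ∸ i))) (merge₄ ((1 ℕ.+ κ) ℕ.* i) (ℓ ℕ.* i) ((ℓ ℕ.+ κ) ℕ.* (r ∸ i)) e₄)))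
      (^-monoʳ-≤ 2 (≤-trans (m≤m+n ((1 ℕ.+ κ) ℕ.* i ℕ.+ (ℓ ℕ.* i ℕ.+ (ℓ ℕ.+ κ) ℕ.* (r ∸ i)) ℕ.+ e₄) (κ ℕ.* i ℕ.+ (1 ℕ.+ κ) ℕ.* (r ∸ i))) (≤-reflexive (P.trans
        (N.solve 6 (λ κ i ℓ s σ t → (N.con 1 N.:+ κ) N.:* i N.:+ (ℓ N.:* i N.:+ (ℓ N.:+ κ) N.:* s) N.:+ ((N.con 1 N.:+ (κ N.:+ κ)) N.:* σ N.:+ t) N.:+ (κ N.:* i N.:+ (N.con 1 N.:+ κ) N.:* s)
          N.:= (N.con 1 N.:+ (κ N.:+ κ)) N.:* ((s N.:+ i) N.:+ σ) N.:+ (ℓ N.:* (s N.:+ i) N.:+ t)) P.refl κ i ℓ (r ∸ i) (Vec.sum rs) (dot ℓs rs))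
        (cong (λ z → (1 ℕ.+ (κ ℕ.+ κ)) ℕ.* (z ℕ.+ Vec.sum rs) ℕ.+ (ℓ ℕ.* z ℕ.+ dot ℓs rs)) (m∸n+n≡m l))))))
      where
      e₄ = (1 ℕ.+ (κ ℕ.+ κ)) ℕ.* Vec.sum rs ℕ.+ dot ℓs rs

  -- The size at one real place of the coefficient of index A of p at a point close to ξ.
  place-bound : ∀ {κ χ h T S m} (ξ : Carrier) → ξ ⊑ 2 ^ χ → ∀ {r Gs ℓs : Exp m} {xs ys Ls} → Shifts ξ xs ys Ls → Close κ Gs ℓs ys Ls →
    ∀ (p : Poly m) → Support (_⊑ᵛ r) p → norm p ≤ 2 ^ h → (∀ I → I ⊑ᵛ r → dot ℓs I < T → ⟨ p , taylorξ ξ I ⟩ ≈ 0#) →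
    ∀ A → (∀ I → T ≤ dot ℓs I → S ≤ gain Gs A I ℕ.+ dot ℓs I) →
    two^ S * ⟨ p , taylorᵛ xs ys r A ⟩ ⊑ 2 ^ (h ℕ.+ (3 ℕ.+ χ ℕ.+ (κ ℕ.+ κ)) ℕ.* Vec.sum r ℕ.+ dot ℓs r)
  place-bound {κ} {χ} {h} {T} {S} ξ hξ {r} {Gs} {ℓs} {xs} {ys} {Ls} sh cl p box nm van A gains =
    ⊑-≈ (sym (trans (*-congˡ expand) (sym (boxSum-*ˡ r (two^ S) _)))) (⊑-mono bound (⊑-boxSum r term))
    where
    R = Vec.sum r
    C = 2 ^ ((1 ℕ.+ χ) ℕ.* R)
    E = (1 ℕ.+ (κ ℕ.+ κ)) ℕ.* R ℕ.+ dot ℓs r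
    expand : ⟨ p , taylorᵛ xs ys r A ⟩ ≈ boxSum r (λ I → ⟨ p , taylorξ ξ I ⟩ * taylorᵛ Ls ys r A I)
    expand = trans (pair-congOn (λ J q → taylorᵛ-shift ξ sh A q) box) (trans (boxSum-pair p r (λ I J → taylorξ ξ I J * taylorᵛ Ls ys r A I)) (boxSum-cong r (λ I _ → pair-*ʳ p _ _)))
    term : ∀ I → I ⊑ᵛ r → two^ S * (⟨ p , taylorξ ξ I ⟩ * taylorᵛ Ls ys r A I) ⊑ (2 ^ h ℕ.* C) ℕ.* 2 ^ E
    term I q with dot ℓs I <? T
    ... | yes l = 0⊑ _ (trans (*-congˡ (trans (*-congʳ (van I q l)) (zeroˡ _))) (zeroʳ _))
    ... | no g = ⊑-≈ (solve 3 (λ s a b → a :* (s :* b) := s :* (a :* b)) refl (two^ S) ⟨ p , taylorξ ξ I ⟩ (taylorᵛ Ls ys r A I))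
        (⊑-* (⊑-mono (*-monoˡ-≤ C nm) (⊑-pair (λ J qJ → taylorξ-⊑ ξ {χ = χ} hξ I J qJ) box)) (two^-≤ (gains I (≮⇒≥ g)) (term-⊑ cl A I q)))
    bound : 2 ^ R ℕ.* ((2 ^ h ℕ.* C) ℕ.* 2 ^ E) ≤ 2 ^ (h ℕ.+ (3 ℕ.+ χ ℕ.+ (κ ℕ.+ κ)) ℕ.* R ℕ.+ dot ℓs r)
    bound = ≤-reflexive (P.trans (merge₄′ R h ((1 ℕ.+ χ) ℕ.* R) E)
      (cong (2 ^_) (N.solve 5 (λ R h χ κ t → R N.:+ (h N.:+ (N.con 1 N.:+ χ) N.:* R N.:+ ((N.con 1 N.:+ (κ N.:+ κ)) N.:* R N.:+ t)) N.:= h N.:+ (N.con 3 N.:+ χ N.:+ (κ N.:+ κ)) N.:* R N.:+ t) P.refl R h χ κ (dot ℓs r))))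

2^-cancel-≤ : ∀ {a b} → 2 ^ a ≤ 2 ^ b → a ≤ b
2^-cancel-≤ {a} {b} h with a ≤? b
... | yes l = l
... | no g = ⊥-elim (<⇒≱ (^-monoʳ-< 2 (s≤s (s≤s z≤n)) (≰⇒> g)) h)

pairing-≤ : ∀ {X : Set} {g : X → ℤ} {B} → (∀ x → ∣ g x ∣ ≤ B) → ∀ p → ∣ ⟪ p , g ⟫ ∣ ≤ norm p ℕ.* B
pairing-≤ h [] = z≤n
pairing-≤ {g = g} {B} h ((c , x) ∷ p) = ≤-trans (∣i+j∣≤∣i∣+∣j∣ (c ℤ.* g x) ⟪ p , g ⟫) (≤-trans
  (+-mono-≤ (≤-trans (≤-reflexive (abs-* c (g x))) (*-monoʳ-≤ ∣ c ∣ (h x))) (pairing-≤ h p)) (≤-reflexive (P.sym (ℕₚ.*-distribʳ-+ B ∣ c ∣ (norm p)))))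

trim : ℕ → Meas ℕ → Meas ℕ
trim d [] = []
trim d ((c , j) ∷ p) with j ℕ.≟ d
... | yes _ = trim d p
... | no _ = (c , j) ∷ trim d p

trim-pair : ∀ d p g → ⟪ p , g ⟫ ≡ ⟪ trim d p , g ⟫ ℤ.+ ⟪ p , (λ j → δ j d) ⟫ ℤ.* g d
trim-pair d [] g = P.refl
trim-pair d ((c , j) ∷ p) g with j ℕ.≟ d
... | yes P.refl = P.trans (cong (λ z → c ℤ.* g d ℤ.+ z) (trim-pair d p g)) (S.solve 4 (λ c g t u → c S.:* g S.:+ (t S.:+ u S.:* g) S.:= t S.:+ (c S.:* S.con 1ℤ S.:+ u) S.:* g) P.refl c (g d) ⟪ trim d p , g ⟫ ⟪ p , (λ j → δ j d) ⟫)
... | no _ = P.trans (cong (λ z → c ℤ.* g j ℤ.+ z) (trim-pair d p g)) (S.solve 5 (λ c h g t u → c S.:* h S.:+ (t S.:+ u S.:* g) S.:= c S.:* h S.:+ t S.:+ (c S.:* S.con 0ℤ S.:+ u) S.:* g) P.refl c (g j) (g d) ⟪ trim d p , g ⟫ ⟪ p , (λ j → δ j d) ⟫)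

trim-box : ∀ {d p} → Support (_≤ suc d) p → Support (_≤ d) (trim (suc d) p)
trim-box [] = []
trim-box {d} {(c , j) ∷ p} (l ∷ s) with j ℕ.≟ suc d
... | yes _ = trim-box s
... | no ne = ≤-pred (≤∧≢⇒< l ne) ∷ trim-box s

trim-norm : ∀ d p → norm (trim d p) ≤ norm p
trim-norm d [] = z≤n
trim-norm d ((c , j) ∷ p) with j ℕ.≟ d
... | yes _ = ≤-trans (trim-norm d p) (m≤n+m _ ∣ c ∣)
... | no _ = +-monoʳ-≤ ∣ c ∣ (trim-norm d p)

-- An order of a number field, with its norm down to ℤ.
record NormedOrder : Set₁ where
  field alg : ℤ-Algebra
  open ℤ-Algebra alg public
  field
    nrm : Carrier → ℤ
    nrm-cong : ∀ {x y} → x ≈ y → nrm x ≡ nrm y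
    nrm-* : ∀ x y → nrm (x * y) ≡ nrm x ℤ.* nrm y
    nrm-ι : ∀ z → nrm (ι z) ≡ z ℤ.* z
    anisotropic : ∀ z → nrm z ≡ 0ℤ → z ≈ 0#
    pair-resp : ∀ {X : Set} (p q : Meas X) → p ≋ q → ∀ g → Pairing.⟨_,_⟩ alg p g ≈ Pairing.⟨_,_⟩ alg q g

module Domain (𝒪 : NormedOrder) where
  open NormedOrder 𝒪
  private module A = Solver alg

  nrm-0 : ∀ {x} → x ≈ 0# → nrm x ≡ 0ℤ
  nrm-0 e = P.trans (nrm-cong (trans e (sym ι-0))) (nrm-ι 0ℤ)

  no-zero-divisors : ∀ x y → x * y ≈ 0# → x ≈ 0# ⊎ y ≈ 0#
  no-zero-divisors x y e with i*j≡0⇒i≡0∨j≡0 (nrm x) (P.trans (P.sym (nrm-* x y)) (nrm-0 e))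
  ... | inj₁ z = inj₁ (anisotropic x z)
  ... | inj₂ z = inj₂ (anisotropic y z)

  ι-injective : ∀ z → ι z ≈ 0# → z ≡ 0ℤ
  ι-injective z e with i*j≡0⇒i≡0∨j≡0 z (P.trans (P.sym (nrm-ι z)) (nrm-0 e))
  ... | inj₁ q = q
  ... | inj₂ q = q

  stable : ∀ x → ¬ ¬ (x ≈ 0#) → x ≈ 0#
  stable x k with nrm x ℤ.≟ 0ℤ
  ... | yes e = anisotropic x e
  ... | no ne = ⊥-elim (k (λ e → ne (nrm-0 e)))

  open Pairing alg using (⟨_,_⟩; pair-*; pair-congOn)
  open Taylor alg using (taylor; ↑-cong; _↑_)

  nrm-1 : nrm 1# ≡ 1ℤ
  nrm-1 = P.trans (nrm-cong (sym ι-1)) (nrm-ι 1ℤ)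

  nrm-neg : ∀ x → nrm (- x) ≡ nrm x
  nrm-neg x = P.trans (nrm-cong (A.solve 1 (λ x → A.:- x A.:= A.con (ℤ.- 1ℤ) A.:* x) refl x)) (P.trans (nrm-* (ι (ℤ.- 1ℤ)) x) (P.trans (cong (ℤ._* nrm x) (nrm-ι (ℤ.- 1ℤ))) (ℤₚ.*-identityˡ (nrm x))))

  nrm-↑ : ∀ x n → nrm (x ↑ n) ≡ nrm x ℤ.^ n
  nrm-↑ x zero = nrm-1
  nrm-↑ x (suc n) = P.trans (nrm-* x (x ↑ n)) (cong (nrm x ℤ.*_) (nrm-↑ x n))

  module _ (x y p q : Carrier) (r : ℤ) (r≢0 : r ≢ 0ℤ) (unimodular : q * x - y * p ≈ ι r) (σ w : ℕ) (r-≤ : ∣ r ∣ ≤ 2 ^ σ) (w-≤ : 2 ^ w ≤ ∣ nrm y ∣) where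

    y≢0 : ¬ (y ≈ 0#)
    y≢0 e = <⇒≱ (m^n>0 2 w) (≤-trans w-≤ (≤-reflexive (cong ∣_∣ (nrm-0 e))))

    open Divisibility alg no-zero-divisors x y p q y≢0 using (leading-divisible)

    ι-↑ : ∀ n → ι r ↑ n ≈ ι (r ℤ.^ n)
    ι-↑ zero = sym ι-1
    ι-↑ (suc n) = trans (*-congˡ (ι-↑ n)) (sym (ι-* r (r ℤ.^ n)))

    module _ (d h i : ℕ) (P : Meas ℕ) (box : Support (_≤ d) P) (nm : norm P ≤ 2 ^ h)
      (vanish : ∀ i′ → i′ < i → ⟨ P , (λ j → taylor x i′ j * y ↑ (d ∸ j)) ⟩ ≈ 0#) (lead≢0 : ⟪ P , (λ j → δ j d) ⟫ ≢ 0ℤ) where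
      private
        a = ⟪ P , (λ j → δ j d) ⟫
        n = a ℤ.* r ℤ.^ d
        Z = proj₁ (leading-divisible d P box i vanish)
        n≡ : ι n ≈ (- y) ↑ i * Z
        n≡ = trans (trans (ι-* a (r ℤ.^ d)) (*-congˡ (trans (sym (ι-↑ d)) (↑-cong (sym unimodular) d)))) (proj₂ (leading-divisible d P box i vanish))
        n≢0 : n ≢ 0ℤ
        n≢0 e = [ lead≢0 , power≢0 r≢0 d ]′ (i*j≡0⇒i≡0∨j≡0 a e)
        squares : n ℤ.* n ≡ nrm y ℤ.^ i ℤ.* nrm Z
        squares = P.trans (P.sym (nrm-ι n)) (P.trans (nrm-cong n≡) (P.trans (nrm-* ((- y) ↑ i) Z) (cong (ℤ._* nrm Z) (P.trans (nrm-↑ (- y) i) (cong (ℤ._^ i) (nrm-neg y))))))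
        Z≢0 : ∣ nrm Z ∣ ≢ 0
        Z≢0 e = [ n≢0 , n≢0 ]′ (i*j≡0⇒i≡0∨j≡0 n (P.trans squares (P.trans (cong (nrm y ℤ.^ i ℤ.*_) (∣i∣≡0⇒i≡0 e)) (ℤₚ.*-zeroʳ (nrm y ℤ.^ i)))))
        n-≤ : ∣ n ∣ ≤ 2 ^ (h ℕ.+ σ ℕ.* d)
        n-≤ = ≤-trans (≤-reflexive (P.trans (abs-* a (r ℤ.^ d)) (cong (∣ a ∣ ℕ.*_) (abs-^ r d)))) (≤-trans
          (*-mono-≤ (≤-trans (pairing-≤ (λ j → δ-≤1 j d) P) (≤-trans (≤-reflexive (ℕₚ.*-identityʳ _)) nm)) (≤-trans (^-monoˡ-≤ d r-≤) (≤-reflexive (^-*-assoc 2 σ d))))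
          (≤-reflexive (P.sym (^-distribˡ-+-* 2 h (σ ℕ.* d)))))

      lead-bound : w ℕ.* i ≤ (h ℕ.+ σ ℕ.* d) ℕ.+ (h ℕ.+ σ ℕ.* d)
      lead-bound = 2^-cancel-≤ (begin
        2 ^ (w ℕ.* i) ≡⟨ P.sym (^-*-assoc 2 w i) ⟩
        (2 ^ w) ^ i ≤⟨ ^-monoˡ-≤ i w-≤ ⟩
        ∣ nrm y ∣ ^ i ≤⟨ m≤m*n _ ∣ nrm Z ∣ {{ℕ.≢-nonZero Z≢0}} ⟩
        ∣ nrm y ∣ ^ i ℕ.* ∣ nrm Z ∣ ≡⟨ cong (ℕ._* ∣ nrm Z ∣) (P.sym (abs-^ (nrm y) i)) ⟩
        ∣ nrm y ℤ.^ i ∣ ℕ.* ∣ nrm Z ∣ ≡⟨ P.sym (abs-* (nrm y ℤ.^ i) (nrm Z)) ⟩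
        ∣ nrm y ℤ.^ i ℤ.* nrm Z ∣ ≡⟨ cong ∣_∣ (P.sym squares) ⟩
        ∣ n ℤ.* n ∣ ≡⟨ abs-* n n ⟩
        ∣ n ∣ ℕ.* ∣ n ∣ ≤⟨ *-mono-≤ n-≤ n-≤ ⟩
        2 ^ (h ℕ.+ σ ℕ.* d) ℕ.* 2 ^ (h ℕ.+ σ ℕ.* d) ≡⟨ P.sym (^-distribˡ-+-* 2 (h ℕ.+ σ ℕ.* d) (h ℕ.+ σ ℕ.* d)) ⟩
        2 ^ (h ℕ.+ σ ℕ.* d ℕ.+ (h ℕ.+ σ ℕ.* d)) ∎)
        where open ℕₚ.≤-Reasoning

    κ : ℕ
    κ = 2 ℕ.+ 2 ℕ.* σ

    height : ∀ d h i (P : Meas ℕ) → Support (_≤ d) P → norm P ≤ 2 ^ h → ¬ (P ≋ []) →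
      (∀ i′ → i′ < i → ⟨ P , (λ j → taylor x i′ j * y ↑ (d ∸ j)) ⟩ ≈ 0#) → w ℕ.* i ≤ κ ℕ.* (h ℕ.+ d)
    height d h i P box nm P≢0 v with ⟪ P , (λ j → δ j d) ⟫ ℤ.≟ 0ℤ
    ... | no ne = ≤-trans (lead-bound d h i P box nm v ne) (≤-trans (m≤m+n _ (2 ℕ.* d ℕ.+ 2 ℕ.* (σ ℕ.* h)))
        (≤-reflexive (solve 3 (λ h σ d → h :+ σ :* d :+ (h :+ σ :* d) :+ (con 2 :* d :+ con 2 :* (σ :* h)) := (con 2 :+ con 2 :* σ) :* (h :+ d)) P.refl h σ d)))
      where open +-*-Solver
    height zero h i P box nm P≢0 v | yes z = ⊥-elim (P≢0 (same (λ g → P.trans (trim-pair 0 P g) (cong₂ (λ a b → a ℤ.+ b ℤ.* g 0) (cong (λ q → ⟪ q , g ⟫) (empty box)) z))))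
      where
      empty : ∀ {P} → Support (_≤ 0) P → trim 0 P ≡ []
      empty [] = P.refl
      empty (z≤n ∷ s) = empty s
    height (suc d) h i P box nm P≢0 v | yes z = ≤-trans (height d h i P′ (trim-box box) (≤-trans (trim-norm (suc d) P) nm) (λ e → P≢0 (same (λ g → P.trans (P.sym (pairings same-P g)) (pairings e g))))
        (λ i′ l → cancel (⟨ P′ , (λ j → taylor x i′ j * y ↑ (d ∸ j)) ⟩) (trans (sym (pair-* P′ y (λ j → taylor x i′ j * y ↑ (d ∸ j)))) (trans (pair-congOn (λ j lj → lower i′ j lj) (trim-box box)) (trans (pair-resp P′ P same-P _) (v i′ l))))))
        (*-monoʳ-≤ κ (+-monoʳ-≤ h (n≤1+n d)))
      where
      P′ = trim (suc d) P
      same-P : P′ ≋ P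
      same-P = same (λ g → P.sym (P.trans (trim-pair (suc d) P g) (P.trans (cong (λ a → ⟪ P′ , g ⟫ ℤ.+ a ℤ.* g (suc d)) z) (ℤₚ.+-identityʳ _))))
      lower : ∀ i′ j → j ≤ d → y * (taylor x i′ j * y ↑ (d ∸ j)) ≈ taylor x i′ j * y ↑ (suc d ∸ j)
      lower i′ j l = trans (trans (sym (*-assoc y (taylor x i′ j) _)) (trans (*-congʳ (*-comm y (taylor x i′ j))) (*-assoc (taylor x i′ j) y _)))
        (*-congˡ (reflexive (cong (y ↑_) (P.sym (+-∸-assoc 1 l)))))
      cancel : ∀ u → y * u ≈ 0# → u ≈ 0#
      cancel u e with no-zero-divisors y u e
      ... | inj₁ q = ⊥-elim (y≢0 q)
      ... | inj₂ q = q

-- The order ℤ[θ] with θ² = b θ + c, as pairs (u , v) = u + v θ.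
module Quadratic (b c : ℤ) where
  𝕆 : Set
  𝕆 = ℤ × ℤ

  infixl 6 _+ᵒ_
  infixl 7 _*ᵒ_
  _+ᵒ_ _*ᵒ_ : 𝕆 → 𝕆 → 𝕆
  (u , v) +ᵒ (u′ , v′) = u ℤ.+ u′ , v ℤ.+ v′
  (u , v) *ᵒ (u′ , v′) = u ℤ.* u′ ℤ.+ c ℤ.* (v ℤ.* v′) , u ℤ.* v′ ℤ.+ v ℤ.* u′ ℤ.+ b ℤ.* (v ℤ.* v′)

  negᵒ : 𝕆 → 𝕆
  negᵒ (u , v) = ℤ.- u , ℤ.- v

  0ᵒ 1ᵒ : 𝕆
  0ᵒ = 0ℤ , 0ℤ
  1ᵒ = 1ℤ , 0ℤ

  ιᵒ : ℤ → 𝕆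
  ιᵒ z = z , 0ℤ

  *ᵒ-comm : ∀ x y → x *ᵒ y ≡ y *ᵒ x
  *ᵒ-comm (u , v) (u′ , v′) = cong₂ _,_ (S.solve 5 (λ c u v u′ v′ → u S.:* u′ S.:+ c S.:* (v S.:* v′) S.:= u′ S.:* u S.:+ c S.:* (v′ S.:* v)) P.refl c u v u′ v′)
    (S.solve 5 (λ b u v u′ v′ → u S.:* v′ S.:+ v S.:* u′ S.:+ b S.:* (v S.:* v′) S.:= u′ S.:* v S.:+ v′ S.:* u S.:+ b S.:* (v′ S.:* v)) P.refl b u v u′ v′)

  *ᵒ-identityˡ : ∀ x → 1ᵒ *ᵒ x ≡ x
  *ᵒ-identityˡ (u , v) = cong₂ _,_ (S.solve 3 (λ c u v → S.con 1ℤ S.:* u S.:+ c S.:* (S.con 0ℤ S.:* v) S.:= u) P.refl c u v)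
    (S.solve 3 (λ b u v → S.con 1ℤ S.:* v S.:+ S.con 0ℤ S.:* u S.:+ b S.:* (S.con 0ℤ S.:* v) S.:= v) P.refl b u v)

  *ᵒ-distribˡ : ∀ x y z → x *ᵒ (y +ᵒ z) ≡ x *ᵒ y +ᵒ x *ᵒ z
  *ᵒ-distribˡ (u , v) (u′ , v′) (u″ , v″) = cong₂ _,_
    (S.solve 7 (λ c u v u′ v′ u″ v″ → u S.:* (u′ S.:+ u″) S.:+ c S.:* (v S.:* (v′ S.:+ v″)) S.:= u S.:* u′ S.:+ c S.:* (v S.:* v′) S.:+ (u S.:* u″ S.:+ c S.:* (v S.:* v″))) P.refl c u v u′ v′ u″ v″)
    (S.solve 7 (λ b u v u′ v′ u″ v″ → u S.:* (v′ S.:+ v″) S.:+ v S.:* (u′ S.:+ u″) S.:+ b S.:* (v S.:* (v′ S.:+ v″)) S.:= u S.:* v′ S.:+ v S.:* u′ S.:+ b S.:* (v S.:* v′) S.:+ (u S.:* v″ S.:+ v S.:* u″ S.:+ b S.:* (v S.:* v″))) P.refl b u v u′ v′ u″ v″)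

  *ᵒ-assoc : ∀ x y z → (x *ᵒ y) *ᵒ z ≡ x *ᵒ (y *ᵒ z)
  *ᵒ-assoc (u , v) (u′ , v′) (u″ , v″) = cong₂ _,_
    (S.solve 8 (λ b c u v u′ v′ u″ v″ → (u S.:* u′ S.:+ c S.:* (v S.:* v′)) S.:* u″ S.:+ c S.:* ((u S.:* v′ S.:+ v S.:* u′ S.:+ b S.:* (v S.:* v′)) S.:* v″)
      S.:= u S.:* (u′ S.:* u″ S.:+ c S.:* (v′ S.:* v″)) S.:+ c S.:* (v S.:* (u′ S.:* v″ S.:+ v′ S.:* u″ S.:+ b S.:* (v′ S.:* v″)))) P.refl b c u v u′ v′ u″ v″)
    (S.solve 8 (λ b c u v u′ v′ u″ v″ → (u S.:* u′ S.:+ c S.:* (v S.:* v′)) S.:* v″ S.:+ (u S.:* v′ S.:+ v S.:* u′ S.:+ b S.:* (v S.:* v′)) S.:* u″ S.:+ b S.:* ((u S.:* v′ S.:+ v S.:* u′ S.:+ b S.:* (v S.:* v′)) S.:* v″)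
      S.:= u S.:* (u′ S.:* v″ S.:+ v′ S.:* u″ S.:+ b S.:* (v′ S.:* v″)) S.:+ v S.:* (u′ S.:* u″ S.:+ c S.:* (v′ S.:* v″)) S.:+ b S.:* (v S.:* (u′ S.:* v″ S.:+ v′ S.:* u″ S.:+ b S.:* (v′ S.:* v″)))) P.refl b c u v u′ v′ u″ v″)

  𝕆-ring : CommutativeRing _ _
  𝕆-ring = record
    { Carrier = 𝕆 ; _≈_ = _≡_ ; _+_ = _+ᵒ_ ; _*_ = _*ᵒ_ ; -_ = negᵒ ; 0# = 0ᵒ ; 1# = 1ᵒ
    ; isCommutativeRing = record
      { isRing = record
        { +-isAbelianGroup = record
          { isGroup = record
            { isMonoid = record
              { isSemigroup = record
                { isMagma = record { isEquivalence = P.isEquivalence ; ∙-cong = cong₂ _+ᵒ_ }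
                ; assoc = λ { (u , v) (u′ , v′) (u″ , v″) → cong₂ _,_ (ℤₚ.+-assoc u u′ u″) (ℤₚ.+-assoc v v′ v″) } }
              ; identity = (λ { (u , v) → cong₂ _,_ (ℤₚ.+-identityˡ u) (ℤₚ.+-identityˡ v) }) , (λ { (u , v) → cong₂ _,_ (ℤₚ.+-identityʳ u) (ℤₚ.+-identityʳ v) }) }
            ; inverse = (λ { (u , v) → cong₂ _,_ (ℤₚ.+-inverseˡ u) (ℤₚ.+-inverseˡ v) }) , (λ { (u , v) → cong₂ _,_ (ℤₚ.+-inverseʳ u) (ℤₚ.+-inverseʳ v) })
            ; ⁻¹-cong = cong negᵒ }
          ; comm = λ { (u , v) (u′ , v′) → cong₂ _,_ (ℤₚ.+-comm u u′) (ℤₚ.+-comm v v′) } }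
        ; *-cong = cong₂ _*ᵒ_
        ; *-assoc = *ᵒ-assoc
        ; *-identity = *ᵒ-identityˡ , (λ x → P.trans (*ᵒ-comm x 1ᵒ) (*ᵒ-identityˡ x))
        ; distrib = *ᵒ-distribˡ , (λ x y z → P.trans (*ᵒ-comm (y +ᵒ z) x) (P.trans (*ᵒ-distribˡ x y z) (cong₂ _+ᵒ_ (*ᵒ-comm x y) (*ᵒ-comm x z)))) }
      ; *-comm = *ᵒ-comm } }

  ιᵒ-* : ∀ x y → ιᵒ (x ℤ.* y) ≡ ιᵒ x *ᵒ ιᵒ y
  ιᵒ-* x y = cong₂ _,_ (S.solve 3 (λ c x y → x S.:* y S.:= x S.:* y S.:+ c S.:* (S.con 0ℤ S.:* S.con 0ℤ)) P.refl c x y)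
    (S.solve 3 (λ b x y → S.con 0ℤ S.:= x S.:* S.con 0ℤ S.:+ S.con 0ℤ S.:* y S.:+ b S.:* (S.con 0ℤ S.:* S.con 0ℤ)) P.refl b x y)

  𝕆-alg : ℤ-Algebra
  𝕆-alg = record { ring = 𝕆-ring ; ι = ιᵒ ; ι-+ = λ _ _ → P.refl ; ι-* = ιᵒ-* ; ι-neg = λ _ → P.refl ; ι-0 = P.refl ; ι-1 = P.refl }

  nrm : 𝕆 → ℤ
  nrm (u , v) = u ℤ.* u ℤ.+ b ℤ.* (u ℤ.* v) ℤ.- c ℤ.* (v ℤ.* v)

  nrm-* : ∀ x y → nrm (x *ᵒ y) ≡ nrm x ℤ.* nrm y
  nrm-* (u , v) (u′ , v′) = S.solve 6 (λ b c u v u′ v′ →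
    let U = u S.:* u′ S.:+ c S.:* (v S.:* v′)
        V = u S.:* v′ S.:+ v S.:* u′ S.:+ b S.:* (v S.:* v′)
    in U S.:* U S.:+ b S.:* (U S.:* V) S.:- c S.:* (V S.:* V) S.:= (u S.:* u S.:+ b S.:* (u S.:* v) S.:- c S.:* (v S.:* v)) S.:* (u′ S.:* u′ S.:+ b S.:* (u′ S.:* v′) S.:- c S.:* (v′ S.:* v′))) P.refl b c u v u′ v′

  nrm-ι : ∀ z → nrm (ιᵒ z) ≡ z ℤ.* z
  nrm-ι z = S.solve 3 (λ b c z → z S.:* z S.:+ b S.:* (z S.:* S.con 0ℤ) S.:- c S.:* (S.con 0ℤ S.:* S.con 0ℤ) S.:= z S.:* z) P.refl b c z

  -- The trace of x times the conjugate of y.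
  tr : 𝕆 → 𝕆 → ℤ
  tr (u , v) (u′ , v′) = + 2 ℤ.* (u ℤ.* u′) ℤ.+ b ℤ.* (u ℤ.* v′ ℤ.+ v ℤ.* u′) ℤ.- + 2 ℤ.* (c ℤ.* (v ℤ.* v′))

  private
    module Symbolic {n : ℕ} (b c : S.Polynomial n) where
      O : Set
      O = S.Polynomial n × S.Polynomial n
      infixl 6 _⊕_
      infixl 7 _⊠_
      _⊕_ _⊠_ : O → O → O
      (u , v) ⊕ (u′ , v′) = u S.:+ u′ , v S.:+ v′
      (u , v) ⊠ (u′ , v′) = u S.:* u′ S.:+ c S.:* (v S.:* v′) , u S.:* v′ S.:+ v S.:* u′ S.:+ b S.:* (v S.:* v′)
      N : O → S.Polynomial n
      N (u , v) = u S.:* u S.:+ b S.:* (u S.:* v) S.:- c S.:* (v S.:* v)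
      T : O → O → S.Polynomial n
      T (u , v) (u′ , v′) = S.con (+ 2) S.:* (u S.:* u′) S.:+ b S.:* (u S.:* v′ S.:+ v S.:* u′) S.:- S.con (+ 2) S.:* (c S.:* (v S.:* v′))
      I : S.Polynomial n → O
      I z = z , S.con 0ℤ
      relation : O → O → O
      relation x y = I (N x) ⊠ (y ⊠ (y ⊠ I (S.con 1ℤ))) ⊕ x ⊠ (I (S.:- T x y) ⊠ (y ⊠ I (S.con 1ℤ)) ⊕ x ⊠ (I (N y) ⊠ I (S.con 1ℤ) ⊕ x ⊠ I (S.con 0ℤ)))

  quadratic-relation : ∀ x y → ιᵒ (nrm x) *ᵒ (y *ᵒ (y *ᵒ 1ᵒ)) +ᵒ x *ᵒ (ιᵒ (ℤ.- tr x y) *ᵒ (y *ᵒ 1ᵒ) +ᵒ x *ᵒ (ιᵒ (nrm y) *ᵒ 1ᵒ +ᵒ x *ᵒ 0ᵒ)) ≡ 0ᵒ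
  quadratic-relation (u , v) (u′ , v′) = cong₂ _,_
    (S.solve 6 (λ b c u v u′ v′ → proj₁ (Symbolic.relation b c (u , v) (u′ , v′)) S.:= S.con 0ℤ) P.refl b c u v u′ v′)
    (S.solve 6 (λ b c u v u′ v′ → proj₂ (Symbolic.relation b c (u , v) (u′ , v′)) S.:= S.con 0ℤ) P.refl b c u v u′ v′)

  linear-form : ∀ x y u v → ιᵒ u *ᵒ (y *ᵒ 1ᵒ) +ᵒ x *ᵒ (ιᵒ v *ᵒ 1ᵒ +ᵒ x *ᵒ 0ᵒ) ≡ (u ℤ.* proj₁ y ℤ.+ v ℤ.* proj₁ x , u ℤ.* proj₂ y ℤ.+ v ℤ.* proj₂ x)
  linear-form (x , x′) (y , y′) u v = cong₂ _,_
    (S.solve 8 (λ b c x x′ y y′ u v → let open Symbolic b c in proj₁ (I u ⊠ ((y , y′) ⊠ I (S.con 1ℤ)) ⊕ (x , x′) ⊠ (I v ⊠ I (S.con 1ℤ) ⊕ (x , x′) ⊠ I (S.con 0ℤ))) S.:= u S.:* y S.:+ v S.:* x) P.refl b c x x′ y y′ u v)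
    (S.solve 8 (λ b c x x′ y y′ u v → let open Symbolic b c in proj₂ (I u ⊠ ((y , y′) ⊠ I (S.con 1ℤ)) ⊕ (x , x′) ⊠ (I v ⊠ I (S.con 1ℤ) ⊕ (x , x′) ⊠ I (S.con 0ℤ))) S.:= u S.:* y′ S.:+ v S.:* x′) P.refl b c x x′ y y′ u v)

  nrm-combination : ∀ x y p q → nrm x ℤ.* (q ℤ.* q) ℤ.+ (ℤ.- tr x y) ℤ.* (p ℤ.* q) ℤ.+ nrm y ℤ.* (p ℤ.* p) ≡ nrm (q ℤ.* proj₁ x ℤ.- p ℤ.* proj₁ y , q ℤ.* proj₂ x ℤ.- p ℤ.* proj₂ y)
  nrm-combination (u , v) (u′ , v′) p q = S.solve 8 (λ b c u v u′ v′ p q → let open Symbolic b c in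
    N (u , v) S.:* (q S.:* q) S.:+ (S.:- T (u , v) (u′ , v′)) S.:* (p S.:* q) S.:+ N (u′ , v′) S.:* (p S.:* p) S.:= N (q S.:* u S.:- p S.:* u′ , q S.:* v S.:- p S.:* v′)) P.refl b c u v u′ v′ p q

  open Pairing 𝕆-alg using (⟨_,_⟩)

  pair-components : ∀ {X : Set} (p : Meas X) (g : X → 𝕆) → ⟨ p , g ⟩ ≡ (⟪ p , (λ x → proj₁ (g x)) ⟫ , ⟪ p , (λ x → proj₂ (g x)) ⟫)
  pair-components [] g = P.refl
  pair-components ((k , x) ∷ p) g = P.trans (cong (ιᵒ k *ᵒ g x +ᵒ_) (pair-components p g)) (cong₂ _,_
    (S.solve 5 (λ c k u v a → k S.:* u S.:+ c S.:* (S.con 0ℤ S.:* v) S.:+ a S.:= k S.:* u S.:+ a) P.refl c k (proj₁ (g x)) (proj₂ (g x)) ⟪ p , (λ x → proj₁ (g x)) ⟫)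
    (S.solve 5 (λ b k u v a → k S.:* v S.:+ S.con 0ℤ S.:* u S.:+ b S.:* (S.con 0ℤ S.:* v) S.:+ a S.:= k S.:* v S.:+ a) P.refl b k (proj₁ (g x)) (proj₂ (g x)) ⟪ p , (λ x → proj₂ (g x)) ⟫))

  pair-resp : ∀ {X : Set} (p q : Meas X) → p ≋ q → ∀ g → ⟨ p , g ⟩ ≡ ⟨ q , g ⟩
  pair-resp p q e g = P.trans (pair-components p g) (P.trans (cong₂ _,_ (pairings e _) (pairings e _)) (P.sym (pair-components q g)))

  order : (∀ z → nrm z ≡ 0ℤ → z ≡ 0ᵒ) → NormedOrder
  order anisotropic = record { alg = 𝕆-alg ; nrm = nrm ; nrm-cong = cong nrm ; nrm-* = nrm-* ; nrm-ι = nrm-ι ; anisotropic = anisotropic ; pair-resp = pair-resp }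

Weights-sum : ∀ {m L} {w r : Exp m} B → Weights L w r → VecAll.All (B ≤_) w → B ℕ.* Vec.sum r ≤ m ℕ.* L
Weights-sum B [] [] = ≤-reflexive (ℕₚ.*-zeroʳ B)
Weights-sum {r = r ∷ rs} B (e ∷ es) (l ∷ ls) = ≤-trans (≤-reflexive (ℕₚ.*-distribˡ-+ B r _))
  (+-mono-≤ (≤-trans (*-monoˡ-≤ r l) (≤-reflexive e)) (Weights-sum B es ls))

Weights-dot : ∀ {m L} {w r : Exp m} → Weights L w r → dot w r ≡ m ℕ.* L
Weights-dot [] = P.refl
Weights-dot (e ∷ es) = cong₂ ℕ._+_ e (Weights-dot es)

count-arith : ∀ n N e D L₀ m k → 2 ℕ.* (e ℕ.* e) ℕ.* m ≡ D ℕ.* (k ℕ.* k) → 0 < m → 0 < k → 0 < L₀ →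
  n ℕ.* ((e ℕ.* (m ℕ.* L₀) ℕ.+ e ℕ.* (m ℕ.* L₀)) ℕ.* (e ℕ.* (m ℕ.* L₀) ℕ.+ e ℕ.* (m ℕ.* L₀))) ≤ N ℕ.* (m ℕ.* ((k ℕ.* L₀) ℕ.* (k ℕ.* L₀))) →
  n ℕ.* D ℕ.+ n ℕ.* D ≤ N
count-arith n N e D L₀ m k h m>0 k>0 L>0 hyp = *-cancelʳ-≤ _ N Q {{ℕ.>-nonZero Q>0}} (≤-trans (≤-reflexive (begin
  (n ℕ.* D ℕ.+ n ℕ.* D) ℕ.* Q ≡⟨ solve 5 (λ n D L m k → (n :* D :+ n :* D) :* (m :* ((k :* L) :* (k :* L))) := n :* m :* (L :* L) :* con 2 :* (D :* (k :* k))) P.refl n D L₀ m k ⟩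
  n ℕ.* m ℕ.* (L₀ ℕ.* L₀) ℕ.* 2 ℕ.* (D ℕ.* (k ℕ.* k)) ≡⟨ cong (n ℕ.* m ℕ.* (L₀ ℕ.* L₀) ℕ.* 2 ℕ.*_) (P.sym h) ⟩
  n ℕ.* m ℕ.* (L₀ ℕ.* L₀) ℕ.* 2 ℕ.* (2 ℕ.* (e ℕ.* e) ℕ.* m)
    ≡⟨ solve 4 (λ n e L m → n :* m :* (L :* L) :* con 2 :* (con 2 :* (e :* e) :* m) := n :* ((e :* (m :* L) :+ e :* (m :* L)) :* (e :* (m :* L) :+ e :* (m :* L)))) P.refl n e L₀ m ⟩
  _ ∎)) hyp)
  where
  open +-*-Solver
  open P.≡-Reasoning
  Q = m ℕ.* ((k ℕ.* L₀) ℕ.* (k ℕ.* L₀))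
  Q>0 : 0 < Q
  Q>0 = *-mono-≤ m>0 (*-mono-≤ (*-mono-≤ k>0 L>0) (*-mono-≤ k>0 L>0))

constants : ∀ e D → 2 ℕ.* (e ℕ.* e) ℕ.* (2048 ℕ.* (e ℕ.* e) ℕ.* D) ≡ D ℕ.* ((64 ℕ.* (e ℕ.* e)) ℕ.* (64 ℕ.* (e ℕ.* e)))
constants e D = +-*-Solver.solve 2 (λ e D → con 2 :* (e :* e) :* (con 2048 :* (e :* e) :* D) := D :* ((con 64 :* (e :* e)) :* (con 64 :* (e :* e)))) P.refl e D
  where open +-*-Solver using (con; _:*_; _:=_)

final-arith : ∀ e μ → 0 < μ → let e′ = suc e ; Y = μ ℕ.* (30 ℕ.+ 32 ℕ.* e) ; V = e′ ℕ.* Y ; T = V ℕ.+ e′ ℕ.* μ in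
  μ ℕ.+ 64 ℕ.* (e′ ℕ.* e′) ℕ.* μ ℕ.+ (μ ℕ.+ 64 ℕ.* (e′ ℕ.* e′) ℕ.* μ) < suc e′ ℕ.* Y ℕ.+ T ℕ.+ (V ℕ.+ T)
final-arith e μ μ>0 = ≤-trans (≤-trans (≤-reflexive (P.trans (cong suc (P.sym (ℕₚ.+-identityʳ _))) (P.sym (+-suc _ 0)))) (+-monoʳ-≤ (μ ℕ.+ 64 ℕ.* (suc e ℕ.* suc e) ℕ.* μ ℕ.+ (μ ℕ.+ 64 ℕ.* (suc e ℕ.* suc e) ℕ.* μ)) (≤-trans μ>0 (m≤m*n μ (22 ℕ.+ 26 ℕ.* e)))))
  (≤-reflexive (solve 2 (λ e μ → let e′ = con 1 :+ e ; Y = μ :* (con 30 :+ con 32 :* e) ; V = e′ :* Y ; T = V :+ e′ :* μ ; Z = μ :+ con 64 :* (e′ :* e′) :* μ in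
    Z :+ Z :+ μ :* (con 22 :+ con 26 :* e) := (con 1 :+ e′) :* Y :+ T :+ (V :+ T)) P.refl e μ))
  where open +-*-Solver

record Embedding (𝒪 : NormedOrder) (𝔸 : BoundedAlgebra) : Set where
  private
    module O = NormedOrder 𝒪
    module TO = Taylor O.alg
    module PO = Pairing O.alg
  open BoundedAlgebra 𝔸
  open Taylor alg using (taylor; taylorᵛ; _↑_)
  open Pairing alg using (⟨_,_⟩)
  field
    ε : O.Carrier → Carrier
    ε-cong : ∀ {z w} → z O.≈ w → ε z ≈ ε w
    ε-+ : ∀ z w → ε (z O.+ w) ≈ ε z + ε w
    ε-* : ∀ z w → ε (z O.* w) ≈ ε z * ε w
    ε-ι : ∀ k → ε (O.ι k) ≈ ι k

  ε-0 : ε O.0# ≈ 0#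
  ε-0 = trans (ε-cong (O.sym O.ι-0)) (trans (ε-ι 0ℤ) ι-0)

  ε-1 : ε O.1# ≈ 1#
  ε-1 = trans (ε-cong (O.sym O.ι-1)) (trans (ε-ι 1ℤ) ι-1)

  ε-pair : ∀ {X : Set} (p : Meas X) (g : X → O.Carrier) → ε (PO.⟨_,_⟩ p g) ≈ ⟨ p , (λ x → ε (g x)) ⟩
  ε-pair List.[] g = ε-0
  ε-pair ((k , x) List.∷ p) g = trans (ε-+ (O.ι k O.* g x) _) (+-cong (trans (ε-* (O.ι k) (g x)) (*-congʳ (ε-ι k))) (ε-pair p g))

  ε-↑ : ∀ z n → ε (z TO.↑ n) ≈ ε z ↑ n
  ε-↑ z zero = ε-1
  ε-↑ z (suc n) = trans (ε-* z (z TO.↑ n)) (*-congˡ (ε-↑ z n))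

  ε-taylor : ∀ z i j → ε (TO.taylor z i j) ≈ taylor (ε z) i j
  ε-taylor z zero zero = ε-1
  ε-taylor z (suc i) zero = ε-0
  ε-taylor z zero (suc j) = trans (ε-* z (TO.taylor z 0 j)) (*-congˡ (ε-taylor z 0 j))
  ε-taylor z (suc i) (suc j) = trans (ε-+ (z O.* TO.taylor z (suc i) j) (TO.taylor z i j)) (+-cong (trans (ε-* z (TO.taylor z (suc i) j)) (*-congˡ (ε-taylor z (suc i) j))) (ε-taylor z i j))

  ε-taylorᵛ : ∀ {m} (xs ys : Vec O.Carrier m) d I J →
    ε (TO.taylorᵛ xs ys d I J) ≈ taylorᵛ (Vec.map ε xs) (Vec.map ε ys) d I J
  ε-taylorᵛ [] [] [] [] [] = ε-1
  ε-taylorᵛ (x ∷ xs) (y ∷ ys) (d ∷ ds) (i ∷ I) (j ∷ J) = trans (ε-* (TO.taylor x i j O.* y TO.↑ (d ∸ j)) _)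
    (*-cong (trans (ε-* (TO.taylor x i j) (y TO.↑ (d ∸ j))) (*-cong (ε-taylor x i j) (ε-↑ y (d ∸ j)))) (ε-taylorᵛ xs ys ds I J))

module Descent (𝔸 : BoundedAlgebra) (𝒪 : NormedOrder) (emb₁ emb₂ : Embedding 𝒪 𝔸)
  (norm-product : ∀ z → BoundedAlgebra._≈_ 𝔸 (BoundedAlgebra._*_ 𝔸 (Embedding.ε emb₁ z) (Embedding.ε emb₂ z)) (BoundedAlgebra.ι 𝔸 (NormedOrder.nrm 𝒪 z))) where
  open BoundedAlgebra 𝔸
  open Bounds 𝔸
  open Pairing alg
  open Sum ring using (sum)
  open Taylor alg using (taylor; taylorξ; _↑_)
  open Solver alg using (solve; _:=_; _:+_; _:*_; _:-_; :-_; con)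
  private
    module O = NormedOrder 𝒪
    module PO = Pairing O.alg
    module E₁ = Embedding emb₁
    module E₂ = Embedding emb₂
    module Dom = Domain 𝒪
    module RL (κ₀ : ℕ) = RothLemma O.alg Dom.ι-injective Dom.no-zero-divisors Dom.stable O.pair-resp κ₀

  small-norm : ∀ z A B S T → two^ A * E₁.ε z ⊑ 2 ^ S → two^ B * E₂.ε z ⊑ 2 ^ T → ¬ (z O.≈ O.0#) → A ℕ.+ B ≤ S ℕ.+ T
  small-norm z A B S T h₁ h₂ z≢0 = 2^-cancel-≤ (≤-trans (m≤m*n (2 ^ (A ℕ.+ B)) ∣ O.nrm z ∣ {{ℕ.≢-nonZero (λ q → z≢0 (O.anisotropic z (∣i∣≡0⇒i≡0 q)))}})
    (≤-trans (≤-reflexive (P.sym (abs-* (+ (2 ^ (A ℕ.+ B))) (O.nrm z)))) (≤-trans (⊑-int (⊑-≈ eq (⊑-* h₁ h₂))) (≤-reflexive (P.sym (^-distribˡ-+-* 2 S T))))))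
    where
    eq : (two^ A * E₁.ε z) * (two^ B * E₂.ε z) ≈ ι (+ (2 ^ (A ℕ.+ B)) ℤ.* O.nrm z)
    eq = trans (solve 4 (λ a x b y → (a :* x) :* (b :* y) := (a :* b) :* (x :* y)) refl (two^ A) (E₁.ε z) (two^ B) (E₂.ε z)) (trans (*-cong (sym (two^-+ A B)) (norm-product z)) (sym (ι-* _ _)))

  module Approximations (ξ : Carrier) (χ : ℕ) (ξ⊑ : ξ ⊑ 2 ^ χ) (D′ : ℕ) (f : ℕ → ℤ) (lead≢0 : f (suc D′) ≢ 0ℤ) (φ : ℕ) (f-≤ : ∀ s → s ≤ suc D′ → ∣ f s ∣ ≤ 2 ^ φ)
    (root : sum (suc (suc D′)) (λ s → ι (f s) * ξ ↑ s) ≈ 0#) (σ κ e₁ : ℕ) where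

    record Point : Set where
      field
        ℓ g : ℕ
        x y p q : O.Carrier
        r : ℤ
        r≢0 : r ≢ 0ℤ
        r-≤ : ∣ r ∣ ≤ 2 ^ σ
        unimodular : q O.* x O.- y O.* p O.≈ O.ι r
        height-≥ : 2 ^ ℓ ≤ ∣ O.nrm y ∣
        close₁ : two^ g * (E₁.ε x - ξ * E₁.ε y) ⊑ 2 ^ κ
        close₂ : two^ ℓ * (E₂.ε x - ξ * E₂.ε y) ⊑ 2 ^ κ
        size₁ : E₁.ε y ⊑ 2 ^ (ℓ ℕ.+ κ)
        size₂ : E₂.ε y ⊑ 2 ^ (ℓ ℕ.+ κ)
        quality : suc (suc e₁) ℕ.* ℓ ≤ suc e₁ ℕ.* g
    open Point

    private
      e′ = suc e₁
      D = suc D′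
      φ′ = suc φ
      κ₀ = 2 ℕ.+ 2 ℕ.* σ
      m = 2048 ℕ.* (e′ ℕ.* e′) ℕ.* D
      K = 64 ℕ.* (e′ ℕ.* e′)
      lemma-E = RL.small-index κ₀ m (64 ℕ.* e′)
      E = proj₁ lemma-E
      c₁ = 4 ℕ.+ φ′ ℕ.+ (3 ℕ.+ χ ℕ.+ (κ ℕ.+ κ))
      B₁ = K ℕ.* c₁
      B₂ = E ℕ.* (5 ℕ.+ φ′) ℕ.* m
      ℓ₀ = 1 ℕ.+ B₁ ℕ.+ B₂
      m>0 : 0 < m
      m>0 = s≤s z≤n

    ℓs gs : ∀ {n} → Vec Point n → Vec ℕ n
    ℓs = Vec.map ℓ
    gs = Vec.map g
    xs ys : ∀ {n} → Vec Point n → Vec O.Carrier n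
    xs = Vec.map x
    ys = Vec.map y

    prod : ∀ {n} → Vec Point n → ℕ
    prod [] = 1
    prod (P ∷ Ps) = ℓ P ℕ.* prod Ps

    degs : ∀ {n} → ℕ → Vec Point n → Exp n
    degs k [] = []
    degs k (P ∷ Ps) = k ℕ.* prod Ps ∷ degs (k ℕ.* ℓ P) Ps

    degs-weights : ∀ {n} k (Ps : Vec Point n) → Weights (k ℕ.* prod Ps) (ℓs Ps) (degs k Ps)
    degs-weights k [] = []
    degs-weights k (P ∷ Ps) = N.solve 3 (λ l k p → l N.:* (k N.:* p) N.:= k N.:* (l N.:* p)) P.refl (ℓ P) k (prod Ps) ∷
      subst (λ L → Weights L (ℓs Ps) (degs (k ℕ.* ℓ P) Ps)) (ℕₚ.*-assoc k (ℓ P) (prod Ps)) (degs-weights (k ℕ.* ℓ P) Ps)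

    Growing : ∀ {n} → Vec Point n → Set
    Growing [] = ⊤
    Growing (P ∷ []) = ⊤
    Growing (P ∷ Q ∷ Ps) = E ℕ.* ℓ Q ≤ ℓ P × Growing (Q ∷ Ps)

    degs-chain : ∀ {n} k (Ps : Vec Point n) → Growing Ps → Chain E (degs k Ps)
    degs-chain k [] _ = tt
    degs-chain k (P ∷ []) _ = tt
    degs-chain k (P ∷ Q ∷ Ps) (h , hs) = ≤-trans (≤-reflexive (N.solve 4 (λ E k q p → E N.:* (k N.:* (q N.:* p)) N.:= (k N.:* (E N.:* q)) N.:* p) P.refl E k (ℓ Q) (prod Ps)))
      (*-monoˡ-≤ (prod Ps) (*-monoʳ-≤ k h)) , degs-chain (k ℕ.* ℓ P) (Q ∷ Ps) hs

    choose : (∀ n → ¬ ¬ (Σ Point λ P → n ≤ ℓ P)) → ∀ n → ¬ ¬ (Σ (Vec Point n) λ Ps → Growing Ps × VecAll.All (ℓ₀ ≤_) (ℓs Ps))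
    choose supply zero k = k ([] , tt , [])
    choose supply (suc n) k = choose supply n λ
      { ([] , _ , _) → supply ℓ₀ λ { (P , h) → k (P ∷ [] , tt , h ∷ []) }
      ; (Q ∷ Ps , gr , as) → supply (ℓ₀ ℕ.+ E ℕ.* ℓ Q) λ { (P , h) → k (P ∷ Q ∷ Ps , (≤-trans (m≤n+m _ ℓ₀) h , gr) , ≤-trans (m≤m+n ℓ₀ _) h ∷ as) } }

    heights : ∀ {n} (Ps : Vec Point n) → RL.Heights κ₀ (xs Ps) (ys Ps) (ℓs Ps)
    heights [] = RothLemma.[]
    heights (P ∷ Ps) = Dom.height (x P) (y P) (p P) (q P) (r P) (r≢0 P) (unimodular P) σ (ℓ P) (r-≤ P) (height-≥ P) RothLemma.∷ heights Ps

    prod>0 : ∀ {n} (Ps : Vec Point n) → VecAll.All (ℓ₀ ≤_) (ℓs Ps) → 0 < prod Ps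
    prod>0 [] [] = s≤s z≤n
    prod>0 (P ∷ Ps) (h ∷ hs) = *-mono-≤ {1} {ℓ P} (≤-trans (s≤s z≤n) h) (prod>0 Ps hs)

    shifts : ∀ {n} (ε : O.Carrier → Carrier) (Ps : Vec Point n) → Shifts ξ (Vec.map ε (xs Ps)) (Vec.map ε (ys Ps)) (Vec.map (λ P → ε (x P) - ξ * ε (y P)) Ps)
    shifts ε [] = []
    shifts ε (P ∷ Ps) = solve 3 (λ x y t → x := t :* y :+ (x :- t :* y)) refl (ε (x P)) (ε (y P)) ξ ∷ shifts ε Ps

    closes₁ : ∀ {n} (Ps : Vec Point n) → Close κ (gs Ps) (ℓs Ps) (Vec.map E₁.ε (ys Ps)) (Vec.map (λ P → E₁.ε (x P) - ξ * E₁.ε (y P)) Ps)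
    closes₁ [] = []
    closes₁ (P ∷ Ps) = (close₁ P , size₁ P) ∷ closes₁ Ps

    closes₂ : ∀ {n} (Ps : Vec Point n) → Close κ (ℓs Ps) (ℓs Ps) (Vec.map E₂.ε (ys Ps)) (Vec.map (λ P → E₂.ε (x P) - ξ * E₂.ε (y P)) Ps)
    closes₂ [] = []
    closes₂ (P ∷ Ps) = (close₂ P , size₂ P) ∷ closes₂ Ps

    gain-dot : ∀ {n} (w A I : Exp n) → dot w I ≤ gain w A I ℕ.+ dot w A
    gain-dot [] [] [] = z≤n
    gain-dot (w ∷ ws) (a ∷ A) (i ∷ I) = ≤-trans (+-mono-≤ (≤-trans (*-monoʳ-≤ w (m≤n+m∸n i a)) (≤-reflexive (ℕₚ.*-distribˡ-+ w a _))) (gain-dot ws A I))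
      (≤-reflexive (N.solve 4 (λ a b c d → a N.:+ b N.:+ (c N.:+ d) N.:= b N.:+ c N.:+ (a N.:+ d)) P.refl (w ℕ.* a) (w ℕ.* (i ∸ a)) (gain ws A I) (dot ws A)))

    gain-quality : ∀ {n} (Ps : Vec Point n) A I → suc e′ ℕ.* gain (ℓs Ps) A I ≤ e′ ℕ.* gain (gs Ps) A I
    gain-quality [] [] [] = ≤-reflexive (P.trans (ℕₚ.*-zeroʳ (suc e′)) (P.sym (ℕₚ.*-zeroʳ e′)))
    gain-quality (P ∷ Ps) (a ∷ A) (i ∷ I) = ≤-trans (≤-reflexive (P.trans (ℕₚ.*-distribˡ-+ (suc e′) (ℓ P ℕ.* (i ∸ a)) _) (cong (ℕ._+ suc e′ ℕ.* gain (ℓs Ps) A I) (P.sym (ℕₚ.*-assoc (suc e′) (ℓ P) (i ∸ a))))))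
      (≤-trans (+-mono-≤ (*-monoˡ-≤ (i ∸ a) (quality P)) (gain-quality Ps A I))
        (≤-reflexive (P.sym (P.trans (ℕₚ.*-distribˡ-+ e′ (g P ℕ.* (i ∸ a)) _) (cong (ℕ._+ e′ ℕ.* gain (gs Ps) A I) (P.sym (ℕₚ.*-assoc e′ (g P) (i ∸ a))))))))

    R>0 : ∀ {n} k (Qs : Vec Point (suc n)) → 0 < k ℕ.* prod Qs → 1 ≤ Vec.sum (degs k Qs)
    R>0 k (Q ∷ Qs) h with k ℕ.* prod Qs ℕ.≟ 0
    ... | no ne = ≤-trans (n≢0⇒n>0 ne) (m≤m+n _ _)
    ... | yes z = ⊥-elim (<⇒≢ h (P.sym (P.trans (N.solve 3 (λ k l p → k N.:* (l N.:* p) N.:= l N.:* (k N.:* p)) P.refl k (ℓ Q) (prod Qs)) (P.trans (cong (ℓ Q ℕ.*_) z) (ℕₚ.*-zeroʳ (ℓ Q))))))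

    module Parameters (Ps : Vec Point m) (growing : Growing Ps) (large : VecAll.All (ℓ₀ ≤_) (ℓs Ps)) where
      private
        L₀ = prod Ps
        L = K ℕ.* L₀
        rs = degs K Ps
        R = Vec.sum rs
        μ = m ℕ.* L₀
        u = e′ ℕ.* μ
        Y = μ ℕ.* (30 ℕ.+ 32 ℕ.* e₁)
        V = e′ ℕ.* Y
        T = V ℕ.+ u
        ws = degs-weights K Ps

      L₀>0 : 0 < L₀
      L₀>0 = prod>0 Ps large
      L>0 : 0 < L
      L>0 = *-mono-≤ {1} {K} (s≤s z≤n) L₀>0
      μ>0 : 0 < μ
      μ>0 = *-mono-≤ {1} {m} m>0 L₀>0

      weaken : ∀ {n B} {v : Vec ℕ n} → B ≤ ℓ₀ → VecAll.All (ℓ₀ ≤_) v → VecAll.All (B ≤_) v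
      weaken l [] = []
      weaken l (h ∷ hs) = ≤-trans l h ∷ weaken l hs

      c₁R≤μ : c₁ ℕ.* R ≤ μ
      c₁R≤μ = *-cancelˡ-≤ K (≤-trans (≤-reflexive (P.sym (ℕₚ.*-assoc K c₁ R))) (≤-trans (Weights-sum B₁ ws (weaken (≤-trans (n≤1+n B₁) (m≤m+n (suc B₁) B₂)) large))
        (≤-reflexive (N.solve 3 (λ m K L → m N.:* (K N.:* L) N.:= K N.:* (m N.:* L)) P.refl m K L₀))))

      ER≤L : E ℕ.* ((4 ℕ.+ φ′) ℕ.* R ℕ.+ R) ≤ L
      ER≤L = *-cancelˡ-≤ m (≤-trans (≤-reflexive (N.solve 4 (λ m E p R → m N.:* (E N.:* ((N.con 4 N.:+ p) N.:* R N.:+ R)) N.:= E N.:* (N.con 5 N.:+ p) N.:* m N.:* R) P.refl m E φ′ R)) (Weights-sum B₂ ws (weaken (m≤n+m B₂ (suc B₁)) large)))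

      mL≡ : m ℕ.* L ≡ 64 ℕ.* (e′ ℕ.* e′) ℕ.* μ
      mL≡ = N.solve 3 (λ m K L → m N.:* (K N.:* L) N.:= K N.:* (m N.:* L)) P.refl m K L₀

      T-split : T ℕ.+ T ℕ.+ (u ℕ.+ u) ≡ m ℕ.* L
      T-split = P.trans (N.solve 2 (λ e μ → let e′ = N.con 1 N.:+ e ; T = e′ N.:* (μ N.:* (N.con 30 N.:+ N.con 32 N.:* e)) N.:+ e′ N.:* μ in T N.:+ T N.:+ (e′ N.:* μ N.:+ e′ N.:* μ) N.:= N.con 64 N.:* (e′ N.:* e′) N.:* μ) P.refl e₁ μ) (P.sym mL≡)

      few : length (lowExps (ℓs Ps) rs T) ℕ.* D ℕ.+ length (lowExps (ℓs Ps) rs T) ℕ.* D ≤ boxSize rs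
      few = count-arith (length (lowExps (ℓs Ps) rs T)) (boxSize rs) e′ D L₀ m K (constants e′ D) m>0 (s≤s z≤n) L₀>0 (lowExps-count ws T u T-split)

      open Aux alg ι-cancel ξ D′ f lead≢0 φ f-≤ using (auxiliary; auxiliary-box; auxiliary-norm; auxiliary≢0; auxiliary-vanishes)

      R≥1 : 1 ≤ R
      R≥1 = R>0 K Ps L>0

      private
        poly = auxiliary root (ℓs Ps) rs T few R≥1
        box = auxiliary-box root (ℓs Ps) rs T few R≥1
        h = (4 ℕ.+ φ′) ℕ.* R
        B = h ℕ.+ (3 ℕ.+ χ ℕ.+ (κ ℕ.+ κ)) ℕ.* R ℕ.+ dot (ℓs Ps) rs

      B-≤ : B ≤ μ ℕ.+ 64 ℕ.* (e′ ℕ.* e′) ℕ.* μ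
      B-≤ = +-mono-≤ (≤-trans (≤-reflexive (P.sym (ℕₚ.*-distribʳ-+ R (4 ℕ.+ φ′) (3 ℕ.+ χ ℕ.+ (κ ℕ.+ κ))))) c₁R≤μ) (≤-reflexive (P.trans (Weights-dot ws) mL≡))

      vanishing : ∀ I → I ⊑ᵛ rs → dot (ℓs Ps) I < T → ⟨ poly , taylorξ ξ I ⟩ ≈ 0#
      vanishing = auxiliary-vanishes root (ℓs Ps) rs T few R≥1

      -- The norm of a nonvanishing derivative of small index would be less than one.
      impossible : ∀ A → suc (64 ℕ.* e′) ℕ.* dot (ℓs Ps) A ≤ L → ¬ (PO.⟨ poly , Taylor.taylorᵛ O.alg (xs Ps) (ys Ps) rs A ⟩ O.≈ O.0#) → ⊥
      impossible A small nz = <⇒≱ (final-arith e₁ μ μ>0) (≤-trans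
        (small-norm z S₁ S₂ B B (at-place emb₁ (closes₁ Ps) S₁ gains₁) (at-place emb₂ (closes₂ Ps) S₂ gains₂) nz)
        (+-mono-≤ B-≤ B-≤))
        where
        z = PO.⟨ poly , Taylor.taylorᵛ O.alg (xs Ps) (ys Ps) rs A ⟩
        S₁ = suc e′ ℕ.* Y ℕ.+ T
        S₂ = V ℕ.+ T
        at-place : ∀ {Gs} (emb : Embedding 𝒪 𝔸) → let open Embedding emb in
          Close κ Gs (ℓs Ps) (Vec.map ε (ys Ps)) (Vec.map (λ P → ε (x P) - ξ * ε (y P)) Ps) →
          ∀ S → (∀ I → T ≤ dot (ℓs Ps) I → S ≤ gain Gs A I ℕ.+ dot (ℓs Ps) I) → two^ S * ε z ⊑ 2 ^ B
        at-place emb cl S gains = ⊑-≈ (*-congˡ (sym (trans (Embedding.ε-pair emb poly _) (pair-cong poly (λ J → Embedding.ε-taylorᵛ emb (xs Ps) (ys Ps) rs A J)))))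
          (place-bound {κ} {χ} {h} {T} {S} ξ ξ⊑ (shifts (Embedding.ε emb) Ps) cl poly box (auxiliary-norm root (ℓs Ps) rs T few R≥1) vanishing A gains)
        A-small : dot (ℓs Ps) A ≤ u
        A-small = ≤-trans (*-cancelˡ-≤ (64 ℕ.* e′) (≤-trans (m≤n+m _ (dot (ℓs Ps) A)) (≤-trans small
          (≤-reflexive (N.solve 3 (λ c e L → c N.:* (e N.:* e) N.:* L N.:= c N.:* e N.:* (e N.:* L)) P.refl 64 e′ L₀))))) (*-monoʳ-≤ e′ (m≤n*m L₀ m {{ℕ.>-nonZero m>0}}))
        V-≤ : ∀ I → T ≤ dot (ℓs Ps) I → V ≤ gain (ℓs Ps) A I
        V-≤ I l = +-cancelʳ-≤ u V _ (≤-trans l (≤-trans (gain-dot (ℓs Ps) A I) (+-monoʳ-≤ _ A-small)))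
        gains₂ : ∀ I → T ≤ dot (ℓs Ps) I → S₂ ≤ gain (ℓs Ps) A I ℕ.+ dot (ℓs Ps) I
        gains₂ I l = +-mono-≤ (V-≤ I l) l
        gains₁ : ∀ I → T ≤ dot (ℓs Ps) I → S₁ ≤ gain (gs Ps) A I ℕ.+ dot (ℓs Ps) I
        gains₁ I l = +-mono-≤ (*-cancelˡ-≤ e′ (≤-trans (≤-reflexive (N.solve 2 (λ e Y → e N.:* ((N.con 1 N.:+ e) N.:* Y) N.:= (N.con 1 N.:+ e) N.:* (e N.:* Y)) P.refl e′ Y))
          (≤-trans (*-monoʳ-≤ (suc e′) (V-≤ I l)) (gain-quality Ps A I)))) l

      absurd : ⊥
      absurd = proj₂ (proj₂ lemma-E) (xs Ps) (ys Ps) (ℓs Ps) rs L h poly (heights Ps) ws (degs-chain K Ps growing) L>0 ER≤L box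
        (auxiliary-norm root (ℓs Ps) rs T few R≥1) (auxiliary≢0 root (ℓs Ps) rs T few R≥1) (λ { (A , small , nz) → impossible A small nz })

    no-approximations : (∀ n → ¬ ¬ (Σ Point λ P → n ≤ ℓ P)) → ⊥
    no-approximations supply = choose supply m λ { (Ps , growing , large) → Parameters.absurd Ps growing large }

-- ∣x∣ ≤ b / k, cleared of denominators.
record AbsLe (x : ℚᵘ) (k b : ℕ) : Set where
  constructor absLe
  field le : ∣ ↥ x ∣ ℕ.* k ≤ b ℕ.* ↧ₙ x
open AbsLe public

AbsLe-≃ : ∀ {x y k b} → x ≃ y → AbsLe x k b → AbsLe y k b
AbsLe-≃ {mkℚᵘ a d} {mkℚᵘ a′ d′} {k} {b} (*≡* e) (absLe h) = absLe (*-cancelʳ-≤ _ _ (suc d) (begin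
  ∣ a′ ∣ ℕ.* k ℕ.* suc d ≡⟨ solve 3 (λ a k d → a :* k :* d := a :* d :* k) P.refl ∣ a′ ∣ k (suc d) ⟩
  ∣ a′ ∣ ℕ.* suc d ℕ.* k ≡⟨ cong (ℕ._* k) (P.trans (P.sym (abs-* a′ (+ suc d))) (P.trans (cong ∣_∣ (P.sym e)) (abs-* a (+ suc d′)))) ⟩
  ∣ a ∣ ℕ.* suc d′ ℕ.* k ≡⟨ solve 3 (λ a d k → a :* d :* k := a :* k :* d) P.refl ∣ a ∣ (suc d′) k ⟩
  ∣ a ∣ ℕ.* k ℕ.* suc d′ ≤⟨ *-monoˡ-≤ (suc d′) h ⟩
  b ℕ.* suc d ℕ.* suc d′ ≡⟨ solve 3 (λ b d d′ → b :* d :* d′ := b :* d′ :* d) P.refl b (suc d) (suc d′) ⟩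
  b ℕ.* suc d′ ℕ.* suc d ∎))
  where
  open +-*-Solver
  open ℕₚ.≤-Reasoning

AbsLe-+ : ∀ {x y k b c} → AbsLe x k b → AbsLe y k c → AbsLe (x Q.+ y) k (b ℕ.+ c)
AbsLe-+ {mkℚᵘ a d} {mkℚᵘ a′ d′} {k} {b} {c} (absLe h) (absLe h′) = absLe (begin
  ∣ a ℤ.* + suc d′ ℤ.+ a′ ℤ.* + suc d ∣ ℕ.* k ≤⟨ *-monoˡ-≤ k (∣i+j∣≤∣i∣+∣j∣ (a ℤ.* + suc d′) (a′ ℤ.* + suc d)) ⟩
  (∣ a ℤ.* + suc d′ ∣ ℕ.+ ∣ a′ ℤ.* + suc d ∣) ℕ.* k ≡⟨ cong₂ (λ u v → (u ℕ.+ v) ℕ.* k) (abs-* a (+ suc d′)) (abs-* a′ (+ suc d)) ⟩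
  (∣ a ∣ ℕ.* suc d′ ℕ.+ ∣ a′ ∣ ℕ.* suc d) ℕ.* k ≡⟨ solve 5 (λ a d′ a′ d k → (a :* d′ :+ a′ :* d) :* k := a :* k :* d′ :+ a′ :* k :* d) P.refl (∣ a ∣) (suc d′) (∣ a′ ∣) (suc d) k ⟩
  ∣ a ∣ ℕ.* k ℕ.* suc d′ ℕ.+ ∣ a′ ∣ ℕ.* k ℕ.* suc d ≤⟨ +-mono-≤ (*-monoˡ-≤ (suc d′) h) (*-monoˡ-≤ (suc d) h′) ⟩
  b ℕ.* suc d ℕ.* suc d′ ℕ.+ c ℕ.* suc d′ ℕ.* suc d ≡⟨ solve 4 (λ b c d d′ → b :* d :* d′ :+ c :* d′ :* d := (b :+ c) :* (d :* d′)) P.refl b c (suc d) (suc d′) ⟩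
  (b ℕ.+ c) ℕ.* (suc d ℕ.* suc d′) ∎)
  where
  open +-*-Solver
  open ℕₚ.≤-Reasoning

AbsLe-* : ∀ {x y k l b c} → AbsLe x k b → AbsLe y l c → AbsLe (x Q.* y) (k ℕ.* l) (b ℕ.* c)
AbsLe-* {mkℚᵘ a d} {mkℚᵘ a′ d′} {k} {l} {b} {c} (absLe h) (absLe h′) = absLe (begin
  ∣ a ℤ.* a′ ∣ ℕ.* (k ℕ.* l) ≡⟨ cong (ℕ._* (k ℕ.* l)) (abs-* a a′) ⟩
  ∣ a ∣ ℕ.* ∣ a′ ∣ ℕ.* (k ℕ.* l) ≡⟨ solve 4 (λ a b c d → a :* b :* (c :* d) := (a :* c) :* (b :* d)) P.refl (∣ a ∣) (∣ a′ ∣) k l ⟩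
  (∣ a ∣ ℕ.* k) ℕ.* (∣ a′ ∣ ℕ.* l) ≤⟨ *-mono-≤ h h′ ⟩
  (b ℕ.* suc d) ℕ.* (c ℕ.* suc d′) ≡⟨ solve 4 (λ a b c d → (a :* b) :* (c :* d) := (a :* c) :* (b :* d)) P.refl b (suc d) c (suc d′) ⟩
  (b ℕ.* c) ℕ.* (suc d ℕ.* suc d′) ∎)
  where
  open +-*-Solver
  open ℕₚ.≤-Reasoning

AbsLe-neg : ∀ {x k b} → AbsLe x k b → AbsLe (Q.- x) k b
AbsLe-neg {mkℚᵘ a d} {k} {b} (absLe h) = absLe (subst (λ n → n ℕ.* k ≤ b ℕ.* suc d) (P.sym (∣-i∣≡∣i∣ a)) h)

AbsLe-cancel : ∀ s .{{_ : ℕ.NonZero s}} {x k b} → AbsLe x (s ℕ.* k) (s ℕ.* b) → AbsLe x k b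
AbsLe-cancel s {mkℚᵘ a d} {k} {b} (absLe h) = absLe (*-cancelˡ-≤ s (≤-trans (≤-reflexive (solve 3 (λ s a k → s :* (a :* k) := a :* (s :* k)) P.refl s ∣ a ∣ k)) (≤-trans h (≤-reflexive (ℕₚ.*-assoc s b (suc d))))))
  where open +-*-Solver

AbsLe-mono : ∀ {x k b c} → b ≤ c → AbsLe x k b → AbsLe x k c
AbsLe-mono {x} l (absLe h) = absLe (≤-trans h (*-monoˡ-≤ (↧ₙ x) l))

Seqℚ : Set
Seqℚ = ℕ → ℚᵘ

-- The limes superior of ∣x_N∣ is at most n.
record Ev (x : Seqℚ) (n : ℕ) : Set where
  constructor ev
  field tail : ∀ M → ∃ λ N₀ → ∀ N → N₀ ≤ N → AbsLe (x N) (suc M) (n ℕ.* suc M ℕ.+ 1)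
open Ev public

Ev-≃ : ∀ {x y n} → (∀ N → x N ≃ y N) → Ev x n → Ev y n
Ev-≃ e h = ev λ M → proj₁ (tail h M) , λ N l → AbsLe-≃ {k = suc M} (e N) (proj₂ (tail h M) N l)

Ev-+ : ∀ {x y m n} → Ev x m → Ev y n → Ev (λ N → x N Q.+ y N) (m ℕ.+ n)
Ev-+ {x} {y} {m} {n} h h′ = ev λ M → let M′ = M ℕ.+ 1 ℕ.* suc M ; N₁ = proj₁ (tail h M′) ; N₂ = proj₁ (tail h′ M′) in N₁ ℕ.+ N₂ , λ N l → AbsLe-cancel 2 {x N Q.+ y N} {suc M} (AbsLe-mono {x N Q.+ y N} {2 ℕ.* suc M}
    (≤-reflexive (solve 3 (λ m n k → m :* (con 2 :* k) :+ con 1 :+ (n :* (con 2 :* k) :+ con 1) := con 2 :* ((m :+ n) :* k :+ con 1)) P.refl m n (suc M)))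
    (AbsLe-+ {x N} {y N} {2 ℕ.* suc M} (proj₂ (tail h M′) N (≤-trans (m≤m+n N₁ N₂) l)) (proj₂ (tail h′ M′) N (≤-trans (m≤n+m N₂ N₁) l))))
  where open +-*-Solver

Ev-* : ∀ {x y m n} → Ev x m → Ev y n → Ev (λ N → x N Q.* y N) (m ℕ.* n)
Ev-* {x} {y} {m} {n} h h′ = ev λ M → let M′ = M ℕ.+ (m ℕ.+ n) ℕ.* suc M ; K = suc M′ ; N₁ = proj₁ (tail h M′) ; N₂ = proj₁ (tail h′ M′) in N₁ ℕ.+ N₂ , λ N l → AbsLe-cancel s {x N Q.* y N} {suc M} (AbsLe-cancel K {x N Q.* y N} {K} (AbsLe-mono {x N Q.* y N} {K ℕ.* K}
    (≤-trans (≤-trans (≤-reflexive (solve 3 (λ m n K → (m :* K :+ con 1) :* (n :* K :+ con 1) := m :* n :* K :* K :+ (m :+ n) :* K :+ con 1) P.refl m n K)) (+-monoʳ-≤ _ (s≤s (z≤n {suc M ℕ.+ (m ℕ.+ n) ℕ.* suc M ∸ 1}))))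
      (≤-reflexive (solve 3 (λ m n k → let s = con 1 :+ (m :+ n) ; K = s :* k in m :* n :* K :* K :+ (m :+ n) :* K :+ K := K :* (s :* (m :* n :* k :+ con 1))) P.refl m n (suc M))))
    (AbsLe-* {x N} {y N} {K} {K} (proj₂ (tail h M′) N (≤-trans (m≤m+n N₁ N₂) l)) (proj₂ (tail h′ M′) N (≤-trans (m≤n+m N₂ N₁) l)))))
  where
  open +-*-Solver
  s = suc (m ℕ.+ n)

Ev-neg : ∀ {x n} → Ev x n → Ev (λ N → Q.- x N) n
Ev-neg {x} h = ev λ M → proj₁ (tail h M) , λ N l → AbsLe-neg {x N} {suc M} (proj₂ (tail h M) N l)

Ev-const : ∀ z → Ev (λ _ → mkℚᵘ z 0) ∣ z ∣
Ev-const z = ev λ M → 0 , λ N _ → absLe (≤-trans (m≤m+n _ 1) (≤-reflexive (P.sym (ℕₚ.*-identityʳ _))))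

Ev-mono : ∀ {x m n} → m ≤ n → Ev x m → Ev x n
Ev-mono {x} l h = ev λ M → proj₁ (tail h M) , λ N l′ → AbsLe-mono {x N} {suc M} (+-monoˡ-≤ 1 (*-monoˡ-≤ (suc M) l)) (proj₂ (tail h M) N l′)

Ev-int : ∀ {z n} → Ev (λ _ → mkℚᵘ z 0) n → ∣ z ∣ ≤ n
Ev-int {z} {n} h = ≤-pred (ℕₚ.*-cancelʳ-< 2 ∣ z ∣ (suc n) (≤-<-trans (le (proj₂ (tail h 1) (proj₁ (tail h 1)) ≤-refl))
  (≤-reflexive (solve 1 (λ n → con 1 :+ (n :* con 2 :+ con 1) :* con 1 := (con 1 :+ n) :* con 2) P.refl n))))
  where open +-*-Solver

Ev-cancel : ∀ k {x n} → Ev (λ N → mkℚᵘ (+ suc k) 0 Q.* x N) (suc k ℕ.* n) → Ev x n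
Ev-cancel k {x} {n} h = ev λ M → proj₁ (tail h M) , λ N l → go M (x N) (proj₂ (tail h M) N l)
  where
  go : ∀ M y → AbsLe (mkℚᵘ (+ suc k) 0 Q.* y) (suc M) (suc k ℕ.* n ℕ.* suc M ℕ.+ 1) → AbsLe y (suc M) (n ℕ.* suc M ℕ.+ 1)
  go M (mkℚᵘ a d) (absLe h) = absLe (*-cancelˡ-≤ (suc k) (begin
    suc k ℕ.* (∣ a ∣ ℕ.* suc M) ≡⟨ P.sym (ℕₚ.*-assoc (suc k) ∣ a ∣ (suc M)) ⟩
    suc k ℕ.* ∣ a ∣ ℕ.* suc M ≡⟨ cong (ℕ._* suc M) (P.sym (abs-* (+ suc k) a)) ⟩
    ∣ + suc k ℤ.* a ∣ ℕ.* suc M ≤⟨ h ⟩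
    (suc k ℕ.* n ℕ.* suc M ℕ.+ 1) ℕ.* (1 ℕ.* suc d) ≤⟨ *-monoˡ-≤ (1 ℕ.* suc d) (+-monoʳ-≤ (suc k ℕ.* n ℕ.* suc M) (s≤s (z≤n {k}))) ⟩
    (suc k ℕ.* n ℕ.* suc M ℕ.+ suc k) ℕ.* (1 ℕ.* suc d) ≡⟨ solve 4 (λ k n M d → (k :* n :* M :+ k) :* (con 1 :* d) := k :* ((n :* M :+ con 1) :* d)) P.refl (suc k) n (suc M) (suc d) ⟩
    suc k ℕ.* ((n ℕ.* suc M ℕ.+ 1) ℕ.* suc d) ∎))
    where
    open +-*-Solver
    open ℕₚ.≤-Reasoning

record ℝ : Set where
  no-eta-equality
  constructor real
  field
    seq : Seqℚ
    bounded : ∃ λ n → Ev seq n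
open ℝ public

infix 4 _≈ʳ_
record _≈ʳ_ (x y : ℝ) : Set where
  constructor null
  field null-diff : Ev (λ N → seq x N Q.- seq y N) 0
open _≈ʳ_ public

_+ʳ_ _*ʳ_ : ℝ → ℝ → ℝ
seq (x +ʳ y) N = seq x N Q.+ seq y N
bounded (x +ʳ y) = proj₁ (bounded x) ℕ.+ proj₁ (bounded y) , Ev-+ {seq x} (proj₂ (bounded x)) (proj₂ (bounded y))
seq (x *ʳ y) N = seq x N Q.* seq y N
bounded (x *ʳ y) = proj₁ (bounded x) ℕ.* proj₁ (bounded y) , Ev-* {seq x} (proj₂ (bounded x)) (proj₂ (bounded y))

-ʳ_ : ℝ → ℝ
seq (-ʳ x) N = Q.- seq x N
bounded (-ʳ x) = proj₁ (bounded x) , Ev-neg {seq x} (proj₂ (bounded x))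

ιʳ : ℤ → ℝ
seq (ιʳ z) _ = mkℚᵘ z 0
bounded (ιʳ z) = ∣ z ∣ , Ev-const z

module Differences (A : ℤ-Algebra) where
  open ℤ-Algebra A
  open Solver A using (solve; _:=_; _:+_; _:*_; _:-_; :-_; con)

  flip-difference : ∀ a b → - (a - b) ≈ b - a
  flip-difference a b = solve 2 (λ a b → :- (a :- b) := b :- a) refl a b

  telescope : ∀ a b c → (a - b) + (b - c) ≈ a - c
  telescope a b c = solve 3 (λ a b c → (a :- b) :+ (b :- c) := a :- c) refl a b c

  sum-difference : ∀ a a′ b b′ → (a - a′) + (b - b′) ≈ (a + b) - (a′ + b′)
  sum-difference a a′ b b′ = solve 4 (λ a a′ b b′ → (a :- a′) :+ (b :- b′) := (a :+ b) :- (a′ :+ b′)) refl a a′ b b′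

  product-difference : ∀ a a′ b b′ → ((a - a′) * b) + (a′ * (b - b′)) ≈ (a * b) - (a′ * b′)
  product-difference a a′ b b′ = solve 4 (λ a a′ b b′ → ((a :- a′) :* b) :+ (a′ :* (b :- b′)) := (a :* b) :- (a′ :* b′)) refl a a′ b b′

  neg-difference : ∀ a b → - (a - b) ≈ - a - - b
  neg-difference a b = solve 2 (λ a b → :- (a :- b) := :- a :- :- b) refl a b

  recover : ∀ a b → a - (a - b) ≈ b
  recover a b = solve 2 (λ a b → a :- (a :- b) := b) refl a b

ℚ-alg : ℤ-Algebra
ℚ-alg = record
  { ring = Qₚ.+-*-commutativeRing ; ι = λ z → mkℚᵘ z 0
  ; ι-+ = λ x y → *≡* (S.solve 2 (λ x y → (x S.:+ y) S.:* S.con 1ℤ S.:= (x S.:* S.con 1ℤ S.:+ y S.:* S.con 1ℤ) S.:* S.con 1ℤ) P.refl x y)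
  ; ι-* = λ x y → QR.refl ; ι-neg = λ x → QR.refl ; ι-0 = QR.refl ; ι-1 = QR.refl }
  where
  module QR = CommutativeRing Qₚ.+-*-commutativeRing

private
  module QR = CommutativeRing Qₚ.+-*-commutativeRing
  open Differences ℚ-alg

pointwise : ∀ {x y} → (∀ N → seq x N ≃ seq y N) → x ≈ʳ y
pointwise {x} {y} e = null (Ev-≃ {λ _ → mkℚᵘ 0ℤ 0} (λ N → QR.sym (QR.trans (QR.+-congʳ (e N)) (QR.-‿inverseʳ (seq y N)))) (Ev-const 0ℤ))

≈ʳ-refl : ∀ {x} → x ≈ʳ x
≈ʳ-refl {x} = pointwise {x} {x} (λ N → QR.refl)

≈ʳ-sym : ∀ {x y} → x ≈ʳ y → y ≈ʳ x
≈ʳ-sym {x} {y} (null h) = null (Ev-≃ {λ N → Q.- (seq x N Q.- seq y N)} (λ N → flip-difference (seq x N) (seq y N)) (Ev-neg {λ N → seq x N Q.- seq y N} h))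

≈ʳ-trans : ∀ {x y z} → x ≈ʳ y → y ≈ʳ z → x ≈ʳ z
≈ʳ-trans {x} {y} {z} (null h) (null h′) = null (Ev-≃ {λ N → (seq x N Q.- seq y N) Q.+ (seq y N Q.- seq z N)} (λ N → telescope (seq x N) (seq y N) (seq z N)) (Ev-+ {λ N → seq x N Q.- seq y N} h h′))

+ʳ-cong : ∀ {x x′ y y′} → x ≈ʳ x′ → y ≈ʳ y′ → (x +ʳ y) ≈ʳ (x′ +ʳ y′)
+ʳ-cong {x} {x′} {y} {y′} (null h) (null h′) = null (Ev-≃ {λ N → (seq x N Q.- seq x′ N) Q.+ (seq y N Q.- seq y′ N)}
  (λ N → sum-difference (seq x N) (seq x′ N) (seq y N) (seq y′ N)) (Ev-+ {λ N → seq x N Q.- seq x′ N} h h′))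

*ʳ-cong : ∀ {x x′ y y′} → x ≈ʳ x′ → y ≈ʳ y′ → (x *ʳ y) ≈ʳ (x′ *ʳ y′)
*ʳ-cong {x} {x′} {y} {y′} (null h) (null h′) = null (Ev-≃ {λ N → ((seq x N Q.- seq x′ N) Q.* seq y N) Q.+ (seq x′ N Q.* (seq y N Q.- seq y′ N))} (λ N → product-difference (seq x N) (seq x′ N) (seq y N) (seq y′ N))
  (subst (Ev _) (ℕₚ.*-zeroʳ (proj₁ (bounded x′))) (Ev-+ {λ N → (seq x N Q.- seq x′ N) Q.* seq y N} (Ev-* {λ N → seq x N Q.- seq x′ N} {seq y} h (proj₂ (bounded y))) (Ev-* {seq x′} {λ N → seq y N Q.- seq y′ N} (proj₂ (bounded x′)) h′))))

-ʳ-cong : ∀ {x y} → x ≈ʳ y → (-ʳ x) ≈ʳ (-ʳ y)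
-ʳ-cong {x} {y} (null h) = null (Ev-≃ {λ N → Q.- (seq x N Q.- seq y N)} (λ N → neg-difference (seq x N) (seq y N)) (Ev-neg {λ N → seq x N Q.- seq y N} h))

ℝ-ring : CommutativeRing _ _
ℝ-ring = record
  { Carrier = ℝ ; _≈_ = _≈ʳ_ ; _+_ = _+ʳ_ ; _*_ = _*ʳ_ ; -_ = -ʳ_ ; 0# = ιʳ 0ℤ ; 1# = ιʳ 1ℤ
  ; isCommutativeRing = record
    { isRing = record
      { +-isAbelianGroup = record
        { isGroup = record
          { isMonoid = record
            { isSemigroup = record
              { isMagma = record { isEquivalence = record { refl = λ {x} → ≈ʳ-refl {x} ; sym = ≈ʳ-sym ; trans = ≈ʳ-trans } ; ∙-cong = +ʳ-cong }
              ; assoc = λ x y z → pointwise (λ N → QR.+-assoc (seq x N) (seq y N) (seq z N)) }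
            ; identity = (λ x → pointwise (λ N → QR.+-identityˡ (seq x N))) , (λ x → pointwise (λ N → QR.+-identityʳ (seq x N))) }
          ; inverse = (λ x → pointwise (λ N → QR.-‿inverseˡ (seq x N))) , (λ x → pointwise (λ N → QR.-‿inverseʳ (seq x N)))
          ; ⁻¹-cong = -ʳ-cong }
        ; comm = λ x y → pointwise (λ N → QR.+-comm (seq x N) (seq y N)) }
      ; *-cong = *ʳ-cong
      ; *-assoc = λ x y z → pointwise (λ N → QR.*-assoc (seq x N) (seq y N) (seq z N))
      ; *-identity = (λ x → pointwise (λ N → QR.*-identityˡ (seq x N))) , (λ x → pointwise (λ N → QR.*-identityʳ (seq x N)))
      ; distrib = (λ x y z → pointwise (λ N → QR.distribˡ (seq x N) (seq y N) (seq z N))) , (λ x y z → pointwise (λ N → QR.distribʳ (seq x N) (seq y N) (seq z N))) }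
    ; *-comm = λ x y → pointwise (λ N → QR.*-comm (seq x N) (seq y N)) } }

ℝ-alg : ℤ-Algebra
ℝ-alg = record
  { ring = ℝ-ring ; ι = ιʳ
  ; ι-+ = λ x y → pointwise (λ N → ℤ-Algebra.ι-+ ℚ-alg x y)
  ; ι-* = λ x y → pointwise (λ N → QR.refl)
  ; ι-neg = λ x → pointwise (λ N → QR.refl)
  ; ι-0 = ≈ʳ-refl {ιʳ 0ℤ} ; ι-1 = ≈ʳ-refl {ιʳ 1ℤ} }

record _⊑ʳ_ (x : ℝ) (n : ℕ) : Set where
  constructor below
  field eventually : Ev (seq x) n
open _⊑ʳ_ public

reals : BoundedAlgebra
reals = record
  { alg = ℝ-alg ; _⊑_ = _⊑ʳ_
  ; ⊑-≈ = λ { {x} {y} {n} (null e) (below h) → below (Ev-≃ {λ N → seq x N Q.- (seq x N Q.- seq y N)} (λ N → recover (seq x N) (seq y N))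
      (subst (Ev _) (ℕₚ.+-identityʳ n) (Ev-+ {seq x} h (Ev-neg {λ N → seq x N Q.- seq y N} e)))) }
  ; ⊑-+ = λ { {x} {y} (below h) (below h′) → below (Ev-+ {seq x} {seq y} h h′) }
  ; ⊑-* = λ { {x} {y} (below h) (below h′) → below (Ev-* {seq x} {seq y} h h′) }
  ; ⊑-ι = λ z → below (Ev-const z)
  ; ⊑-int = λ { (below h) → Ev-int h }
  ; ⊑-mono = λ { {x} l (below h) → below (Ev-mono {seq x} l h) }
  ; ⊑-cancel = λ { k {x} (below h) → below (Ev-cancel k {seq x} h) }
  ; ⊑-zero = λ { {x} (below h) → null (Ev-≃ {seq x} (λ N → QR.sym (QR.+-identityʳ (seq x N))) h) } }

module Words where
  open import Data.Nat using (_+_; _*_)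

  Vec² : Set
  Vec² = ℕ × ℕ

  e₁ e₂ : Vec²
  e₁ = 1 , 0
  e₂ = 0 , 1

  size : Vec² → ℕ
  size (X , Y) = X + Y

  -- Matrices are pairs of columns.
  Mat : Set
  Mat = Vec² × Vec²

  infixr 7 _∙_
  _∙_ : Mat → Vec² → Vec²
  ((t , s) , (t′ , s′)) ∙ (X , Y) = t * X + t′ * Y , s * X + s′ * Y

  step : ℕ → Vec² → Vec²
  step u (X , Y) = u * X + Y , X

  det : Vec² → Vec² → ℤ
  det (X , Y) (X′ , Y′) = + X ℤ.* + Y′ ℤ.- + X′ ℤ.* + Y

  cast : ∀ u X v Y → + (u * X + v * Y) ≡ + u ℤ.* + X ℤ.+ + v ℤ.* + Y
  cast u X v Y = cong₂ ℤ._+_ (pos-* u X) (pos-* v Y)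

  det-step : ∀ u v w → det (step u v) (step u w) ≡ ℤ.- det v w
  det-step u (X , Y) (X′ , Y′) = P.trans (cong₂ (λ a b → (a ℤ.+ + Y) ℤ.* + X′ ℤ.- (b ℤ.+ + Y′) ℤ.* + X) (pos-* u X) (pos-* u X′))
    (S.solve 5 (λ u X Y X′ Y′ → (u S.:* X S.:+ Y) S.:* X′ S.:- (u S.:* X′ S.:+ Y′) S.:* X S.:= S.:- (X S.:* Y′ S.:- X′ S.:* Y)) P.refl (+ u) (+ X) (+ Y) (+ X′) (+ Y′))

  det-swap : ∀ v w → ∣ det v w ∣ ≡ ∣ det w v ∣
  det-swap (X , Y) (X′ , Y′) = P.trans (P.sym (∣-i∣≡∣i∣ (det (X , Y) (X′ , Y′)))) (cong ∣_∣ (S.solve 4 (λ X Y X′ Y′ → S.:- (X S.:* Y′ S.:- X′ S.:* Y) S.:= X′ S.:* Y S.:- X S.:* Y′) P.refl (+ X) (+ Y) (+ X′) (+ Y′)))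

  det-≤ : ∀ v w → ∣ det v w ∣ ≤ size v * size w
  det-≤ (X , Y) (X′ , Y′) = ≤-trans (∣i-j∣≤∣i∣+∣j∣ (+ X ℤ.* + Y′) (+ X′ ℤ.* + Y)) (≤-trans (≤-reflexive (cong₂ _+_ (abs-* (+ X) (+ Y′)) (abs-* (+ X′) (+ Y))))
    (≤-trans (m≤m+n (X * Y′ + X′ * Y) (X * X′ + Y * Y′)) (≤-reflexive (solve 4 (λ X Y X′ Y′ → X :* Y′ :+ X′ :* Y :+ (X :* X′ :+ Y :* Y′) := (X :+ Y) :* (X′ :+ Y′)) P.refl X Y X′ Y′))))
    where open +-*-Solver

  difference-≥ : ∀ x y B → y + B ≤ x → B ≤ ∣ + x ℤ.- + y ∣
  difference-≥ x y B h = +-cancelˡ-≤ y B _ (≤-trans h (≤-reflexive (P.sym (P.trans (cong (ℕ._+_ y) (cong ∣_∣ (P.trans (ℤₚ.m-n≡m⊖n x y) (ℤₚ.⊖-≥ y≤x)))) (m+[n∸m]≡n y≤x)))))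
    where y≤x = ≤-trans (m≤m+n y B) h

  distinct-letters-> : ∀ u v X Y X′ Y′ B → v < u → Y′ ≤ X′ → B ≤ Y * X′ → B ≤ ∣ det (step u (X , Y)) (step v (X′ , Y′)) ∣
  distinct-letters-> u v X Y X′ Y′ B v<u l h = subst (λ z → B ≤ ∣ z ∣) (cong₂ ℤ._-_ (pos-* (u * X + Y) X′) (pos-* (v * X′ + Y′) X)) (difference-≥ ((u * X + Y) * X′) ((v * X′ + Y′) * X) B (begin
    (v * X′ + Y′) * X + B ≤⟨ +-mono-≤ (*-monoˡ-≤ X (+-monoʳ-≤ (v * X′) l)) h ⟩
    (v * X′ + X′) * X + Y * X′ ≡⟨ solve 4 (λ v X Y X′ → (v :* X′ :+ X′) :* X :+ Y :* X′ := ((con 1 :+ v) :* X :+ Y) :* X′) P.refl v X Y X′ ⟩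
    (suc v * X + Y) * X′ ≤⟨ *-monoˡ-≤ X′ (+-monoˡ-≤ Y (*-monoˡ-≤ X v<u)) ⟩
    (u * X + Y) * X′ ∎))
    where
    open +-*-Solver
    open ℕₚ.≤-Reasoning

  distinct-letters : ∀ u v X Y X′ Y′ B → u ≢ v → Y ≤ X → Y′ ≤ X′ → B ≤ Y * X′ → B ≤ Y′ * X → B ≤ ∣ det (step u (X , Y)) (step v (X′ , Y′)) ∣
  distinct-letters u v X Y X′ Y′ B ne l l′ h h′ with <-cmp u v
  ... | tri< u<v _ _ = ≤-trans (distinct-letters-> v u X′ Y′ X Y B u<v l h′) (≤-reflexive (det-swap (step v (X′ , Y′)) (step u (X , Y))))
  ... | tri≈ _ u≡v _ = ⊥-elim (ne u≡v)
  ... | tri> _ _ v<u = distinct-letters-> u v X Y X′ Y′ B v<u l′ h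

  Large : ℕ → Vec² → Set
  Large B v = B ≤ proj₁ v × B ≤ proj₂ v

  ∙-size : ∀ {B M} → Large B (proj₁ M) → Large B (proj₂ M) → ∀ v → Large (B * size v) (M ∙ v)
  ∙-size {B} {(t , s) , (t′ , s′)} (l₁ , l₂) (l₃ , l₄) (X , Y) = row l₁ l₃ , row l₂ l₄
    where
    row : ∀ {x y} → B ≤ x → B ≤ y → B * (X + Y) ≤ x * X + y * Y
    row h h′ = ≤-trans (≤-reflexive (ℕₚ.*-distribˡ-+ B X Y)) (+-mono-≤ (*-monoˡ-≤ X h) (*-monoˡ-≤ Y h′))

  iterate : {X : Set} → ℕ → (X → X) → X → X
  iterate zero f x = x
  iterate (suc k) f x = f (iterate k f x)

  iterate-+ : ∀ {X : Set} (f : X → X) j k x → iterate (j + k) f x ≡ iterate j f (iterate k f x)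
  iterate-+ f zero k x = P.refl
  iterate-+ f (suc j) k x = cong f (iterate-+ f j k x)

  module Word (a : Seq) where
    -- The product of the matrices [[a_i, 1], [1, 0]] for n ≤ i < n + k, acting on column vectors.
    act : ℕ → ℕ → Vec² → Vec²
    act n zero v = v
    act n (suc k) v = step (a n) (act (suc n) k v)

    act-+ : ∀ n j k v → act n (j + k) v ≡ act n j (act (n + j) k v)
    act-+ n zero k v = cong (λ m → act m k v) (P.sym (ℕₚ.+-identityʳ n))
    act-+ n (suc j) k v = cong (step (a n)) (P.trans (act-+ (suc n) j k v) (cong (λ m → act (suc n) j (act m k v)) (P.sym (+-suc n j))))

    mat : ℕ → ℕ → Mat
    mat n k = act n k e₁ , act n k e₂

    act-linear : ∀ n k v → act n k v ≡ mat n k ∙ v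
    act-linear n zero (X , Y) = cong₂ _,_ (solve 2 (λ X Y → X := con 1 :* X :+ con 0 :* Y) P.refl X Y) (solve 2 (λ X Y → Y := con 0 :* X :+ con 1 :* Y) P.refl X Y)
      where open +-*-Solver
    act-linear n (suc k) (X , Y) = P.trans (cong (step (a n)) (act-linear (suc n) k (X , Y)))
      (cong (_, proj₂ (mat n (suc k) ∙ (X , Y))) (go (a n) (act (suc n) k e₁) (act (suc n) k e₂)))
      where
      open +-*-Solver
      go : ∀ u (c d : Vec²) → u * (proj₁ c * X + proj₁ d * Y) + (proj₂ c * X + proj₂ d * Y) ≡ (u * proj₁ c + proj₂ c) * X + (u * proj₁ d + proj₂ d) * Y
      go u (t , s) (t′ , s′) = solve 7 (λ u t s t′ s′ X Y → u :* (t :* X :+ t′ :* Y) :+ (s :* X :+ s′ :* Y) := (u :* t :+ s) :* X :+ (u :* t′ :+ s′) :* Y) P.refl u t s t′ s′ X Y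

    act-cong : ∀ n m k v → (∀ i → i < k → a (n + i) ≡ a (m + i)) → act n k v ≡ act m k v
    act-cong n m zero v h = P.refl
    act-cong n m (suc k) v h = cong₂ step (P.trans (cong a (P.sym (ℕₚ.+-identityʳ n))) (P.trans (h 0 (s≤s z≤n)) (cong a (ℕₚ.+-identityʳ m))))
      (act-cong (suc n) (suc m) k v (λ i l → P.trans (cong a (P.sym (+-suc n i))) (P.trans (h (suc i) (s≤s l)) (cong a (+-suc m i)))))

    det-act : ∀ n k v w → ∣ det (act n k v) (act n k w) ∣ ≡ ∣ det v w ∣
    det-act n zero v w = P.refl
    det-act n (suc k) v w = P.trans (cong ∣_∣ (det-step (a n) (act (suc n) k v) (act (suc n) k w))) (P.trans (∣-i∣≡∣i∣ (det (act (suc n) k v) (act (suc n) k w))) (det-act (suc n) k v w))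

    mat-pq : ∀ n → mat 0 (suc n) ≡ pq a n
    mat-pq zero = cong₂ _,_ (cong (_, 1) (P.trans (ℕₚ.+-identityʳ _) (ℕₚ.*-identityʳ (a 0)))) (cong (_, 0) (cong (λ z → z + 1) (ℕₚ.*-zeroʳ (a 0))))
    mat-pq (suc n) with pq a n | mat-pq n
    ... | _ | P.refl = cong₂ _,_
          (P.trans (snoc e₁) (cong₂ _,_ (col (a (suc n)) (proj₁ (act 0 (suc n) e₁)) (proj₁ (act 0 (suc n) e₂))) (col (a (suc n)) (proj₂ (act 0 (suc n) e₁)) (proj₂ (act 0 (suc n) e₂)))))
          (P.trans (snoc e₂) (cong₂ _,_ (col′ (a (suc n)) (proj₁ (act 0 (suc n) e₁)) (proj₁ (act 0 (suc n) e₂))) (col′ (a (suc n)) (proj₂ (act 0 (suc n) e₁)) (proj₂ (act 0 (suc n) e₂)))))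
      where
      open +-*-Solver
      snoc : ∀ v → act 0 (suc (suc n)) v ≡ mat 0 (suc n) ∙ step (a (suc n)) v
      snoc v = P.trans (cong (λ k → act 0 k v) (ℕₚ.+-comm 1 (suc n))) (P.trans (act-+ 0 (suc n) 1 v) (act-linear 0 (suc n) (step (a (suc n)) v)))
      col : ∀ u x y → x * (u * 1 + 0) + y * 1 ≡ u * x + y
      col = solve 3 (λ u x y → x :* (u :* con 1 :+ con 0) :+ y :* con 1 := u :* x :+ y) P.refl
      col′ : ∀ u x y → x * (u * 0 + 1) + y * 0 ≡ x
      col′ = solve 3 (λ u x y → x :* (u :* con 0 :+ con 1) :+ y :* con 0 := x) P.refl

    -- Q (suc n) is q_n, and Q 0 = q_{-1} = 0.
    Q : ℕ → ℕ
    Q n = proj₂ (act 0 n e₁)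

    Q-q : ∀ n → Q (suc n) ≡ Defs.q a n
    Q-q n = cong (λ m → proj₂ (proj₁ m)) (mat-pq n)

    col₂ : ∀ n k → act n (suc k) e₂ ≡ act n k e₁
    col₂ n zero = cong (_, 0) (cong (λ z → z + 1) (ℕₚ.*-zeroʳ (a n)))
    col₂ n (suc k) = cong (step (a n)) (col₂ (suc n) k)

    Q-suc : ∀ n → Q (suc (suc n)) ≡ a (suc n) * Q (suc n) + Q n
    Q-suc n = P.trans (Q-q (suc n)) (cong₂ (λ x y → a (suc n) * x + y) (P.sym (Q-q n)) (P.sym (P.trans (cong proj₂ (P.sym (col₂ 0 n))) (cong (λ m → proj₂ (proj₂ m)) (mat-pq n)))))

    module Positive (a≥1 : ∀ m → 1 ≤ a m) where
      step-size : ∀ u v → 1 ≤ u → size v ≤ proj₁ (step u v)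
      step-size u (X , Y) l = +-monoˡ-≤ Y (m≤n*m X u {{ℕ.>-nonZero l}})

      act-descending : ∀ n k v → proj₂ (act n (suc k) v) ≤ proj₁ (act n (suc k) v)
      act-descending n k v = ≤-trans (m≤m+n (proj₁ w) (proj₂ w)) (step-size (a n) w (a≥1 n))
        where w = act (suc n) k v

      act-size : ∀ n k v → size v ≤ size (act n k v)
      act-size n zero v = ≤-refl
      act-size n (suc k) v = ≤-trans (act-size (suc n) k v) (≤-trans (step-size (a n) (act (suc n) k v) (a≥1 n)) (m≤m+n _ _))

      grow : ∀ g n k v → 1 ≤ size v → suc (suc (g + g)) ≤ k → Large (2 ^ g) (act n k v)
      grow zero n (suc zero) v h (s≤s ())
      grow zero n (suc (suc k)) v h l = ≤-trans snd (act-descending n (suc k) v) , snd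
        where snd = ≤-trans h (≤-trans (act-size (suc (suc n)) k v) (step-size (a (suc n)) (act (suc (suc n)) k v) (a≥1 (suc n))))
      grow (suc g) n (suc zero) v h (s≤s ())
      grow (suc g) n (suc (suc k)) v h l = ≤-trans snd (act-descending n (suc k) v) , snd
        where
        ih = grow g (suc (suc n)) k v h (≤-pred (≤-trans (≤-reflexive (cong (λ z → suc (suc z)) (P.sym (+-suc g g)))) (≤-pred l)))
        w = act (suc (suc n)) k v
        snd : 2 ^ suc g ≤ proj₂ (act n (suc (suc k)) v)
        snd = ≤-trans (≤-trans (≤-reflexive (cong (ℕ._+_ (2 ^ g)) (ℕₚ.+-identityʳ (2 ^ g)))) (+-mono-≤ (proj₁ ih) (proj₂ ih))) (step-size (a (suc n)) w (a≥1 (suc n)))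

      Q-mono-suc : ∀ n → Q n ≤ Q (suc n)
      Q-mono-suc zero = z≤n
      Q-mono-suc (suc n) = ≤-trans (≤-trans (m≤n*m (Q (suc n)) (a (suc n)) {{ℕ.>-nonZero (a≥1 (suc n))}}) (m≤m+n _ (Q n))) (≤-reflexive (P.sym (Q-suc n)))

      Q-mono : ∀ {m n} → m ≤ n → Q m ≤ Q n
      Q-mono {m} {n} l = subst (λ k → Q m ≤ Q k) (m∸n+n≡m l) (go (n ∸ m))
        where
        go : ∀ k → Q m ≤ Q (k + m)
        go zero = ≤-refl
        go (suc k) = ≤-trans (go k) (Q-mono-suc (k + m))

      Q≥1 : ∀ n → 1 ≤ Q (suc n)
      Q≥1 n = Q-mono {1} {suc n} (s≤s z≤n)

      -- If the period R of the block starting at n = suc (suc (suc n′)) does not extend to the left, the conjugate quadratic form is large.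
      left-maximal : ∀ n R → 2 ≤ R → let n₃ = suc (suc (suc n)) ; n₂ = suc (suc n) in a n₂ ≢ a (R + n₂) → Q n₃ ≤ ∣ det (Q n₃ , Q n₂) (Q (R + n₃) , Q (R + n₂)) ∣
      left-maximal n (suc zero) (s≤s ())
      left-maximal n (suc (suc R)) _ ne = subst (Q n₃ ≤_) (cong ∣_∣ (cong₂ det (cong (_, Q n₂) (P.sym (Q-suc (suc n)))) (cong₂ _,_ (P.trans (P.sym (Q-suc (suc (R + n₂)))) (cong Q (shift R n₂))) P.refl)))
        (distinct-letters (a n₂) (a (2 + R + n₂)) (Q n₂) (Q (suc n)) (Q (2 + R + n₂)) (Q (suc (R + n₂))) (Q n₃) ne (Q-mono-suc (suc n)) (Q-mono-suc (suc (R + n₂)))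
          (≤-trans (Q-mono {n₃} {2 + R + n₂} (≤-trans (m≤n+m n₃ (suc R)) (≤-reflexive (+-suc (suc R) n₂)))) (m≤n*m (Q (2 + R + n₂)) (Q (suc n)) {{ℕ.>-nonZero (Q≥1 n)}}))
          (≤-trans (Q-mono {n₃} {suc (R + n₂)} (≤-trans (m≤n+m n₃ R) (≤-reflexive (+-suc R n₂)))) (m≤m*n (Q (suc (R + n₂))) (Q n₂) {{ℕ.>-nonZero (Q≥1 (suc n))}})))
        where
        n₂ = suc (suc n)
        n₃ = suc n₂
        shift : ∀ R n → suc (suc (suc (R + n))) ≡ suc (suc R) + suc n
        shift R n = cong (λ z → suc (suc z)) (P.sym (+-suc R n))

open Words

square-cancel-≤ : ∀ m n → m ℕ.* m ≤ n ℕ.* n → m ≤ n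
square-cancel-≤ m n h with m ≤? n
... | yes l = l
... | no g = ⊥-elim (<⇒≱ (*-mono-< (≰⇒> g) (≰⇒> g)) h)

-- From a solution (X , V) with X = k V + Z one gets the smaller solution (j V - k Z , Z).
between-squares : ∀ k j → 0 < j → j ≤ k ℕ.+ k → ∀ n V X → V ≤ n → X ℕ.* X ≡ (k ℕ.* k ℕ.+ j) ℕ.* (V ℕ.* V) → V ≡ 0
between-squares k j 0<j j≤2k zero V X l e = n≤0⇒n≡0 l
between-squares k j 0<j j≤2k (suc n) V X l e with V ℕ.≟ 0
... | yes V≡0 = V≡0
... | no V≢0 = finish (between-squares k j 0<j j≤2k n Z X′ (≤-pred (≤-trans Z<V l)) smaller)
  where
  open +-*-Solver
  instance
    V-nonZero : ℕ.NonZero V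
    V-nonZero = ℕ.≢-nonZero V≢0
  0<V² : 0 < V ℕ.* V
  0<V² = *-mono-≤ (n≢0⇒n>0 V≢0) (n≢0⇒n>0 V≢0)
  kV≤X : k ℕ.* V ≤ X
  kV≤X = square-cancel-≤ (k ℕ.* V) X (≤-trans (m≤m+n _ (j ℕ.* (V ℕ.* V))) (≤-reflexive (P.trans (solve 3 (λ k j V → (k :* V) :* (k :* V) :+ j :* (V :* V) := (k :* k :+ j) :* (V :* V)) P.refl k j V) (P.sym e))))
  Z = X ∸ k ℕ.* V
  X≡ : k ℕ.* V ℕ.+ Z ≡ X
  X≡ = m+[n∸m]≡n kV≤X
  quad : (k ℕ.* V ℕ.+ k ℕ.* V) ℕ.* Z ℕ.+ Z ℕ.* Z ≡ j ℕ.* (V ℕ.* V)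
  quad = +-cancelˡ-≡ ((k ℕ.* V) ℕ.* (k ℕ.* V)) _ _ (P.trans (solve 2 (λ w Z → w :* w :+ ((w :+ w) :* Z :+ Z :* Z) := (w :+ Z) :* (w :+ Z)) P.refl (k ℕ.* V) Z)
    (P.trans (cong (λ x → x ℕ.* x) X≡) (P.trans e (solve 3 (λ k j V → (k :* k :+ j) :* (V :* V) := (k :* V) :* (k :* V) :+ j :* (V :* V)) P.refl k j V))))
  Z<V : Z < V
  Z<V with V ≤? Z
  ... | no g = ≰⇒> g
  ... | yes V≤Z = ⊥-elim (ℕₚ.<-irrefl P.refl (begin-strict
    j ℕ.* (V ℕ.* V) ≤⟨ *-monoˡ-≤ (V ℕ.* V) j≤2k ⟩
    (k ℕ.+ k) ℕ.* (V ℕ.* V) <⟨ m<m+n _ {V ℕ.* V} 0<V² ⟩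
    (k ℕ.+ k) ℕ.* (V ℕ.* V) ℕ.+ V ℕ.* V ≡⟨ solve 2 (λ k V → (k :+ k) :* (V :* V) :+ V :* V := (k :* V :+ k :* V) :* V :+ V :* V) P.refl k V ⟩
    (k ℕ.* V ℕ.+ k ℕ.* V) ℕ.* V ℕ.+ V ℕ.* V ≤⟨ +-mono-≤ (*-monoʳ-≤ (k ℕ.* V ℕ.+ k ℕ.* V) V≤Z) (*-mono-≤ V≤Z V≤Z) ⟩
    (k ℕ.* V ℕ.+ k ℕ.* V) ℕ.* Z ℕ.+ Z ℕ.* Z ≡⟨ quad ⟩
    j ℕ.* (V ℕ.* V) ∎))
    where open ℕₚ.≤-Reasoning
  kZ≤jV : k ℕ.* Z ≤ j ℕ.* V
  kZ≤jV = *-cancelʳ-≤ (k ℕ.* Z) (j ℕ.* V) V (≤-trans (m≤m+n _ (k ℕ.* V ℕ.* Z ℕ.+ Z ℕ.* Z)) (≤-reflexive (P.trans (solve 3 (λ k V Z → k :* Z :* V :+ (k :* V :* Z :+ Z :* Z) := (k :* V :+ k :* V) :* Z :+ Z :* Z) P.refl k V Z)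
    (P.trans quad (P.sym (ℕₚ.*-assoc j V V))))))
  X′ = j ℕ.* V ∸ k ℕ.* Z
  X′≡ : k ℕ.* Z ℕ.+ X′ ≡ j ℕ.* V
  X′≡ = m+[n∸m]≡n kZ≤jV
  smaller : X′ ℕ.* X′ ≡ (k ℕ.* k ℕ.+ j) ℕ.* (Z ℕ.* Z)
  smaller = +-cancelˡ-≡ ((k ℕ.* Z ℕ.+ X′) ℕ.* (k ℕ.* Z) ℕ.+ k ℕ.* Z ℕ.* X′) _ _ (begin
    (k ℕ.* Z ℕ.+ X′) ℕ.* (k ℕ.* Z) ℕ.+ k ℕ.* Z ℕ.* X′ ℕ.+ X′ ℕ.* X′ ≡⟨ solve 2 (λ w x → (w :+ x) :* w :+ w :* x :+ x :* x := (w :+ x) :* (w :+ x)) P.refl (k ℕ.* Z) X′ ⟩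
    (k ℕ.* Z ℕ.+ X′) ℕ.* (k ℕ.* Z ℕ.+ X′) ≡⟨ cong (λ w → w ℕ.* w) X′≡ ⟩
    (j ℕ.* V) ℕ.* (j ℕ.* V) ≡⟨ solve 2 (λ j V → (j :* V) :* (j :* V) := j :* (j :* (V :* V))) P.refl j V ⟩
    j ℕ.* (j ℕ.* (V ℕ.* V)) ≡⟨ cong (j ℕ.*_) (P.sym quad) ⟩
    j ℕ.* ((k ℕ.* V ℕ.+ k ℕ.* V) ℕ.* Z ℕ.+ Z ℕ.* Z) ≡⟨ solve 4 (λ j k V Z → j :* ((k :* V :+ k :* V) :* Z :+ Z :* Z) := (j :* V) :* (k :* Z :+ k :* Z) :+ j :* (Z :* Z)) P.refl j k V Z ⟩
    (j ℕ.* V) ℕ.* (k ℕ.* Z ℕ.+ k ℕ.* Z) ℕ.+ j ℕ.* (Z ℕ.* Z) ≡⟨ cong (λ w → w ℕ.* (k ℕ.* Z ℕ.+ k ℕ.* Z) ℕ.+ j ℕ.* (Z ℕ.* Z)) (P.sym X′≡) ⟩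
    (k ℕ.* Z ℕ.+ X′) ℕ.* (k ℕ.* Z ℕ.+ k ℕ.* Z) ℕ.+ j ℕ.* (Z ℕ.* Z)
      ≡⟨ solve 4 (λ j k x Z → (k :* Z :+ x) :* (k :* Z :+ k :* Z) :+ j :* (Z :* Z) := (k :* Z :+ x) :* (k :* Z) :+ k :* Z :* x :+ (k :* k :+ j) :* (Z :* Z)) P.refl j k X′ Z ⟩
    (k ℕ.* Z ℕ.+ X′) ℕ.* (k ℕ.* Z) ℕ.+ k ℕ.* Z ℕ.* X′ ℕ.+ (k ℕ.* k ℕ.+ j) ℕ.* (Z ℕ.* Z) ∎)
    where open P.≡-Reasoning
  finish : Z ≡ 0 → V ≡ 0
  finish Z≡0 = ⊥-elim (<⇒≢ (*-mono-≤ {1} {j} {1} {V ℕ.* V} 0<j 0<V²) (P.sym vanish))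
    where
    X≤kV : X ≤ k ℕ.* V
    X≤kV = m∸n≡0⇒m≤n Z≡0
    vanish : j ℕ.* (V ℕ.* V) ≡ 0
    vanish = n≤0⇒n≡0 (+-cancelˡ-≤ ((k ℕ.* V) ℕ.* (k ℕ.* V)) _ 0 (≤-trans (≤-reflexive (P.trans (solve 3 (λ k j V → (k :* V) :* (k :* V) :+ j :* (V :* V) := (k :* k :+ j) :* (V :* V)) P.refl k j V) (P.sym e)))
      (≤-trans (*-mono-≤ X≤kV X≤kV) (≤-reflexive (P.sym (ℕₚ.+-identityʳ _))))))

-- The discriminant is (t + s′)² ∓ 4, which lies strictly between two consecutive squares.
discriminant : ∀ τ (d : ℤ) → 3 ≤ τ → ∣ d ∣ ≡ 1 → ∃ λ k → ∃ λ j → 0 < j × j ≤ k ℕ.+ k × + τ ℤ.* + τ ℤ.- + 4 ℤ.* d ≡ + (k ℕ.* k ℕ.+ j)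
discriminant (suc (suc (suc τ))) (+ 1) (s≤s (s≤s (s≤s z≤n))) P.refl = 2 ℕ.+ τ , 1 ℕ.+ (τ ℕ.+ τ) , s≤s z≤n ,
  ≤-trans (m≤n+m _ 3) (≤-reflexive (N.solve 1 (λ τ → N.con 4 N.:+ (τ N.:+ τ) N.:= N.con 2 N.:+ τ N.:+ (N.con 2 N.:+ τ)) P.refl τ)) ,
  P.trans (S.solve 1 (λ τ → (S.con (+ 3) S.:+ τ) S.:* (S.con (+ 3) S.:+ τ) S.:- S.con (+ 4) S.:* S.con 1ℤ S.:= (S.con (+ 2) S.:+ τ) S.:* (S.con (+ 2) S.:+ τ) S.:+ (S.con 1ℤ S.:+ (τ S.:+ τ))) P.refl (+ τ)) (cong (ℤ._+ + (1 ℕ.+ (τ ℕ.+ τ))) (P.sym (pos-* (2 ℕ.+ τ) (2 ℕ.+ τ))))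
discriminant (suc (suc (suc τ))) ℤ.-[1+ 0 ] (s≤s (s≤s (s≤s z≤n))) P.refl = 3 ℕ.+ τ , 4 , s≤s z≤n ,
  ≤-trans (m≤m+n 4 (2 ℕ.+ (τ ℕ.+ τ))) (≤-reflexive (N.solve 1 (λ τ → N.con 4 N.:+ (N.con 2 N.:+ (τ N.:+ τ)) N.:= N.con 3 N.:+ τ N.:+ (N.con 3 N.:+ τ)) P.refl τ)) ,
  cong (ℤ._+ + 4) (P.sym (pos-* (3 ℕ.+ τ) (3 ℕ.+ τ)))

module _ (t t′ s s′ : ℕ) (trace : 3 ≤ t ℕ.+ s′) (unimodular : ∣ det (t , s) (t′ , s′) ∣ ≡ 1) where
  open Quadratic (+ t ℤ.- + s′) (+ s ℤ.* + t′) using (nrm; 0ᵒ)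

  nrm-anisotropic : ∀ z → nrm z ≡ 0ℤ → z ≡ 0ᵒ
  nrm-anisotropic (u , v) e with discriminant (t ℕ.+ s′) (det (t , s) (t′ , s′)) trace unimodular
  ... | k , j , 0<j , j≤2k , disc′ = cong₂ _,_ u≡0 v≡0
    where
    b = + t ℤ.- + s′
    c = + s ℤ.* + t′
    disc = P.trans (S.solve 4 (λ t t′ s s′ → (t S.:- s′) S.:* (t S.:- s′) S.:+ S.con (+ 4) S.:* (s S.:* t′) S.:= (t S.:+ s′) S.:* (t S.:+ s′) S.:- S.con (+ 4) S.:* (t S.:* s′ S.:- t′ S.:* s)) P.refl (+ t) (+ t′) (+ s) (+ s′)) disc′
    X = + 2 ℤ.* u ℤ.+ b ℤ.* v
    X² : X ℤ.* X ≡ + (k ℕ.* k ℕ.+ j) ℤ.* (v ℤ.* v)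
    X² = P.trans (S.solve 4 (λ b c u v → (S.con (+ 2) S.:* u S.:+ b S.:* v) S.:* (S.con (+ 2) S.:* u S.:+ b S.:* v) S.:= S.con (+ 4) S.:* (u S.:* u S.:+ b S.:* (u S.:* v) S.:- c S.:* (v S.:* v)) S.:+ (b S.:* b S.:+ S.con (+ 4) S.:* c) S.:* (v S.:* v)) P.refl b c u v)
      (P.trans (cong₂ (λ n d → + 4 ℤ.* n ℤ.+ d ℤ.* (v ℤ.* v)) e disc) (ℤₚ.+-identityˡ _))
    v≡0 : v ≡ 0ℤ
    v≡0 = ∣i∣≡0⇒i≡0 (between-squares k j 0<j j≤2k (∣ v ∣) (∣ v ∣) (∣ X ∣) ≤-refl (P.trans (P.sym (abs-* X X)) (P.trans (cong ∣_∣ X²) (P.trans (abs-* (+ (k ℕ.* k ℕ.+ j)) (v ℤ.* v)) (cong ((k ℕ.* k ℕ.+ j) ℕ.*_) (abs-* v v))))))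
    u² : u ℤ.* u ≡ 0ℤ
    u² = P.trans (S.solve 3 (λ b c u → u S.:* u S.:= u S.:* u S.:+ b S.:* (u S.:* S.con 0ℤ) S.:- c S.:* (S.con 0ℤ S.:* S.con 0ℤ)) P.refl b c u) (P.trans (cong (λ v → nrm (u , v)) (P.sym v≡0)) e)
    u≡0 : u ≡ 0ℤ
    u≡0 = [ id , id ]′ (i*j≡0⇒i≡0∨j≡0 u u²)

coeff : List ℤ → ℕ → ℤ
coeff [] _ = 0ℤ
coeff (c ∷ P) zero = c
coeff (c ∷ P) (suc j) = coeff P j

Zero : List ℤ → Set
Zero = All (_≡ 0ℤ)

monomials : ℕ → List ℤ → Poly 1
monomials j [] = []
monomials j (c ∷ P) = (c , j ∷ []) ∷ monomials (suc j) P

monomials-box : ∀ {d} j P → j ℕ.+ length P ≤ suc d → Support (_⊑ᵛ (d ∷ [])) (monomials j P)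
monomials-box j [] l = []
monomials-box j (c ∷ P) l = (≤-pred (≤-trans (s≤s (m≤m+n j (length P))) (≤-trans (≤-reflexive (P.sym (+-suc j (length P)))) l)) Pointwise.∷ Pointwise.[]) ∷
  monomials-box (suc j) P (≤-trans (≤-reflexive (P.sym (+-suc j (length P)))) l)

module Horner (A : ℤ-Algebra) where
  open ℤ-Algebra A
  open Pairing A
  open Sum ring
  open Taylor A using (taylor; _↑_)
  open Solver A using (solve; _:=_; _:+_; _:*_; _:-_; :-_; con)
  open import Relation.Binary.Reasoning.Setoid setoid

  eval : List ℤ → Carrier → Carrier
  eval [] z = 0#
  eval (c ∷ P) z = ι c + z * eval P z

  eval-sum : ∀ P z → eval P z ≈ sum (length P) (λ j → ι (coeff P j) * z ↑ j)
  eval-sum [] z = refl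
  eval-sum (c ∷ P) z = +-cong (sym (*-identityʳ _)) (trans (*-congˡ (eval-sum P z)) (trans (sym (sum-*ˡ (length P) z (λ j → ι (coeff P j) * z ↑ j)))
    (sum-cong (length P) {λ j → z * (ι (coeff P j) * z ↑ j)} {λ j → ι (coeff P j) * (z * z ↑ j)} (λ j _ → solve 3 (λ z c w → z :* (c :* w) := c :* (z :* w)) refl z (ι (coeff P j)) (z ↑ j)))))

  eval-∷ʳ0 : ∀ P z → eval (P ∷ʳ 0ℤ) z ≈ eval P z
  eval-∷ʳ0 [] z = trans (+-cong ι-0 (zeroʳ z)) (+-identityʳ 0#)
  eval-∷ʳ0 (c ∷ P) z = +-congˡ (*-congˡ (eval-∷ʳ0 P z))

  eval-scale : ∀ k P z → eval (map (k ℤ.*_) P) z ≈ ι k * eval P z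
  eval-scale k [] z = sym (zeroʳ _)
  eval-scale k (c ∷ P) z = trans (+-cong (ι-* k c) (*-congˡ (eval-scale k P z))) (solve 4 (λ k c z e → k :* c :+ z :* (k :* e) := k :* (c :+ z :* e)) refl (ι k) (ι c) z (eval P z))

  hom : List ℤ → Carrier → Carrier → Carrier
  hom [] x y = 0#
  hom (c ∷ P) x y = ι c * y ↑ length P + x * hom P x y

  hom-scale : ∀ k P x y → hom (map (k ℤ.*_) P) x y ≈ ι k * hom P x y
  hom-scale k [] x y = sym (zeroʳ _)
  hom-scale k (c ∷ P) x y = trans (+-cong (*-cong (ι-* k c) (reflexive (cong (y ↑_) (length-map (k ℤ.*_) P)))) (*-congˡ (hom-scale k P x y)))
    (solve 5 (λ k c Y x h → k :* c :* Y :+ x :* (k :* h) := k :* (c :* Y :+ x :* h)) refl (ι k) (ι c) (y ↑ length P) x (hom P x y))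

  taylor-0 : ∀ x j → taylor x 0 j ≈ x ↑ j
  taylor-0 x zero = refl
  taylor-0 x (suc j) = *-congˡ (taylor-0 x j)

  monomials-hom : ∀ d x y j P → j ℕ.+ length P ≡ suc d → (g : Exp 1 → Carrier) → (∀ i → g (i ∷ []) ≈ taylor x 0 i * y ↑ (d ∸ i)) → ⟨ monomials j P , g ⟩ ≈ x ↑ j * hom P x y
  monomials-hom d x y j [] l g h = sym (zeroʳ _)
  monomials-hom d x y j (c ∷ P) l g h = begin
    ι c * g (j ∷ []) + ⟨ monomials (suc j) P , g ⟩ ≈⟨ +-cong (*-congˡ (trans (h j) (*-cong (taylor-0 x j) (reflexive (cong (y ↑_) d-j))))) (monomials-hom d x y (suc j) P l′ g h) ⟩
    ι c * (x ↑ j * y ↑ length P) + (x * x ↑ j) * hom P x y ≈⟨ solve 5 (λ c X Y x h → c :* (X :* Y) :+ (x :* X) :* h := X :* (c :* Y :+ x :* h)) refl (ι c) (x ↑ j) (y ↑ length P) x (hom P x y) ⟩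
    x ↑ j * (ι c * y ↑ length P + x * hom P x y) ∎
    where
    l′ = P.trans (P.sym (+-suc j (length P))) l
    d-j : d ∸ j ≡ length P
    d-j = P.trans (cong (_∸ j) (ℕₚ.suc-injective (P.sym l′))) (m+n∸m≡n j (length P))

  monomials-eval : ∀ z j P (g : Exp 1 → Carrier) → (∀ i → g (i ∷ []) ≈ taylor z 0 i) → ⟨ monomials j P , g ⟩ ≈ z ↑ j * eval P z
  monomials-eval z j [] g h = sym (zeroʳ _)
  monomials-eval z j (c ∷ P) g h = trans (+-cong (*-congˡ (trans (h j) (taylor-0 z j))) (monomials-eval z (suc j) P g h))
    (solve 4 (λ c Z z e → c :* Z :+ (z :* Z) :* e := Z :* (c :+ z :* e)) refl (ι c) (z ↑ j) z (eval P z))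

-- Division of P by the quadratic c + b X + a X², starting from the constant term; (x : y) is a root of the quadratic.
module Divide (A : ℤ-Algebra) (O : ℤ-Algebra) (x y : ℤ-Algebra.Carrier O) (a b c : ℤ) (c≢0 : c ≢ 0ℤ)
  (x-regular : ∀ z → ℤ-Algebra._≈_ O (ℤ-Algebra._*_ O x z) (ℤ-Algebra.0# O) → ℤ-Algebra._≈_ O z (ℤ-Algebra.0# O))
  (quadratic : ℤ-Algebra._≈_ O (Horner.hom O (c ∷ b ∷ a ∷ []) x y) (ℤ-Algebra.0# O))
  (independent : ∀ u v → ℤ-Algebra._≈_ O (Horner.hom O (u ∷ v ∷ []) x y) (ℤ-Algebra.0# O) → u ≡ 0ℤ × v ≡ 0ℤ) where
  private
    module HA = Horner A
    module HO = Horner O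
    module A = ℤ-Algebra A
    module O = ℤ-Algebra O
    module SA = Solver A
    module SO = Solver O
    open Taylor O using (_↑_)
    F : List ℤ
    F = c ∷ b ∷ a ∷ []

  next : ℤ → ℤ → ℤ → List ℤ → List ℤ
  next f₀ f₁ f₂ R = c ℤ.* f₁ ℤ.- f₀ ℤ.* b ∷ c ℤ.* f₂ ℤ.- f₀ ℤ.* a ∷ map (c ℤ.*_) R

  next-hom : ∀ f₀ f₁ f₂ R → HO.hom (f₀ ∷ f₁ ∷ f₂ ∷ R) x y O.≈ O.0# → HO.hom (next f₀ f₁ f₂ R) x y O.≈ O.0#
  next-hom f₀ f₁ f₂ R h = x-regular _ (begin
    x O.* (O.ι (c ℤ.* f₁ ℤ.- f₀ ℤ.* b) O.* (y O.* y ↑ length (map (c ℤ.*_) R)) O.+ x O.* (O.ι (c ℤ.* f₂ ℤ.- f₀ ℤ.* a) O.* y ↑ length (map (c ℤ.*_) R) O.+ x O.* HO.hom (map (c ℤ.*_) R) x y))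
      ≈⟨ O.*-congˡ (O.+-cong (O.*-cong (sub c f₁ f₀ b) (O.*-congˡ len)) (O.*-congˡ (O.+-cong (O.*-cong (sub c f₂ f₀ a) len) (O.*-congˡ (HO.hom-scale c R x y))))) ⟩
    x O.* ((O.ι c O.* O.ι f₁ O.- O.ι f₀ O.* O.ι b) O.* (y O.* Y) O.+ x O.* ((O.ι c O.* O.ι f₂ O.- O.ι f₀ O.* O.ι a) O.* Y O.+ x O.* (O.ι c O.* H)))
      ≈⟨ O.*-congˡ (O.+-cong
           (SO.solve 5 (λ c f₁ f₀ b W → (c SO.:* f₁ SO.:- f₀ SO.:* b) SO.:* W SO.:= c SO.:* (f₁ SO.:* W) SO.:- f₀ SO.:* (b SO.:* W)) O.refl (O.ι c) (O.ι f₁) (O.ι f₀) (O.ι b) (y O.* Y))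
           (SO.solve 7 (λ c f₂ f₀ a Y x H → x SO.:* ((c SO.:* f₂ SO.:- f₀ SO.:* a) SO.:* Y SO.:+ x SO.:* (c SO.:* H)) SO.:= c SO.:* (x SO.:* (f₂ SO.:* Y SO.:+ x SO.:* H)) SO.:- f₀ SO.:* (x SO.:* (a SO.:* Y))) O.refl (O.ι c) (O.ι f₂) (O.ι f₀) (O.ι a) Y x H)) ⟩
    x O.* ((O.ι c O.* T₁ O.- O.ι f₀ O.* G₁) O.+ (O.ι c O.* T₂ O.- O.ι f₀ O.* G₂))
      ≈⟨ SO.solve 8 (λ x c f₀ V T₁ T₂ G₁ G₂ → x SO.:* ((c SO.:* T₁ SO.:- f₀ SO.:* G₁) SO.:+ (c SO.:* T₂ SO.:- f₀ SO.:* G₂)) SO.:= c SO.:* (f₀ SO.:* V SO.:+ x SO.:* (T₁ SO.:+ T₂)) SO.:- f₀ SO.:* (c SO.:* V SO.:+ x SO.:* (G₁ SO.:+ G₂))) O.refl x (O.ι c) (O.ι f₀) (y O.* (y O.* Y)) T₁ T₂ G₁ G₂ ⟩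
    O.ι c O.* HO.hom (f₀ ∷ f₁ ∷ f₂ ∷ R) x y O.- O.ι f₀ O.* (O.ι c O.* (y O.* (y O.* Y)) O.+ x O.* (G₁ O.+ G₂))
      ≈⟨ O.+-cong (O.*-congˡ h) (O.-‿cong (O.*-congˡ form)) ⟩
    O.ι c O.* O.0# O.- O.ι f₀ O.* (Y O.* O.0#) ≈⟨ O.+-cong (O.zeroʳ _) (O.-‿cong (O.trans (O.*-congˡ (O.zeroʳ _)) (O.zeroʳ _))) ⟩
    O.0# O.- O.0# ≈⟨ O.-‿inverseʳ _ ⟩
    O.0# ∎)
    where
    open import Relation.Binary.Reasoning.Setoid O.setoid
    Y = y ↑ length R
    H = HO.hom R x y
    T₁ = O.ι f₁ O.* (y O.* Y)
    T₂ = x O.* (O.ι f₂ O.* Y O.+ x O.* H)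
    G₁ = O.ι b O.* (y O.* Y)
    G₂ = x O.* (O.ι a O.* Y)
    len : y ↑ length (map (c ℤ.*_) R) O.≈ Y
    len = O.reflexive (cong (y ↑_) (length-map (c ℤ.*_) R))
    sub : ∀ u v w z → O.ι (u ℤ.* v ℤ.- w ℤ.* z) O.≈ O.ι u O.* O.ι v O.- O.ι w O.* O.ι z
    sub u v w z = O.trans (O.ι-+ _ _) (O.+-cong (O.ι-* u v) (O.trans (O.ι-neg _) (O.-‿cong (O.ι-* w z))))
    form : O.ι c O.* (y O.* (y O.* Y)) O.+ x O.* (G₁ O.+ G₂) O.≈ Y O.* O.0#
    form = O.trans (SO.solve 6 (λ x y Y c b a → c SO.:* (y SO.:* (y SO.:* Y)) SO.:+ x SO.:* (b SO.:* (y SO.:* Y) SO.:+ x SO.:* (a SO.:* Y)) SO.:= Y SO.:* (c SO.:* (y SO.:* y) SO.:+ x SO.:* (b SO.:* y SO.:+ x SO.:* a))) O.refl x y Y (O.ι c) (O.ι b) (O.ι a))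
      (O.*-congˡ (O.trans (O.sym (O.+-cong (O.*-congˡ (O.*-congˡ (O.*-identityʳ y))) (O.*-congˡ (O.+-cong (O.*-congˡ (O.*-identityʳ y)) (O.*-congˡ (O.trans (O.+-cong (O.*-identityʳ _) (O.zeroʳ x)) (O.+-identityʳ _))))))) quadratic))

  next-eval : ∀ f₀ f₁ f₂ R z → A.ι c A.* HA.eval (f₀ ∷ f₁ ∷ f₂ ∷ R) z A.≈ A.ι f₀ A.* HA.eval F z A.+ z A.* HA.eval (next f₀ f₁ f₂ R) z
  next-eval f₀ f₁ f₂ R z = A.sym (A.trans (A.+-congˡ (A.*-congˡ (A.+-cong (sub c f₁ f₀ b) (A.*-congˡ (A.+-cong (sub c f₂ f₀ a) (A.*-congˡ (HA.eval-scale c R z)))))))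
    (A.trans (A.+-cong (A.*-congˡ (A.+-congˡ (A.*-congˡ (A.+-congˡ (A.*-congˡ (A.trans (A.+-congˡ (A.zeroʳ z)) (A.+-identityʳ _)))))))
        (A.*-congˡ (A.+-congˡ (SA.solve 6 (λ c f₂ f₀ a z H → z SA.:* ((c SA.:* f₂ SA.:- f₀ SA.:* a) SA.:+ z SA.:* (c SA.:* H)) SA.:= c SA.:* (z SA.:* (f₂ SA.:+ z SA.:* H)) SA.:- f₀ SA.:* (z SA.:* a)) A.refl (A.ι c) (A.ι f₂) (A.ι f₀) (A.ι a) z (HA.eval R z)))))
      (SA.solve 7 (λ z c b f₀ f₁ T G → f₀ SA.:* (c SA.:+ z SA.:* (b SA.:+ G)) SA.:+ z SA.:* ((c SA.:* f₁ SA.:- f₀ SA.:* b) SA.:+ (c SA.:* T SA.:- f₀ SA.:* G)) SA.:= c SA.:* (f₀ SA.:+ z SA.:* (f₁ SA.:+ T)))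
        A.refl z (A.ι c) (A.ι b) (A.ι f₀) (A.ι f₁) (z A.* (A.ι f₂ A.+ z A.* HA.eval R z)) (z A.* A.ι a))))
    where
    sub : ∀ u v w z → A.ι (u ℤ.* v ℤ.- w ℤ.* z) A.≈ A.ι u A.* A.ι v A.- A.ι w A.* A.ι z
    sub u v w z = A.trans (A.ι-+ _ _) (A.+-cong (A.ι-* u v) (A.trans (A.ι-neg _) (A.-‿cong (A.ι-* w z))))

  cancel : ∀ {k z} → k ≢ 0ℤ → k ℤ.* z ≡ 0ℤ → z ≡ 0ℤ
  cancel {k} ne h = [ (λ q → ⊥-elim (ne q)) , (λ q → q) ]′ (i*j≡0⇒i≡0∨j≡0 k h)

  zero-next : ∀ f₀ f₁ f₂ R → f₀ ≡ 0ℤ → Zero (next f₀ f₁ f₂ R) → Zero (f₀ ∷ f₁ ∷ f₂ ∷ R)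
  zero-next f₀ f₁ f₂ R P.refl (h₁ ∷ h₂ ∷ hs) = P.refl ∷ cancel c≢0 (P.trans (P.sym (ℤₚ.+-identityʳ _)) h₁) ∷ cancel c≢0 (P.trans (P.sym (ℤₚ.+-identityʳ _)) h₂) ∷ go R hs
    where
    go : ∀ R → Zero (map (c ℤ.*_) R) → Zero R
    go [] [] = []
    go (r ∷ R) (h ∷ hs) = cancel c≢0 h ∷ go R hs

  record Quotient (k : ℕ) (P : List ℤ) (z : A.Carrier) : Set where
    field
      H : List ℤ
      length-H : length H ≡ k
      Zero-H : Zero H → Zero P
      e : ℕ
      division : A.ι (c ℤ.^ e) A.* HA.eval P z A.≈ HA.eval F z A.* HA.eval H z

  quotient-0 : ∀ u v z → u ≡ 0ℤ × v ≡ 0ℤ → Quotient 0 (u ∷ v ∷ []) z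
  quotient-0 u v z (P.refl , P.refl) = record { H = [] ; length-H = P.refl ; Zero-H = λ _ → P.refl ∷ P.refl ∷ [] ; e = 0
    ; division = A.trans (A.*-congˡ (A.trans (A.+-cong A.ι-0 (A.trans (A.*-congˡ (A.trans (A.+-cong A.ι-0 (A.zeroʳ z)) (A.+-identityˡ _))) (A.zeroʳ z))) (A.+-identityˡ _))) (A.trans (A.zeroʳ _) (A.sym (A.zeroʳ _))) }

  quotient-suc : ∀ k f₀ f₁ f₂ R z → Quotient k (next f₀ f₁ f₂ R) z → Quotient (suc k) (f₀ ∷ f₁ ∷ f₂ ∷ R) z
  quotient-suc k f₀ f₁ f₂ R z q = record { H = c ℤ.^ q.e ℤ.* f₀ ∷ q.H ; length-H = cong suc q.length-H
    ; Zero-H = λ { (z₀ ∷ zs) → zero-next f₀ f₁ f₂ R (cancel (power≢0 c≢0 q.e) z₀) (q.Zero-H zs) } ; e = suc q.e ; division = A.trans (A.*-congʳ (A.ι-* c (c ℤ.^ q.e))) (begin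
    A.ι c A.* E A.* f ≈⟨ SA.solve 3 (λ c E f → c SA.:* E SA.:* f SA.:= E SA.:* (c SA.:* f)) A.refl (A.ι c) E f ⟩
    E A.* (A.ι c A.* f) ≈⟨ A.*-congˡ (next-eval f₀ f₁ f₂ R z) ⟩
    E A.* (A.ι f₀ A.* G A.+ z A.* N) ≈⟨ SA.solve 5 (λ E f₀ G z N → E SA.:* (f₀ SA.:* G SA.:+ z SA.:* N) SA.:= G SA.:* (E SA.:* f₀) SA.:+ z SA.:* (E SA.:* N)) A.refl E (A.ι f₀) G z N ⟩
    G A.* (E A.* A.ι f₀) A.+ z A.* (E A.* N) ≈⟨ A.+-cong (A.*-congˡ (A.sym (A.ι-* _ _))) (A.*-congˡ q.division) ⟩
    G A.* A.ι (c ℤ.^ q.e ℤ.* f₀) A.+ z A.* (G A.* HA.eval q.H z) ≈⟨ SA.solve 4 (λ G u z h → G SA.:* u SA.:+ z SA.:* (G SA.:* h) SA.:= G SA.:* (u SA.:+ z SA.:* h)) A.refl G (A.ι (c ℤ.^ q.e ℤ.* f₀)) z (HA.eval q.H z) ⟩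
    G A.* (A.ι (c ℤ.^ q.e ℤ.* f₀) A.+ z A.* HA.eval q.H z) ∎) }
    where
    open import Relation.Binary.Reasoning.Setoid A.setoid
    module q = Quotient q
    E = A.ι (c ℤ.^ q.e)
    f = HA.eval (f₀ ∷ f₁ ∷ f₂ ∷ R) z
    G = HA.eval F z
    N = HA.eval (next f₀ f₁ f₂ R) z

  divide : ∀ k P → length P ≡ suc (suc k) → HO.hom P x y O.≈ O.0# → ∀ z → Quotient k P z
  divide zero (u ∷ v ∷ []) l h z = quotient-0 u v z (independent u v h)
  divide (suc k) (f₀ ∷ f₁ ∷ f₂ ∷ R) l h z = quotient-suc k f₀ f₁ f₂ R z (divide k (next f₀ f₁ f₂ R) (P.trans (cong (λ n → suc (suc n)) (length-map (c ℤ.*_) R)) (ℕₚ.suc-injective l)) (next-hom f₀ f₁ f₂ R h) z)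

module Identity (A : ℤ-Algebra) where
  open ℤ-Algebra A
  open Solver A using (solve; _:=_; _:+_; _:*_; _:-_; :-_; con)

  split-combination : ∀ k ξ θ s p q p′ q′ → (ι s * (k * (ι p′ - ξ * ι q′))) + (θ * (k * (ι p - ξ * ι q))) ≈ k * ((ι (s ℤ.* p′) + ι p * θ) - ξ * (ι (s ℤ.* q′) + ι q * θ))
  split-combination k ξ θ s p q p′ q′ = trans (solve 8 (λ k x t s p q p′ q′ → (s :* (k :* (p′ :- x :* q′))) :+ (t :* (k :* (p :- x :* q))) := k :* ((s :* p′ :+ p :* t) :- x :* (s :* q′ :+ q :* t))) refl k ξ θ (ι s) (ι p) (ι q) (ι p′) (ι q′))
    (*-congˡ (+-cong (+-congʳ (sym (ι-* s p′))) (-‿cong (*-congˡ (+-congʳ (sym (ι-* s q′)))))))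

module _ (𝔸 : BoundedAlgebra) (b c : ℤ) (anisotropic : ∀ z → Quadratic.nrm b c z ≡ 0ℤ → z ≡ Quadratic.0ᵒ b c) where
  open BoundedAlgebra 𝔸
  open Quadratic b c
  open Solver alg using (solve; _:=_; _:+_; _:*_; _:-_; :-_; con)
  open import Relation.Binary.Reasoning.Setoid setoid

  module Root (θ : Carrier) (θ² : θ * θ ≈ ι b * θ + ι c) where
    value : 𝕆 → Carrier
    value (u , v) = ι u + ι v * θ

    value-+ : ∀ z w → value (z +ᵒ w) ≈ value z + value w
    value-+ (u , v) (u′ , v′) = trans (+-cong (ι-+ u u′) (*-congʳ (ι-+ v v′))) (solve 5 (λ u u′ v v′ t → u :+ u′ :+ (v :+ v′) :* t := u :+ v :* t :+ (u′ :+ v′ :* t)) refl (ι u) (ι u′) (ι v) (ι v′) θ)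

    value-* : ∀ z w → value (z *ᵒ w) ≈ value z * value w
    value-* (u , v) (u′ , v′) = begin
      ι (u ℤ.* u′ ℤ.+ c ℤ.* (v ℤ.* v′)) + ι (u ℤ.* v′ ℤ.+ v ℤ.* u′ ℤ.+ b ℤ.* (v ℤ.* v′)) * θ
        ≈⟨ +-cong (trans (ι-+ _ _) (+-cong (ι-* u u′) (trans (ι-* c _) (*-congˡ (ι-* v v′)))))
                  (*-congʳ (trans (ι-+ _ _) (+-cong (trans (ι-+ _ _) (+-cong (ι-* u v′) (ι-* v u′))) (trans (ι-* b _) (*-congˡ (ι-* v v′)))))) ⟩
      ι u * ι u′ + ι c * (ι v * ι v′) + (ι u * ι v′ + ι v * ι u′ + ι b * (ι v * ι v′)) * θ
        ≈⟨ solve 7 (λ b c t u v u′ v′ → u :* u′ :+ c :* (v :* v′) :+ (u :* v′ :+ v :* u′ :+ b :* (v :* v′)) :* t := u :* u′ :+ (u :* v′ :+ v :* u′) :* t :+ (v :* v′) :* (b :* t :+ c)) refl (ι b) (ι c) θ (ι u) (ι v) (ι u′) (ι v′) ⟩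
      ι u * ι u′ + (ι u * ι v′ + ι v * ι u′) * θ + (ι v * ι v′) * (ι b * θ + ι c) ≈⟨ +-congˡ (*-congˡ (sym θ²)) ⟩
      ι u * ι u′ + (ι u * ι v′ + ι v * ι u′) * θ + (ι v * ι v′) * (θ * θ)
        ≈⟨ solve 5 (λ t u v u′ v′ → u :* u′ :+ (u :* v′ :+ v :* u′) :* t :+ (v :* v′) :* (t :* t) := (u :+ v :* t) :* (u′ :+ v′ :* t)) refl θ (ι u) (ι v) (ι u′) (ι v′) ⟩
      _ ∎

    value-ι : ∀ k → value (ιᵒ k) ≈ ι k
    value-ι k = trans (+-congˡ (trans (*-congʳ ι-0) (zeroˡ θ))) (+-identityʳ _)

    embedding : Embedding (order anisotropic) 𝔸
    embedding = record { ε = value ; ε-cong = λ e → reflexive (cong value e) ; ε-+ = value-+ ; ε-* = value-* ; ε-ι = value-ι }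

  module Conjugates (θ₁ : Carrier) (θ₁² : θ₁ * θ₁ ≈ ι b * θ₁ + ι c) where
    θ₂ : Carrier
    θ₂ = ι b - θ₁

    θ₂² : θ₂ * θ₂ ≈ ι b * θ₂ + ι c
    θ₂² = trans (solve 2 (λ b t → (b :- t) :* (b :- t) := b :* b :- (b :* t :+ b :* t) :+ t :* t) refl (ι b) θ₁)
      (trans (+-congˡ θ₁²) (solve 3 (λ b c t → b :* b :- (b :* t :+ b :* t) :+ (b :* t :+ c) := b :* (b :- t) :+ c) refl (ι b) (ι c) θ₁))

    norm-product : ∀ z → Root.value θ₁ θ₁² z * Root.value θ₂ θ₂² z ≈ ι (nrm z)
    norm-product (u , v) = begin
      (ι u + ι v * θ₁) * (ι u + ι v * (ι b - θ₁)) ≈⟨ solve 4 (λ u v b t → (u :+ v :* t) :* (u :+ v :* (b :- t)) := u :* u :+ b :* (u :* v) :+ v :* v :* (b :* t) :- v :* v :* (t :* t)) refl (ι u) (ι v) (ι b) θ₁ ⟩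
      ι u * ι u + ι b * (ι u * ι v) + ι v * ι v * (ι b * θ₁) - ι v * ι v * (θ₁ * θ₁) ≈⟨ +-congˡ (-‿cong (*-congˡ θ₁²)) ⟩
      ι u * ι u + ι b * (ι u * ι v) + ι v * ι v * (ι b * θ₁) - ι v * ι v * (ι b * θ₁ + ι c)
        ≈⟨ solve 5 (λ u v b c t → u :* u :+ b :* (u :* v) :+ v :* v :* (b :* t) :- v :* v :* (b :* t :+ c) := u :* u :+ b :* (u :* v) :- c :* (v :* v)) refl (ι u) (ι v) (ι b) (ι c) θ₁ ⟩
      ι u * ι u + ι b * (ι u * ι v) - ι c * (ι v * ι v)
        ≈⟨ sym (trans (ι-+ _ _) (+-cong (trans (ι-+ _ _) (+-cong (ι-* u u) (trans (ι-* b _) (*-congˡ (ι-* u v))))) (trans (ι-neg _) (-‿cong (trans (ι-* c _) (*-congˡ (ι-* v v))))))) ⟩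
      ι (nrm (u , v)) ∎

fraction : ∀ z d → 1 ≤ d → mkℚᵘ (+ d) 0 Q.* mkℚᵘ z (pred d) ≃ mkℚᵘ z 0
fraction z (suc d) _ = *≡* (P.trans (S.solve 2 (λ d z → d S.:* z S.:* S.con 1ℤ S.:= z S.:* d) P.refl (+ suc d) z) (cong (λ n → z ℤ.* + n) (P.sym (ℕₚ.*-identityˡ (suc d)))))

cleared-abs : ∀ d {x z} → mkℚᵘ (+ d) 0 Q.* x ≃ mkℚᵘ z 0 → d ℕ.* ∣ ↥ x ∣ ≡ ∣ z ∣ ℕ.* ↧ₙ x
cleared-abs d {mkℚᵘ a e} {z} (*≡* h) = P.trans (P.sym (abs-* (+ d) a)) (P.trans (cong ∣_∣ (P.trans (P.sym (ℤₚ.*-identityʳ (+ d ℤ.* a))) h)) (P.trans (abs-* z (+ (1 ℕ.* suc e))) (cong (∣ z ∣ ℕ.*_) (ℕₚ.*-identityˡ (suc e)))))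

AbsLe-cleared : ∀ d {x z k b} → 1 ≤ d → mkℚᵘ (+ d) 0 Q.* x ≃ mkℚᵘ z 0 → ∣ z ∣ ℕ.* k ≤ b ℕ.* d → AbsLe x k b
AbsLe-cleared d@(suc _) {mkℚᵘ a e} {z} {k} {b} _ h l = absLe (*-cancelˡ-≤ d (begin
  d ℕ.* (∣ a ∣ ℕ.* k) ≡⟨ P.sym (ℕₚ.*-assoc d ∣ a ∣ k) ⟩
  d ℕ.* ∣ a ∣ ℕ.* k ≡⟨ cong (ℕ._* k) (cleared-abs d {mkℚᵘ a e} {z} h) ⟩
  ∣ z ∣ ℕ.* suc e ℕ.* k ≡⟨ solve 3 (λ z e k → z :* e :* k := z :* k :* e) P.refl ∣ z ∣ (suc e) k ⟩
  ∣ z ∣ ℕ.* k ℕ.* suc e ≤⟨ *-monoˡ-≤ (suc e) l ⟩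
  b ℕ.* d ℕ.* suc e ≡⟨ solve 3 (λ b d e → b :* d :* e := d :* (b :* e)) P.refl b d (suc e) ⟩
  d ℕ.* (b ℕ.* suc e) ∎))
  where
  open +-*-Solver
  open ℕₚ.≤-Reasoning

≥-cleared : ∀ d {x z} K → 1 ≤ d → mkℚᵘ (+ d) 0 Q.* x ≃ mkℚᵘ z 0 → d ≤ ∣ z ∣ ℕ.* K → ↧ₙ x ≤ ∣ ↥ x ∣ ℕ.* K
≥-cleared d@(suc _) {mkℚᵘ a e} {z} K _ h l = *-cancelˡ-≤ d (begin
  d ℕ.* suc e ≤⟨ *-monoˡ-≤ (suc e) l ⟩
  ∣ z ∣ ℕ.* K ℕ.* suc e ≡⟨ solve 3 (λ z K e → z :* K :* e := z :* e :* K) P.refl ∣ z ∣ K (suc e) ⟩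
  ∣ z ∣ ℕ.* suc e ℕ.* K ≡⟨ cong (ℕ._* K) (P.sym (cleared-abs d {mkℚᵘ a e} {z} h)) ⟩
  d ℕ.* ∣ a ∣ ℕ.* K ≡⟨ ℕₚ.*-assoc d ∣ a ∣ K ⟩
  d ℕ.* (∣ a ∣ ℕ.* K) ∎)
  where
  open +-*-Solver
  open ℕₚ.≤-Reasoning

Ev-from : ∀ {x : Seqℚ} {n} N₀ → (∀ N → N₀ ≤ N → AbsLe (x N) 1 n) → Ev x n
Ev-from {x} {n} N₀ h = ev λ M → N₀ , λ N l → absLe (≤-trans (≤-trans (*-monoˡ-≤ (suc M) (≤-trans (≤-reflexive (P.sym (ℕₚ.*-identityʳ (∣ ↥ (x N) ∣)))) (le (h N l)))) (≤-reflexive (solve 3 (λ n d k → n :* d :* k := n :* k :* d) P.refl n (↧ₙ (x N)) (suc M))))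
  (*-monoˡ-≤ (↧ₙ (x N)) (m≤m+n (n ℕ.* suc M) 1)))
  where open +-*-Solver

Ev-divide : ∀ {x y : Seqℚ} K N₀ → (∀ N → N₀ ≤ N → ↧ₙ (x N) ≤ ∣ ↥ (x N) ∣ ℕ.* suc K) → Ev (λ N → x N Q.* y N) 0 → Ev y 0
Ev-divide {x} {y} K N₀ far h = ev λ M → let M′ = M ℕ.+ K ℕ.* suc M in N₀ ℕ.+ proj₁ (tail h M′) , λ N l →
  go (x N) (y N) M (far N (≤-trans (m≤m+n N₀ _) l)) (proj₂ (tail h M′) N (≤-trans (m≤n+m _ N₀) l))
  where
  go : ∀ x y M → ↧ₙ x ≤ ∣ ↥ x ∣ ℕ.* suc K → AbsLe (x Q.* y) (suc (M ℕ.+ K ℕ.* suc M)) 1 → AbsLe y (suc M) 1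
  go (mkℚᵘ a d) (mkℚᵘ a′ d′) M l (absLe h) = absLe (*-cancelˡ-≤ (∣ a ∣ ℕ.* suc K) {{ℕ.>-nonZero (≤-trans (s≤s z≤n) l)}} (begin
    ∣ a ∣ ℕ.* suc K ℕ.* (∣ a′ ∣ ℕ.* suc M) ≡⟨ solve 4 (λ a K a′ M → a :* K :* (a′ :* M) := a :* a′ :* (K :* M)) P.refl (∣ a ∣) (suc K) (∣ a′ ∣) (suc M) ⟩
    ∣ a ∣ ℕ.* ∣ a′ ∣ ℕ.* (suc K ℕ.* suc M) ≡⟨ cong (ℕ._* (suc K ℕ.* suc M)) (P.sym (abs-* a a′)) ⟩
    ∣ a ℤ.* a′ ∣ ℕ.* (suc K ℕ.* suc M) ≤⟨ h ⟩
    1 ℕ.* (suc d ℕ.* suc d′) ≡⟨ ℕₚ.*-identityˡ _ ⟩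
    suc d ℕ.* suc d′ ≤⟨ *-monoˡ-≤ (suc d′) l ⟩
    ∣ a ∣ ℕ.* suc K ℕ.* suc d′ ≡⟨ cong (∣ a ∣ ℕ.* suc K ℕ.*_) (P.sym (ℕₚ.*-identityˡ (suc d′))) ⟩
    ∣ a ∣ ℕ.* suc K ℕ.* (1 ℕ.* suc d′) ∎))
    where
    open +-*-Solver
    open ℕₚ.≤-Reasoning

module Clear (A : ℤ-Algebra) where
  open ℤ-Algebra A
  open Solver A using (solve; _:=_; _:+_; _:*_; _:-_; :-_; con)

  ι-sub : ∀ x y → ι (x ℤ.- y) ≈ ι x - ι y
  ι-sub x y = trans (ι-+ x _) (+-congˡ (ι-neg y))

  clear-scaled : ∀ g d {x z} → ι d * x ≈ ι z → ι d * (ι g * x) ≈ ι (g ℤ.* z)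
  clear-scaled g d {x} {z} h = trans (solve 3 (λ d g x → d :* (g :* x) := g :* (d :* x)) refl (ι d) (ι g) x) (trans (*-congˡ h) (sym (ι-* g z)))

  clear-square : ∀ {V θ S} b c → ι V * θ ≈ ι S → ι (V ℤ.* V) * (θ * θ - (ι b * θ + ι c)) ≈ ι (S ℤ.* S ℤ.- (b ℤ.* S ℤ.* V ℤ.+ c ℤ.* (V ℤ.* V)))
  clear-square {V} {θ} {S} b c h = trans (*-congʳ (ι-* V V)) (trans (solve 4 (λ V t b c → V :* V :* (t :* t :- (b :* t :+ c)) := (V :* t) :* (V :* t) :- (b :* (V :* t) :* V :+ c :* (V :* V))) refl (ι V) θ (ι b) (ι c))
    (trans (+-cong (*-cong h h) (-‿cong (+-congʳ (*-congʳ (*-congˡ h)))))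
      (sym (trans (ι-sub _ _) (+-cong (ι-* S S) (-‿cong (trans (ι-+ _ _) (+-cong (trans (ι-* _ V) (*-congʳ (ι-* b S))) (trans (ι-* c _) (*-congˡ (ι-* V V)))))))))))

  clear-difference : ∀ {V θ S q ξ p} u v u′ v′ → ι V * θ ≈ ι S → ι q * ξ ≈ ι p →
    ι (V ℤ.* q) * ((ι u + ι v * θ) - ξ * (ι u′ + ι v′ * θ)) ≈ ι ((u ℤ.* V ℤ.+ v ℤ.* S) ℤ.* q ℤ.- p ℤ.* (u′ ℤ.* V ℤ.+ v′ ℤ.* S))
  clear-difference {V} {θ} {S} {q} {ξ} {p} u v u′ v′ h h′ = trans (*-congʳ (ι-* V q)) (trans
    (solve 8 (λ V q t x u v u′ v′ → V :* q :* ((u :+ v :* t) :- x :* (u′ :+ v′ :* t)) := (u :* V :+ v :* (V :* t)) :* q :- q :* x :* (u′ :* V :+ v′ :* (V :* t))) refl (ι V) (ι q) θ ξ (ι u) (ι v) (ι u′) (ι v′))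
    (trans (+-cong (*-congʳ (+-congˡ (*-congˡ h))) (-‿cong (*-cong h′ (+-congˡ (*-congˡ h)))))
      (sym (trans (ι-sub _ _) (+-cong (trans (ι-* _ q) (*-congʳ (trans (ι-+ _ _) (+-cong (ι-* u V) (ι-* v S))))) (-‿cong (trans (ι-* p _) (*-congˡ (trans (ι-+ _ _) (+-cong (ι-* u′ V) (ι-* v′ S)))))))))))

  clear-linear : ∀ {q ξ p} u v → ι q * ξ ≈ ι p → ι q * (ι u - ξ * ι v) ≈ ι (u ℤ.* q ℤ.- p ℤ.* v)
  clear-linear {q} {ξ} {p} u v h = trans (solve 4 (λ q x u v → q :* (u :- x :* v) := u :* q :- q :* x :* v) refl (ι q) ξ (ι u) (ι v))
    (trans (+-congˡ (-‿cong (*-congʳ h))) (sym (trans (ι-sub _ _) (+-cong (ι-* u q) (-‿cong (ι-* p v))))))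

  clear-quadratic : ∀ {q ξ p} c b a → ι q * ξ ≈ ι p → ι (q ℤ.* q) * (ι c + ξ * (ι b + ξ * (ι a + ξ * 0#))) ≈ ι (c ℤ.* (q ℤ.* q) ℤ.+ b ℤ.* (p ℤ.* q) ℤ.+ a ℤ.* (p ℤ.* p))
  clear-quadratic {q} {ξ} {p} c b a h = trans (*-cong (ι-* q q) (+-congˡ (*-congˡ (+-congˡ (*-congˡ (trans (+-congˡ (zeroʳ ξ)) (+-identityʳ _)))))))
    (trans (solve 5 (λ q x c b a → q :* q :* (c :+ x :* (b :+ x :* a)) := c :* (q :* q) :+ b :* (q :* x :* q) :+ a :* (q :* x :* (q :* x))) refl (ι q) ξ (ι c) (ι b) (ι a))
    (trans (+-cong (+-congˡ (*-congˡ (*-congʳ h))) (*-congˡ (*-cong h h)))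
      (sym (trans (ι-+ _ _) (+-cong (trans (ι-+ _ _) (+-cong (trans (ι-* c _) (*-congˡ (ι-* q q))) (trans (ι-* b _) (*-congˡ (ι-* p q))))) (trans (ι-* a _) (*-congˡ (ι-* p p))))))))

open Clear ℚ-alg public

det-∙ : ∀ M v w → det (M ∙ v) (M ∙ w) ≡ det (proj₁ M) (proj₂ M) ℤ.* det v w
det-∙ ((t , s) , (t′ , s′)) (X , Y) (X′ , Y′) = P.trans (cong₂ (λ a b → a ℤ.- b) (cong₂ ℤ._*_ (cast t X t′ Y) (cast s X′ s′ Y′)) (cong₂ ℤ._*_ (cast t X′ t′ Y′) (cast s X s′ Y)))
  (S.solve 8 (λ t s t′ s′ X Y X′ Y′ → (t S.:* X S.:+ t′ S.:* Y) S.:* (s S.:* X′ S.:+ s′ S.:* Y′) S.:- (t S.:* X′ S.:+ t′ S.:* Y′) S.:* (s S.:* X S.:+ s′ S.:* Y)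
    S.:= (t S.:* s′ S.:- t′ S.:* s) S.:* (X S.:* Y′ S.:- X′ S.:* Y)) P.refl (+ t) (+ s) (+ t′) (+ s′) (+ X) (+ Y) (+ X′) (+ Y′))

-- θ = s β for the attracting fixed point β of a positive unimodular matrix, as the limit of the images of ∞.
module FixedPoint (t s t′ s′ : ℕ) (l₁ : Large 1 (t , s)) (l₂ : Large 1 (t′ , s′)) (unimodular : ∣ det (t , s) (t′ , s′) ∣ ≡ 1) where
  W : Mat
  W = (t , s) , (t′ , s′)

  images : ℕ → Vec²
  images N = iterate (suc N) (W ∙_) e₁

  W-size : ∀ v → Large (size v) (W ∙ v)
  W-size v = subst (λ n → Large n (W ∙ v)) (ℕₚ.*-identityˡ (size v)) (∙-size {1} {W} l₁ l₂ v)

  images-large : ∀ N → Large (suc N) (images N)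
  images-large zero = W-size e₁
  images-large (suc N) = ≤-trans grows (proj₁ (W-size (images N))) , ≤-trans grows (proj₂ (W-size (images N)))
    where
    grows : suc (suc N) ≤ size (images N)
    grows = +-mono-≤ {1} (≤-trans (s≤s z≤n) (proj₁ (images-large N))) (proj₂ (images-large N))

  images-det : ∀ N → ∣ det (images N) (W ∙ images N) ∣ ≡ s
  images-det N = P.trans (go (suc N)) (cong ∣_∣ (P.trans (S.solve 2 (λ x y → S.con 1ℤ S.:* y S.:- x S.:* S.con 0ℤ S.:= y) P.refl (+ (t ℕ.* 1 ℕ.+ t′ ℕ.* 0)) (+ (s ℕ.* 1 ℕ.+ s′ ℕ.* 0)))
      (cong +_ (solve 2 (λ s s′ → s :* con 1 :+ s′ :* con 0 := s) P.refl s s′))))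
    where
    open +-*-Solver
    go : ∀ N → ∣ det (iterate N (W ∙_) e₁) (W ∙ iterate N (W ∙_) e₁) ∣ ≡ ∣ det e₁ (W ∙ e₁) ∣
    go zero = P.refl
    go (suc N) = P.trans (cong ∣_∣ (det-∙ W v (W ∙ v))) (P.trans (abs-* (det (t , s) (t′ , s′)) (det v (W ∙ v))) (P.trans (cong (ℕ._* ∣ det v (W ∙ v) ∣) unimodular) (P.trans (ℕₚ.*-identityˡ _) (go N))))
      where v = iterate N (W ∙_) e₁

  θ-seq : Seqℚ
  θ-seq N = mkℚᵘ (+ (s ℕ.* proj₁ (images N))) (pred (proj₂ (images N)))

  V≥1 : ∀ N → 1 ≤ proj₂ (images N)
  V≥1 N = ≤-trans (s≤s z≤n) (proj₂ (images-large N))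

  θ-fraction : ∀ N → mkℚᵘ (+ proj₂ (images N)) 0 Q.* θ-seq N ≃ mkℚᵘ (+ (s ℕ.* proj₁ (images N))) 0
  θ-fraction N = fraction (+ (s ℕ.* proj₁ (images N))) (proj₂ (images N)) (V≥1 N)

  θ-bound : ℕ
  θ-bound = s ℕ.* (t ℕ.+ t′)

  θ-bounded : Ev θ-seq θ-bound
  θ-bounded = Ev-from 0 (λ N _ → AbsLe-cleared (proj₂ (images N)) (V≥1 N) (θ-fraction N) (≤-trans (≤-reflexive (ℕₚ.*-identityʳ _)) (≤-trans (*-monoʳ-≤ s (go (iterate N (W ∙_) e₁))) (≤-reflexive (P.sym (ℕₚ.*-assoc s _ _))))))
    where
    go : ∀ v → proj₁ (W ∙ v) ≤ (t ℕ.+ t′) ℕ.* proj₂ (W ∙ v)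
    go v@(X , Y) = ≤-trans (+-mono-≤ (*-monoʳ-≤ t (m≤m+n X Y)) (*-monoʳ-≤ t′ (m≤n+m Y X))) (≤-trans (≤-reflexive (P.sym (ℕₚ.*-distribʳ-+ (X ℕ.+ Y) t t′))) (*-monoʳ-≤ (t ℕ.+ t′) (proj₂ (W-size v))))

  θ : ℝ
  θ = real θ-seq (θ-bound , θ-bounded)

  b c : ℤ
  b = + t ℤ.- + s′
  c = + s ℤ.* + t′

  θ² : (θ *ʳ θ) ≈ʳ ((ιʳ b *ʳ θ) +ʳ ιʳ c)
  θ² = null (ev λ M → s ℕ.* s ℕ.* suc M , λ N l → AbsLe-cleared (proj₂ (images N) ℕ.* proj₂ (images N)) (*-mono-≤ (V≥1 N) (V≥1 N)) (form N)
      (≤-trans (≤-reflexive (cong (ℕ._* suc M) (residue (images N) (images-det N))))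
        (≤-trans l (≤-trans (n≤1+n N) (≤-trans (proj₂ (images-large N)) (≤-trans (m≤m*n (proj₂ (images N)) (proj₂ (images N)) {{ℕ.>-nonZero (V≥1 N)}}) (≤-reflexive (P.sym (ℕₚ.*-identityˡ _)))))))))
    where
    poly : Vec² → ℤ
    poly (U , V) = + (s ℕ.* U) ℤ.* + (s ℕ.* U) ℤ.- (b ℤ.* + (s ℕ.* U) ℤ.* + V ℤ.+ c ℤ.* (+ V ℤ.* + V))
    residue : ∀ v → ∣ det v (W ∙ v) ∣ ≡ s → ∣ poly v ∣ ≡ s ℕ.* s
    residue v@(U , V) h = P.trans (cong ∣_∣ eq) (P.trans (abs-* (+ s) (det v (W ∙ v))) (cong (s ℕ.*_) h))
      where
      eq : poly v ≡ + s ℤ.* det v (W ∙ v)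
      eq = P.trans (cong (λ x → x ℤ.* x ℤ.- (b ℤ.* x ℤ.* + V ℤ.+ c ℤ.* (+ V ℤ.* + V))) (pos-* s U))
        (P.trans (S.solve 6 (λ t s t′ s′ U V → (s S.:* U) S.:* (s S.:* U) S.:- ((t S.:- s′) S.:* (s S.:* U) S.:* V S.:+ s S.:* t′ S.:* (V S.:* V)) S.:= s S.:* (U S.:* (s S.:* U S.:+ s′ S.:* V) S.:- (t S.:* U S.:+ t′ S.:* V) S.:* V)) P.refl (+ t) (+ s) (+ t′) (+ s′) (+ U) (+ V))
          (cong₂ (λ x y → + s ℤ.* (+ U ℤ.* x ℤ.- y ℤ.* + V)) (P.sym (cast s U s′ V)) (P.sym (cast t U t′ V))))
    form : ∀ N → mkℚᵘ (+ (proj₂ (images N) ℕ.* proj₂ (images N))) 0 Q.* (seq (θ *ʳ θ) N Q.- seq ((ιʳ b *ʳ θ) +ʳ ιʳ c) N) ≃ mkℚᵘ (poly (images N)) 0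
    form N = subst (λ d → mkℚᵘ d 0 Q.* (θ-seq N Q.* θ-seq N Q.- (mkℚᵘ b 0 Q.* θ-seq N Q.+ mkℚᵘ c 0)) ≃ mkℚᵘ (poly (images N)) 0) (P.sym (pos-* (proj₂ (images N)) (proj₂ (images N))))
      (clear-square {+ proj₂ (images N)} {θ-seq N} b c (θ-fraction N))

module Limit (a : Seq) (a≥1 : ∀ m → 1 ≤ a m) where
  open Word a
  open Positive a≥1

  tail-vector : ℕ → Vec²
  tail-vector N = act 0 (suc N) e₁

  ξ-fraction : ∀ N → mkℚᵘ (+ proj₂ (tail-vector N)) 0 Q.* convergent a N ≃ mkℚᵘ (+ proj₁ (tail-vector N)) 0
  ξ-fraction N = subst (λ v → mkℚᵘ (+ proj₂ v) 0 Q.* convergent a N ≃ mkℚᵘ (+ proj₁ v) 0) (P.sym (cong proj₁ (mat-pq N)))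
    (fraction (+ Defs.p a N) (Defs.q a N) (subst (1 ≤_) (Q-q N) (Q≥1 N)))

  ξ-bounded : Ev (convergent a) (suc (a 0))
  ξ-bounded = Ev-from 0 (λ N _ → AbsLe-cleared (proj₂ (tail-vector N)) (Q≥1 N) (ξ-fraction N) (≤-trans (≤-reflexive (ℕₚ.*-identityʳ _)) (go N)))
    where
    descending : ∀ N → proj₂ (act 1 N e₁) ≤ proj₁ (act 1 N e₁)
    descending zero = z≤n
    descending (suc N) = act-descending 1 N e₁
    go : ∀ N → proj₁ (tail-vector N) ≤ suc (a 0) ℕ.* proj₂ (tail-vector N)
    go N = ≤-trans (+-monoʳ-≤ (a 0 ℕ.* proj₁ (act 1 N e₁)) (descending N)) (≤-reflexive (ℕₚ.+-comm _ (proj₁ (act 1 N e₁))))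

  ξ : ℝ
  ξ = real (convergent a) (suc (a 0) , ξ-bounded)

AbsLe-cleared₂ : ∀ d e {x z k b} → 1 ≤ d → 1 ≤ e → mkℚᵘ (+ d ℤ.* + e) 0 Q.* x ≃ mkℚᵘ z 0 → ∣ z ∣ ℕ.* k ≤ b ℕ.* (d ℕ.* e) → AbsLe x k b
AbsLe-cleared₂ d e {x} {z} l l′ h = AbsLe-cleared (d ℕ.* e) {x} {z} (*-mono-≤ l l′) (subst (λ i → mkℚᵘ i 0 Q.* x ≃ mkℚᵘ z 0) (P.sym (pos-* d e)) h)

size-arith : ∀ A B s u w D V q → A ≤ q → B ℕ.* u ≤ V → B ℕ.* w ≤ D → A ℕ.* (B ℕ.* B) ℕ.* (s ℕ.* (u ℕ.* w)) ≤ s ℕ.* (V ℕ.* (q ℕ.* D))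
size-arith A B s u w D V q h₁ h₂ h₃ = ≤-trans (≤-reflexive (solve 5 (λ A B s u w → A :* (B :* B) :* (s :* (u :* w)) := s :* ((B :* u) :* (A :* (B :* w)))) P.refl A B s u w))
  (*-monoʳ-≤ s (*-mono-≤ h₂ (*-mono-≤ h₁ h₃)))
  where open +-*-Solver

module Block (a : Seq) (a≥1 : ∀ m → 1 ≤ a m) where
  open Word a
  open Positive a≥1
  open Limit a a≥1

  Periodic : ℕ → ℕ → ℕ → Set
  Periodic n E R = ∀ m → n ≤ m → m ℕ.+ R < E → a (m ℕ.+ R) ≡ a m

  act-power : ∀ {n E R} → Periodic n E R → ∀ k v → n ℕ.+ k ℕ.* R ≤ E → act n (k ℕ.* R) v ≡ iterate k (mat n R ∙_) v
  act-power per zero v l = P.refl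
  act-power {n} {E} {R} per (suc k) v l = P.trans (act-+ n R (k ℕ.* R) v) (P.trans (act-linear n R _) (cong (mat n R ∙_)
    (P.trans (act-cong (n ℕ.+ R) n (k ℕ.* R) v letters) (act-power per k v (≤-trans (+-monoʳ-≤ n (m≤n+m (k ℕ.* R) R)) l)))))
    where
    open +-*-Solver
    letters : ∀ i → i < k ℕ.* R → a (n ℕ.+ R ℕ.+ i) ≡ a (n ℕ.+ i)
    letters i i< = P.trans (cong a (solve 3 (λ n R i → n :+ R :+ i := n :+ i :+ R) P.refl n R i)) (per (n ℕ.+ i) (m≤m+n n i)
      (≤-trans (≤-trans (≤-reflexive (solve 3 (λ n R i → con 1 :+ (n :+ i :+ R) := n :+ (R :+ (con 1 :+ i))) P.refl n R i)) (+-monoʳ-≤ n (+-monoʳ-≤ R i<))) l))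

  large₁ : ∀ n R → 2 ≤ R → Large 1 (act n R e₁)
  large₁ n R l = grow 0 n R e₁ (s≤s z≤n) l

  large₂ : ∀ n R → 2 ≤ R → Large 1 (act n R e₂)
  large₂ n R l = grow 0 n R e₂ (s≤s z≤n) l

  trace-≥ : ∀ n R → 3 ≤ R → 3 ≤ proj₁ (act n R e₁) ℕ.+ proj₂ (act n R e₂)
  trace-≥ n (suc R) (s≤s l) = +-mono-≤ {2} (≤-trans (+-mono-≤ (proj₁ w) (proj₂ w)) (step-size (a n) (act (suc n) R e₁) (a≥1 n))) (proj₂ (large₂ n (suc R) (≤-trans l (n≤1+n R))))
    where w = large₁ (suc n) R l

  module Conjugate (t s t′ s′ : ℕ) (l₁ : Large 1 (t , s)) (l₂ : Large 1 (t′ , s′)) (trace : 3 ≤ t ℕ.+ s′) (unimodular : ∣ det (t , s) (t′ , s′) ∣ ≡ 1) where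
    open FixedPoint t s t′ s′ l₁ l₂ unimodular
    anisotropic : ∀ z → Quadratic.nrm b c z ≡ 0ℤ → z ≡ Quadratic.0ᵒ b c
    anisotropic = nrm-anisotropic t t′ s s′ trace unimodular
    open Quadratic b c using (𝕆; _+ᵒ_; _*ᵒ_; negᵒ; ιᵒ; nrm; 𝕆-alg)
    open BoundedAlgebra reals using (_⊑_; _+_; _*_; _-_; ι; _≈_; sym; trans; refl; +-cong; ⊑-≈; ⊑-+; ⊑-*; ⊑-ι; ⊑-mono; ⊑-int; alg; +-congˡ; -‿cong)
    open Bounds reals using (two^)
    𝒪 : NormedOrder
    𝒪 = Quadratic.order b c anisotropic
    open Conjugates reals b c anisotropic θ θ² using (θ₂; θ₂²; norm-product) public
    emb₁ emb₂ : Embedding 𝒪 reals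
    emb₁ = Root.embedding reals b c anisotropic θ θ²
    emb₂ = Root.embedding reals b c anisotropic θ₂ θ₂²
    ε₁ ε₂ : 𝕆 → ℝ
    ε₁ = Embedding.ε emb₁
    ε₂ = Embedding.ε emb₂

    bound : ℕ
    bound = s ℕ.+ (∣ b ∣ ℕ.+ θ-bound)

    θ₁-⊑ : θ ⊑ ∣ b ∣ ℕ.+ θ-bound
    θ₁-⊑ = ⊑-mono {θ} (m≤n+m θ-bound ∣ b ∣) (below θ-bounded)

    θ₂-⊑ : θ₂ ⊑ ∣ b ∣ ℕ.+ θ-bound
    θ₂-⊑ = below (Ev-+ {λ _ → mkℚᵘ b 0} (Ev-const b) (Ev-neg {θ-seq} θ-bounded))

    module At (n : ℕ) where
      pₙ qₙ pₙ′ qₙ′ : ℕ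
      pₙ = proj₁ (act 0 n e₁)
      qₙ = proj₂ (act 0 n e₁)
      pₙ′ = proj₁ (act 0 n e₂)
      qₙ′ = proj₂ (act 0 n e₂)

      x y : 𝕆
      x = + s ℤ.* + pₙ′ , + pₙ
      y = + s ℤ.* + qₙ′ , + qₙ

      r : ℤ
      r = + s ℤ.* (+ qₙ ℤ.* + pₙ′ ℤ.- + qₙ′ ℤ.* + pₙ)

      ∣r∣ : ∣ r ∣ ≡ s
      ∣r∣ = P.trans (abs-* (+ s) _) (P.trans (cong (s ℕ.*_) (P.trans (cong ∣_∣ (S.solve 4 (λ p q p′ q′ → q S.:* p′ S.:- q′ S.:* p S.:= p′ S.:* q S.:- p S.:* q′) P.refl (+ pₙ) (+ qₙ) (+ pₙ′) (+ qₙ′)))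
        (P.trans (det-swap (act 0 n e₂) (act 0 n e₁)) (det-act 0 n e₁ e₂)))) (ℕₚ.*-identityʳ s))

      r≢0 : r ≢ 0ℤ
      r≢0 e = <⇒≢ (proj₂ l₁) (P.sym (P.trans (P.sym ∣r∣) (cong ∣_∣ e)))

      x-y-unimodular : ιᵒ (+ qₙ) *ᵒ x +ᵒ negᵒ (y *ᵒ ιᵒ (+ pₙ)) ≡ ιᵒ r
      x-y-unimodular = cong₂ _,_
        (S.solve 6 (λ c s p q p′ q′ → q S.:* (s S.:* p′) S.:+ c S.:* (S.con 0ℤ S.:* p) S.:- (s S.:* q′ S.:* p S.:+ c S.:* (q S.:* S.con 0ℤ)) S.:= s S.:* (q S.:* p′ S.:- q′ S.:* p)) P.refl c (+ s) (+ pₙ) (+ qₙ) (+ pₙ′) (+ qₙ′))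
        (S.solve 6 (λ b s p q p′ q′ → q S.:* p S.:+ S.con 0ℤ S.:* (s S.:* p′) S.:+ b S.:* (S.con 0ℤ S.:* p) S.:- (s S.:* q′ S.:* S.con 0ℤ S.:+ q S.:* p S.:+ b S.:* (q S.:* S.con 0ℤ)) S.:= S.con 0ℤ) P.refl b (+ s) (+ pₙ) (+ qₙ) (+ pₙ′) (+ qₙ′))

      form : ℤ
      form = det (qₙ , qₙ′) (qₙ ℕ.* t ℕ.+ qₙ′ ℕ.* s , qₙ ℕ.* t′ ℕ.+ qₙ′ ℕ.* s′)

      nrm-y : nrm y ≡ ℤ.- (+ s ℤ.* form)
      nrm-y = P.trans (S.solve 6 (λ t s t′ s′ q q′ → (s S.:* q′) S.:* (s S.:* q′) S.:+ (t S.:- s′) S.:* (s S.:* q′ S.:* q) S.:- s S.:* t′ S.:* (q S.:* q) S.:= S.:- (s S.:* (q S.:* (q S.:* t′ S.:+ q′ S.:* s′) S.:- (q S.:* t S.:+ q′ S.:* s) S.:* q′))) P.refl (+ t) (+ s) (+ t′) (+ s′) (+ qₙ) (+ qₙ′))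
        (cong₂ (λ u v → ℤ.- (+ s ℤ.* (+ qₙ ℤ.* u ℤ.- v ℤ.* + qₙ′))) (P.sym (cast qₙ t′ qₙ′ s′)) (P.sym (cast qₙ t qₙ′ s)))

      ∣nrm-y∣-≥ : ∣ form ∣ ≤ ∣ nrm y ∣
      ∣nrm-y∣-≥ = ≤-trans (m≤n*m ∣ form ∣ s {{ℕ.>-nonZero (proj₂ l₁)}}) (≤-reflexive (P.sym (P.trans (cong ∣_∣ nrm-y) (P.trans (∣-i∣≡∣i∣ (+ s ℤ.* form)) (abs-* (+ s) form)))))

      -- |p q_N - p_N q| and |p′ q_N - p_N q′| are the coordinates of the tail vector.
      linear-⊑ : ∀ ℓ v → 2 ^ ℓ ≤ qₙ → size v ≡ 1 → (∀ w → proj₂ w ≤ proj₁ w → ∣ det v w ∣ ≤ proj₁ w) →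
        two^ ℓ * (ι (+ proj₁ (act 0 n v)) - ξ * ι (+ proj₂ (act 0 n v))) ⊑ 1
      linear-⊑ ℓ v h₁ h₂ h₃ = below (Ev-from n (λ N l → go N (N ∸ n) (P.trans (cong suc (P.sym (m+[n∸m]≡n l))) (P.sym (+-suc n (N ∸ n))))))
        where
        u = act 0 n v
        go : ∀ N k → suc N ≡ n ℕ.+ suc k → AbsLe (mkℚᵘ (+ (2 ^ ℓ)) 0 Q.* (mkℚᵘ (+ proj₁ u) 0 Q.- convergent a N Q.* mkℚᵘ (+ proj₂ u) 0)) 1 1
        go N k e = AbsLe-cleared (proj₂ (tail-vector N)) {z = + (2 ^ ℓ) ℤ.* det u (tail-vector N)} (Q≥1 N)
            (clear-scaled (+ (2 ^ ℓ)) (+ proj₂ (tail-vector N)) {x = mkℚᵘ (+ proj₁ u) 0 Q.- convergent a N Q.* mkℚᵘ (+ proj₂ u) 0} (clear-linear {+ proj₂ (tail-vector N)} {convergent a N} (+ proj₁ u) (+ proj₂ u) (ξ-fraction N)))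
            (≤-trans (≤-reflexive (P.trans (ℕₚ.*-identityʳ _) (abs-* (+ (2 ^ ℓ)) (det u (tail-vector N))))) (≤-trans (*-mono-≤ h₁ (≤-trans (≤-reflexive (P.trans (cong (λ w → ∣ det u w ∣) tail≡) (det-act 0 n v w))) (h₃ w (act-descending n k e₁)))) (≤-trans (m≤m+n (qₙ ℕ.* proj₁ w) (qₙ′ ℕ.* proj₂ w))
              (≤-reflexive (P.trans (cong proj₂ (P.sym (P.trans tail≡ (act-linear 0 n w)))) (P.sym (ℕₚ.*-identityˡ _)))))))
          where
          w = act n (suc k) e₁
          tail≡ : tail-vector N ≡ act 0 n w
          tail≡ = P.trans (cong (λ k → act 0 k e₁) e) (act-+ 0 n (suc k) e₁)

      -- ε₂ x - ξ ε₂ y = s (p′ - ξ q′) + θ₂ (p - ξ q), which needs no closeness of θ₂ to ξ.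
      close₂ : ∀ ℓ → 2 ^ ℓ ≤ qₙ → two^ ℓ * (ε₂ x - ξ * ε₂ y) ⊑ bound
      close₂ ℓ h = ⊑-≈ {(ι (+ s) * A′) + (θ₂ * A)} {two^ ℓ * (ε₂ x - ξ * ε₂ y)} split (⊑-mono {(ι (+ s) * A′) + (θ₂ * A)} (≤-reflexive (cong₂ ℕ._+_ (ℕₚ.*-identityʳ s) (ℕₚ.*-identityʳ _)))
          (⊑-+ {ι (+ s) * A′} {θ₂ * A} (⊑-* {ι (+ s)} {A′} (⊑-ι (+ s)) (linear-⊑ ℓ e₂ h P.refl coord₂)) (⊑-* {θ₂} {A} θ₂-⊑ (linear-⊑ ℓ e₁ h P.refl coord₁))))
        where
        module SA = Solver alg
        A A′ : ℝ
        A = two^ ℓ * (ι (+ pₙ) - ξ * ι (+ qₙ))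
        A′ = two^ ℓ * (ι (+ pₙ′) - ξ * ι (+ qₙ′))
        coord₁ : ∀ w → proj₂ w ≤ proj₁ w → ∣ det e₁ w ∣ ≤ proj₁ w
        coord₁ (X , Y) l = ≤-trans (≤-reflexive (cong ∣_∣ (S.solve 2 (λ X Y → S.con 1ℤ S.:* Y S.:- X S.:* S.con 0ℤ S.:= Y) P.refl (+ X) (+ Y)))) l
        coord₂ : ∀ w → proj₂ w ≤ proj₁ w → ∣ det e₂ w ∣ ≤ proj₁ w
        coord₂ (X , Y) l = ≤-reflexive (P.trans (cong ∣_∣ (S.solve 2 (λ X Y → S.con 0ℤ S.:* Y S.:- X S.:* S.con 1ℤ S.:= S.:- X) P.refl (+ X) (+ Y))) (∣-i∣≡∣i∣ (+ X)))
        split : (ι (+ s) * A′) + (θ₂ * A) ≈ two^ ℓ * (ε₂ x - ξ * ε₂ y)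
        split = Identity.split-combination alg (two^ ℓ) ξ θ₂ (+ s) (+ pₙ) (+ qₙ) (+ pₙ′) (+ qₙ′)

      y-⊑ : ∀ (η : ℝ) → η ⊑ ∣ b ∣ ℕ.+ θ-bound → qₙ′ ≤ qₙ → (ι (+ s ℤ.* + qₙ′) + (ι (+ qₙ) * η)) ⊑ qₙ ℕ.* bound
      y-⊑ η h l = ⊑-mono {ι (+ s ℤ.* + qₙ′) + (ι (+ qₙ) * η)} (≤-trans (+-monoˡ-≤ _ (≤-trans (≤-reflexive (P.trans (abs-* (+ s) (+ qₙ′)) (ℕₚ.*-comm s qₙ′))) (*-monoˡ-≤ s l))) (≤-reflexive (P.sym (ℕₚ.*-distribˡ-+ qₙ s _))))
        (⊑-+ {ι (+ s ℤ.* + qₙ′)} {ι (+ qₙ) * η} (⊑-ι (+ s ℤ.* + qₙ′)) (⊑-* {ι (+ qₙ)} {η} (⊑-ι (+ qₙ)) h))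

      -- The words of ξ and of the fixed point agree on the first n + Λ R letters.
      close₁ : ∀ {E R Λ} → Periodic n E R → mat n R ≡ W → n ℕ.+ Λ ℕ.* R ≤ E → ∀ ℓ g → 2 ^ ℓ ≤ qₙ → suc (suc (g ℕ.+ g)) ≤ Λ ℕ.* R →
        two^ (ℓ ℕ.+ (g ℕ.+ g)) * (ε₁ x - ξ * ε₁ y) ⊑ s
      close₁ {E} {R} {Λ} per W≡ end ℓ g hq hg = below (Ev-from (Λ ℕ.+ (n ℕ.+ Λ ℕ.* R)) (λ N l →
          go N (suc N ∸ Λ) (suc N ∸ (n ℕ.+ Λ ℕ.* R)) (P.sym (m+[n∸m]≡n (≤-trans (m≤m+n Λ _) (≤-trans l (n≤1+n N))))) (P.sym (m+[n∸m]≡n (≤-trans (m≤n+m _ Λ) (≤-trans l (n≤1+n N)))))))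
        where
        K = Λ ℕ.* R
        G = ℓ ℕ.+ (g ℕ.+ g)
        power : ∀ v → act n K v ≡ iterate Λ (W ∙_) v
        power v = P.trans (act-power per Λ v end) (cong (λ M → iterate Λ (M ∙_) v) W≡)
        enlarge : ∀ v → Large (2 ^ g ℕ.* size v) (act n K v)
        enlarge v = subst (Large _) (P.sym (act-linear n K v)) (∙-size {2 ^ g} {mat n K} (grow g n K e₁ (s≤s z≤n) hg) (grow g n K e₂ (s≤s z≤n) hg) v)
        go : ∀ N j k → suc N ≡ Λ ℕ.+ j → suc N ≡ n ℕ.+ K ℕ.+ k → AbsLe (mkℚᵘ (+ (2 ^ G)) 0 Q.* ((mkℚᵘ (+ s ℤ.* + pₙ′) 0 Q.+ mkℚᵘ (+ pₙ) 0 Q.* θ-seq N) Q.- convergent a N Q.* (mkℚᵘ (+ s ℤ.* + qₙ′) 0 Q.+ mkℚᵘ (+ qₙ) 0 Q.* θ-seq N))) 1 s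
        go N j k eΛ eK = AbsLe-cleared₂ V D {z = + (2 ^ G) ℤ.* num} (V≥1 N) (Q≥1 N)
            (clear-scaled (+ (2 ^ G)) (+ V ℤ.* + D) {x = (mkℚᵘ (+ s ℤ.* + pₙ′) 0 Q.+ mkℚᵘ (+ pₙ) 0 Q.* θ-seq N) Q.- convergent a N Q.* (mkℚᵘ (+ s ℤ.* + qₙ′) 0 Q.+ mkℚᵘ (+ qₙ) 0 Q.* θ-seq N)}
              (clear-difference {+ V} {θ-seq N} {+ (s ℕ.* U)} {+ D} {convergent a N} {+ proj₁ (tail-vector N)} (+ s ℤ.* + pₙ′) (+ pₙ) (+ s ℤ.* + qₙ′) (+ qₙ) (θ-fraction N) (ξ-fraction N)))
            (≤-trans (≤-reflexive (P.trans (ℕₚ.*-identityʳ _) (P.trans (abs-* (+ (2 ^ G)) num) (cong (2 ^ G ℕ.*_) (P.trans (cong ∣_∣ num≡) (P.trans (abs-* (+ s) _) (cong (s ℕ.*_) det≡)))))))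
              (≤-trans (*-monoʳ-≤ (2 ^ G) (*-monoʳ-≤ s (det-≤ u w)))
              (≤-trans (≤-reflexive (cong (ℕ._* (s ℕ.* (size u ℕ.* size w))) (P.trans (^-distribˡ-+-* 2 ℓ (g ℕ.+ g)) (cong (2 ^ ℓ ℕ.*_) (^-distribˡ-+-* 2 g g)))))
              (≤-trans (size-arith (2 ^ ℓ) (2 ^ g) s (size u) (size w) (proj₁ z) V qₙ hq (subst (λ v → 2 ^ g ℕ.* size u ≤ proj₂ v) (P.sym images≡) (proj₂ (enlarge u))) (proj₁ (enlarge w)))
                (*-monoʳ-≤ s (*-monoʳ-≤ V (≤-trans (m≤m+n (qₙ ℕ.* proj₁ z) (qₙ′ ℕ.* proj₂ z)) (≤-reflexive (cong proj₂ (P.sym (P.trans tail≡ (act-linear 0 n z)))))))))) ))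
          where
          u = iterate j (W ∙_) e₁
          w = act (n ℕ.+ K) k e₁
          z = act n K w
          U = proj₁ (images N)
          V = proj₂ (images N)
          D = proj₂ (tail-vector N)
          images≡ : images N ≡ act n K u
          images≡ = P.trans (cong (λ k → iterate k (W ∙_) e₁) eΛ) (P.trans (iterate-+ (W ∙_) Λ j e₁) (P.sym (power u)))
          tail≡ : tail-vector N ≡ act 0 n z
          tail≡ = P.trans (cong (λ k → act 0 k e₁) (P.trans eK (ℕₚ.+-assoc n K k))) (P.trans (act-+ 0 n (K ℕ.+ k) e₁) (cong (act 0 n) (act-+ n K k e₁)))
          num : ℤ
          num = ((+ s ℤ.* + pₙ′) ℤ.* + V ℤ.+ + pₙ ℤ.* + (s ℕ.* U)) ℤ.* + D ℤ.- + proj₁ (tail-vector N) ℤ.* ((+ s ℤ.* + qₙ′) ℤ.* + V ℤ.+ + qₙ ℤ.* + (s ℕ.* U))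
          row : ∀ p p′ → (+ s ℤ.* + p′) ℤ.* + V ℤ.+ + p ℤ.* + (s ℕ.* U) ≡ + s ℤ.* + (p ℕ.* U ℕ.+ p′ ℕ.* V)
          row p p′ = P.trans (cong (λ S → (+ s ℤ.* + p′) ℤ.* + V ℤ.+ + p ℤ.* S) (pos-* s U)) (P.trans (S.solve 5 (λ s p p′ U V → (s S.:* p′) S.:* V S.:+ p S.:* (s S.:* U) S.:= s S.:* (p S.:* U S.:+ p′ S.:* V)) P.refl (+ s) (+ p) (+ p′) (+ U) (+ V)) (cong (+ s ℤ.*_) (P.sym (cast p U p′ V))))
          num≡ : num ≡ + s ℤ.* det (mat 0 n ∙ images N) (tail-vector N)
          num≡ = P.trans (cong₂ (λ A B → A ℤ.* + D ℤ.- + proj₁ (tail-vector N) ℤ.* B) (row pₙ pₙ′) (row qₙ qₙ′)) (S.solve 5 (λ s A B D X → s S.:* A S.:* D S.:- X S.:* (s S.:* B) S.:= s S.:* (A S.:* D S.:- X S.:* B)) P.refl (+ s) (+ (pₙ ℕ.* U ℕ.+ pₙ′ ℕ.* V)) (+ (qₙ ℕ.* U ℕ.+ qₙ′ ℕ.* V)) (+ D) (+ proj₁ (tail-vector N)))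
          det≡ : ∣ det (mat 0 n ∙ images N) (tail-vector N) ∣ ≡ ∣ det u w ∣
          det≡ = P.trans (cong₂ (λ v v′ → ∣ det v v′ ∣) (P.trans (P.sym (act-linear 0 n (images N))) (cong (act 0 n) images≡)) tail≡) (P.trans (det-act 0 n (act n K u) z) (det-act n K u w))

module SmallForm (𝔸 : BoundedAlgebra) (𝒪 : NormedOrder) (emb₁ emb₂ : Embedding 𝒪 𝔸)
  (norm-product : ∀ z → BoundedAlgebra._≈_ 𝔸 (BoundedAlgebra._*_ 𝔸 (Embedding.ε emb₁ z) (Embedding.ε emb₂ z)) (BoundedAlgebra.ι 𝔸 (NormedOrder.nrm 𝒪 z)))
  (P : List ℤ) (D : ℕ) (len : length P ≡ suc D) (h : ℕ) (norm-≤ : norm (monomials 0 P) ≤ 2 ^ h)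
  (ξ : BoundedAlgebra.Carrier 𝔸) (χ : ℕ) (ξ⊑ : BoundedAlgebra._⊑_ 𝔸 ξ (2 ^ χ)) (root : BoundedAlgebra._≈_ 𝔸 (Horner.eval (BoundedAlgebra.alg 𝔸) P ξ) (BoundedAlgebra.0# 𝔸)) where
  open BoundedAlgebra 𝔸
  open Bounds 𝔸
  open Pairing alg using (⟨_,_⟩; pair-cong)
  open Taylor alg using (taylorξ)
  open Solver alg using (solve; _:=_; _:+_; _:*_; _:-_; :-_; con)
  private
    module O = NormedOrder 𝒪
    module PO = Pairing O.alg
    module E₁ = Embedding emb₁
    module E₂ = Embedding emb₂
    module Dom = Domain 𝒪

  root-form : ∀ I → I ⊑ᵛ (D ∷ []) → dot (1 ∷ []) I < 1 → ⟨ monomials 0 P , taylorξ ξ I ⟩ ≈ 0#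
  root-form (zero ∷ []) _ _ = trans (Horner.monomials-eval alg ξ 0 P (taylorξ ξ (0 ∷ [])) (λ i → *-identityʳ _)) (trans (*-congˡ root) (zeroʳ _))
  root-form (suc i ∷ []) _ (s≤s ())

  module _ (x y : O.Carrier) (κ : ℕ) where
    X : ℕ
    X = h ℕ.+ (3 ℕ.+ χ ℕ.+ (κ ℕ.+ κ)) ℕ.* (D ℕ.+ 0) ℕ.+ (1 ℕ.* D ℕ.+ 0)

    z : O.Carrier
    z = PO.⟨ monomials 0 P , Taylor.taylorᵛ O.alg (x ∷ []) (y ∷ []) (D ∷ []) (0 ∷ []) ⟩

    z≈hom : z O.≈ Horner.hom O.alg P x y
    z≈hom = O.trans (Horner.monomials-hom O.alg D x y 0 P len (Taylor.taylorᵛ O.alg (x ∷ []) (y ∷ []) (D ∷ []) (0 ∷ [])) (λ i → O.*-identityʳ _)) (O.*-identityˡ _)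

    at-place : ∀ (emb : Embedding 𝒪 𝔸) G → let open Embedding emb in two^ G * (ε x - ξ * ε y) ⊑ 2 ^ κ → ε y ⊑ 2 ^ (1 ℕ.+ κ) → two^ G * ε z ⊑ 2 ^ X
    at-place emb G close size = ⊑-≈ (*-congˡ (sym (trans (Embedding.ε-pair emb (monomials 0 P) _) (pair-cong (monomials 0 P) (λ J → Embedding.ε-taylorᵛ emb (x ∷ []) (y ∷ []) (D ∷ []) (0 ∷ []) J)))))
      (place-bound {κ} {χ} {h} {1} {G} ξ ξ⊑ {D ∷ []} {G ∷ []} {1 ∷ []} (solve 3 (λ x y t → x := t :* y :+ (x :- t :* y)) refl (Embedding.ε emb x) (Embedding.ε emb y) ξ ∷ []) ((close , size) ∷ [])
        (monomials 0 P) (monomials-box 0 P (≤-reflexive len)) norm-≤ root-form (0 ∷ []) gains)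
      where
      gains : ∀ I → 1 ≤ dot (1 ∷ []) I → G ≤ gain (G ∷ []) (0 ∷ []) I ℕ.+ dot (1 ∷ []) I
      gains (suc i ∷ []) _ = ≤-trans (≤-trans (m≤m*n G (suc i)) (m≤m+n (G ℕ.* suc i) 0)) (m≤m+n _ (1 ℕ.* suc i ℕ.+ 0))

    hom-vanishes : ∀ G → two^ G * (E₁.ε x - ξ * E₁.ε y) ⊑ 2 ^ κ → two^ 0 * (E₂.ε x - ξ * E₂.ε y) ⊑ 2 ^ κ →
      E₁.ε y ⊑ 2 ^ (1 ℕ.+ κ) → E₂.ε y ⊑ 2 ^ (1 ℕ.+ κ) → X ℕ.+ X < G → Horner.hom O.alg P x y O.≈ O.0#
    hom-vanishes G c₁ c₂ s₁ s₂ lt = Dom.stable _ (λ nz → <⇒≱ lt (≤-trans (m≤m+n G 0)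
      (Descent.small-norm 𝔸 𝒪 emb₁ emb₂ norm-product z G 0 X X (at-place emb₁ G c₁ s₁) (at-place emb₂ 0 c₂ s₂) (λ e → nz (O.trans (O.sym z≈hom) e)))))

product-arith : ∀ q K₁ K₂ X₁ Y₁ X₂ Y₂ → q ≤ K₁ ℕ.* Y₁ → q ≤ K₂ ℕ.* Y₂ → Y₁ ≤ X₁ → Y₂ ≤ X₂ → q ℕ.* q ≤ ((Y₁ ℕ.* X₂) ⊓ (Y₂ ℕ.* X₁)) ℕ.* (K₁ ℕ.* K₂)
product-arith q K₁ K₂ X₁ Y₁ X₂ Y₂ h₁ h₂ l₁ l₂ = ≤-trans (⊓-glb
    (≤-trans (*-mono-≤ h₁ (≤-trans h₂ (*-monoʳ-≤ K₂ l₂))) (≤-reflexive (solve 4 (λ k l x y → (k :* y) :* (l :* x) := y :* x :* (k :* l)) P.refl K₁ K₂ X₂ Y₁)))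
    (≤-trans (*-mono-≤ (≤-trans h₁ (*-monoʳ-≤ K₁ l₁)) h₂) (≤-reflexive (solve 4 (λ k l x y → (k :* x) :* (l :* y) := y :* x :* (k :* l)) P.refl K₁ K₂ X₁ Y₂))))
  (≤-reflexive (P.sym (ℕₚ.*-distribʳ-⊓ (K₁ ℕ.* K₂) (Y₁ ℕ.* X₂) (Y₂ ℕ.* X₁))))
  where open +-*-Solver

module LargePeriod (a : Seq) (a≥1 : ∀ m → 1 ≤ a m) where
  open Word a
  open Positive a≥1
  open Limit a a≥1
  open Block a a≥1

  row-size : ℕ → ℕ
  row-size i = proj₂ (act 0 (suc (suc i)) e₁) ℕ.+ proj₂ (act 0 (suc (suc i)) e₂)

  tail-≤ : ∀ N i j → suc N ≡ i ℕ.+ suc (suc (suc j)) → proj₂ (tail-vector N) ≤ row-size i ℕ.* proj₂ (act (suc i) (suc (suc j)) e₁)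
  tail-≤ N i j e = ≤-trans (≤-reflexive (cong proj₂ (P.trans (cong (λ k → act 0 k e₁) (P.trans e (P.trans (+-suc i _) (cong suc (+-suc i _))))) (P.trans (act-+ 0 (suc (suc i)) (suc j) e₁) (act-linear 0 (suc (suc i)) w)))))
    (≤-trans (+-monoʳ-≤ (x ℕ.* proj₁ w) (*-monoʳ-≤ y (act-descending (suc (suc i)) j e₁))) (≤-reflexive (P.sym (ℕₚ.*-distribʳ-+ (proj₁ w) x y))))
    where
    w = act (suc (suc i)) (suc j) e₁
    x = proj₂ (act 0 (suc (suc i)) e₁)
    y = proj₂ (act 0 (suc (suc i)) e₂)

  block-bound : ℕ → ℕ → ℕ
  block-bound n R = let (t , s) = act n R e₁ ; (t′ , s′) = act n R e₂ in s ℕ.+ (∣ + t ℤ.- + s′ ∣ ℕ.+ s ℕ.* (t ℕ.+ t′))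

  module _ (n R : ℕ) (1≤n : 1 ≤ n) (R≥3 : 3 ≤ R) where
    t s t′ s′ : ℕ
    t = proj₁ (act n R e₁)
    s = proj₂ (act n R e₁)
    t′ = proj₁ (act n R e₂)
    s′ = proj₂ (act n R e₂)
    private
      R≥2 = ≤-trans (n≤1+n 2) R≥3
      l₁ = large₁ n R R≥2
      l₂ = large₂ n R R≥2
      tr≥3 = trace-≥ n R R≥3
      uni : ∣ det (t , s) (t′ , s′) ∣ ≡ 1
      uni = det-act n R e₁ e₂
    open FixedPoint t s t′ s′ l₁ l₂ uni
    open Conjugate t s t′ s′ l₁ l₂ tr≥3 uni
    open At n
    open Quadratic b c using (𝕆; nrm; tr; ιᵒ; 𝕆-alg; 0ᵒ; quadratic-relation; linear-form; nrm-combination)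
    open BoundedAlgebra reals using (⊑-mono)

    vanishing : ∀ f D → length f ≡ suc D → Horner.eval ℝ-alg f ξ ≈ʳ ιʳ 0ℤ → ∀ {E} Λ g κ → Periodic n E R → n ℕ.+ Λ ℕ.* R ≤ E → suc (suc (g ℕ.+ g)) ≤ Λ ℕ.* R →
      Q n ℕ.* block-bound n R ≤ 2 ^ κ →
      (let h = norm (monomials 0 f) ; X = h ℕ.+ (3 ℕ.+ suc (a 0) ℕ.+ (κ ℕ.+ κ)) ℕ.* (D ℕ.+ 0) ℕ.+ (1 ℕ.* D ℕ.+ 0) in X ℕ.+ X < g ℕ.+ g) →
      Horner.hom 𝕆-alg f x y ≡ 0ᵒ
    vanishing f D len root {E} Λ g κ per end hg q-bound lt = SmallForm.hom-vanishes reals 𝒪 emb₁ emb₂ norm-product f D len (norm (monomials 0 f)) (n≤2^n _)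
        ξ (suc (a 0)) (⊑-mono {ξ} (n≤2^n (suc (a 0))) (below ξ-bounded)) root x y κ (g ℕ.+ g)
        (⊑-mono (≤-trans (m≤m+n s _) bound-≤) (close₁ {E} {R} {Λ} per P.refl end 0 g q≥1 hg))
        (⊑-mono bound-≤ (close₂ 0 q≥1))
        (⊑-mono (≤-trans q-bound κ≤) (y-⊑ θ θ₁-⊑ (q′≤q n 1≤n)))
        (⊑-mono (≤-trans q-bound κ≤) (y-⊑ θ₂ θ₂-⊑ (q′≤q n 1≤n))) lt
      where
      q≥1 : 1 ≤ qₙ
      q≥1 = Q-mono {1} {n} 1≤n
      bound-≤ : bound ≤ 2 ^ κ
      bound-≤ = ≤-trans (m≤n*m bound qₙ {{ℕ.>-nonZero q≥1}}) q-bound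
      q′≤q : ∀ n → 1 ≤ n → proj₂ (act 0 n e₂) ≤ proj₂ (act 0 n e₁)
      q′≤q (suc n) _ = ≤-trans (≤-reflexive (cong proj₂ (col₂ 0 n))) (Q-mono-suc n)
      κ≤ : 2 ^ κ ≤ 2 ^ (1 ℕ.+ κ)
      κ≤ = ^-monoʳ-≤ 2 (n≤1+n κ)

    -- x - ξ y vanishes at ξ = p_N / q_N only if the tail of ξ is fixed by W.
    numerator : ∀ z → let (X , Y) = act 0 n z in ∣ nrm (+ Y ℤ.* proj₁ x ℤ.- + X ℤ.* proj₁ y , + Y ℤ.* proj₂ x ℤ.- + X ℤ.* proj₂ y) ∣ ≡ s ℕ.* ∣ det z (W ∙ z) ∣
    numerator z@(X , Y) = P.trans (cong ∣_∣ (P.trans (cong nrm (cong₂ _,_ first second)) (P.trans scaled (cong (ℤ._* (+ s ℤ.* det z (W ∙ z))) ε²)))) (P.trans (cong ∣_∣ (ℤₚ.*-identityˡ (+ s ℤ.* det z (W ∙ z)))) (abs-* (+ s) (det z (W ∙ z))))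
      where
      ε = det (act 0 n e₁) (act 0 n e₂)
      square : ∀ i → ∣ i ∣ ≡ 1 → i ℤ.* i ≡ 1ℤ
      square (+ 1) _ = P.refl
      square ℤ.-[1+ 0 ] _ = P.refl
      ε² : ε ℤ.* ε ≡ 1ℤ
      ε² = square ε (det-act 0 n e₁ e₂)
      A B : ℕ
      A = proj₁ (act 0 n z)
      B = proj₂ (act 0 n z)
      expand : ∀ v → det (act 0 n v) (act 0 n z) ≡ ε ℤ.* det v z
      expand v = P.trans (cong₂ det (act-linear 0 n v) (act-linear 0 n z)) (det-∙ (mat 0 n) v z)
      first : + B ℤ.* proj₁ x ℤ.- + A ℤ.* proj₁ y ≡ + s ℤ.* (ε ℤ.* (ℤ.- + X))
      first = P.trans (S.solve 5 (λ A B s p q → B S.:* (s S.:* p) S.:- A S.:* (s S.:* q) S.:= s S.:* (p S.:* B S.:- A S.:* q)) P.refl (+ A) (+ B) (+ s) (+ pₙ′) (+ qₙ′))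
        (cong (+ s ℤ.*_) (P.trans (expand e₂) (cong (ε ℤ.*_) (S.solve 2 (λ X Y → S.con 0ℤ S.:* Y S.:- X S.:* S.con 1ℤ S.:= S.:- X) P.refl (+ X) (+ Y)))))
      second : + B ℤ.* proj₂ x ℤ.- + A ℤ.* proj₂ y ≡ ε ℤ.* + Y
      second = P.trans (cong (ℤ._- + A ℤ.* + qₙ) (ℤₚ.*-comm (+ B) (+ pₙ))) (P.trans (expand e₁) (cong (ε ℤ.*_) (S.solve 2 (λ X Y → S.con 1ℤ S.:* Y S.:- X S.:* S.con 0ℤ S.:= Y) P.refl (+ X) (+ Y))))
      scaled : nrm (+ s ℤ.* (ε ℤ.* (ℤ.- + X)) , ε ℤ.* + Y) ≡ ε ℤ.* ε ℤ.* (+ s ℤ.* det z (W ∙ z))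
      scaled = P.trans (S.solve 7 (λ d t s t′ s′ X Y → let u = s S.:* (d S.:* (S.:- X)) ; v = d S.:* Y in
          u S.:* u S.:+ (t S.:- s′) S.:* (u S.:* v) S.:- s S.:* t′ S.:* (v S.:* v) S.:= d S.:* d S.:* (s S.:* (X S.:* (s S.:* X S.:+ s′ S.:* Y) S.:- (t S.:* X S.:+ t′ S.:* Y) S.:* Y))) P.refl ε (+ t) (+ s) (+ t′) (+ s′) (+ X) (+ Y))
        (cong₂ (λ u v → ε ℤ.* ε ℤ.* (+ s ℤ.* (+ X ℤ.* u ℤ.- v ℤ.* + Y))) (P.sym (cast s X s′ Y)) (P.sym (cast t X t′ Y)))

    -- The expansions of a tail of ξ and of its image under W first differ after the letters a_e and a_{e + R}.
    module FirstMismatch (m : ℕ) (agree : ∀ i → i < m → a (n ℕ.+ i ℕ.+ R) ≡ a (n ℕ.+ i)) (mismatch : a (n ℕ.+ m ℕ.+ R) ≢ a (n ℕ.+ m)) where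
      e = n ℕ.+ m

      det-≥ : ∀ N j → suc N ≡ e ℕ.+ R ℕ.+ suc (suc (suc j)) → ∃ λ z → tail-vector N ≡ act 0 n z ×
        proj₂ (tail-vector N) ℕ.* proj₂ (tail-vector N) ≤ ∣ det z (W ∙ z) ∣ ℕ.* (row-size (e ℕ.+ R) ℕ.* row-size e)
      det-≥ N j eN = z , tail≡ , ≤-trans (product-arith (proj₂ (tail-vector N)) (row-size (e ℕ.+ R)) (row-size e) (proj₁ w₁) (proj₂ w₁) (proj₁ w₂) (proj₂ w₂)
            (tail-≤ N (e ℕ.+ R) j eN) (tail-≤ N e (R ℕ.+ j) eN′) (act-descending (suc (e ℕ.+ R)) (suc j) e₁) (act-descending (suc e) (suc (R ℕ.+ j)) e₁))
          (*-monoˡ-≤ (row-size (e ℕ.+ R) ℕ.* row-size e) (≤-trans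
            (distinct-letters (a (e ℕ.+ R)) (a e) (proj₁ w₁) (proj₂ w₁) (proj₁ w₂) (proj₂ w₂) ((proj₂ w₁ ℕ.* proj₁ w₂) ⊓ (proj₂ w₂ ℕ.* proj₁ w₁)) mismatch
              (act-descending (suc (e ℕ.+ R)) (suc j) e₁) (act-descending (suc e) (suc (R ℕ.+ j)) e₁) (m⊓n≤m (proj₂ w₁ ℕ.* proj₁ w₂) _) (m⊓n≤n (proj₂ w₁ ℕ.* proj₁ w₂) _))
            (≤-reflexive (P.sym det≡))))
        where
        open +-*-Solver
        eN′ : suc N ≡ e ℕ.+ suc (suc (suc (R ℕ.+ j)))
        eN′ = P.trans eN (solve 3 (λ e R j → e :+ R :+ (con 3 :+ j) := e :+ (con 3 :+ (R :+ j))) P.refl e R j)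
        w₁ = act (suc (e ℕ.+ R)) (suc (suc j)) e₁
        w₂ = act (suc e) (suc (suc (R ℕ.+ j))) e₁
        z₁ = step (a (e ℕ.+ R)) w₁
        z₂ = step (a e) w₂
        z = act n m z₂
        tail≡ : tail-vector N ≡ act 0 n z
        tail≡ = P.trans (cong (λ k → act 0 k e₁) (P.trans eN′ (ℕₚ.+-assoc n m _))) (P.trans (act-+ 0 n (m ℕ.+ suc (suc (suc (R ℕ.+ j)))) e₁) (cong (act 0 n) (act-+ n m (suc (suc (suc (R ℕ.+ j)))) e₁)))
        z-R : z ≡ act n R (act n m z₁)
        z-R = P.trans (P.sym (act-+ n m _ e₁)) (P.trans (cong (λ k → act n k e₁) (solve 3 (λ m R j → m :+ (con 3 :+ (R :+ j)) := R :+ (m :+ (con 3 :+ j))) P.refl m R j))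
          (P.trans (act-+ n R (m ℕ.+ suc (suc (suc j))) e₁) (cong (act n R) (P.trans (act-+ (n ℕ.+ R) m (suc (suc (suc j))) e₁)
            (P.trans (cong (λ i → act (n ℕ.+ R) m (act i (suc (suc (suc j))) e₁)) (solve 3 (λ n m R → n :+ R :+ m := n :+ m :+ R) P.refl n m R))
              (act-cong (n ℕ.+ R) n m z₁ (λ i l → P.trans (cong a (solve 3 (λ n i R → n :+ R :+ i := n :+ i :+ R) P.refl n i R)) (agree i l))))))))
        det≡ : ∣ det z (W ∙ z) ∣ ≡ ∣ det z₁ z₂ ∣
        det≡ = P.trans (cong₂ (λ u v → ∣ det u v ∣) z-R (P.sym (act-linear n R z))) (P.trans (det-act n R (act n m z₁) (act n m z₂)) (det-act n m z₁ z₂))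

      K : ℕ
      K = row-size (e ℕ.+ R) ℕ.* row-size e

      F : List ℤ
      F = nrm x ∷ ℤ.- tr x y ∷ nrm y ∷ []

      away-from-zero : ∀ N → e ℕ.+ R ℕ.+ 3 ≤ N → ↧ₙ (seq (Horner.eval ℝ-alg F ξ) N) ≤ ∣ ↥ (seq (Horner.eval ℝ-alg F ξ) N) ∣ ℕ.* suc K
      away-from-zero N l = go (N ∸ (e ℕ.+ R ℕ.+ 2)) (P.trans (cong suc (P.sym (m+[n∸m]≡n (≤-trans (+-monoʳ-≤ (e ℕ.+ R) (n≤1+n 2)) l)))) (solve 2 (λ e j → con 1 :+ (e :+ con 2 :+ j) := e :+ (con 3 :+ j)) P.refl (e ℕ.+ R) _))
        where
        open +-*-Solver
        q = proj₂ (tail-vector N)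
        p = proj₁ (tail-vector N)
        go : ∀ j → suc N ≡ e ℕ.+ R ℕ.+ suc (suc (suc j)) → ↧ₙ (seq (Horner.eval ℝ-alg F ξ) N) ≤ ∣ ↥ (seq (Horner.eval ℝ-alg F ξ) N) ∣ ℕ.* suc K
        go j eN = ≥-cleared (q ℕ.* q) {seq (Horner.eval ℝ-alg F ξ) N} {nrm x ℤ.* (+ q ℤ.* + q) ℤ.+ (ℤ.- tr x y) ℤ.* (+ p ℤ.* + q) ℤ.+ nrm y ℤ.* (+ p ℤ.* + p)} (suc K) (*-mono-≤ (Q≥1 N) (Q≥1 N))
            (subst (λ d → mkℚᵘ d 0 Q.* seq (Horner.eval ℝ-alg F ξ) N ≃ mkℚᵘ (nrm x ℤ.* (+ q ℤ.* + q) ℤ.+ (ℤ.- tr x y) ℤ.* (+ p ℤ.* + q) ℤ.+ nrm y ℤ.* (+ p ℤ.* + p)) 0) (P.sym (pos-* q q))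
              (clear-quadratic {+ q} {convergent a N} {+ p} (nrm x) (ℤ.- tr x y) (nrm y) (ξ-fraction N)))
            (bound-from (det-≥ N j eN))
          where
          bound-from : (∃ λ z → tail-vector N ≡ act 0 n z × q ℕ.* q ≤ ∣ det z (W ∙ z) ∣ ℕ.* K) → q ℕ.* q ≤ ∣ nrm x ℤ.* (+ q ℤ.* + q) ℤ.+ (ℤ.- tr x y) ℤ.* (+ p ℤ.* + q) ℤ.+ nrm y ℤ.* (+ p ℤ.* + p) ∣ ℕ.* suc K
          bound-from (z , tail≡ , h) = ≤-trans h (*-mono-≤ (≤-trans (m≤n*m ∣ det z (W ∙ z) ∣ s {{ℕ.>-nonZero (proj₂ l₁)}}) (≤-reflexive (P.sym (P.trans (cong ∣_∣ (nrm-combination x y (+ p) (+ q)))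
            (P.trans (cong (λ v → ∣ nrm (+ proj₂ v ℤ.* proj₁ x ℤ.- + proj₁ v ℤ.* proj₁ y , + proj₂ v ℤ.* proj₂ x ℤ.- + proj₁ v ℤ.* proj₂ y) ∣) tail≡) (numerator z)))))) (n≤1+n K))

      cancel-F : ∀ η → (Horner.eval ℝ-alg F ξ *ʳ η) ≈ʳ ιʳ 0ℤ → η ≈ʳ ιʳ 0ℤ
      cancel-F η h = BoundedAlgebra.⊑-zero reals (below (Ev-divide {seq (Horner.eval ℝ-alg F ξ)} {seq η} K (e ℕ.+ R ℕ.+ 3) away-from-zero (eventually (Bounds.≈0⇒⊑0 reals h))))

      pₙ≥1 : 1 ≤ pₙ
      pₙ≥1 = go n 1≤n
        where
        go : ∀ n → 1 ≤ n → 1 ≤ proj₁ (act 0 n e₁)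
        go (suc n) _ = ≤-trans (act-size 1 n e₁) (step-size (a 0) (act 1 n e₁) (a≥1 0))

      x≢0 : ¬ (x ≡ 0ᵒ)
      x≢0 h = <⇒≢ pₙ≥1 (P.sym (cong ∣_∣ (cong proj₂ h)))

      x-regular : ∀ z → Quadratic._*ᵒ_ b c x z ≡ 0ᵒ → z ≡ 0ᵒ
      x-regular z h = [ (λ q → ⊥-elim (x≢0 q)) , (λ q → q) ]′ (Domain.no-zero-divisors 𝒪 x z h)

      independent : ∀ u v → Horner.hom 𝕆-alg (u ∷ v ∷ []) x y ≡ 0ᵒ → u ≡ 0ℤ × v ≡ 0ℤ
      independent u v h = cancel (P.trans (S.solve 7 (λ s p q p′ q′ u v → u S.:* (s S.:* (q S.:* p′ S.:- q′ S.:* p)) S.:= (s S.:* p′) S.:* (u S.:* q S.:+ v S.:* p) S.:- p S.:* (u S.:* (s S.:* q′) S.:+ v S.:* (s S.:* p′))) P.refl (+ s) (+ pₙ) (+ qₙ) (+ pₙ′) (+ qₙ′) u v) (zero-combination (+ s ℤ.* + pₙ′) (+ pₙ) (cong proj₂ h′) (cong proj₁ h′))) ,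
          cancel (P.trans (S.solve 7 (λ s p q p′ q′ u v → v S.:* (s S.:* (q S.:* p′ S.:- q′ S.:* p)) S.:= q S.:* (u S.:* (s S.:* q′) S.:+ v S.:* (s S.:* p′)) S.:- (s S.:* q′) S.:* (u S.:* q S.:+ v S.:* p)) P.refl (+ s) (+ pₙ) (+ qₙ) (+ pₙ′) (+ qₙ′) u v) (zero-combination (+ qₙ) (+ s ℤ.* + qₙ′) (cong proj₁ h′) (cong proj₂ h′)))
        where
        h′ : (u ℤ.* proj₁ y ℤ.+ v ℤ.* proj₁ x , u ℤ.* proj₂ y ℤ.+ v ℤ.* proj₂ x) ≡ 0ᵒ
        h′ = P.trans (P.sym (linear-form x y u v)) h
        zero-combination : ∀ k l {A B} → A ≡ 0ℤ → B ≡ 0ℤ → k ℤ.* A ℤ.- l ℤ.* B ≡ 0ℤ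
        zero-combination k l P.refl P.refl = S.solve 2 (λ k l → k S.:* S.con 0ℤ S.:- l S.:* S.con 0ℤ S.:= S.con 0ℤ) P.refl k l
        cancel : ∀ {i} → i ℤ.* r ≡ 0ℤ → i ≡ 0ℤ
        cancel {i} q = [ (λ z → z) , (λ z → ⊥-elim (r≢0 z)) ]′ (i*j≡0⇒i≡0∨j≡0 i q)

      nrm-x≢0 : nrm x ≢ 0ℤ
      nrm-x≢0 h = x≢0 (anisotropic x h)

      shorter-root : ∀ f k → length f ≡ suc (suc k) → Horner.hom 𝕆-alg f x y ≡ 0ᵒ → Horner.eval ℝ-alg f ξ ≈ʳ ιʳ 0ℤ →
        ∃ λ H → length H ≡ k × (Zero H → Zero f) × Horner.eval ℝ-alg H ξ ≈ʳ ιʳ 0ℤ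
      shorter-root f k len h root = Quotient.H q , Quotient.length-H q , Quotient.Zero-H q ,
          cancel-F (Horner.eval ℝ-alg (Quotient.H q) ξ) (≈ʳ-trans (≈ʳ-sym (Quotient.division q)) (≈ʳ-trans (*ʳ-cong (≈ʳ-refl {ιʳ (nrm x ℤ.^ Quotient.e q)}) root) (ℤ-Algebra.zeroʳ ℝ-alg (ιʳ (nrm x ℤ.^ Quotient.e q)))))
        where
        open Divide ℝ-alg 𝕆-alg x y (nrm y) (ℤ.- tr x y) (nrm x) nrm-x≢0 x-regular (quadratic-relation x y) independent using (Quotient; divide)
        q = divide k f len h ξ

      divided-root : ∀ f k → length f ≡ suc (suc k) → Horner.eval ℝ-alg f ξ ≈ʳ ιʳ 0ℤ → ∀ {E} Λ g κ → Periodic n E R → n ℕ.+ Λ ℕ.* R ≤ E → suc (suc (g ℕ.+ g)) ≤ Λ ℕ.* R →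
        Q n ℕ.* block-bound n R ≤ 2 ^ κ →
        (let D = suc k ; h = norm (monomials 0 f) ; X = h ℕ.+ (3 ℕ.+ suc (a 0) ℕ.+ (κ ℕ.+ κ)) ℕ.* (D ℕ.+ 0) ℕ.+ (1 ℕ.* D ℕ.+ 0) in X ℕ.+ X < g ℕ.+ g) →
        ∃ λ H → length H ≡ k × (Zero H → Zero f) × Horner.eval ℝ-alg H ξ ≈ʳ ιʳ 0ℤ
      divided-root f k len root Λ g κ per end hg q-bound lt = shorter-root f k len (vanishing f (suc k) len root Λ g κ per end hg q-bound lt) root

coeff-≤ : ∀ j P i → ∣ coeff P i ∣ ≤ norm (monomials j P)
coeff-≤ j [] i = z≤n
coeff-≤ j (c ∷ P) zero = m≤m+n ∣ c ∣ _
coeff-≤ j (c ∷ P) (suc i) = ≤-trans (coeff-≤ (suc j) P i) (m≤n+m _ ∣ c ∣)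

logarithm : ∀ n → 1 ≤ n → ∃ λ ℓ → 2 ^ ℓ ≤ n × n < 2 ^ suc ℓ
logarithm (suc zero) _ = 0 , s≤s z≤n , s≤s (s≤s z≤n)
logarithm (suc (suc n)) _ with logarithm (suc n) (s≤s z≤n)
... | ℓ , l , u with suc (suc n) <? 2 ^ suc ℓ
... | yes u′ = ℓ , ≤-trans l (n≤1+n _) , u′
... | no g = suc ℓ , ≮⇒≥ g , ≤-<-trans u (m<m+n (2 ^ suc ℓ) {2 ^ suc ℓ ℕ.+ 0} (≤-trans (m^n>0 2 (suc ℓ)) (m≤m+n _ 0)))

module SmallPeriod (a : Seq) (a≥1 : ∀ m → 1 ≤ a m) where
  open Word a
  open Positive a≥1
  open Limit a a≥1
  open Block a a≥1

  record GoodBlock (W : Mat) (e₁′ B : ℕ) : Set where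
    field
      n′ R E Λ g : ℕ
    n = suc (suc (suc n′))
    field
      R≥3 : 3 ≤ R
      periodic : Periodic n E R
      W≡ : mat n R ≡ W
      end : n ℕ.+ Λ ℕ.* R ≤ E
      maximal : a (suc (suc n′)) ≢ a (R ℕ.+ suc (suc n′))
      n-large : suc (suc (B ℕ.+ B)) ≤ n
      g-small : suc (suc (g ℕ.+ g)) ≤ Λ ℕ.* R
      long : ∀ ℓ → 2 ^ ℓ ≤ Q n → ℓ ≤ suc e₁′ ℕ.* (g ℕ.+ g)

  module _ (t s t′ s′ : ℕ) (l₁ : Large 1 (t , s)) (l₂ : Large 1 (t′ , s′)) (trace : 3 ≤ t ℕ.+ s′) (unimodular : ∣ det (t , s) (t′ , s′) ∣ ≡ 1)
    (f : List ℤ) (D′ : ℕ) (len : length f ≡ suc (suc D′)) (lead≢0 : coeff f (suc D′) ≢ 0ℤ) (root : Horner.eval ℝ-alg f ξ ≈ʳ ιʳ 0ℤ) (e₁′ : ℕ) where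
    open FixedPoint t s t′ s′ l₁ l₂ unimodular
    open Conjugate t s t′ s′ l₁ l₂ trace unimodular
    open BoundedAlgebra reals using (_⊑_; _≈_; ⊑-mono; trans; sym)

    private
      κ = suc bound
      module App = Descent.Approximations reals 𝒪 emb₁ emb₂ norm-product ξ (suc (a 0)) (⊑-mono {ξ} (n≤2^n (suc (a 0))) (below ξ-bounded)) D′ (coeff f) lead≢0
        (norm (monomials 0 f)) (λ i _ → ≤-trans (coeff-≤ 0 f i) (n≤2^n _)) (subst (λ k → Sum.sum ℝ-ring k (λ j → ιʳ (coeff f j) *ʳ Taylor._↑_ ℝ-alg ξ j) ≈ ιʳ 0ℤ) len (≈ʳ-trans (≈ʳ-sym (Horner.eval-sum ℝ-alg f ξ)) root)) s κ e₁′

    point : ∀ B → GoodBlock W e₁′ B → Σ App.Point λ P → B ≤ App.Point.ℓ P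
    point B block = record
      { ℓ = ℓ ; g = ℓ ℕ.+ (g ℕ.+ g) ; x = x ; y = y ; p = Quadratic.ιᵒ b c (+ pₙ) ; q = Quadratic.ιᵒ b c (+ qₙ) ; r = r ; r≢0 = r≢0
      ; r-≤ = ≤-trans (≤-reflexive ∣r∣) (n≤2^n s)
      ; unimodular = x-y-unimodular
      ; height-≥ = ≤-trans ℓ-≤ (≤-trans form-large ∣nrm-y∣-≥)
      ; close₁ = ⊑-mono (≤-trans (m≤m+n s _) bound-≤) (close₁ {E} {R} {Λ} periodic W≡ end ℓ g ℓ-≤ g-small)
      ; close₂ = ⊑-mono bound-≤ (close₂ ℓ ℓ-≤)
      ; size₁ = ⊑-mono size-≤ (y-⊑ θ θ₁-⊑ q′≤q)
      ; size₂ = ⊑-mono size-≤ (y-⊑ θ₂ θ₂-⊑ q′≤q)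
      ; quality = ≤-trans (+-monoˡ-≤ _ (long ℓ ℓ-≤)) (≤-reflexive (P.trans (ℕₚ.+-comm (suc e₁′ ℕ.* (g ℕ.+ g)) (suc e₁′ ℕ.* ℓ)) (P.sym (ℕₚ.*-distribˡ-+ (suc e₁′) ℓ (g ℕ.+ g)))))
      } , B≤ℓ
      where
      open GoodBlock block
      open At n
      q≥1 : 1 ≤ qₙ
      q≥1 = Q≥1 (suc (suc n′))
      log = logarithm qₙ q≥1
      ℓ = proj₁ log
      ℓ-≤ = proj₁ (proj₂ log)
      ℓ-> = proj₂ (proj₂ log)
      q′≡ : qₙ′ ≡ Q (suc (suc n′))
      q′≡ = cong proj₂ (col₂ 0 (suc (suc n′)))
      q′≤q : qₙ′ ≤ qₙ
      q′≤q = ≤-trans (≤-reflexive q′≡) (Q-mono-suc (suc (suc n′)))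
      bound-≤ : bound ≤ 2 ^ κ
      bound-≤ = ≤-trans (n≤2^n bound) (^-monoʳ-≤ 2 (n≤1+n bound))
      size-≤ : qₙ ℕ.* bound ≤ 2 ^ (ℓ ℕ.+ κ)
      size-≤ = ≤-trans (*-mono-≤ (<⇒≤ ℓ->) (n≤2^n bound)) (≤-reflexive (P.trans (P.sym (^-distribˡ-+-* 2 (suc ℓ) bound)) (cong (2 ^_) (P.sym (+-suc ℓ bound)))))
      B≤ℓ : B ≤ ℓ
      B≤ℓ = ≤-pred (≰⇒> (λ h → <⇒≱ ℓ-> (≤-trans (^-monoʳ-≤ 2 h) (proj₂ (grow B 0 n e₁ (s≤s z≤n) n-large)))))
      row : ∀ v → proj₂ (act 0 (n ℕ.+ R) v) ≡ qₙ ℕ.* proj₁ (act n R v) ℕ.+ qₙ′ ℕ.* proj₂ (act n R v)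
      row v = cong proj₂ (P.trans (act-+ 0 n R v) (act-linear 0 n (act n R v)))
      next : Q (R ℕ.+ n) ≡ qₙ ℕ.* t ℕ.+ qₙ′ ℕ.* s
      next = P.trans (cong Q (ℕₚ.+-comm R n)) (P.trans (row e₁) (cong (λ M → qₙ ℕ.* proj₁ (proj₁ M) ℕ.+ qₙ′ ℕ.* proj₂ (proj₁ M)) W≡))
      next′ : Q (R ℕ.+ suc (suc n′)) ≡ qₙ ℕ.* t′ ℕ.+ qₙ′ ℕ.* s′
      next′ = P.trans (cong Q (ℕₚ.+-comm R (suc (suc n′)))) (P.trans (P.sym (cong proj₂ (col₂ 0 (suc (suc (n′ ℕ.+ R)))))) (P.trans (row e₂) (cong (λ M → qₙ ℕ.* proj₁ (proj₂ M) ℕ.+ qₙ′ ℕ.* proj₂ (proj₂ M)) W≡)))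
      form-large : qₙ ≤ ∣ form ∣
      form-large = ≤-trans (left-maximal n′ R (≤-trans (n≤1+n 2) R≥3) maximal) (≤-reflexive (cong ∣_∣ (cong₂ det (cong (qₙ ,_) (P.sym q′≡)) (cong₂ _,_ next next′))))

    roth-contradiction : (∀ B → ¬ ¬ GoodBlock W e₁′ B) → ⊥
    roth-contradiction supply = App.no-approximations (λ B k → supply B (λ block → k (point B block)))

pigeonhole : ∀ {V : Set} (vs : List V) (S : V → ℕ → Set) → (∀ v {K K′} → K ≤ K′ → S v K′ → S v K) →
  (∀ K → ¬ ¬ (∃ λ v → v ∈ vs × S v K)) → ¬ ¬ (∃ λ v → ∀ K → ¬ ¬ S v K)
pigeonhole [] S mono h k = h 0 (λ { (_ , () , _) })
pigeonhole (v ∷ vs) S mono h k = k (v , λ K₀ bad → pigeonhole vs S mono (λ K k′ → h (K ⊔ K₀) (λ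
  { (_ , here P.refl , s) → bad (mono v (m≤n⊔m K K₀) s)
  ; (w , there w∈ , s) → k′ (w , w∈ , mono w (m≤m⊔n K K₀) s) })) k)

half : ∀ m → 2 ≤ m → ∃ λ g → suc (suc (g ℕ.+ g)) ≤ m × m ≤ 3 ℕ.+ (g ℕ.+ g)
half (suc zero) (s≤s ())
half (suc (suc zero)) _ = 0 , ≤-refl , n≤1+n 2
half (suc (suc (suc zero))) _ = 0 , n≤1+n 2 , ≤-refl
half (suc (suc (suc (suc m)))) _ with half (suc (suc m)) (s≤s (s≤s z≤n))
... | g , l , u = suc g , ≤-trans (≤-reflexive eq) (s≤s (s≤s l)) , ≤-trans (s≤s (s≤s u)) (≤-reflexive (cong (3 ℕ.+_) (cong suc (P.sym (+-suc g g)))))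
  where
  eq : suc (suc (suc g ℕ.+ suc g)) ≡ suc (suc (suc (suc (g ℕ.+ g))))
  eq = cong (λ z → suc (suc (suc z))) (+-suc g g)

^-cancelʳ-≤ : ∀ m n k → 1 ≤ k → m ^ k ≤ n ^ k → m ≤ n
^-cancelʳ-≤ m n k@(suc _) _ h with m ≤? n
... | yes l = l
... | no g = ⊥-elim (<⇒≱ (^-monoˡ-< k (≰⇒> g)) h)

bound-arith : ∀ s t t′ d T → s ≤ T → t ≤ T → t′ ≤ T → d ≤ T ℕ.+ T → 1 ≤ T → s ℕ.+ (d ℕ.+ s ℕ.* (t ℕ.+ t′)) ≤ 8 ℕ.* (T ℕ.* T)
bound-arith s t t′ d T hs ht ht′ hd T≥1 = ≤-trans (+-mono-≤ (≤-trans hs T≤T²) (+-mono-≤ (≤-trans hd (+-mono-≤ T≤T² T≤T²)) (*-mono-≤ hs (+-mono-≤ ht ht′))))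
  (≤-trans (m≤m+n _ (3 ℕ.* (T ℕ.* T))) (≤-reflexive (solve 1 (λ T → T :* T :+ (T :* T :+ T :* T :+ T :* (T :+ T)) :+ con 3 :* (T :* T) := con 8 :* (T :* T)) P.refl T)))
  where
  open +-*-Solver
  T≤T² = m≤m*n T T {{ℕ.>-nonZero T≥1}}

-- The linear form is so small that it beats the heights of x and y once R and Λ are large.
exponent-arith : ∀ D χ₀ h C n R Λ c → n ≤ c ℕ.* Λ → 1 ≤ R →
  let β = 12 ℕ.* D ℕ.* C ; α = 2 ℕ.* h ℕ.+ 2 ℕ.* (D ℕ.* (10 ℕ.+ χ₀)) ℕ.+ 4 ; τ = C ℕ.* (n ℕ.+ R) ; κ = 3 ℕ.+ (τ ℕ.+ τ ℕ.+ τ)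
      X = h ℕ.+ (3 ℕ.+ χ₀ ℕ.+ (κ ℕ.+ κ)) ℕ.* (D ℕ.+ 0) ℕ.+ (1 ℕ.* D ℕ.+ 0) in
  2 ℕ.* β ℕ.* c ≤ R → 2 ℕ.* β ℕ.+ 2 ℕ.* α ≤ Λ → 4 ℕ.+ (X ℕ.+ X) ≤ Λ ℕ.* R
exponent-arith D χ₀ h C n R Λ c n≤ R≥1 hR hΛ = *-cancelˡ-≤ 2 (begin
  2 ℕ.* (4 ℕ.+ (X ℕ.+ X)) ≡⟨ solve 6 (λ D χ₀ h C n R → let τ = C :* (n :+ R) ; κ = con 3 :+ (τ :+ τ :+ τ) ; X = h :+ (con 3 :+ χ₀ :+ (κ :+ κ)) :* (D :+ con 0) :+ (con 1 :* D :+ con 0) ; β = con 12 :* D :* C in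
     con 2 :* (con 4 :+ (X :+ X)) := con 2 :* β :* n :+ (con 2 :* β :* R :+ con 2 :* (con 2 :* h :+ con 2 :* (D :* (con 10 :+ χ₀)) :+ con 4))) P.refl D χ₀ h C n R ⟩
  2 ℕ.* β ℕ.* n ℕ.+ (2 ℕ.* β ℕ.* R ℕ.+ 2 ℕ.* α)
    ≤⟨ +-mono-≤ (*-monoʳ-≤ (2 ℕ.* β) n≤) (+-monoʳ-≤ (2 ℕ.* β ℕ.* R) (m≤m*n (2 ℕ.* α) R {{ℕ.>-nonZero R≥1}})) ⟩
  2 ℕ.* β ℕ.* (c ℕ.* Λ) ℕ.+ (2 ℕ.* β ℕ.* R ℕ.+ 2 ℕ.* α ℕ.* R) ≡⟨ solve 5 (λ b c L R a → con 2 :* b :* (c :* L) :+ (con 2 :* b :* R :+ con 2 :* a :* R) := L :* (con 2 :* b :* c) :+ (con 2 :* b :+ con 2 :* a) :* R) P.refl β c Λ R α ⟩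
  Λ ℕ.* (2 ℕ.* β ℕ.* c) ℕ.+ (2 ℕ.* β ℕ.+ 2 ℕ.* α) ℕ.* R ≤⟨ +-mono-≤ (*-monoʳ-≤ Λ hR) (*-monoˡ-≤ R hΛ) ⟩
  Λ ℕ.* R ℕ.+ Λ ℕ.* R ≡⟨ solve 1 (λ x → x :+ x := con 2 :* x) P.refl (Λ ℕ.* R) ⟩
  2 ℕ.* (Λ ℕ.* R) ∎)
  where
  open +-*-Solver
  open ℕₚ.≤-Reasoning
  β = 12 ℕ.* D ℕ.* C
  α = 2 ℕ.* h ℕ.+ 2 ℕ.* (D ℕ.* (10 ℕ.+ χ₀)) ℕ.+ 4
  X = h ℕ.+ (3 ℕ.+ χ₀ ℕ.+ (3 ℕ.+ (C ℕ.* (n ℕ.+ R) ℕ.+ C ℕ.* (n ℕ.+ R) ℕ.+ C ℕ.* (n ℕ.+ R)) ℕ.+ (3 ℕ.+ (C ℕ.* (n ℕ.+ R) ℕ.+ C ℕ.* (n ℕ.+ R) ℕ.+ C ℕ.* (n ℕ.+ R))))) ℕ.* (D ℕ.+ 0) ℕ.+ (1 ℕ.* D ℕ.+ 0)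

module Transcendence (a : Seq) (a≥1 : ∀ m → 1 ≤ a m) (aperiodic : ¬ UltimatelyPeriodic a) (nk λk rk : ℕ → ℕ)
  (nk≥1 : 1 ≤ nk 0) (nk-increasing : ∀ k → nk k < nk (suc k)) (λk≥1 : ∀ k → 1 ≤ λk k) (rk≥1 : ∀ k → 1 ≤ rk k)
  (repeats : ∀ k m → nk k ≤ m → m ℕ.+ 1 ≤ nk k ℕ.+ (λk k ∸ 1) ℕ.* rk k → a (m ℕ.+ rk k) ≡ a m)
  (C : ℕ) (q-≤ : ∀ n → 1 ≤ n → Defs.q a n ≤ C ^ n)
  (c : ℕ) (long : ∀ K → ∃[ k ] (K ≤ k × nk k ≤ suc c ℕ.* λk k)) where
  open Word a
  open Positive a≥1
  open Limit a a≥1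
  open Block a a≥1
  open SmallPeriod a a≥1 using (GoodBlock)
  open Horner ℝ-alg using (eval; eval-∷ʳ0)

  k<nk : ∀ k → k < nk k
  k<nk zero = nk≥1
  k<nk (suc k) = ≤-<-trans (k<nk k) (nk-increasing k)

  end : ℕ → ℕ
  end k = nk k ℕ.+ λk k ℕ.* rk k

  periodic : ∀ k → Periodic (nk k) (end k) (rk k)
  periodic k m l u = repeats k m l (go (λk k) (λk≥1 k) u)
    where
    go : ∀ Λ → 1 ≤ Λ → m ℕ.+ rk k < nk k ℕ.+ Λ ℕ.* rk k → m ℕ.+ 1 ≤ nk k ℕ.+ (Λ ∸ 1) ℕ.* rk k
    go (suc Λ) _ u = +-cancelʳ-≤ (rk k) _ _ (≤-trans (≤-reflexive (solve 2 (λ m r → m :+ con 1 :+ r := con 1 :+ (m :+ r)) P.refl m (rk k))) (≤-trans u (≤-reflexive (solve 3 (λ n r L → n :+ (r :+ L :* r) := n :+ L :* r :+ r) P.refl (nk k) (rk k) Λ))))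
      where open +-*-Solver

  C≥1 : 1 ≤ C
  C≥1 = ≤-trans (subst (1 ≤_) (Q-q 1) (Q≥1 1)) (≤-trans (q-≤ 1 (s≤s z≤n)) (≤-reflexive (ℕₚ.*-identityʳ C)))

  Q-≤ : ∀ n → Q n ≤ 2 ^ (C ℕ.* n)
  Q-≤ n = ≤-trans (below-C n) (≤-trans (^-monoˡ-≤ n (n≤2^n C)) (≤-reflexive (^-*-assoc 2 C n)))
    where
    below-C : ∀ n → Q n ≤ C ^ n
    below-C zero = z≤n
    below-C (suc zero) = ≤-trans C≥1 (≤-reflexive (P.sym (ℕₚ.*-identityʳ C)))
    below-C (suc (suc n)) = ≤-trans (≤-reflexive (Q-q (suc n))) (≤-trans (q-≤ (suc n) (s≤s z≤n)) (m≤n*m (C ^ suc n) C {{ℕ.>-nonZero C≥1}}))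

  act-mono : ∀ n k → proj₁ (act n k e₁) ≤ proj₁ (act n (suc k) e₁) × proj₂ (act n k e₁) ≤ proj₂ (act n (suc k) e₁)
  act-mono n zero = ≤-trans (a≥1 n) (≤-reflexive (P.sym (P.trans (ℕₚ.+-identityʳ _) (ℕₚ.*-identityʳ (a n))))) , z≤n
  act-mono n (suc k) = +-mono-≤ (*-monoʳ-≤ (a n) (proj₁ (act-mono (suc n) k))) (proj₂ (act-mono (suc n) k)) , proj₁ (act-mono (suc n) k)

  entries-≤ : ∀ n R → 1 ≤ R → proj₂ (act n R e₁) ≤ proj₁ (act n R e₁) × proj₁ (act n R e₂) ≤ proj₁ (act n R e₁) × proj₂ (act n R e₂) ≤ proj₁ (act n R e₁)
  entries-≤ n (suc R) _ = act-descending n R e₁ , second , ≤-trans (act-descending n R e₂) second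
    where
    second : proj₁ (act n (suc R) e₂) ≤ proj₁ (act n (suc R) e₁)
    second = ≤-trans (≤-reflexive (cong proj₁ (col₂ n R))) (proj₁ (act-mono n R))

  Q-split : ∀ n k → 1 ≤ n → proj₁ (act n k e₁) ≤ Q (n ℕ.+ k)
  Q-split (suc n) k _ = ≤-trans (m≤n*m (proj₁ v) (Q (suc n)) {{ℕ.>-nonZero (Q≥1 n)}}) (≤-trans (m≤m+n _ _) (≤-reflexive (P.sym (cong proj₂ (P.trans (act-+ 0 (suc n) k e₁) (act-linear 0 (suc n) v))))))
    where v = act (suc n) k e₁

  Root : List ℤ → Set
  Root f = eval f ξ ≈ʳ ιʳ 0ℤ

  NoRoot : ℕ → Set
  NoRoot L = ∀ f → length f ≤ L → ¬ Zero f → Root f → ⊥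

  first-mismatch : ∀ n R → 1 ≤ R → ¬ ¬ (∃ λ m → (∀ i → i < m → a (n ℕ.+ i ℕ.+ R) ≡ a (n ℕ.+ i)) × a (n ℕ.+ m ℕ.+ R) ≢ a (n ℕ.+ m))
  first-mismatch n R R≥1 k = aperiodic (n , R , R≥1 , λ m l → subst (λ m → a (m ℕ.+ R) ≡ a m) (m+[n∸m]≡n l) (all (suc (m ∸ n)) (m ∸ n) ≤-refl))
    where
    all : ∀ m i → i < m → a (n ℕ.+ i ℕ.+ R) ≡ a (n ℕ.+ i)
    all (suc m) i l with i ℕ.≟ m
    ... | no ne = all m i (≤∧≢⇒< (≤-pred l) ne)
    ... | yes P.refl = decidable-stable (_ ℕ.≟ _) (λ ne → k (m , all m , ne))

  module LargePeriods (f : List ℤ) (D′ : ℕ) (len : length f ≡ suc (suc D′)) (f≢0 : ¬ Zero f) (lead≢0 : coeff f (suc D′) ≢ 0ℤ) (root : Root f) (shorter : NoRoot D′) where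
    D = suc D′
    χ₀ = suc (a 0)
    h = norm (monomials 0 f)
    β = 12 ℕ.* D ℕ.* C
    α = 2 ℕ.* h ℕ.+ 2 ℕ.* (D ℕ.* (10 ℕ.+ χ₀)) ℕ.+ 4
    ρ = 3 ℕ.+ 2 ℕ.* β ℕ.* suc c
    Λ₀ = 2 ℕ.* β ℕ.+ 2 ℕ.* α
    K₀ = suc c ℕ.* Λ₀

    -- If some long block has a large period, f vanishes at the corresponding quadratic number, and so is divisible by its minimal polynomial.
    large-period : ∀ n R Λ → 1 ≤ n → Periodic n (n ℕ.+ Λ ℕ.* R) R → ρ ≤ R → Λ₀ ≤ Λ → n ≤ suc c ℕ.* Λ → ⊥
    large-period n R Λ n≥1 per ρ≤R Λ₀≤Λ n≤ = first-mismatch n R R≥1 (λ { (m , agree , mismatch) →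
        finish (LargePeriod.FirstMismatch.divided-root a a≥1 n R n≥1 R≥3 m agree mismatch f D′ len root Λ g κ per ≤-refl (proj₁ (proj₂ gs)) q-bound (+-cancelˡ-≤ 3 (suc (X ℕ.+ X)) (g ℕ.+ g) (≤-trans exponents (proj₂ (proj₂ gs))))) })
      where
      R≥3 : 3 ≤ R
      R≥3 = ≤-trans (m≤m+n 3 _) ρ≤R
      R≥1 : 1 ≤ R
      R≥1 = ≤-trans (s≤s z≤n) R≥3
      τ = C ℕ.* (n ℕ.+ R)
      κ = 3 ℕ.+ (τ ℕ.+ τ ℕ.+ τ)
      X = h ℕ.+ (3 ℕ.+ χ₀ ℕ.+ (κ ℕ.+ κ)) ℕ.* (D ℕ.+ 0) ℕ.+ (1 ℕ.* D ℕ.+ 0)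
      exponents : 4 ℕ.+ (X ℕ.+ X) ≤ Λ ℕ.* R
      exponents = exponent-arith D χ₀ h C n R Λ (suc c) n≤ R≥1 (≤-trans (m≤n+m _ 3) ρ≤R) Λ₀≤Λ
      gs = half (Λ ℕ.* R) (≤-trans (s≤s (s≤s z≤n)) exponents)
      g = proj₁ gs
      T = 2 ^ τ
      t≤T : proj₁ (act n R e₁) ≤ T
      t≤T = ≤-trans (Q-split n R n≥1) (Q-≤ (n ℕ.+ R))
      small = entries-≤ n R R≥1
      bound≤ : LargePeriod.block-bound a a≥1 n R ≤ 8 ℕ.* (T ℕ.* T)
      bound≤ = bound-arith _ _ _ _ T (≤-trans (proj₁ small) t≤T) t≤T (≤-trans (proj₁ (proj₂ small)) t≤T)
        (≤-trans (∣i-j∣≤∣i∣+∣j∣ (+ proj₁ (act n R e₁)) (+ proj₂ (act n R e₂))) (+-mono-≤ t≤T (≤-trans (proj₂ (proj₂ small)) t≤T))) (m^n>0 2 τ)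
      q-bound : Q n ℕ.* LargePeriod.block-bound a a≥1 n R ≤ 2 ^ κ
      q-bound = ≤-trans (*-mono-≤ (≤-trans (Q-≤ n) (^-monoʳ-≤ 2 (*-monoʳ-≤ C (m≤m+n n R)))) bound≤)
        (≤-reflexive (P.trans (solve 1 (λ T → T :* (con 8 :* (T :* T)) := con 8 :* (T :* T :* T)) P.refl T) (P.sym (P.trans (^-distribˡ-+-* 2 3 (τ ℕ.+ τ ℕ.+ τ)) (cong (8 ℕ.*_) (P.trans (^-distribˡ-+-* 2 (τ ℕ.+ τ) τ) (cong (ℕ._* T) (^-distribˡ-+-* 2 τ τ))))))))
        where open +-*-Solver
      finish : (∃ λ H → length H ≡ D′ × (Zero H → Zero f) × Root H) → ⊥
      finish (H , lenH , zero-H , rootH) = shorter H (≤-reflexive lenH) (λ z → f≢0 (zero-H z)) rootH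

    small-periods : ∀ k → K₀ ≤ k → nk k ≤ suc c ℕ.* λk k → rk k < ρ
    small-periods k l n≤ = decidable-stable (rk k <? ρ) (λ g → large-period (nk k) (rk k) (λk k) (≤-trans (s≤s z≤n) (k<nk k)) (periodic k) (≮⇒≥ g)
      (*-cancelˡ-≤ (suc c) (≤-trans l (≤-trans (<⇒≤ (k<nk k)) n≤))) n≤)

  record Chosen (r B : ℕ) : Set where
    constructor chosen
    field
      k : ℕ
      B≤k : B ≤ k
      good : nk k ≤ suc c ℕ.* λk k
      rk≡r : rk k ≡ r

  extend-left : ∀ E R n → Periodic n E R → ∃ λ n₀ → n₀ ≤ n × Periodic n₀ E R × (∀ m → n₀ ≡ suc m → a m ≢ a (m ℕ.+ R))
  extend-left E R zero per = 0 , z≤n , per , λ m ()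
  extend-left E R (suc n) per with a (n ℕ.+ R) ℕ.≟ a n
  ... | no ne = suc n , ≤-refl , per , λ { m P.refl e → ne (P.sym e) }
  ... | yes e with extend-left E R n per′
    where
    per′ : Periodic n E R
    per′ m l u with n ℕ.≟ m
    ... | yes P.refl = e
    ... | no ne = per m (≤∧≢⇒< l ne) u
  ... | n₀ , l , per₀ , max = n₀ , ≤-trans l (n≤1+n n) , per₀ , max

  -- Tripling the period makes every word of length R at least three letters long.
  triple : ∀ {n E r} → Periodic n E r → Periodic n E (3 ℕ.* r)
  triple {n} {E} {r} per m l u = P.trans (cong a (solve 2 (λ m r → m :+ con 3 :* r := m :+ r :+ r :+ r) P.refl m r))
    (P.trans (per (m ℕ.+ r ℕ.+ r) (≤-trans l (≤-trans (m≤m+n m r) (m≤m+n _ r))) (≤-trans (≤-reflexive (cong suc (solve 2 (λ m r → m :+ r :+ r :+ r := m :+ con 3 :* r) P.refl m r))) u))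
    (P.trans (per (m ℕ.+ r) (≤-trans l (m≤m+n m r)) (≤-trans (s≤s (≤-trans (m≤m+n _ r) (≤-reflexive (solve 2 (λ m r → m :+ r :+ r :+ r := m :+ con 3 :* r) P.refl m r)))) u))
      (per m l (≤-trans (s≤s (≤-trans (m≤m+n _ (r ℕ.+ r)) (≤-reflexive (solve 2 (λ m r → m :+ r :+ (r :+ r) := m :+ con 3 :* r) P.refl m r)))) u))))
    where open +-*-Solver

  module FixedPeriod (r : ℕ) (r≥1 : 1 ≤ r) (supply : ∀ B → ¬ ¬ Chosen r B) where
    R = 3 ℕ.* r
    R≥3 : 3 ≤ R
    R≥3 = *-monoʳ-≤ 3 r≥1

    record Extended (B : ℕ) : Set where
      constructor extended
      field
        base : Chosen r B
      open Chosen base public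
      field
        n₀ : ℕ
        n₀≤n : n₀ ≤ nk k
        periodic₀ : Periodic n₀ (end k) R
        maximal₀ : ∀ m → n₀ ≡ suc m → a m ≢ a (m ℕ.+ R)
        B≤n₀ : B ≤ n₀

    -- Otherwise blocks of one period reach arbitrarily far from a fixed index.
    extended-supply : ∀ B → ¬ ¬ Extended B
    extended-supply B none = aperiodic (B , R , ≤-trans (s≤s z≤n) R≥3 , λ m B≤m → decidable-stable (a (m ℕ.+ R) ℕ.≟ a m) (λ ne → supply (B ℕ.+ suc (m ℕ.+ R)) (λ ch → refute m B≤m ne ch
      (extend-left (end (Chosen.k ch)) R (nk (Chosen.k ch)) (triple (subst (Periodic (nk (Chosen.k ch)) (end (Chosen.k ch))) (Chosen.rk≡r ch) (periodic (Chosen.k ch))))))))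
      where
      refute : ∀ m → B ≤ m → a (m ℕ.+ R) ≢ a m → (ch : Chosen r (B ℕ.+ suc (m ℕ.+ R))) → (∃ λ n₀ → n₀ ≤ nk (Chosen.k ch) × Periodic n₀ (end (Chosen.k ch)) R × (∀ m → n₀ ≡ suc m → a m ≢ a (m ℕ.+ R))) → ⊥
      refute m B≤m ne ch (n₀ , l , per , max) = [ (λ B≤n₀ → none (extended (chosen k (≤-trans (m≤m+n B _) B≤k) good rk≡r) n₀ l per max B≤n₀)) ,
          (λ n₀<B → ne (per m (≤-trans (<⇒≤ n₀<B) B≤m) (≤-trans (m≤n+m _ B) (≤-trans B≤k (≤-trans (<⇒≤ (k<nk k)) (m≤m+n _ _)))))) ]′ (≤-<-connex B n₀)
        where open Chosen ch

    B₀ = 3 ℕ.+ suc c ℕ.* 6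

    module Bounds₀ {B : ℕ} (x : Extended B) (B₀≤B : B₀ ≤ B) where
      open Extended x
      Λ = λk k / 3
      n₀≥3 : 3 ≤ n₀
      n₀≥3 = ≤-trans (m≤m+n 3 _) (≤-trans B₀≤B B≤n₀)
      λ≥6 : 6 ≤ λk k
      λ≥6 = *-cancelˡ-≤ (suc c) (≤-trans (m≤n+m _ 3) (≤-trans B₀≤B (≤-trans B≤k (≤-trans (<⇒≤ (k<nk k)) good))))
      λ≤ : λk k ≤ 2 ℕ.+ Λ ℕ.* 3
      λ≤ = ≤-trans (≤-reflexive (DM.m≡m%n+[m/n]*n (λk k) 3)) (+-monoˡ-≤ (Λ ℕ.* 3) (≤-pred (DM.m%n<n (λk k) 3)))
      Λ≥2 : 2 ≤ Λ
      Λ≥2 = ≮⇒≥ (λ Λ<2 → <⇒≱ (s≤s (+-monoʳ-≤ 2 (*-monoˡ-≤ 3 (≤-pred Λ<2)))) (≤-trans λ≥6 λ≤))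
      end₀ : n₀ ℕ.+ Λ ℕ.* R ≤ end k
      end₀ = +-mono-≤ n₀≤n (≤-trans (≤-reflexive (P.sym (ℕₚ.*-assoc Λ 3 r))) (*-mono-≤ (DM.m/n*n≤m (λk k) 3) (≤-reflexive (P.sym rk≡r))))
      λ≤5Λ : λk k ≤ 5 ℕ.* Λ
      λ≤5Λ = ≤-trans λ≤ (≤-trans (+-monoˡ-≤ (Λ ℕ.* 3) (*-monoʳ-≤ 2 (≤-trans (s≤s z≤n) Λ≥2))) (≤-reflexive (solve 1 (λ L → con 2 :* L :+ L :* con 3 := con 5 :* L) P.refl Λ)))
        where open +-*-Solver

      exponent = C ℕ.* ((suc c ℕ.+ r) ℕ.* 5)

      power-≤ : ∀ k → proj₁ (act n₀ R e₁) ^ k ≤ proj₁ (iterate k (mat n₀ R ∙_) e₁)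
      power-≤ zero = ≤-refl
      power-≤ (suc k) = ≤-trans (*-monoʳ-≤ (proj₁ (act n₀ R e₁)) (power-≤ k)) (m≤m+n _ _)

      -- The powers of W divide the word of ξ, and q_N grows at most exponentially.
      entry-≤ : proj₁ (act n₀ R e₁) ≤ 2 ^ exponent
      entry-≤ = ^-cancelʳ-≤ _ _ Λ (≤-trans (s≤s z≤n) Λ≥2) (≤-trans (power-≤ Λ) (≤-trans (≤-reflexive (cong proj₁ (P.sym (act-power periodic₀ Λ e₁ end₀))))
        (≤-trans (Q-split n₀ (Λ ℕ.* R) (≤-trans (s≤s z≤n) n₀≥3)) (≤-trans (Q-≤ (n₀ ℕ.+ Λ ℕ.* R)) (≤-trans (^-monoʳ-≤ 2 exponents) (≤-reflexive (P.sym (^-*-assoc 2 exponent Λ))))))))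
        where
        open +-*-Solver
        exponents : C ℕ.* (n₀ ℕ.+ Λ ℕ.* R) ≤ exponent ℕ.* Λ
        exponents = ≤-trans (*-monoʳ-≤ C (≤-trans end₀ (≤-trans (+-mono-≤ good (≤-reflexive (cong (λk k ℕ.*_) rk≡r)))
          (≤-trans (≤-reflexive (solve 3 (λ c L r → c :* L :+ L :* r := (c :+ r) :* L) P.refl (suc c) (λk k) r)) (*-monoʳ-≤ (suc c ℕ.+ r) λ≤5Λ)))))
          (≤-reflexive (solve 3 (λ C x L → C :* (x :* (con 5 :* L)) := C :* (x :* con 5) :* L) P.refl C (suc c ℕ.+ r) Λ))

    record Attained (W : Mat) (B : ℕ) : Set where
      constructor attained
      field
        {B′} : ℕ
        block : Extended B′
        B₀≤B′ : B₀ ≤ B′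
        B≤B′ : B ≤ B′
        matrix : mat (Extended.n₀ block) R ≡ W

    entries : List ℕ
    entries = upTo (suc (2 ^ (C ℕ.* ((suc c ℕ.+ r) ℕ.* 5))))

    matrices : List Mat
    matrices = cartesianProduct (cartesianProduct entries entries) (cartesianProduct entries entries)

    fixed-matrix : ¬ ¬ (∃ λ W → ∀ B → ¬ ¬ Attained W B)
    fixed-matrix = pigeonhole matrices Attained (λ _ l x → attained (Attained.block x) (Attained.B₀≤B′ x) (≤-trans l (Attained.B≤B′ x)) (Attained.matrix x))
      (λ B none → extended-supply (B ℕ.+ B₀) (λ x → none (mat (Extended.n₀ x) R , member x (m≤n+m B₀ B) , attained x (m≤n+m B₀ B) (m≤m+n B B₀) P.refl)))
      where
      member : ∀ {B} (x : Extended B) → B₀ ≤ B → mat (Extended.n₀ x) R ∈ matrices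
      member x l = ∈-cartesianProduct⁺ (∈-cartesianProduct⁺ (∈-upTo⁺ (s≤s t≤)) (∈-upTo⁺ (s≤s (≤-trans (proj₁ small) t≤)))) (∈-cartesianProduct⁺ (∈-upTo⁺ (s≤s (≤-trans (proj₁ (proj₂ small)) t≤))) (∈-upTo⁺ (s≤s (≤-trans (proj₂ (proj₂ small)) t≤))))
        where
        t≤ = Bounds₀.entry-≤ x l
        small = entries-≤ (Extended.n₀ x) R (≤-trans (s≤s z≤n) R≥3)

    e₁′ = C ℕ.* suc c ℕ.* 4

    good-block : ∀ W B → Attained W (suc (suc (B ℕ.+ B))) → GoodBlock W e₁′ B
    good-block W B x = assemble n₀ P.refl n₀≥3 (Λ ∸ 1) (P.sym (m+[n∸m]≡n (≤-trans (s≤s z≤n) Λ≥2)))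
      where
      open Attained x
      open Extended block
      open Bounds₀ block B₀≤B′
      assemble : ∀ n → n ≡ n₀ → 3 ≤ n → ∀ g → Λ ≡ suc g → GoodBlock W e₁′ B
      assemble (suc zero) _ (s≤s ())
      assemble (suc (suc zero)) _ (s≤s (s≤s ()))
      assemble (suc (suc (suc n′))) n≡ _ g Λ≡ = record
        { n′ = n′ ; R = R ; E = end k ; Λ = suc g ; g = g ; R≥3 = R≥3
        ; periodic = subst (λ n → Periodic n (end k) R) (P.sym n≡) periodic₀
        ; W≡ = P.trans (cong (λ n → mat n R) n≡) matrix
        ; end = subst₂ (λ n L → n ℕ.+ L ℕ.* R ≤ end k) (P.sym n≡) Λ≡ end₀
        ; maximal = λ e → maximal₀ (suc (suc n′)) (P.sym n≡) (P.trans e (cong a (ℕₚ.+-comm R (suc (suc n′)))))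
        ; n-large = ≤-trans B≤B′ (≤-trans B≤n₀ (≤-reflexive (P.sym n≡)))
        ; g-small = ≤-trans (≤-reflexive (solve 1 (λ g → con 2 :+ (g :+ g) := (con 1 :+ g) :* con 2) P.refl g)) (*-monoʳ-≤ (suc g) (≤-trans (n≤1+n 2) R≥3))
        ; long = λ ℓ h → ≤-trans (2^-cancel-≤ (≤-trans h (Q-≤ (suc (suc (suc n′))))))
            (≤-trans (*-monoʳ-≤ C (≤-trans (≤-reflexive n≡) (≤-trans n₀≤n (≤-trans good (*-monoʳ-≤ (suc c) λ≤8g)))))
              (≤-trans (≤-reflexive (solve 3 (λ C c g → C :* (c :* (con 8 :* g)) := C :* c :* con 4 :* (g :+ g)) P.refl C (suc c) g)) (*-monoˡ-≤ (g ℕ.+ g) (n≤1+n e₁′))))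
        }
        where
        open +-*-Solver
        λ≤8g : λk k ≤ 8 ℕ.* g
        λ≤8g = ≤-trans λ≤ (≤-trans (≤-reflexive (P.trans (cong (λ L → 2 ℕ.+ L ℕ.* 3) Λ≡) (solve 1 (λ g → con 2 :+ (con 1 :+ g) :* con 3 := con 5 :* con 1 :+ con 3 :* g) P.refl g)))
          (≤-trans (+-monoˡ-≤ (3 ℕ.* g) (*-monoʳ-≤ 5 (≤-pred (subst (2 ≤_) Λ≡ Λ≥2)))) (≤-reflexive (solve 1 (λ g → con 5 :* g :+ con 3 :* g := con 8 :* g) P.refl g))))

    impossible : ∀ f D′ → length f ≡ suc (suc D′) → coeff f (suc D′) ≢ 0ℤ → Root f → ⊥
    impossible f D′ len lead≢0 root = fixed-matrix (λ { (W , supplyW) → supplyW 0 (λ x → go W supplyW (Extended.n₀ (Attained.block x)) (Attained.matrix x)) })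
      where
      go : ∀ W → (∀ B → ¬ ¬ Attained W B) → ∀ n → mat n R ≡ W → ⊥
      go _ supplyW n P.refl = SmallPeriod.roth-contradiction a a≥1 _ _ _ _ (large₁ n R (≤-trans (n≤1+n 2) R≥3)) (large₂ n R (≤-trans (n≤1+n 2) R≥3)) (trace-≥ n R R≥3) (det-act n R e₁ e₂)
        f D′ len lead≢0 root e₁′ (λ B none → supplyW (suc (suc (B ℕ.+ B))) (λ x → none (good-block (mat n R) B x)))

  module SmallPeriods (f : List ℤ) (D′ : ℕ) (len : length f ≡ suc (suc D′)) (lead≢0 : coeff f (suc D′) ≢ 0ℤ) (root : Root f)
    (ρ K₀ : ℕ) (small-periods : ∀ k → K₀ ≤ k → nk k ≤ suc c ℕ.* λk k → rk k < ρ) where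
    refutation : ⊥
    refutation = pigeonhole (upTo ρ) Chosen (λ _ l x → chosen (Chosen.k x) (≤-trans l (Chosen.B≤k x)) (Chosen.good x) (Chosen.rk≡r x)) (λ B none → none (choose (long (B ℕ.+ K₀))))
      (λ { (r , supply) → supply 0 (λ x → FixedPeriod.impossible r (subst (1 ≤_) (Chosen.rk≡r x) (rk≥1 (Chosen.k x))) supply f D′ len lead≢0 root) })
      where
      choose : ∀ {B} → (∃[ k ] (B ℕ.+ K₀ ≤ k × nk k ≤ suc c ℕ.* λk k)) → ∃ λ r → r ∈ upTo ρ × Chosen r B
      choose {B} (k , l , n≤) = rk k , ∈-upTo⁺ (small-periods k (≤-trans (m≤n+m K₀ B) l) n≤) , chosen k (≤-trans (m≤m+n B K₀) l) n≤ P.refl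

  main-step : ∀ f D′ → length f ≡ suc (suc D′) → ¬ Zero f → coeff f (suc D′) ≢ 0ℤ → Root f → NoRoot D′ → ⊥
  main-step f D′ len f≢0 lead≢0 root shorter = SmallPeriods.refutation f D′ len lead≢0 root
    (LargePeriods.ρ f D′ len f≢0 lead≢0 root shorter) (LargePeriods.K₀ f D′ len f≢0 lead≢0 root shorter) (LargePeriods.small-periods f D′ len f≢0 lead≢0 root shorter)

  coeff-last : ∀ xs z → coeff (xs ∷ʳ z) (length xs) ≡ z
  coeff-last [] z = P.refl
  coeff-last (x ∷ xs) z = coeff-last xs z

  length-∷ʳ : ∀ (xs : List ℤ) z → length (xs ∷ʳ z) ≡ suc (length xs)
  length-∷ʳ [] z = P.refl
  length-∷ʳ (x ∷ xs) z = cong suc (length-∷ʳ xs z)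

  constant-root : ∀ z → Root (z ∷ []) → z ≡ 0ℤ
  constant-root z root = ∣i∣≡0⇒i≡0 (n≤0⇒n≡0 (BoundedAlgebra.⊑-int reals (Bounds.≈0⇒⊑0 reals
    (≈ʳ-trans (≈ʳ-sym (≈ʳ-trans (+ʳ-cong (≈ʳ-refl {ιʳ z}) (ℤ-Algebra.zeroʳ ℝ-alg ξ)) (ℤ-Algebra.+-identityʳ ℝ-alg (ιʳ z)))) root))))

  nonzero-last : ∀ L → NoRoot L → ∀ xs z → length (xs ∷ʳ z) ≤ suc L → ¬ Zero (xs ∷ʳ z) → Root (xs ∷ʳ z) → z ≢ 0ℤ → ⊥
  nonzero-last L ih [] z l f≢0 root z≢0 = z≢0 (constant-root z root)
  nonzero-last L ih (y ∷ ys) z l f≢0 root z≢0 = main-step ((y ∷ ys) ∷ʳ z) (length ys) (cong suc (length-∷ʳ ys z)) f≢0 (λ e → z≢0 (P.trans (P.sym (coeff-last ys z)) e)) root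
    (λ H lH → ih H (≤-trans lH (≤-pred (≤-trans (n≤1+n _) (subst (_≤ suc L) (cong suc (length-∷ʳ ys z)) l)))))

  zero-last : ∀ L → NoRoot L → ∀ xs z → length (xs ∷ʳ z) ≤ suc L → ¬ Zero (xs ∷ʳ z) → Root (xs ∷ʳ z) → z ≢ 0ℤ
  zero-last L ih xs .0ℤ l f≢0 root P.refl = ih xs (≤-pred (subst (_≤ suc L) (length-∷ʳ xs 0ℤ) l)) (λ zs → f≢0 (Allₚ.++⁺ zs (P.refl ∷ []))) (≈ʳ-trans (≈ʳ-sym (eval-∷ʳ0 xs ξ)) root)

  no-root : ∀ L → NoRoot L
  no-root zero [] _ f≢0 _ = f≢0 []
  no-root (suc L) f l f≢0 root = by-last f (initLast f) l f≢0 root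
    where
    by-last : ∀ f → InitLast f → length f ≤ suc L → ¬ Zero f → Root f → ⊥
    by-last .[] [] _ f≢0 _ = f≢0 []
    by-last .(xs ∷ʳ z) (xs ∷ʳ′ z) l f≢0 root = nonzero-last L (no-root L) xs z l f≢0 root (zero-last L (no-root L) xs z l f≢0 root)

  eval-seq : ∀ f N → seq (eval f ξ) N ≡ evalPoly f (convergent a N)
  eval-seq [] N = P.refl
  eval-seq (z ∷ f) N = cong (λ v → mkℚᵘ z 0 Q.+ convergent a N Q.* v) (eval-seq f N)

  transcendental : TranscendentalCF a
  transcendental (f , f≢0 , root) = no-root (length f) f ≤-refl (nonzero f≢0) (BoundedAlgebra.⊑-zero reals (below (ev λ M → proj₁ (root M) , λ N l → subst (λ v → AbsLe v (suc M) 1) (P.sym (eval-seq f N)) (small M (evalPoly f (convergent a N)) (proj₂ (root M) N l)))))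
    where
    nonzero : ∀ {f} → NonZeroPoly f → ¬ Zero f
    nonzero (here ne) (z ∷ _) = ne z
    nonzero (there n) (_ ∷ zs) = nonzero n zs
    small : ∀ M v → Q.∣ v ∣ Q.< mkℚᵘ (+ 1) M → AbsLe v (suc M) 1
    small M (mkℚᵘ i d) (Q.*<* h) = absLe (ℤₚ.drop‿+≤+ (subst₂ ℤ._≤_ (P.sym (pos-* ∣ i ∣ (suc M))) (P.sym (pos-* 1 (suc d))) (ℤₚ.<⇒≤ h)))

open import Data.Nat using (_+_; _*_)
open Defs using (q)

theorem5 : (a : ℕ → ℕ) → (∀ m → 1 ≤ a m) → ¬ UltimatelyPeriodic a →
    (nk λk rk : ℕ → ℕ) →
    1 ≤ nk 0 → (∀ k → nk k < nk (suc k)) →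
    (∀ k → 1 ≤ λk k) → (∀ k → 1 ≤ rk k) →
    (∀ k → nk k + λk k * rk k ≤ nk (suc k)) →
    (∀ k m → nk k ≤ m → m + 1 ≤ nk k + (λk k ∸ 1) * rk k →
    a (m + rk k) ≡ a m) →
    (∃[ C ] (∀ n → 1 ≤ n → q a n ≤ C ^ n)) →
    (∃[ c ] (∀ K → ∃[ k ] (K ≤ k × nk k ≤ suc c * λk k))) →
    TranscendentalCF a
theorem5 a a≥1 aper nk λk rk n≥1 inc λ≥1 r≥1 gap rep (C , hC) (c , hc) = Transcendence.transcendental a a≥1 aper nk λk rk n≥1 inc λ≥1 r≥1 rep C hC c hc
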